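{- Let $\mathcal{P}$ denote the portrait $8(4)$. (a) For every prime $p$ and every residue class $\mathfrak{c}\in\mathbb{Z}/p\mathbb{Z}$, there exist infinitely many squarefree integers $d\in\mathfrak{c}$ such that $X_1(\mathcal{P})$ has a quadratic point defined over $\mathbb{Q}(\sqrt d)$. (b) There exist infinitely many imaginary quadratic fields $K$ with class number divisible by $10$ such that $X_1(\mathcal{P})$ has a quadratic point defined over $K$.
   Context: A portrait is a directed graph in which every vertex has out-degree 1. The portrait $8(4)$ consists of a directed 4-cycle together with, for each vertex of the cycle, one additional vertex mapping to it. For a finite portrait $\mathcal{P}$ with vertices $1,\dots,n$ and edges $i\to\varphi(i)$, $Y_1(\mathcal{P})$ is the affine curve over $\mathbb{Q}$ with coordinates $(c,z_1,\dots,z_n)$ given by $z_i^2+c=z_{\varphi(i)}$ for all $i$ together with the open conditions $z_i\ne z_j$ for $i\neq j$; it parametrizes maps $f_c(z)=z^2+c$ together with marked preperiodic points forming a copy of $\mathcal{P}$. $X_1(\mathcal{P})$ is the smooth projective curve over $\mathbb{Q}$ birational to $Y_1(\mathcal{P})$. For $\mathcal{P}=8(4)$, $X_1(\mathcal{P})$ is the smooth projective hyperelliptic (genus 2) curve with affine model $y^2=-x(x^2+1)(x^2-2x-1)$ over $\mathbb{Q}$ (it is isomorphic to the classical modular curve $X_1(16)$ parametrizing elliptic curves with a torsion point of order 16). A quadratic point on a curve over $\mathbb{Q}$ is a point whose field of definition is a quadratic extension of $\mathbb{Q}$; it is a quadratic point defined over $K$ if this field of definition is the quadratic field $K$. -}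

module Defs where

open import Algebra.Bundles using (CommutativeRing)
open import Algebra.Morphism.Structures using (module RingMorphisms)
open import Data.Fin.Base using (Fin)
open import Data.Integer.Base as ℤ using (ℤ; 0ℤ; 1ℤ)
open import Data.Integer.Divisibility using (_∣_)
open import Data.List.Base using (List; []; _∷_)
open import Data.List.Relation.Unary.All using (All)
open import Data.List.Relation.Unary.Any using (Any)
open import Data.Nat.Base using (ℕ)
open import Data.Product.Base using (Σ; ∃; _×_; _,_; proj₁; proj₂)
open import Data.Rational.Base as ℚ using (ℚ; 0ℚ; 1ℚ)
import Data.Rational.Properties as ℚ
open import Data.Rational.Solver using (module +-*-Solver)
open import Function.Bundles using (Bijection; _⇔_; mk⇔; module Equivalence)
open import Level using (Level; 0ℓ; _⊔_)
open import Relation.Binary.Bundles using (Setoid)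
open import Relation.Binary.PropositionalEquality
  using (_≡_; _≢_; refl; sym; trans; cong; cong₂; subst; setoid; isEquivalence)
open import Relation.Nullary.Negation using (¬_)

-- No finite list exhausts the elements satisfying P up to ≈.
InfinitelyMany : ∀ {a p ℓ} {A : Set a} → (A → A → Set ℓ) → (A → Set p) → Set (a ⊔ p ⊔ ℓ)
InfinitelyMany {A = A} _≈_ P = ∀ (xs : List A) → ∃ λ x → P x × All (λ y → ¬ (x ≈ y)) xs

Squarefree : ℤ → Set
Squarefree d = ∀ k → k ℤ.* k ∣ d → k ∣ 1ℤ

------------------------------------------------------------------------
-- Quadratic fields

-- rat + irr·√d
record ℚ[√_] (d : ℤ) : Set where
  constructor _+√_
  field
    rat irr : ℚ

open ℚ[√_] public

module _ {d : ℤ} where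

  infixl 6 _⊕_
  infixl 7 _⊛_

  _⊕_ _⊛_ : ℚ[√ d ] → ℚ[√ d ] → ℚ[√ d ]
  (a +√ b) ⊕ (a′ +√ b′) = (a ℚ.+ a′) +√ (b ℚ.+ b′)
  (a +√ b) ⊛ (a′ +√ b′) =
    (a ℚ.* a′ ℚ.+ (d ℚ./ 1) ℚ.* (b ℚ.* b′)) +√ (a ℚ.* b′ ℚ.+ b ℚ.* a′)

  ⊝_ : ℚ[√ d ] → ℚ[√ d ]
  ⊝ (a +√ b) = (ℚ.- a) +√ (ℚ.- b)

  fromℚ : ℚ → ℚ[√ d ]
  fromℚ q = q +√ 0ℚ

ℚ[√]-commutativeRing : ℤ → CommutativeRing 0ℓ 0ℓ
ℚ[√]-commutativeRing d = record
  { Carrier = ℚ[√ d ]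
  ; _≈_ = _≡_
  ; _+_ = _⊕_
  ; _*_ = _⊛_
  ; -_ = ⊝_
  ; 0# = fromℚ 0ℚ
  ; 1# = fromℚ 1ℚ
  ; isCommutativeRing = record
    { isRing = record
      { +-isAbelianGroup = record
        { isGroup = record
          { isMonoid = record
            { isSemigroup = record
              { isMagma = record { isEquivalence = isEquivalence ; ∙-cong = cong₂ _⊕_ }
              ; assoc = λ (a +√ b) (a′ +√ b′) (a″ +√ b″) →
                  cong₂ _+√_ (ℚ.+-assoc a a′ a″) (ℚ.+-assoc b b′ b″)
              }
            ; identity =
                (λ (a +√ b) → cong₂ _+√_ (ℚ.+-identityˡ a) (ℚ.+-identityˡ b))
              , (λ (a +√ b) → cong₂ _+√_ (ℚ.+-identityʳ a) (ℚ.+-identityʳ b))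
            }
          ; inverse =
              (λ (a +√ b) → cong₂ _+√_ (ℚ.+-inverseˡ a) (ℚ.+-inverseˡ b))
            , (λ (a +√ b) → cong₂ _+√_ (ℚ.+-inverseʳ a) (ℚ.+-inverseʳ b))
          ; ⁻¹-cong = cong ⊝_
          }
        ; comm = λ (a +√ b) (a′ +√ b′) → cong₂ _+√_ (ℚ.+-comm a a′) (ℚ.+-comm b b′)
        }
      ; *-cong = cong₂ _⊛_
      ; *-assoc = ⊛-assoc
      ; *-identity = ⊛-identityˡ , λ x → trans (⊛-comm x _) (⊛-identityˡ x)
      ; distrib = ⊛-distribˡ , λ x y z →
          trans (⊛-comm (y ⊕ z) x)
            (trans (⊛-distribˡ x y z) (cong₂ _⊕_ (⊛-comm x y) (⊛-comm x z)))
      }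
    ; *-comm = ⊛-comm
    }
  }
  where
  open +-*-Solver
  D = d ℚ./ 1

  ⊛-comm : ∀ (x y : ℚ[√ d ]) → x ⊛ y ≡ y ⊛ x
  ⊛-comm (a +√ b) (a′ +√ b′) = cong₂ _+√_
    (solve 5 (λ D a b a′ b′ → a :* a′ :+ D :* (b :* b′) := a′ :* a :+ D :* (b′ :* b))
      refl D a b a′ b′)
    (solve 4 (λ a b a′ b′ → a :* b′ :+ b :* a′ := a′ :* b :+ b′ :* a)
      refl a b a′ b′)

  ⊛-assoc : ∀ (x y z : ℚ[√ d ]) → (x ⊛ y) ⊛ z ≡ x ⊛ (y ⊛ z)
  ⊛-assoc (a +√ b) (a′ +√ b′) (a″ +√ b″) = cong₂ _+√_
    (solve 7 (λ D a b a′ b′ a″ b″ →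
        (a :* a′ :+ D :* (b :* b′)) :* a″ :+ D :* ((a :* b′ :+ b :* a′) :* b″)
      := a :* (a′ :* a″ :+ D :* (b′ :* b″)) :+ D :* (b :* (a′ :* b″ :+ b′ :* a″)))
      refl D a b a′ b′ a″ b″)
    (solve 7 (λ D a b a′ b′ a″ b″ →
        (a :* a′ :+ D :* (b :* b′)) :* b″ :+ (a :* b′ :+ b :* a′) :* a″
      := a :* (a′ :* b″ :+ b′ :* a″) :+ b :* (a′ :* a″ :+ D :* (b′ :* b″)))
      refl D a b a′ b′ a″ b″)

  ⊛-distribˡ : ∀ (x y z : ℚ[√ d ]) → x ⊛ (y ⊕ z) ≡ (x ⊛ y) ⊕ (x ⊛ z)
  ⊛-distribˡ (a +√ b) (a′ +√ b′) (a″ +√ b″) = cong₂ _+√_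
    (solve 7 (λ D a b a′ b′ a″ b″ →
        a :* (a′ :+ a″) :+ D :* (b :* (b′ :+ b″))
      := a :* a′ :+ D :* (b :* b′) :+ (a :* a″ :+ D :* (b :* b″)))
      refl D a b a′ b′ a″ b″)
    (solve 6 (λ a b a′ b′ a″ b″ →
        a :* (b′ :+ b″) :+ b :* (a′ :+ a″)
      := a :* b′ :+ b :* a′ :+ (a :* b″ :+ b :* a″))
      refl a b a′ b′ a″ b″)

  ⊛-identityˡ : ∀ (x : ℚ[√ d ]) → fromℚ 1ℚ ⊛ x ≡ x
  ⊛-identityˡ (a +√ b) = cong₂ _+√_
    (solve 3 (λ D a b → con 1ℚ :* a :+ D :* (con 0ℚ :* b) := a) refl D a b)
    (solve 2 (λ a b → con 1ℚ :* b :+ con 0ℚ :* a := b) refl a b)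

-- Every quadratic field is ℚ(√d) for a unique squarefree d ≠ 1.
record QuadraticField : Set where
  constructor ℚ⟮√_⟯
  field
    radicand   : ℤ
    squarefree : Squarefree radicand
    ≢1         : radicand ≢ 1ℤ

  ring : CommutativeRing 0ℓ 0ℓ
  ring = ℚ[√]-commutativeRing radicand

  open CommutativeRing ring public using (Carrier; rawRing; _+_; _*_; 0#; 1#)

open QuadraticField using (radicand)

_≅_ : QuadraticField → QuadraticField → Set
K ≅ L = ∃ IsRingIsomorphism
  where open RingMorphisms (QuadraticField.rawRing K) (QuadraticField.rawRing L)

Imaginary : QuadraticField → Set
Imaginary K = radicand K ℤ.< 0ℤ

------------------------------------------------------------------------
-- The class number

module _ (K : QuadraticField) where
  open QuadraticField K
  open CommutativeRing ring using (*-assoc; *-comm; *-identityˡ)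

  -- evalMonic (c₀ ∷ … ∷ cₙ₋₁ ∷ []) x = c₀ + c₁x + ⋯ + cₙ₋₁xⁿ⁻¹ + xⁿ
  evalMonic : List ℤ → Carrier → Carrier
  evalMonic []       x = 1#
  evalMonic (c ∷ cs) x = fromℚ (c ℚ./ 1) + x * evalMonic cs x

  -- Membership in the ring of integers.
  Integral : Carrier → Set
  Integral x = ∃ λ cs → evalMonic cs x ≡ 0#

  -- A nonzero fractional ideal, presented by finitely many generators (the
  -- ring of integers is Noetherian, so every fractional ideal arises).
  record FractionalIdeal : Set where
    field
      generators : List Carrier
      nonzero    : Any (_≢ 0#) generators

  open FractionalIdeal

  -- The span of a list over the ring of integers.
  Span : List Carrier → Carrier → Set
  Span []       x = x ≡ 0#
  Span (g ∷ gs) x = ∃ λ r → ∃ λ y → Integral r × Span gs y × x ≡ r * g + y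

  _∈ᴵ_ : Carrier → FractionalIdeal → Set
  x ∈ᴵ I = Span (generators I) x

  -- J = αI for some α ∈ K×; since α is invertible, J = αI says exactly that
  -- x ∈ I ⇔ αx ∈ J for all x.
  _∼_ : FractionalIdeal → FractionalIdeal → Set
  I ∼ J = ∃ λ α → (∃ λ α⁻¹ → α * α⁻¹ ≡ 1#) × (∀ x → x ∈ᴵ I ⇔ (α * x) ∈ᴵ J)

  -- The underlying set of the class group.
  idealClasses : Setoid 0ℓ 0ℓ
  idealClasses = record
    { Carrier = FractionalIdeal
    ; _≈_ = _∼_
    ; isEquivalence = record
      { refl = λ {I} → ∼-refl {I} ; sym = λ {I} {J} → ∼-sym {I} {J}
      ; trans = λ {I} {J} {L} → ∼-trans {I} {J} {L} }
    }
    where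
    ⇔-subst : ∀ {p} (P : Carrier → Set p) {x y} → x ≡ y → P x ⇔ P y
    ⇔-subst P refl = mk⇔ (λ p → p) (λ p → p)

    open Equivalence

    cancel : ∀ α β → α * β ≡ 1# → ∀ x → α * (β * x) ≡ x
    cancel α β αβ≡1 x =
      trans (sym (*-assoc α β x)) (trans (cong (_* x) αβ≡1) (*-identityˡ x))

    ∼-refl : ∀ {I} → I ∼ I
    ∼-refl {I} = 1# , (1# , *-identityˡ 1#) , λ x → ⇔-subst (_∈ᴵ I) (sym (*-identityˡ x))

    ∼-sym : ∀ {I J} → I ∼ J → J ∼ I
    ∼-sym {I} {J} (α , (β , αβ≡1) , I⇔J) =
      β , (α , trans (*-comm β α) αβ≡1) , λ y → mk⇔
        (λ y∈J → from (I⇔J (β * y)) (subst (_∈ᴵ J) (sym (cancel α β αβ≡1 y)) y∈J))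
        (λ βy∈I → subst (_∈ᴵ J) (cancel α β αβ≡1 y) (to (I⇔J (β * y)) βy∈I))

    ∼-trans : ∀ {I J L} → I ∼ J → J ∼ L → I ∼ L
    ∼-trans {I} {J} {L} (α , (β , αβ≡1) , I⇔J) (γ , (δ , γδ≡1) , J⇔L) =
      γ * α
      , (β * δ , trans (*-assoc γ α (β * δ)) (trans (cong (γ *_) (cancel α β αβ≡1 δ)) γδ≡1))
      , λ x → mk⇔
          (λ x∈I → subst (_∈ᴵ L) (sym (*-assoc γ α x)) (to (J⇔L (α * x)) (to (I⇔J x) x∈I)))
          (λ γαx∈L → from (I⇔J x) (from (J⇔L (α * x)) (subst (_∈ᴵ L) (*-assoc γ α x) γαx∈L)))

  HasClassNumber : ℕ → Set
  HasClassNumber h = Bijection (setoid (Fin h)) idealClasses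

------------------------------------------------------------------------
-- The curve X₁(8(4))

-- The smooth projective model of y² = -x(x²+1)(x²-2x-1) is
--   y² = -xz(x²+z²)(x²-2xz-z²)  in the weighted projective plane ℙ(1,3,1).
-- On the chart z = 1 it is birational to Y₁(8(4)) by sending (x, y) to
--   c = (x²-4x-1)(x⁴+x³+2x²-x+1) / (4x(x-1)²(x+1)²)
-- and the point (x-1)/(2(x+1)) + y/(2x(x-1)) of period 4 for z² + c; the
-- other marked points are the iterates of this one and the negatives of the
-- four points so obtained.
module X₁⟨8⟨4⟩⟩ {c ℓ} (R : CommutativeRing c ℓ) where
  open CommutativeRing R

  -- R is meant to be a field.
  record Point : Set (c ⊔ ℓ) where
    field
      x y z   : Carrier
      nonzero : ¬ (x ≈ 0# × y ≈ 0# × z ≈ 0#)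
      onCurve : y * y ≈ - (x * z) * (x * x + z * z) * (x * x - (1# + 1#) * (x * z) - z * z)

  -- The point P is (x : y : z).
  record _HasCoordinates_,_,_ (P : Point) (x y z : Carrier) : Set (c ⊔ ℓ) where
    field
      t t⁻¹  : Carrier
      tt⁻¹≈1 : t * t⁻¹ ≈ 1#
      x≈     : x ≈ t * Point.x P
      y≈     : y ≈ t * t * t * Point.y P
      z≈     : z ≈ t * Point.z P

-- The field of definition of a K-point is ℚ or K, as [K : ℚ] = 2; it is K
-- unless the point has rational coordinates.
HasQuadraticPoint : QuadraticField → Set
HasQuadraticPoint K = ∃ λ (P : Point) →
  ¬ (∃ λ (x : ℚ) → ∃ λ (y : ℚ) → ∃ λ (z : ℚ) → P HasCoordinates fromℚ x , fromℚ y , fromℚ z)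
  where open X₁⟨8⟨4⟩⟩ (QuadraticField.ring K)

{-# OPTIONS --safe #-}
module Submission where

-- The point with x = a/b has y in ℚ(√d), where d is the squarefree part of
-- F(a, b) = -ab(a² + b²)(a² - 2ab - b²). If a = D²a′ and b ≡ 1 mod D², where p and every prime ≤ 64
-- divide D, then F/D² ≡ a′ mod D, so that d is controlled modulo p as soon as F/D² is squarefree.
-- That this happens for infinitely many (a′, b) in a given class modulo D² follows from a sieve over
-- an N × N grid: for each prime q not dividing D and up to about N/64, the pairs for which q² divides
-- a factor of F are counted row by row. For larger q the pairs for which q² divides
-- one of the quadratic factors fall into two classes, in each of which ab′ - a′b is divisible by q²;
-- the fractions a/b of a class are then so far apart that their number is bounded.
--
-- On the Jacobian, (1, 2) - ∞ has order 10, which gives an identity P² - FQ² = (a - b)¹⁰. For the same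
-- values of a and b the ideal ((a - b)², P + Q√F) of norm (a - b)² < |d| therefore has a principal
-- fifth power but is not principal, and neither is the ramified prime (2, √d). So the class group of
-- ℚ(√d), which is finite by reduction theory, admits free actions of groups of orders 5 and 2.

-- Counting row by row costs an error of order N for each q. Summed over all integers q up to the
-- square roots of the quadratic factors, a large multiple of N, these errors would exceed the N²
-- available pairs; hence the separate treatment of large q, with a bound independent of N. No
-- estimate for the density of the primes enters: the sums run over all integers q > 64, and 64 is
-- large enough for the total to stay below N². Part (b) takes the class 0 modulo 2: for even
-- squarefree d the ring of integers is ℤ[√d], and 2 ramifies. The norm of ω = P + Q√F is the fifth
-- power of (a - b)², so the ideal of norm (a - b)² has a class of order dividing the prime 5,
-- whereas for the ideal of norm a - b the order is only known to divide 10. It is not principal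
-- because an element of ℤ[√d] of norm less than |d| is rational, and no prime factor of a - b
-- divides ω. Two arbitrary ideal classes are never multiplied: one fixed ideal acts on the
-- fractional ideals, and counting orbits of prime length replaces Lagrange's theorem.

-- Counting in lists: union bounds, tails of sums of inverse squares, residue classes

module Counting where
  open import Data.Bool.Base using (if_then_else_)
  open import Data.List.Base using (List; []; _∷_; _++_; map; length; upTo; cartesianProduct)
  open import Data.List.Membership.Propositional using (_∈_)
  open import Data.List.Membership.Propositional.Properties using (∈-upTo⁻)
  open import Data.List.Relation.Unary.All as All using (All; []; _∷_)
  open import Data.List.Relation.Unary.AllPairs using ([]; _∷_)
  open import Data.List.Relation.Unary.Any using (here; there)
  open import Data.List.Relation.Unary.Unique.Propositional using (Unique)
  open import Data.List.Relation.Unary.Unique.Propositional.Properties using (upTo⁺)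
  open import Data.Nat.Base
  open import Data.Nat.DivMod using (m≡m%n+[m/n]*n; m%n<n; /-mono-≤)
  open import Data.Nat.Divisibility using (_∣_; ∣⇒≤)
  open import Data.Nat.Properties
  open import Data.Nat.Tactic.RingSolver using (solve-∀)
  open import Data.Product.Base using (∃-syntax; _×_; _,_)
  open import Data.Sum.Base using (_⊎_; inj₁; inj₂)
  open import Function.Base using (_∘_)
  open import Relation.Binary.PropositionalEquality
  open import Relation.Nullary.Decidable using (yes; no; does; _×-dec_; ¬?)
  open import Relation.Nullary.Negation using (¬_; contradiction)
  open import Relation.Unary using (Decidable)

  private
    variable
      A B : Set

  count : {P : A → Set} → Decidable P → List A → ℕ
  count P? []       = 0
  count P? (x ∷ xs) = (if does (P? x) then 1 else 0) + count P? xs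

  module _ {P : A → Set} (P? : Decidable P) where

    count-all : ∀ {xs} → (∀ {x} → x ∈ xs → P x) → count P? xs ≡ length xs
    count-all {[]} p = refl
    count-all {x ∷ xs} p with P? x
    ... | yes _ = cong suc (count-all (p ∘ there))
    ... | no ¬p = contradiction (p (here refl)) ¬p

    count-none : ∀ {xs} → (∀ {x} → x ∈ xs → ¬ P x) → count P? xs ≡ 0
    count-none {[]} p = refl
    count-none {x ∷ xs} p with P? x
    ... | yes q = contradiction q (p (here refl))
    ... | no _ = count-none (p ∘ there)

    count-++ : ∀ xs ys → count P? (xs ++ ys) ≡ count P? xs + count P? ys
    count-++ []       ys = refl
    count-++ (x ∷ xs) ys =
      trans (cong (_ +_) (count-++ xs ys)) (sym (+-assoc _ (count P? xs) (count P? ys)))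

    count-map : ∀ (f : B → A) xs → count P? (map f xs) ≡ count (P? ∘ f) xs
    count-map f []       = refl
    count-map f (x ∷ xs) = cong (_ +_) (count-map f xs)

  module _ {P Q R : A → Set} (P? : Decidable P) (Q? : Decidable Q) (R? : Decidable R) where

    count-⊎ : ∀ {xs} → (∀ {x} → x ∈ xs → P x → Q x ⊎ R x) → count P? xs ≤ count Q? xs + count R? xs
    count-⊎ {[]} p = z≤n
    count-⊎ {x ∷ xs} p with ih ← count-⊎ (p ∘ there) | P? x | Q? x | R? x
    ... | no _  | no _  | no _  = ih
    ... | no _  | no _  | yes _ = ≤-trans ih (+-monoʳ-≤ (count Q? xs) (n≤1+n _))
    ... | no _  | yes _ | no _  = m≤n⇒m≤1+n ih
    ... | no _  | yes _ | yes _ = ≤-trans ih (+-mono-≤ (n≤1+n _) (n≤1+n _))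
    ... | yes _ | yes _ | no _  = s≤s ih
    ... | yes _ | yes _ | yes _ = s≤s (≤-trans ih (+-monoʳ-≤ (count Q? xs) (n≤1+n _)))
    ... | yes _ | no _  | yes _ = ≤-trans (s≤s ih) (≤-reflexive (sym (+-suc _ _)))
    ... | yes a | no b  | no c  with p (here refl) a
    ... | inj₁ q = contradiction q b
    ... | inj₂ r = contradiction r c

  count-mono : ∀ {P Q : A → Set} (P? : Decidable P) (Q? : Decidable Q) {xs} →
    (∀ {x} → x ∈ xs → P x → Q x) → count P? xs ≤ count Q? xs
  count-mono P? Q? {[]} p = z≤n
  count-mono P? Q? {x ∷ xs} p with ih ← count-mono P? Q? (p ∘ there) | P? x | Q? x
  ... | no _  | no _  = ih
  ... | no _  | yes _ = m≤n⇒m≤1+n ih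
  ... | yes _ | yes _ = s≤s ih
  ... | yes a | no b  = contradiction (p (here refl) a) b

  ∑ : ℕ → (ℕ → ℕ) → ℕ
  ∑ zero    f = 0
  ∑ (suc n) f = f 0 + ∑ n (f ∘ suc)

  ∑-mono : ∀ n {f g} → (∀ i → f i ≤ g i) → ∑ n f ≤ ∑ n g
  ∑-mono zero    p = z≤n
  ∑-mono (suc n) p = +-mono-≤ (p 0) (∑-mono n (p ∘ suc))

  ∑-const : ∀ n k → ∑ n (λ _ → k) ≡ n * k
  ∑-const zero    k = refl
  ∑-const (suc n) k = cong (k +_) (∑-const n k)

  ∑-+ : ∀ n f k → ∑ n (λ i → f i + k) ≡ ∑ n f + n * k
  ∑-+ zero    f k = refl
  ∑-+ (suc n) f k = trans (cong (f 0 + k +_) (∑-+ n (f ∘ suc) k)) (lemma (f 0) k (∑ n (f ∘ suc)) (n * k))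
    where
    lemma : ∀ a b c d → a + b + (c + d) ≡ a + c + (b + d)
    lemma = solve-∀

  ∑-split : ∀ m n f → ∑ (m + n) f ≡ ∑ m f + ∑ n (f ∘ (m +_))
  ∑-split zero    n f = refl
  ∑-split (suc m) n f = trans (cong (f 0 +_) (∑-split m n (f ∘ suc))) (sym (+-assoc (f 0) _ _))

  -- Comparison of the tail of ∑ 1/k² with the telescoping sum of 1/(k - 1) - 1/k: terms at most
  -- X/k² for k > z add up to at most X/z. The induction passes from z to z + 1 and multiplies by z
  -- + 1, so that no division occurs; z(z + 1) ≤ (z + 1)² settles the first term.
  ∑-telescope : ∀ X n z (f : ℕ → ℕ) → (∀ i → (z + suc i) * (z + suc i) * f i ≤ X) → z * ∑ n f ≤ X
  ∑-telescope X zero    z f p = subst (_≤ X) (sym (*-zeroʳ z)) z≤n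
  ∑-telescope X (suc n) z f p = *-cancelˡ-≤ (suc z) (begin
    suc z * (z * (f 0 + ∑ n (f ∘ suc)))                              ≡⟨ lemma₁ z (f 0) _ ⟩
    (z + z * z) * f 0 + z * (suc z * ∑ n (f ∘ suc))                  ≤⟨ +-mono-≤ (*-monoˡ-≤ (f 0) (le z)) (*-monoʳ-≤ z ih) ⟩
    (z + 1) * (z + 1) * f 0 + z * X                                  ≤⟨ +-monoˡ-≤ (z * X) (p 0) ⟩
    X + z * X                                                        ∎)
    where
    open ≤-Reasoning
    ih : suc z * ∑ n (f ∘ suc) ≤ X
    ih = ∑-telescope X n (suc z) (f ∘ suc) (λ i → subst (λ k → k * k * f (suc i) ≤ X) (+-suc z (suc i)) (p (suc i)))
    lemma₁ : ∀ z a b → suc z * (z * (a + b)) ≡ (z + z * z) * a + z * (suc z * b)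
    lemma₁ = solve-∀
    lemma₂ : ∀ z → (z + 1) * (z + 1) ≡ (z + z * z) + (z + 1)
    lemma₂ = solve-∀
    le : ∀ z → z + z * z ≤ (z + 1) * (z + 1)
    le z = subst (z + z * z ≤_) (sym (lemma₂ z)) (m≤m+n _ _)

  count-⋃ : ∀ {P : A → Set} {Q : ℕ → A → Set} (P? : Decidable P) (Q? : ∀ k → Decidable (Q k)) {xs} n →
    (∀ {x} → x ∈ xs → P x → ∃[ k ] k < n × Q k x) → count P? xs ≤ ∑ n (λ k → count (Q? k) xs)
  count-⋃ P? Q? zero    p = ≤-reflexive (count-none P? (λ x∈ Px → case₀ (p x∈ Px)))
    where
    case₀ : ∀ {Q : ℕ → Set} → ¬ (∃[ k ] k < 0 × Q k)
    case₀ (_ , () , _)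
  count-⋃ {A = A} {P} {Q} P? Q? {xs} (suc n) p = ≤-trans
    (count-⊎ P? (Q? 0) P′? split)
    (+-monoʳ-≤ (count (Q? 0) xs) (count-⋃ P′? (Q? ∘ suc) n rest))
    where
    P′ : A → Set
    P′ x = P x × ¬ Q 0 x
    P′? : Decidable P′
    P′? x = P? x ×-dec ¬? (Q? 0 x)
    split : ∀ {x} → x ∈ xs → P x → Q 0 x ⊎ P′ x
    split {x} _ Px with Q? 0 x
    ... | yes q = inj₁ q
    ... | no ¬q = inj₂ (Px , ¬q)
    rest : ∀ {x} → x ∈ xs → P′ x → ∃[ k ] k < n × Q (suc k) x
    rest x∈ (Px , ¬q) with p x∈ Px
    ... | zero  , _       , q = contradiction q ¬q
    ... | suc k , s≤s k<n , q = k , k<n , q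

  -- Limits P to two classes without naming them. This is how the two roots of a quadratic
  -- congruence enter: no square root has to be exhibited. With `_≡_` it limits the number of
  -- elements.
  AnyTwoOfThree : (A → A → Set) → (A → Set) → Set
  AnyTwoOfThree _~_ P = ∀ {x y z} → P x → P y → P z → x ~ y ⊎ x ~ z ⊎ y ~ z

  module _ {P : A → Set} (P? : Decidable P) where

    count-≤2 : ∀ {xs} → Unique xs → AnyTwoOfThree _≡_ (λ x → x ∈ xs × P x) → count P? xs ≤ 2
    count-≤2 {xs} u p = go xs u (λ x∈ → x∈)
      where
      second : ∀ {x y} zs → Unique (y ∷ zs) → (∀ {z} → z ∈ zs → z ∈ xs) → All (x ≢_) (y ∷ zs) →
        x ∈ xs × P x → y ∈ xs × P y → count P? zs ≤ 0
      second []       _ _ _ _ _ = z≤n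
      second (z ∷ zs) ((y≢z ∷ y≢zs) ∷ (_ ∷ u)) i (x≢y ∷ x≢z ∷ x≢zs) px py with P? z
      ... | no _ = second zs (y≢zs ∷ u) (i ∘ there) (x≢y ∷ x≢zs) px py
      ... | yes pz with p px py (i (here refl) , pz)
      ... | inj₁ e        = contradiction e x≢y
      ... | inj₂ (inj₁ e) = contradiction e x≢z
      ... | inj₂ (inj₂ e) = contradiction e y≢z
      first : ∀ {x} ys → Unique ys → (∀ {y} → y ∈ ys → y ∈ xs) → All (x ≢_) ys → x ∈ xs × P x → count P? ys ≤ 1
      first []       _ _ _ _ = z≤n
      first (y ∷ ys) (y≢ys ∷ u) i (x≢y ∷ x≢ys) px with P? y
      ... | no _   = first ys u (i ∘ there) x≢ys px
      ... | yes py = s≤s (second ys (y≢ys ∷ u) (i ∘ there) (x≢y ∷ x≢ys) px (i (here refl) , py))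
      go : ∀ ys → Unique ys → (∀ {y} → y ∈ ys → y ∈ xs) → count P? ys ≤ 2
      go []       _        _ = z≤n
      go (y ∷ ys) (y≢ys ∷ u) i with P? y
      ... | no _   = go ys u (i ∘ there)
      ... | yes py = s≤s (first ys u (i ∘ there) y≢ys (i (here refl) , py))

  count-bins : ∀ {P : A → Set} (P? : Decidable P) {xs} → Unique xs → (β : A → ℕ) → ∀ b → (∀ {x} → x ∈ xs → P x → β x < b) →
    (∀ k → AnyTwoOfThree _≡_ (λ x → x ∈ xs × P x × β x ≡ k)) → count P? xs ≤ b * 2
  count-bins P? u β b β<b p = ≤-trans
    (count-⋃ P? (λ k x → P? x ×-dec (β x ≟ k)) b (λ x∈ Px → _ , β<b x∈ Px , Px , refl))
    (≤-trans (∑-mono b (λ k → count-≤2 _ u (p k))) (≤-reflexive (∑-const b 2)))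

  count-rows : ∀ {P : A → Set} {R : A × B → Set} (P? : Decidable P) (R? : Decidable R) xs ys k →
    (∀ {x y} → R (x , y) → P x) → (∀ {x} → x ∈ xs → count (R? ∘ (x ,_)) ys ≤ k) →
    count R? (cartesianProduct xs ys) ≤ count P? xs * k
  count-rows P? R? []       ys k imp rows = z≤n
  count-rows {P = P} P? R? (x ∷ xs) ys k imp rows = begin
    count R? (map (x ,_) ys ++ cartesianProduct xs ys)             ≡⟨ count-++ R? (map (x ,_) ys) _ ⟩
    count R? (map (x ,_) ys) + count R? (cartesianProduct xs ys)   ≤⟨ +-mono-≤ row (count-rows P? R? xs ys k imp (rows ∘ there)) ⟩
    (if does (P? x) then 1 else 0) * k + count P? xs * k           ≡⟨ *-distribʳ-+ k (if does (P? x) then 1 else 0) _ ⟨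
    count P? (x ∷ xs) * k                                          ∎
    where
    open ≤-Reasoning
    row : count R? (map (x ,_) ys) ≤ (if does (P? x) then 1 else 0) * k
    row rewrite count-map R? (x ,_) ys with P? x
    ... | yes _ = ≤-trans (rows (here refl)) (≤-reflexive (sym (+-identityʳ k)))
    ... | no ¬p = ≤-reflexive (count-none (R? ∘ (x ,_)) {ys} (λ _ r → ¬p (imp r)))

  n≡r+[n/m]m : ∀ m .{{_ : NonZero m}} n → ∃[ r ] r < m × n ≡ r + n / m * m
  n≡r+[n/m]m m n = n % m , m%n<n n m , m≡m%n+[m/n]*n n m

  same-quotient : ∀ m .{{_ : NonZero m}} {i j} → i / m ≡ j / m → m ∣ ∣ i - j ∣ → i ≡ j
  same-quotient m {i} {j} eq m∣ with n≡r+[n/m]m m i | n≡r+[n/m]m m j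
  ... | r , r<m , i≡ | s , s<m , j≡ = ∣m-n∣≡0⇒m≡n (small _ (subst (_< m) (sym diff) (<-≤-trans (s≤s (∣m-n∣≤m⊔n r s)) (⊔-lub r<m s<m))) m∣)
    where
    diff : ∣ i - j ∣ ≡ ∣ r - s ∣
    diff = trans (cong₂ ∣_-_∣ (trans i≡ (trans (cong (λ k → r + k * m) eq) (+-comm r _))) (trans j≡ (+-comm s _)))
      (∣m+n-m+o∣≡∣n-o∣ (j / m * m) r s)
    small : ∀ k → k < m → m ∣ k → k ≡ 0
    small zero    _ _ = refl
    small (suc k) k<m m∣k = contradiction (∣⇒≤ m∣k) (<⇒≱ k<m)

  -- Blocks of m consecutive indices serve as bins, since congruent indices in one block are equal.
  -- The summand 1 accounts for the last, possibly incomplete block.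
  count-periodic : ∀ {P : ℕ → Set} (P? : Decidable P) m .{{_ : NonZero m}} n →
    AnyTwoOfThree (λ i j → m ∣ ∣ i - j ∣) P → count P? (upTo n) ≤ (n / m + 1) * 2
  count-periodic {P} P? m n p = count-bins P? (upTo⁺ n) (_/ m) (n / m + 1)
    (λ {i} i∈ _ → subst (i / m <_) (+-comm 1 (n / m)) (s≤s (/-mono-≤ {o = m} (<⇒≤ (∈-upTo⁻ i∈)) ≤-refl))) λ k → two k
    where
    two : ∀ k → AnyTwoOfThree _≡_ (λ i → i ∈ upTo n × P i × i / m ≡ k)
    two k (_ , px , ex) (_ , py , ey) (_ , pz , ez) with p px py pz
    ... | inj₁ d        = inj₁ (same-quotient m (trans ex (sym ey)) d)
    ... | inj₂ (inj₁ d) = inj₂ (inj₁ (same-quotient m (trans ex (sym ez)) d))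
    ... | inj₂ (inj₂ d) = inj₂ (inj₂ (same-quotient m (trans ey (sym ez)) d))

-- Squares of primes dividing products and values of the quadratic forms

module PrimeSquares where
  open import Data.Integer.Base renaming (∣_∣ to abs)
  open import Data.Integer.Divisibility.Signed
  open import Data.Integer.Properties using (abs-*; *-comm)
  open import Data.Integer.Tactic.RingSolver using (solve-∀)
  import Data.Nat.Base as ℕ
  import Data.Nat.Divisibility as ℕ
  import Data.Nat.Properties as ℕ
  open import Data.Nat.Primality using (Prime; euclidsLemma; prime⇒nonZero; prime[2])
  open import Data.Nat.Primality.Factorisation using (factorise)
  open import Data.List.Base using ([]; _∷_)
  open import Data.Nat.ListAction using (product)
  open import Data.List.Relation.Unary.All using ([]; _∷_)
  open import Data.Product.Base using (∃-syntax; _×_; _,_; proj₁; proj₂)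
  open import Data.Sum.Base using (_⊎_; inj₁; inj₂; [_,_]′)
  open import Function.Base using (_∘_)
  open import Relation.Binary.PropositionalEquality
  open import Relation.Nullary.Decidable using (yes; no)
  open import Relation.Nullary.Negation using (¬_; contradiction)

  prime-divisor : ∀ n → n ≢ 1 → ∃[ p ] Prime p × p ℕ.∣ n
  prime-divisor 0 _ = 2 , prime[2] , ℕ.divides 0 refl
  prime-divisor 1 n≢1 = contradiction refl n≢1
  prime-divisor n@(ℕ.suc (ℕ.suc _)) _ with factorise n
  ... | record { factors = [] ; isFactorisation = () }
  ... | record { factors = p ∷ ps ; isFactorisation = eq ; factorsPrime = p-prime ∷ _ } =
    p , p-prime , ℕ.divides (product ps) (trans eq (ℕ.*-comm p (product ps)))

  ∣-by : ∀ {i m n} → i ∣ m → m ≡ n → i ∣ n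
  ∣-by i∣m refl = i∣m

  private
    swap : ∀ k p n → k * p * n ≡ p * (k * n)
    swap = solve-∀

    X²-[X²-k] : ∀ X k → X * X - (X * X - k) ≡ k
    X²-[X²-k] = solve-∀

  module _ {P : ℤ} (p-prime : Prime (abs P)) where

    private
      instance
        P≢0 : NonZero P
        P≢0 = prime⇒nonZero p-prime

    prime∣product : ∀ m n → P ∣ m * n → P ∣ m ⊎ P ∣ n
    prime∣product m n p∣mn with euclidsLemma (abs m) (abs n) p-prime (subst (abs P ℕ.∣_) (abs-* m n) (∣⇒∣ᵤ p∣mn))
    ... | inj₁ p∣m = inj₁ (∣ᵤ⇒∣ p∣m)
    ... | inj₂ p∣n = inj₂ (∣ᵤ⇒∣ p∣n)

    prime∣square : ∀ m → P ∣ m * m → P ∣ m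
    prime∣square m p∣mm with prime∣product m m p∣mm
    ... | inj₁ p∣m = p∣m
    ... | inj₂ p∣m = p∣m

    square∣⇒∣ : ∀ {m} → P * P ∣ m → P ∣ m
    square∣⇒∣ = ∣-trans (divides P refl)

    prime-square∣product : ∀ m n → ¬ P ∣ n → P * P ∣ m * n → P * P ∣ m
    prime-square∣product m n p∤n pp∣mn with prime∣product m n (square∣⇒∣ pp∣mn)
    ... | inj₂ p∣n = contradiction p∣n p∤n
    ... | inj₁ (divides k m≡kp) = ∣-by (*-monoˡ-∣ P {P} {k} p∣k) (sym m≡kp)
      where
      p∣kn : P ∣ k * n
      p∣kn = *-cancelˡ-∣ P {P} {k * n} (∣-by pp∣mn (trans (cong (_* n) m≡kp) (swap k P n)))
      p∣k : P ∣ k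
      p∣k = [ (λ p∣k → p∣k) , (λ p∣n → contradiction p∣n p∤n) ]′ (prime∣product k n p∣kn)

    prime-square-splits : ∀ m n → ¬ (P ∣ m × P ∣ n) → P * P ∣ m * n → P * P ∣ m ⊎ P * P ∣ n
    prime-square-splits m n ¬both pp∣mn with P ∣? n
    ... | no p∤n  = inj₁ (prime-square∣product m n p∤n pp∣mn)
    ... | yes p∣n = inj₂ (prime-square∣product n m (λ p∣m → ¬both (p∣m , p∣n)) (∣-by pp∣mn (*-comm m n)))

  -- (a - s b)² - κ b² is a² + b² for (s, κ) = (0, -1) and a² - 2ab - b² for (s, κ) = (1, 2).
  form : ℤ → ℤ → ℤ → ℤ → ℤ
  form s κ a b = (a - s * b) * (a - s * b) - κ * (b * b)

  cross : ℤ × ℤ → ℤ × ℤ → ℤ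
  cross (a₁ , b₁) (a₂ , b₂) = a₁ * b₂ - a₂ * b₁

  module _ {P : ℤ} (p-prime : Prime (abs P)) (s κ : ℤ) (p∤2 : ¬ P ∣ + 2) (p∤κ : ¬ P ∣ κ) where

    private
      P² : ℤ
      P² = P * P

    -- With X = a - s b the quotient X/b is a square root of κ modulo P². The numerators of the
    -- difference and of the sum of two such roots are `cross` and `conj`.
    Root : ℤ × ℤ → Set
    Root (a , b) = ¬ P ∣ b × P² ∣ form s κ a b

    private
      conj : ℤ × ℤ → ℤ × ℤ → ℤ
      conj (a₁ , b₁) (a₂ , b₂) = (a₁ - s * b₁) * b₂ + (a₂ - s * b₂) * b₁

      root-unit : ∀ {x} → Root x → ¬ P ∣ proj₁ x - s * proj₂ x
      root-unit {a , b} (p∤b , r) p∣X = [ p∤κ , (λ p∣bb → p∤b (prime∣square p-prime b p∣bb)) ]′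
        (prime∣product p-prime κ (b * b)
          (∣-by (∣m∣n⇒∣m-n (∣m⇒∣m*n (a - s * b) p∣X) (square∣⇒∣ p-prime r)) (X²-[X²-k] (a - s * b) (κ * (b * b)))))

      -- Two square roots of κ agree up to sign modulo P²: `cross` times `conj` is a combination of
      -- the two values of the form, and P cannot divide both factors, because their sum 2 X₁ b₂ is
      -- a unit.
      root-pair : ∀ {x y} → Root x → Root y → P² ∣ cross x y ⊎ P² ∣ conj x y
      root-pair {x@(a₁ , b₁)} {y@(a₂ , b₂)} rx@(p∤b₁ , r₁) (p∤b₂ , r₂) =
        prime-square-splits p-prime (cross x y) (conj x y) ¬both
          (∣-by (∣m∣n⇒∣m-n (∣n⇒∣m*n (b₂ * b₂) r₁) (∣n⇒∣m*n (b₁ * b₁) r₂))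
            (trans (lemma₁ κ (a₁ - s * b₁) b₁ (a₂ - s * b₂) b₂) (cong (_* conj x y) (lemma₀ s a₁ b₁ a₂ b₂))))
        where
        lemma₀ : ∀ s a₁ b₁ a₂ b₂ → (a₁ - s * b₁) * b₂ - (a₂ - s * b₂) * b₁ ≡ a₁ * b₂ - a₂ * b₁
        lemma₀ = solve-∀
        lemma₁ : ∀ κ X₁ b₁ X₂ b₂ →
          b₂ * b₂ * (X₁ * X₁ - κ * (b₁ * b₁)) - b₁ * b₁ * (X₂ * X₂ - κ * (b₂ * b₂)) ≡ (X₁ * b₂ - X₂ * b₁) * (X₁ * b₂ + X₂ * b₁)
        lemma₁ = solve-∀
        lemma₂ : ∀ s a₁ b₁ a₂ b₂ →
          (a₁ * b₂ - a₂ * b₁) + ((a₁ - s * b₁) * b₂ + (a₂ - s * b₂) * b₁) ≡ + 2 * ((a₁ - s * b₁) * b₂)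
        lemma₂ = solve-∀
        ¬both : ¬ (P ∣ cross x y × P ∣ conj x y)
        ¬both (u , v) = [ p∤2 , [ root-unit {a₁ , b₁} rx , p∤b₂ ]′ ∘ prime∣product p-prime (a₁ - s * b₁) b₂ ]′
          (prime∣product p-prime (+ 2) _ (∣-by (∣m∣n⇒∣m+n u v) (lemma₂ s a₁ b₁ a₂ b₂)))

    -- Signs are compared with that of x: if y and z both have the opposite sign, they agree with
    -- each other.
    root-cross : ∀ {x y z} → Root x → Root y → Root z → P² ∣ cross x y ⊎ P² ∣ cross x z ⊎ P² ∣ cross y z
    root-cross {x@(a₁ , b₁)} {y@(a₂ , b₂)} {z@(a₃ , b₃)} rx@(p∤b₁ , _) ry rz =
      [ inj₁ , (λ u → [ inj₂ ∘ inj₁ , inj₂ ∘ inj₂ ∘ third u ]′ (root-pair {x} {z} rx rz)) ]′ (root-pair {x} {y} rx ry)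
      where
      lemma : ∀ s a₁ b₁ a₂ b₂ a₃ b₃ →
        b₃ * ((a₁ - s * b₁) * b₂ + (a₂ - s * b₂) * b₁) - b₂ * ((a₁ - s * b₁) * b₃ + (a₃ - s * b₃) * b₁)
        ≡ (a₂ * b₃ - a₃ * b₂) * b₁
      lemma = solve-∀
      third : P² ∣ conj x y → P² ∣ conj x z → P² ∣ cross y z
      third u v = prime-square∣product p-prime (cross y z) b₁ p∤b₁
        (∣-by (∣m∣n⇒∣m-n (∣n⇒∣m*n b₃ u) (∣n⇒∣m*n b₂ v)) (lemma s a₁ b₁ a₂ b₂ a₃ b₃))

-- Counting the grid points at which a prime square divides a factor

module Events where
  open Counting
  open PrimeSquares
  open import Data.Integer.Base as ℤ using (ℤ)
  open import Data.Integer.Divisibility.Signed as ℤ using (∣ᵤ⇒∣; ∣⇒∣ᵤ) renaming (_∣_ to _∣ℤ_)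
  import Data.Integer.Properties as ℤ
  import Data.Integer.Tactic.RingSolver as ℤSolver
  open import Data.List.Base using (List; length; upTo; cartesianProduct)
  open import Data.List.Membership.Propositional using (_∈_)
  open import Data.List.Membership.Propositional.Properties using (∈-upTo⁻; ∈-cartesianProduct⁻)
  open import Data.List.Properties using (length-upTo)
  open import Data.List.Relation.Unary.Unique.Propositional.Properties using (upTo⁺; cartesianProduct⁺)
  open import Data.Nat.Base
  open import Data.Nat.Coprimality as Coprimality using (Coprime; coprime?; coprime-divisor)
  open import Data.Nat.Divisibility
  open import Data.Nat.DivMod using (m<n*o⇒m/o<n)
  open import Data.Nat.Primality
  open import Data.Nat.Properties
  open import Data.Nat.Tactic.RingSolver using (solve-∀)
  open import Data.Product.Base using (_×_; _,_; proj₁; proj₂)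
  open import Data.Sum.Base using (_⊎_; inj₁; inj₂; [_,_]′) renaming (map to map-⊎)
  open import Data.Unit.Base using (tt)
  open import Function.Base using (_∘_)
  open import Relation.Binary.PropositionalEquality
  open import Relation.Nullary.Decidable using (yes; _×-dec_)
  open import Relation.Nullary.Negation using (¬_; contradiction)
  open import Relation.Unary using (Decidable)

  ∣-∣-∣ : ∀ {d m n} → d ∣ m → d ∣ n → d ∣ ∣ m - n ∣
  ∣-∣-∣ {d} (divides k refl) (divides l refl) = divides ∣ k - l ∣ (sym (*-distribʳ-∣-∣ d k l))

  abs-difference : ∀ m n → ℤ.∣ ℤ.+ m ℤ.- ℤ.+ n ∣ ≡ ∣ m - n ∣
  abs-difference m n = trans (cong ℤ.∣_∣ (ℤ.[+m]-[+n]≡m⊖n m n)) ([ ≤-case , ≥-case ]′ (≤-total m n))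
    where
    ≤-case : m ≤ n → ℤ.∣ m ℤ.⊖ n ∣ ≡ ∣ m - n ∣
    ≤-case m≤n = trans (ℤ.∣⊖∣-≤ m≤n) (sym (m≤n⇒∣m-n∣≡n∸m m≤n))
    ≥-case : n ≤ m → ℤ.∣ m ℤ.⊖ n ∣ ≡ ∣ m - n ∣
    ≥-case n≤m = trans (ℤ.∣m⊖n∣≡∣n⊖m∣ m n) (trans (ℤ.∣⊖∣-≤ n≤m) (sym (m≤n⇒∣n-m∣≡n∸m n≤m)))

  square-≤ : ∀ {m n} → m * m ≤ n * n → m ≤ n
  square-≤ mm≤nn = ≮⇒≥ (λ n<m → <⇒≱ (*-mono-< n<m n<m) mm≤nn)

  ∣∧<⇒≡0 : ∀ {d m} → d ∣ m → m < d → m ≡ 0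
  ∣∧<⇒≡0 {m = zero}  _   _   = refl
  ∣∧<⇒≡0 {m = suc _} d∣m m<d = contradiction (∣⇒≤ d∣m) (<⇒≱ m<d)

  coprime-cross : ∀ {a b c d} → Coprime a b → Coprime c d → a * d ≡ c * b → a ≡ c × b ≡ d
  coprime-cross {a} {b} {c} {d} ab cd eq =
    ∣-antisym (coprime-divisor ab (divides d (trans (*-comm b c) (trans (sym eq) (*-comm a d)))))
              (coprime-divisor cd (divides b (trans (*-comm d a) (trans eq (*-comm c b))))) ,
    ∣-antisym (coprime-divisor (Coprimality.sym ab) (divides c eq))
              (coprime-divisor (Coprimality.sym cd) (divides a (sym eq)))

  prime∤⇒coprime : ∀ {p n} → Prime p → ¬ p ∣ n → Coprime p n
  prime∤⇒coprime p-prime p∤n (d∣p , d∣n) with prime⇒irreducible p-prime d∣p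
  ... | inj₁ d≡1 = d≡1
  ... | inj₂ refl = contradiction d∣n p∤n

  coprime-square : ∀ {p n} → Coprime p n → Coprime (p * p) n
  coprime-square {p} {n} c {d} (d∣pp , d∣n) =
    c (coprime-divisor (λ {e} (e∣d , e∣p) → c (e∣p , ∣-trans e∣d d∣n)) d∣pp , d∣n)

  count≤length : ∀ {A : Set} {P : A → Set} (P? : Decidable P) xs → count P? xs ≤ length xs
  count≤length P? xs = ≤-trans (count-mono P? (λ _ → yes tt) {xs} (λ _ _ → tt)) (≤-reflexive (count-all (λ _ → yes tt) {xs} (λ _ → tt)))

  Points : ℕ → List (ℕ × ℕ)
  Points n = cartesianProduct (upTo n) (upTo n)

  count-rows-≤ : ∀ {R : ℕ × ℕ → Set} (R? : Decidable R) n k →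
    (∀ i → count (R? ∘ (i ,_)) (upTo n) ≤ k) → count R? (Points n) ≤ n * k
  count-rows-≤ R? n k rows = ≤-trans
    (count-rows (λ _ → yes tt) R? (upTo n) (upTo n) k (λ _ → tt) (λ {i} _ → rows i))
    (*-monoˡ-≤ k (≤-trans (count≤length (λ _ → yes tt) (upTo n)) (≤-reflexive (length-upTo n))))

  ∣progression : ∀ {m M} → Coprime m M → ∀ u N {i j} → m ∣ u + M * (N + i) → m ∣ u + M * (N + j) → m ∣ ∣ i - j ∣
  ∣progression {m} {M} c u N {i} {j} p q = coprime-divisor c (subst (m ∣_) eq (∣-∣-∣ p q))
    where
    eq : ∣ u + M * (N + i) - u + M * (N + j) ∣ ≡ M * ∣ i - j ∣
    eq = trans (∣m+n-m+o∣≡∣n-o∣ u _ _) (trans (sym (*-distribˡ-∣-∣ M (N + i) (N + j))) (cong (M *_) (∣m+n-m+o∣≡∣n-o∣ N i j)))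

  -- A single residue class is treated as a special case of two, at the price of a harmless factor
  -- 2.
  count-progression : ∀ m {M} .{{_ : NonZero m}} → Coprime m M → ∀ u N →
    count (λ i → m ∣? u + M * (N + i)) (upTo N) ≤ (N / m + 1) * 2
  count-progression m c u N = count-periodic _ m N (λ px py _ → inj₁ (∣progression c u N px py))

  module Grid (M c N : ℕ) where

    -- The indices start at N so that, for c ≤ M and indices below N, all values lie between MN and
    -- 3MN; the fractions a/b then stay in a bounded interval. The point of the curve belongs to the
    -- pair (M a, b).
    a b : ℕ → ℕ
    a i = c + M * (N + i)
    b j = 1 + M * (N + j)

    module _ {q : ℕ} (q-prime : Prime q) (q∤M : ¬ q ∣ M) where

      private
        instance
          q≢0 : NonZero q
          q≢0 = prime⇒nonZero q-prime
          qq≢0 : NonZero (q * q)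
          qq≢0 = m*n≢0 q q

        q⊥M : Coprime q M
        q⊥M = prime∤⇒coprime q-prime q∤M

        qq⊥M : Coprime (q * q) M
        qq⊥M = coprime-square q⊥M

      count-common : count (λ (i , j) → q ∣? a i ×-dec q ∣? b j) (Points N) ≤ ((N / q + 1) * 2) * ((N / q + 1) * 2)
      count-common = ≤-trans
        (count-rows (λ i → q ∣? a i) (λ (i , j) → q ∣? a i ×-dec q ∣? b j) (upTo N) (upTo N) ((N / q + 1) * 2) proj₁
          (λ {i} _ → ≤-trans (count-mono (λ j → q ∣? a i ×-dec q ∣? b j) (λ j → q ∣? b j) {upTo N} (λ _ → proj₂)) (count-progression q q⊥M 1 N)))
        (*-monoˡ-≤ _ (count-progression q q⊥M c N))

      count-square∣a : count (λ (i , j) → q * q ∣? a i) (Points N) ≤ N * ((N / (q * q) + 1) * 2)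
      count-square∣a = ≤-trans
        (count-rows (λ i → q * q ∣? a i) (λ (i , j) → q * q ∣? a i) (upTo N) (upTo N) N (λ r → r)
          (λ {i} _ → ≤-trans (count≤length (λ _ → q * q ∣? a i) (upTo N)) (≤-reflexive (length-upTo N))))
        (≤-trans (*-monoˡ-≤ N (count-progression (q * q) qq⊥M c N)) (≤-reflexive (*-comm _ N)))

      count-square∣b : count (λ (i , j) → q * q ∣? b j) (Points N) ≤ N * ((N / (q * q) + 1) * 2)
      count-square∣b = count-rows-≤ (λ (i , j) → q * q ∣? b j) N ((N / (q * q) + 1) * 2)
        (λ _ → count-progression (q * q) qq⊥M 1 N)

    Q : ℤ → ℤ → ℕ → ℕ → ℕ
    Q s κ i j = ℤ.∣ form s κ (ℤ.+ (M * a i)) (ℤ.+ b j) ∣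

    -- Coprimality is part of the event because it makes b a unit modulo q, so that the pair is a
    -- root of the quadratic congruence; pairs with a common prime factor form an event of their
    -- own.
    FormEvent : ℤ → ℤ → ℕ → ℕ × ℕ → Set
    FormEvent s κ q (i , j) = Coprime (a i) (b j) × q * q ∣ Q s κ i j

    formEvent? : ∀ s κ q → Decidable (FormEvent s κ q)
    formEvent? s κ q (i , j) = coprime? (a i) (b j) ×-dec q * q ∣? Q s κ i j

    module FormCount {q : ℕ} (q-prime : Prime q) (q∤M : ¬ q ∣ M)
      (s κ : ℤ)
      (q∤2 : ¬ ℤ.+ q ∣ℤ ℤ.+ 2) (q∤κ : ¬ ℤ.+ q ∣ℤ κ) (q∤s²-κ : ¬ ℤ.+ q ∣ℤ s ℤ.* s ℤ.- κ) where

      private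
        E : ℕ × ℕ → Set
        E = FormEvent s κ q

        E? : Decidable E
        E? = formEvent? s κ q

      private
        instance
          q≢0 : NonZero q
          q≢0 = prime⇒nonZero q-prime
          qq≢0 : NonZero (q * q)
          qq≢0 = m*n≢0 q q

        qq : ℤ
        qq = ℤ.+ q ℤ.* ℤ.+ q

        qq∣form : ∀ {i j} → q * q ∣ Q s κ i j → qq ∣ℤ form s κ (ℤ.+ (M * a i)) (ℤ.+ b j)
        qq∣form {i} {j} d = ∣ᵤ⇒∣ (subst (_∣ Q s κ i j) (sym (ℤ.abs-* (ℤ.+ q) (ℤ.+ q))) d)

        q∣ : ∀ {m n} → ℤ.+ q ∣ℤ ℤ.+ (m * n) → q ∣ m ⊎ q ∣ n
        q∣ {m} {n} d = euclidsLemma m n q-prime (∣⇒∣ᵤ d)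

        q∣M* : ∀ {n} → ℤ.+ q ∣ℤ ℤ.+ (M * n) → q ∣ n
        q∣M* d = [ (λ q∣M → contradiction q∣M q∤M) , (λ x → x) ]′ (q∣ d)

        -- If q divided b, the form would give q ∣ (M a - s b)², hence q ∣ M a and q ∣ a, against
        -- coprimality.
        unit-b : ∀ i j → E (i , j) → ¬ ℤ.+ q ∣ℤ ℤ.+ b j
        unit-b i j (a⊥b , d) q∣b = <⇒≢ (nonTrivial⇒n>1 q {{prime⇒nonTrivial q-prime}}) (sym (a⊥b (q∣a , ∣⇒∣ᵤ q∣b)))
          where
          A B : ℤ
          A = ℤ.+ (M * a i)
          B = ℤ.+ b j
          lemma : ∀ X κ B → X ℤ.* X ≡ (X ℤ.* X ℤ.- κ ℤ.* (B ℤ.* B)) ℤ.+ κ ℤ.* B ℤ.* B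
          lemma = ℤSolver.solve-∀
          q∣X : ℤ.+ q ∣ℤ A ℤ.- s ℤ.* B
          q∣X = prime∣square q-prime _ (∣-by (ℤ.∣m∣n⇒∣m+n (square∣⇒∣ q-prime (qq∣form {i} {j} d)) (ℤ.∣n⇒∣m*n (κ ℤ.* B) q∣b))
            (sym (lemma (A ℤ.- s ℤ.* B) κ B)))
          lemma₂ : ∀ X Y → X ℤ.- Y ℤ.+ Y ≡ X
          lemma₂ = ℤSolver.solve-∀
          q∣a : q ∣ a i
          q∣a = q∣M* (∣-by (ℤ.∣m∣n⇒∣m+n q∣X (ℤ.∣n⇒∣m*n s q∣b)) (lemma₂ A (s ℤ.* B)))

        -- Modulo M a the form reduces to (s² - κ) b², so a factor q of M a would divide b.
        unit-a : ∀ i j → E (i , j) → ¬ ℤ.+ q ∣ℤ ℤ.+ (M * a i)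
        unit-a i j e q∣A = unit-b i j e (prime∣square q-prime _
          ([ (λ x → contradiction x q∤s²-κ) , (λ x → x) ]′ (prime∣product q-prime (s ℤ.* s ℤ.- κ) _
            (∣-by (ℤ.∣m∣n⇒∣m-n (square∣⇒∣ q-prime (qq∣form {i} {j} (proj₂ e))) (ℤ.∣m⇒∣m*n (A ℤ.- (s ℤ.* B) ℤ.- (s ℤ.* B)) q∣A))
              (lemma s κ A B)))))
          where
          A B : ℤ
          A = ℤ.+ (M * a i)
          B = ℤ.+ b j
          lemma : ∀ s κ A B → (A ℤ.- s ℤ.* B) ℤ.* (A ℤ.- s ℤ.* B) ℤ.- κ ℤ.* (B ℤ.* B) ℤ.- A ℤ.* (A ℤ.- (s ℤ.* B) ℤ.- (s ℤ.* B))
            ≡ (s ℤ.* s ℤ.- κ) ℤ.* (B ℤ.* B)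
          lemma = ℤSolver.solve-∀

        point : ℕ × ℕ → ℤ × ℤ
        point (i , j) = ℤ.+ (M * a i) , ℤ.+ b j

        cross-abs : ∀ i j k l → ℤ.∣ cross (point (i , j)) (point (k , l)) ∣ ≡ M * ∣ a i * b l - a k * b j ∣
        cross-abs i j k l = begin
          ℤ.∣ ℤ.+ (M * a i) ℤ.* ℤ.+ b l ℤ.- ℤ.+ (M * a k) ℤ.* ℤ.+ b j ∣  ≡⟨ cong₂ (λ x y → ℤ.∣ x ℤ.- y ∣) (ℤ.pos-* (M * a i) (b l)) (ℤ.pos-* (M * a k) (b j)) ⟨
          ℤ.∣ ℤ.+ (M * a i * b l) ℤ.- ℤ.+ (M * a k * b j) ∣             ≡⟨ abs-difference (M * a i * b l) (M * a k * b j) ⟩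
          ∣ M * a i * b l - M * a k * b j ∣                             ≡⟨ cong₂ ∣_-_∣ (*-assoc M (a i) (b l)) (*-assoc M (a k) (b j)) ⟩
          ∣ M * (a i * b l) - M * (a k * b j) ∣                         ≡⟨ *-distribˡ-∣-∣ M _ _ ⟨
          M * ∣ a i * b l - a k * b j ∣                                 ∎
          where open ≡-Reasoning

        qq∣cross : ∀ {i j k l} → qq ∣ℤ cross (point (i , j)) (point (k , l)) → q * q ∣ ∣ a i * b l - a k * b j ∣
        qq∣cross {i} {j} {k} {l} d = coprime-divisor (coprime-square (prime∤⇒coprime q-prime q∤M))
          (subst₂ _∣_ (ℤ.abs-* (ℤ.+ q) (ℤ.+ q)) (cross-abs i j k l) (∣⇒∣ᵤ d))

        root : ∀ i j → E (i , j) → Root q-prime s κ q∤2 q∤κ (point (i , j))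
        root i j e = unit-b i j e , qq∣form {i} {j} (proj₂ e)

      three-crosses : ∀ {i j k l m n} → E (i , j) → E (k , l) → E (m , n) →
        q * q ∣ ∣ a i * b l - a k * b j ∣ ⊎ q * q ∣ ∣ a i * b n - a m * b j ∣ ⊎ q * q ∣ ∣ a k * b n - a m * b l ∣
      three-crosses {i} {j} {k} {l} {m} {n} e f g =
        map-⊎ (qq∣cross {i} {j} {k} {l}) (map-⊎ (qq∣cross {i} {j} {m} {n}) (qq∣cross {k} {l} {m} {n}))
          (root-cross q-prime s κ q∤2 q∤κ {point (i , j)} {point (k , l)} {point (m , n)} (root i j e) (root k l f) (root m n g))

      -- Within a row a is fixed, and the determinant of two points is a M times the difference of
      -- their indices. Since a M is prime to q, the roots fill at most two residue classes modulo
      -- q².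
      count-form-rows : count E? (Points N) ≤ N * ((N / (q * q) + 1) * 2)
      count-form-rows = count-rows-≤ E? N _ (λ i → count-periodic (E? ∘ (i ,_)) (q * q) N (two i))
        where
        same-row : ∀ {i j l} → E (i , j) → q * q ∣ ∣ a i * b l - a i * b j ∣ → q * q ∣ ∣ j - l ∣
        same-row {i} {j} {l} e d = coprime-divisor (coprime-square (prime∤⇒coprime q-prime q∤aM)) (subst (q * q ∣_) eq d)
          where
          q∤aM : ¬ q ∣ a i * M
          q∤aM q∣aM = unit-a i j e (∣ᵤ⇒∣ (subst (q ∣_) (*-comm (a i) M) q∣aM))
          eq : ∣ a i * b l - a i * b j ∣ ≡ a i * M * ∣ j - l ∣
          eq = begin
            ∣ a i * b l - a i * b j ∣         ≡⟨ *-distribˡ-∣-∣ (a i) (b l) (b j) ⟨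
            a i * ∣ b l - b j ∣               ≡⟨ cong (a i *_) (*-distribˡ-∣-∣ M (N + l) (N + j)) ⟨
            a i * (M * ∣ N + l - N + j ∣)     ≡⟨ cong (λ k → a i * (M * k)) (trans (∣m+n-m+o∣≡∣n-o∣ N l j) (∣-∣-comm l j)) ⟩
            a i * (M * ∣ j - l ∣)             ≡⟨ *-assoc (a i) M _ ⟨
            a i * M * ∣ j - l ∣               ∎
            where open ≡-Reasoning
        two : ∀ i → AnyTwoOfThree (λ j l → q * q ∣ ∣ j - l ∣) (λ j → E (i , j))
        two i {j} {l} {n} e f g = map-⊎ (same-row {i} {j} {l} e) (map-⊎ (same-row {i} {j} {n} e) (same-row {i} {l} {n} f))
          (three-crosses {i} {j} {i} {l} {i} {n} e f g)

      -- Coprime pairs are determined by the fraction a / b, and two fractions in one bin of length 1 / T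
      -- differ by less than q² / (b b′) when b² ≤ T q² for all b.
      count-form-bins : .{{NonZero M}} → ∀ T X →
        (∀ {i} → i < N → b i ≤ X) → X * X ≤ T * (q * q) → (∀ {i j} → i < N → j < N → a i ≤ 3 * b j) →
        count E? (Points N) ≤ (3 * T + 1) * 2
      count-form-bins T X b≤X XX≤Tqq a≤3b =
        count-bins E? (cartesianProduct⁺ (upTo⁺ N) (upTo⁺ N)) bin (3 * T + 1) (λ {x} x∈ _ → bin< x x∈) two
        where
        bin : ℕ × ℕ → ℕ
        bin (i , j) = a i * T / b j
        bounds : ∀ {i j} → (i , j) ∈ Points N → i < N × j < N
        bounds x∈ with ∈-cartesianProduct⁻ (upTo N) (upTo N) x∈
        ... | i∈ , j∈ = ∈-upTo⁻ i∈ , ∈-upTo⁻ j∈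
        bin< : ∀ x → x ∈ Points N → bin x < 3 * T + 1
        bin< (i , j) x∈ = m<n*o⇒m/o<n {a i * T} {3 * T + 1} {b j} (begin-strict
          a i * T                 ≤⟨ *-monoˡ-≤ T (a≤3b (proj₁ (bounds x∈)) (proj₂ (bounds x∈))) ⟩
          3 * b j * T             <⟨ m<m+n _ z<s ⟩
          3 * b j * T + b j       ≡⟨ lemma (b j) T ⟩
          (3 * T + 1) * b j       ∎)
          where
          open ≤-Reasoning
          lemma : ∀ b T → 3 * b * T + b ≡ (3 * T + 1) * b
          lemma = solve-∀
        -- T a/b and T a′/b′ have the same integer part, which cancels in T (a b′ - a′ b). What
        -- remains is a difference r b′ - s b of remainders with r < b and s < b′, hence less than b
        -- b′.
        close : ∀ {k i j m n} → (i , j) ∈ Points N → (m , n) ∈ Points N → bin (i , j) ≡ k → bin (m , n) ≡ k →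
          ∣ a i * b n - a m * b j ∣ < q * q
        close {k} {i} {j} {m} {n} x∈ y∈ refl eq with n≡r+[n/m]m (b j) (a i * T) | n≡r+[n/m]m (b n) (a m * T)
        ... | r , r<b , i≡ | s , s<b , m≡ = *-cancelˡ-< T _ _ (begin-strict
          T * ∣ a i * b n - a m * b j ∣            ≡⟨ *-distribˡ-∣-∣ T (a i * b n) (a m * b j) ⟩
          ∣ T * (a i * b n) - T * (a m * b j) ∣    ≡⟨ cong₂ ∣_-_∣ (expand (a i) (b n) (b j) i≡) (expand (a m) (b j) (b n) (trans m≡ (cong (λ k → s + k * b n) eq))) ⟩
          ∣ K * b j * b n + r * b n - K * b n * b j + s * b j ∣  ≡⟨ cong (λ t → ∣ K * b j * b n + r * b n - t + s * b j ∣) (swap K (b n) (b j)) ⟩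
          ∣ K * b j * b n + r * b n - K * b j * b n + s * b j ∣  ≡⟨ ∣m+n-m+o∣≡∣n-o∣ (K * b j * b n) (r * b n) (s * b j) ⟩
          ∣ r * b n - s * b j ∣                    ≤⟨ ∣m-n∣≤m⊔n (r * b n) (s * b j) ⟩
          r * b n ⊔ s * b j                        <⟨ ⊔-lub (*-monoˡ-< (b n) r<b) (subst (s * b j <_) (*-comm (b n) (b j)) (*-monoˡ-< (b j) s<b)) ⟩
          b j * b n                                ≤⟨ *-mono-≤ (b≤X (proj₂ (bounds x∈))) (b≤X (proj₂ (bounds y∈))) ⟩
          X * X                                    ≤⟨ XX≤Tqq ⟩
          T * (q * q)                              ∎)
          where
          open ≤-Reasoning
          K : ℕ
          K = bin (i , j)
          swap : ∀ k b c → k * b * c ≡ k * c * b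
          swap = solve-∀
          expand′ : ∀ T a b → T * (a * b) ≡ (a * T) * b
          expand′ = solve-∀
          expand″ : ∀ r K d b → (r + K * d) * b ≡ K * d * b + r * b
          expand″ = solve-∀
          expand : ∀ a b d {r} → a * T ≡ r + K * d → T * (a * b) ≡ K * d * b + r * b
          expand a b d {r} eq = trans (expand′ T a b) (trans (cong (_* b) eq) (expand″ r K d b))
        injective : ∀ {x y} → x ∈ Points N → y ∈ Points N → E x → E y → ∀ {k} → bin x ≡ k → bin y ≡ k →
          q * q ∣ ∣ a (proj₁ x) * b (proj₂ y) - a (proj₁ y) * b (proj₂ x) ∣ → x ≡ y
        injective {i , j} {m , n} x∈ y∈ e f eqx eqy d = cong₂ _,_
          (+-cancelˡ-≡ N _ _ (*-cancelˡ-≡ _ _ M (+-cancelˡ-≡ c _ _ (proj₁ same))))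
          (+-cancelˡ-≡ N _ _ (*-cancelˡ-≡ _ _ M (+-cancelˡ-≡ 1 _ _ (proj₂ same))))
          where
          same : a i ≡ a m × b j ≡ b n
          same = coprime-cross (proj₁ e) (proj₁ f) (∣m-n∣≡0⇒m≡n (∣∧<⇒≡0 d (close {i = i} {j} {m} {n} x∈ y∈ eqx eqy)))
        two : ∀ k → AnyTwoOfThree _≡_ (λ x → x ∈ Points N × E x × bin x ≡ k)
        two k {x} {y} {z} (x∈ , e , p) (y∈ , f , q) (z∈ , g , r) =
          map-⊎ (injective x∈ y∈ e f p q) (map-⊎ (injective x∈ z∈ e g p r) (injective y∈ z∈ f g q r))
            (three-crosses {proj₁ x} {proj₂ x} {proj₁ y} {proj₂ y} {proj₁ z} {proj₂ z} e f g)

-- The sieve over the grid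

module Sieving where
  open Counting
  open Events
  open PrimeSquares
  open import Data.Integer.Base as ℤ using (ℤ; 0ℤ; 1ℤ; -1ℤ)
  open import Data.Integer.Divisibility.Signed as ℤ using (∣⇒∣ᵤ) renaming (_∣_ to _∣ℤ_)
  import Data.Integer.Properties as ℤ
  import Data.Integer.Tactic.RingSolver as ℤSolver
  open import Data.List.Base using (length; upTo; cartesianProduct)
  open import Data.List.Membership.Propositional using (_∈_; find)
  open import Data.List.Membership.Propositional.Properties using (∈-upTo⁻; ∈-cartesianProduct⁻)
  open import Data.List.Properties using (length-upTo)
  open import Data.List.Relation.Unary.All as All using (all?)
  open import Data.List.Relation.Unary.All.Properties using (¬All⇒Any¬)
  open import Data.Nat.Base
  open import Data.Nat.Coprimality using (Coprime)
  open import Data.Nat.Divisibility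
  open import Data.Nat.DivMod using (m/n*n≤m; m<n*o⇒m/o<n)
  open import Data.Nat.Primality
  open import Data.Nat.Properties
  open import Data.Nat.Tactic.RingSolver using (solve-∀)
  open import Data.Product.Base using (∃-syntax; _×_; _,_; proj₁; proj₂)
  open import Data.Sum.Base using (_⊎_; inj₁; inj₂)
  open import Data.Unit.Base using (tt)
  open import Function.Base using (_∘_)
  open import Relation.Binary.PropositionalEquality
  open import Relation.Nullary.Decidable using (Dec; yes; no; _×-dec_; _⊎-dec_; ¬?; decidable-stable)
  open import Relation.Nullary.Negation using (¬_; contradiction)
  open import Relation.Unary using (Decidable)

  length-Points : ∀ n → length (Points n) ≡ n * n
  length-Points n = trans (go (upTo n) (upTo n)) (cong₂ _*_ (length-upTo n) (length-upTo n))
    where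
    open import Data.List.Base using (List; []; _∷_; map)
    open import Data.List.Properties using (length-++; length-map)
    go : ∀ (xs ys : List ℕ) → length (cartesianProduct xs ys) ≡ length xs * length ys
    go []       ys = refl
    go (x ∷ xs) ys = trans (length-++ (map (x ,_) ys)) (cong₂ _+_ (length-map (x ,_) ys) (go xs ys))

  escape : ∀ n {E : ℕ → ℕ × ℕ → Set} (E? : ∀ k → Decidable (E k)) t →
    ∑ t (λ k → count (E? k) (Points n)) < n * n →
    ∃[ i ] ∃[ j ] i < n × j < n × (∀ k → k < t → ¬ E k (i , j))
  escape n {E} E? t small with all? (λ x → anyUpTo? (λ k → E? k x) t) (Points n)
  ... | yes all = contradiction
    (≤-trans (≤-reflexive (sym (length-Points n)))
      (≤-trans (≤-reflexive (sym (count-all (λ _ → yes tt) {Points n} (λ _ → tt))))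
        (count-⋃ (λ _ → yes tt) E? t (λ x∈ _ → All.lookup all x∈))))
    (<⇒≱ small)
  ... | no ¬all with find (¬All⇒Any¬ (λ x → anyUpTo? (λ k → E? k x) t) (Points n) ¬all)
  ... | (i , j) , x∈ , ¬E with ∈-cartesianProduct⁻ (upTo n) (upTo n) x∈
  ... | i∈ , j∈ = i , j , ∈-upTo⁻ i∈ , ∈-upTo⁻ j∈ , λ k k<t e → ¬E (k , k<t , e)

  -- The constants are variables constrained by equations, since their values must not be unfolded.
  module Sieve (M c L : ℕ) (36≤M : 36 ≤ M) (c≤M : c ≤ M) (0<c : 0 < c)
    (small∣M : ∀ q → Prime q → q ≤ 64 → q ∣ M)
    (z C T K N : ℕ) (z≡ : z ≡ 64) (C≡ : C ≡ (z + 1) * 2 * ((z + 1) * 2)) (T≡ : T ≡ 9 * (z * z) * (M * M))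
    (K≡ : K ≡ C + ((3 * T + 1) * 2 + (3 * T + 1) * 2)) (N≡ : N ≡ z * L) where

    open Grid M c N public

    -- Writing M a = 3b + t turns A² - 2Ab - b² into a polynomial with positive coefficients, so
    -- that the sieve stays within ℕ and this factor is visibly positive.
    t Q₁ Q₂ : ℕ → ℕ → ℕ
    t i j = M * a i ∸ 3 * b j
    Q₁ i j = M * a i * (M * a i) + b j * b j
    Q₂ i j = 2 * (b j * b j) + 4 * (b j * t i j) + t i j * t i j

    module _ (L-large : 3 * z * M + 12 * (M * M) * K < L) where

      private
        instance
          M≢0 : NonZero M
          M≢0 = >-nonZero (<-≤-trans z<s 36≤M)

        0<L : 0 < L
        0<L = ≤-<-trans z≤n L-large

        0<N : 0 < N
        0<N = subst (0 <_) (sym N≡) (*-mono-≤ {1} {z} (subst (1 ≤_) (sym z≡) (s≤s z≤n)) 0<L)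

        X : ℕ
        X = 3 * (M * N)

        linear-≤ : ∀ u {i} → u ≤ M → i < N → u + M * (N + i) ≤ X
        linear-≤ u {i} u≤M i<N = begin
          u + M * (N + i)       ≤⟨ +-mono-≤ u≤MN (*-monoʳ-≤ M (+-monoʳ-≤ N (<⇒≤ i<N))) ⟩
          M * N + M * (N + N)   ≡⟨ lemma M N ⟩
          3 * (M * N)           ∎
          where
          open ≤-Reasoning
          u≤MN : u ≤ M * N
          u≤MN = ≤-trans u≤M (≤-trans (≤-reflexive (sym (*-identityʳ M))) (*-monoʳ-≤ M 0<N))
          lemma : ∀ M N → M * N + M * (N + N) ≡ 3 * (M * N)
          lemma = solve-∀

        a≤X : ∀ {i} → i < N → a i ≤ X
        a≤X = linear-≤ c c≤M

        b≤X : ∀ {j} → j < N → b j ≤ X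
        b≤X = linear-≤ 1 (≤-trans (s≤s z≤n) 36≤M)

        MN≤b : ∀ j → M * N ≤ b j
        MN≤b j = ≤-trans (*-monoʳ-≤ M (m≤m+n N j)) (n≤1+n _)

        MN≤a : ∀ i → M * N ≤ a i
        MN≤a i = ≤-trans (*-monoʳ-≤ M (m≤m+n N i)) (m≤n+m _ c)

        3b≤Ma : ∀ i {j} → j < N → 3 * b j ≤ M * a i
        3b≤Ma i {j} j<N = begin
          3 * b j           ≤⟨ *-monoʳ-≤ 3 (b≤X j<N) ⟩
          3 * (3 * (M * N)) ≡⟨ *-assoc 3 3 (M * N) ⟨
          9 * (M * N)       ≤⟨ *-mono-≤ (≤-trans (m≤m+n 9 27) 36≤M) (MN≤a i) ⟩
          M * a i           ∎
          where open ≤-Reasoning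

      Ma≡3b+t : ∀ i {j} → j < N → M * a i ≡ 3 * b j + t i j
      Ma≡3b+t i j<N = sym (m+[n∸m]≡n (3b≤Ma i j<N))

      Q≡Q₁ : ∀ i j → Q 0ℤ -1ℤ i j ≡ Q₁ i j
      Q≡Q₁ i j = cong ℤ.∣_∣ (sym (trans (cong₂ ℤ._+_ (ℤ.pos-* (M * a i) (M * a i)) (ℤ.pos-* (b j) (b j)))
        (lemma (ℤ.+ (M * a i)) (ℤ.+ b j))))
        where
        lemma : ∀ A B → A ℤ.* A ℤ.+ B ℤ.* B ≡ (A ℤ.- 0ℤ ℤ.* B) ℤ.* (A ℤ.- 0ℤ ℤ.* B) ℤ.- -1ℤ ℤ.* (B ℤ.* B)
        lemma = ℤSolver.solve-∀

      Q≡Q₂ : ∀ i {j} → j < N → Q 1ℤ (ℤ.+ 2) i j ≡ Q₂ i j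
      Q≡Q₂ i {j} j<N = cong ℤ.∣_∣ (sym (begin
        ℤ.+ Q₂ i j                                                                ≡⟨ cast (b j) (t i j) ⟩
        ℤ.+ 2 ℤ.* (B ℤ.* B) ℤ.+ ℤ.+ 4 ℤ.* (B ℤ.* S) ℤ.+ S ℤ.* S                   ≡⟨ lemma B S ⟩
        (ℤ.+ 3 ℤ.* B ℤ.+ S ℤ.- 1ℤ ℤ.* B) ℤ.* (ℤ.+ 3 ℤ.* B ℤ.+ S ℤ.- 1ℤ ℤ.* B) ℤ.- ℤ.+ 2 ℤ.* (B ℤ.* B)
          ≡⟨ cong (λ A → (A ℤ.- 1ℤ ℤ.* B) ℤ.* (A ℤ.- 1ℤ ℤ.* B) ℤ.- ℤ.+ 2 ℤ.* (B ℤ.* B)) A≡ ⟨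
        form 1ℤ (ℤ.+ 2) (ℤ.+ (M * a i)) B                                         ∎))
        where
        open ≡-Reasoning
        B S : ℤ
        B = ℤ.+ b j
        S = ℤ.+ t i j
        A≡ : ℤ.+ (M * a i) ≡ ℤ.+ 3 ℤ.* B ℤ.+ S
        A≡ = trans (cong ℤ.+_ (Ma≡3b+t i j<N)) (cong (ℤ._+ S) (ℤ.pos-* 3 (b j)))
        cast : ∀ m n → ℤ.+ (2 * (m * m) + 4 * (m * n) + n * n) ≡ ℤ.+ 2 ℤ.* (ℤ.+ m ℤ.* ℤ.+ m) ℤ.+ ℤ.+ 4 ℤ.* (ℤ.+ m ℤ.* ℤ.+ n) ℤ.+ ℤ.+ n ℤ.* ℤ.+ n
        cast m n = cong₂ ℤ._+_ (cong₂ ℤ._+_ (cast′ 2 m m) (cast′ 4 m n)) (ℤ.pos-* n n)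
          where
          cast′ : ∀ k m n → ℤ.+ (k * (m * n)) ≡ ℤ.+ k ℤ.* (ℤ.+ m ℤ.* ℤ.+ n)
          cast′ k m n = trans (ℤ.pos-* k (m * n)) (cong (ℤ.+ k ℤ.*_) (ℤ.pos-* m n))
        lemma : ∀ B S → ℤ.+ 2 ℤ.* (B ℤ.* B) ℤ.+ ℤ.+ 4 ℤ.* (B ℤ.* S) ℤ.+ S ℤ.* S
          ≡ (ℤ.+ 3 ℤ.* B ℤ.+ S ℤ.- 1ℤ ℤ.* B) ℤ.* (ℤ.+ 3 ℤ.* B ℤ.+ S ℤ.- 1ℤ ℤ.* B) ℤ.- ℤ.+ 2 ℤ.* (B ℤ.* B)
        lemma = ℤSolver.solve-∀

      private
        Common SquareA SquareB : ℕ → ℕ × ℕ → Set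
        Common  q (i , j) = q ∣ a i × q ∣ b j
        SquareA q (i , j) = q * q ∣ a i
        SquareB q (i , j) = q * q ∣ b j

        common? : ∀ q → Decidable (Common q)
        common? q (i , j) = q ∣? a i ×-dec q ∣? b j
        squareA? : ∀ q → Decidable (SquareA q)
        squareA? q (i , j) = q * q ∣? a i
        squareB? : ∀ q → Decidable (SquareB q)
        squareB? q (i , j) = q * q ∣? b j

        Form₁ Form₂ : ℕ → ℕ × ℕ → Set
        Form₁ = FormEvent 0ℤ -1ℤ
        Form₂ = FormEvent 1ℤ (ℤ.+ 2)

        form₁? : ∀ q → Decidable (Form₁ q)
        form₁? = formEvent? 0ℤ -1ℤ
        form₂? : ∀ q → Decidable (Form₂ q)
        form₂? = formEvent? 1ℤ (ℤ.+ 2)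

        -- These are all the obstructions outside M: for a coprime pair the four factors of the
        -- sextic form have no common prime there, so a repeated prime factor of the product is
        -- repeated in one of them.
        Event : ℕ → ℕ × ℕ → Set
        Event q x = Common q x ⊎ SquareA q x ⊎ SquareB q x ⊎ Form₁ q x ⊎ Form₂ q x

        event? : ∀ q → Decidable (Event q)
        event? q x = common? q x ⊎-dec squareA? q x ⊎-dec squareB? q x ⊎-dec form₁? q x ⊎-dec form₂? q x

        Bad : ℕ → ℕ × ℕ → Set
        Bad q x = (Prime q × ¬ q ∣ M) × Event q x

        bad? : ∀ q → Decidable (Bad q)
        bad? q x = (prime? q ×-dec ¬? (q ∣? M)) ×-dec event? q x

        count-event : ∀ q {k₁ k₂ k₃ k₄ k₅} →
          count (common? q) (Points N) ≤ k₁ → count (squareA? q) (Points N) ≤ k₂ → count (squareB? q) (Points N) ≤ k₃ →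
          count (form₁? q) (Points N) ≤ k₄ → count (form₂? q) (Points N) ≤ k₅ →
          count (event? q) (Points N) ≤ k₁ + (k₂ + (k₃ + (k₄ + k₅)))
        count-event q h₁ h₂ h₃ h₄ h₅ =
          ≤-trans (count-⊎ (event? q) (common? q) r₁? {pts} (λ _ e → e)) (+-mono-≤ h₁
          (≤-trans (count-⊎ r₁? (squareA? q) r₂? {pts} (λ _ e → e)) (+-mono-≤ h₂
          (≤-trans (count-⊎ r₂? (squareB? q) r₃? {pts} (λ _ e → e)) (+-mono-≤ h₃
          (≤-trans (count-⊎ r₃? (form₁? q) (form₂? q) {pts} (λ _ e → e)) (+-mono-≤ h₄ h₅)))))))
          where
          pts = Points N
          r₃? : Decidable (λ x → Form₁ q x ⊎ Form₂ q x)
          r₃? x = form₁? q x ⊎-dec form₂? q x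
          r₂? : Decidable (λ x → SquareB q x ⊎ Form₁ q x ⊎ Form₂ q x)
          r₂? x = squareB? q x ⊎-dec r₃? x
          r₁? : Decidable (λ x → SquareA q x ⊎ SquareB q x ⊎ Form₁ q x ⊎ Form₂ q x)
          r₁? x = squareA? q x ⊎-dec r₂? x

        count-bad : ∀ q k → (Prime q → ¬ q ∣ M → count (event? q) (Points N) ≤ k) → count (bad? q) (Points N) ≤ k
        count-bad q k h = go (prime? q ×-dec ¬? (q ∣? M))
          where
          go : Dec (Prime q × ¬ q ∣ M) → count (bad? q) (Points N) ≤ k
          go (yes (q-prime , q∤M)) = ≤-trans (count-mono (bad? q) (event? q) {Points N} (λ _ → proj₂)) (h q-prime q∤M)
          go (no ¬p) = ≤-trans (≤-reflexive (count-none (bad? q) {Points N} (λ _ → ¬p ∘ proj₁))) z≤n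

        q>64 : ∀ {q} → Prime q → ¬ q ∣ M → 64 < q
        q>64 {q} q-prime q∤M = ≰⇒> (λ q≤64 → q∤M (small∣M q q-prime q≤64))

        q∤unit : ∀ {q} → 64 < q → ∀ z .{{_ : NonZero ℤ.∣ z ∣}} → ℤ.∣ z ∣ ≤ 64 → ¬ ℤ.+ q ∣ℤ z
        q∤unit 64<q u z≤64 q∣z = <⇒≱ 64<q (≤-trans (∣⇒≤ {n = ℤ.∣ u ∣} (∣⇒∣ᵤ q∣z)) z≤64)

        module _ {q : ℕ} (q-prime : Prime q) (q∤M : ¬ q ∣ M) where

          private
            ∤ : ∀ z .{{_ : NonZero ℤ.∣ z ∣}} → ℤ.∣ z ∣ ≤ 64 → ¬ ℤ.+ q ∣ℤ z
            ∤ = q∤unit (q>64 q-prime q∤M)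

          module Form₁Count = FormCount q-prime q∤M 0ℤ -1ℤ (∤ (ℤ.+ 2) (s≤s (s≤s z≤n))) (∤ -1ℤ (s≤s z≤n)) (∤ 1ℤ (s≤s z≤n))
          module Form₂Count = FormCount q-prime q∤M 1ℤ (ℤ.+ 2) (∤ (ℤ.+ 2) (s≤s (s≤s z≤n))) (∤ (ℤ.+ 2) (s≤s (s≤s z≤n))) (∤ -1ℤ (s≤s z≤n))

        -- The main term, of size N²/q², of the count for one small q. The value at 0 is a filler
        -- that keeps the divisions defined; the summation begins at z + 1.
        g : ℕ → ℕ
        g zero      = 0
        g q@(suc _) = 8 * (N / q * (N / q) + N * (N / (q * q)))

        -- The term linear in N / q is absorbed by 2x ≤ x² + 1. The error 16 N collects 8 N from the
        -- incomplete blocks of the four counts of squares and the constant 8 from the common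
        -- factors.
        count-small : ∀ q → count (bad? q) (Points N) ≤ g q + 16 * N
        count-small zero = count-bad 0 _ (λ p → contradiction p ¬prime[0])
        count-small q@(suc _) = count-bad q _ (λ q-prime q∤M → ≤-trans
          (count-event q (count-common q-prime q∤M) (count-square∣a q-prime q∤M) (count-square∣b q-prime q∤M)
            (Form₁Count.count-form-rows q-prime q∤M) (Form₂Count.count-form-rows q-prime q∤M))
          (bound (N / q) (N / (q * q)) 0<N))
          where
          2x≤x²+1 : ∀ x → x + x ≤ x * x + 1
          2x≤x²+1 zero    = z≤n
          2x≤x²+1 (suc x) = subst (suc x + suc x ≤_) (lemma x) (m≤m+n (suc x + suc x) (x * x))
            where
            lemma : ∀ x → suc x + suc x + x * x ≡ suc x * suc x + 1
            lemma = solve-∀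
          bound : ∀ x y {n} → 0 < n →
            (x + 1) * 2 * ((x + 1) * 2) + (n * ((y + 1) * 2) + (n * ((y + 1) * 2) + (n * ((y + 1) * 2) + n * ((y + 1) * 2))))
            ≤ 8 * (x * x + n * y) + 16 * n
          bound x y {suc n} _ = begin
            (x + 1) * 2 * ((x + 1) * 2) + (k + (k + (k + k)))                           ≡⟨ lemma₁ x y n ⟩
            4 * (x + x) + (4 * (x * x) + 8 * (suc n * y) + 8 * n + 12)                  ≤⟨ +-monoˡ-≤ _ (*-monoʳ-≤ 4 (2x≤x²+1 x)) ⟩
            4 * (x * x + 1) + (4 * (x * x) + 8 * (suc n * y) + 8 * n + 12)              ≤⟨ m≤m+n _ (8 * n) ⟩
            4 * (x * x + 1) + (4 * (x * x) + 8 * (suc n * y) + 8 * n + 12) + 8 * n      ≡⟨ lemma₂ x y n ⟩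
            8 * (x * x + suc n * y) + 16 * suc n                                        ∎
            where
            open ≤-Reasoning
            k = suc n * ((y + 1) * 2)
            lemma₁ : ∀ x y n → (x + 1) * 2 * ((x + 1) * 2) + (suc n * ((y + 1) * 2) + (suc n * ((y + 1) * 2) + (suc n * ((y + 1) * 2) + suc n * ((y + 1) * 2))))
              ≡ 4 * (x + x) + (4 * (x * x) + 8 * (suc n * y) + 8 * n + 12)
            lemma₁ = solve-∀
            lemma₂ : ∀ x y n → 4 * (x * x + 1) + (4 * (x * x) + 8 * (suc n * y) + 8 * n + 12) + 8 * n ≡ 8 * (x * x + suc n * y) + 16 * suc n
            lemma₂ = solve-∀

        qqg≤ : ∀ q → q * q * g q ≤ 16 * (N * N)
        qqg≤ zero = z≤n
        qqg≤ q@(suc _) = begin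
          q * q * (8 * (x * x + N * y))                 ≡⟨ lemma q x y N ⟩
          8 * ((x * q) * (x * q)) + 8 * (N * (y * (q * q)))  ≤⟨ +-mono-≤ (*-monoʳ-≤ 8 (*-mono-≤ (m/n*n≤m N q) (m/n*n≤m N q))) (*-monoʳ-≤ 8 (*-monoʳ-≤ N (m/n*n≤m N (q * q)))) ⟩
          8 * (N * N) + 8 * (N * N)                     ≡⟨ *-distribʳ-+ (N * N) 8 8 ⟨
          16 * (N * N)                                  ∎
          where
          open ≤-Reasoning
          x y : ℕ
          x = N / q
          y = N / (q * q)
          lemma : ∀ q x y n → q * q * (8 * (x * x + n * y)) ≡ 8 * ((x * q) * (x * q)) + 8 * (n * (y * (q * q)))
          lemma = solve-∀

        X<qq : ∀ {q} → L < q → X < q * q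
        X<qq {q} L<q = ≤-<-trans (begin
          3 * (M * N)          ≡⟨ cong (λ n → 3 * (M * n)) N≡ ⟩
          3 * (M * (z * L))   ≡⟨ lemma z M L ⟩
          3 * z * M * L          ≤⟨ *-monoˡ-≤ L (≤-trans (m≤m+n (3 * z * M) _) (<⇒≤ L-large)) ⟩
          L * L                ∎) (*-mono-< L<q L<q)
          where
          open ≤-Reasoning
          lemma : ∀ E M L → 3 * (M * (E * L)) ≡ 3 * E * M * L
          lemma = solve-∀

        bounds : ∀ {i j} → (i , j) ∈ Points N → i < N × j < N
        bounds x∈ with ∈-cartesianProduct⁻ (upTo N) (upTo N) x∈
        ... | i∈ , j∈ = ∈-upTo⁻ i∈ , ∈-upTo⁻ j∈

        XX≤Tqq : ∀ {q} → L < q → X * X ≤ T * (q * q)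
        XX≤Tqq {q} L<q = begin
          X * X                                       ≡⟨ cong (λ n → 3 * (M * n) * (3 * (M * n))) N≡ ⟩
          3 * (M * (z * L)) * (3 * (M * (z * L)))   ≡⟨ lemma z M L ⟩
          9 * (z * z) * (M * M) * (L * L)           ≡⟨ cong (_* (L * L)) T≡ ⟨
          T * (L * L)                                 ≤⟨ *-monoʳ-≤ T (*-mono-≤ (<⇒≤ L<q) (<⇒≤ L<q)) ⟩
          T * (q * q)                                 ∎
          where
          open ≤-Reasoning
          lemma : ∀ E M L → 3 * (M * (E * L)) * (3 * (M * (E * L))) ≡ 9 * (E * E) * (M * M) * (L * L)
          lemma = solve-∀

        a≤3b : ∀ {i j} → i < N → j < N → a i ≤ 3 * b j
        a≤3b {i} {j} i<N _ = ≤-trans (a≤X i<N) (*-monoʳ-≤ 3 (MN≤b j))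

        N/q+1≤z+1 : ∀ q .{{_ : NonZero q}} → L < q → N / q + 1 ≤ z + 1
        N/q+1≤z+1 q L<q = ≤-trans (≤-reflexive (+-comm (N / q) 1)) (m<n*o⇒m/o<n {N} {z + 1} {q} (begin-strict
          N            ≡⟨ N≡ ⟩
          z * L        ≤⟨ *-monoʳ-≤ z (<⇒≤ L<q) ⟩
          z * q        <⟨ *-monoˡ-< q (m<m+n z z<s) ⟩
          (z + 1) * q  ∎))
          where open ≤-Reasoning

        -- For q > L neither a nor b, both at most 3MN, reaches q²; common factors account for at
        -- most C pairs, since N / q ≤ z; and each quadratic factor leaves at most two pairs per
        -- bin. The bound does not depend on N.
        count-large : ∀ q → L < q → count (bad? q) (Points N) ≤ K
        count-large q L<q = count-bad q K (λ q-prime q∤M → ≤-trans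
          (count-event q (common-≤C q-prime q∤M)
            (≤-reflexive (count-none (squareA? q) (λ {x} x∈ d → <⇒≱ (X<qq L<q) (≤-trans (∣⇒≤ {{>-nonZero (≤-trans 0<c (m≤m+n c _))}} d) (a≤X (proj₁ (bounds x∈)))))))
            (≤-reflexive (count-none (squareB? q) (λ {x} x∈ d → <⇒≱ (X<qq L<q) (≤-trans (∣⇒≤ d) (b≤X (proj₂ (bounds x∈)))))))
            (Form₁Count.count-form-bins q-prime q∤M T X b≤X (XX≤Tqq L<q) a≤3b)
            (Form₂Count.count-form-bins q-prime q∤M T X b≤X (XX≤Tqq L<q) a≤3b))
          (≤-reflexive (sym K≡)))
          where
          common-≤C : Prime q → ¬ q ∣ M → count (common? q) (Points N) ≤ C
          common-≤C q-prime q∤M = ≤-trans (count-common q-prime q∤M) (≤-trans (*-mono-≤ 2N/q≤ 2N/q≤) (≤-reflexive (sym C≡)))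
            where
            instance
              q≢0 : NonZero q
              q≢0 = prime⇒nonZero q-prime
            2N/q≤ : (N / q + 1) * 2 ≤ (z + 1) * 2
            2N/q≤ = *-monoˡ-≤ 2 (N/q+1≤z+1 q L<q)

        -- No event occurs beyond q = R: the numbers that q or q² would divide are positive, M a and
        -- b are at most MX, and the quadratic factors are at most (2MX)² = R².
        R : ℕ
        R = 6 * (M * M) * N

        -- The budget of N² pairs: the main terms give at most 16 N²/64 = N²/4 by telescoping over q
        -- > 64, the errors of the L small q give L · 16 N = N²/4 because N = 64 L, and the large q
        -- give R K = 6 M² N K < N²/2 by the choice of L.
        total : ∑ (L + R) (λ k → count (bad? (z + suc k)) (Points N)) < N * N
        total = *-cancelˡ-< 4 _ _ (begin-strict
          4 * ∑ (L + R) f                                         ≡⟨ cong (4 *_) (∑-split L R f) ⟩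
          4 * (∑ L f + ∑ R (f ∘ (L +_)))                          ≤⟨ *-monoʳ-≤ 4 (+-mono-≤ (∑-mono L (λ k → count-small (z + suc k)))
                                                                      (∑-mono R (λ k → count-large (z + suc (L + k)) (≤-trans (s≤s (m≤m+n L k)) (m≤n+m _ z))))) ⟩
          4 * (∑ L (λ k → g (z + suc k) + 16 * N) + ∑ R (λ _ → K)) ≡⟨ cong₂ (λ x y → 4 * (x + y)) (∑-+ L (λ k → g (z + suc k)) (16 * N)) (∑-const R K) ⟩
          4 * (G + L * (16 * N) + R * K)                          ≡⟨ lemma₁ 16 G L M N K ⟩
          4 * G + 4 * 16 * L * N + 2 * (12 * (M * M) * K * N)     ≡⟨ cong (λ n → 4 * G + n * N + 2 * (12 * (M * M) * K * N)) (trans N≡ (cong (_* L) z≡)) ⟨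
          4 * G + N * N + 2 * (12 * (M * M) * K * N)              <⟨ +-mono-≤-< (+-monoˡ-≤ (N * N) 4G≤NN) (*-monoʳ-< 2 12MMKN<NN) ⟩
          N * N + N * N + 2 * (N * N)                             ≡⟨ lemma₂ (N * N) ⟩
          4 * (N * N)                                             ∎)
          where
          open ≤-Reasoning
          f : ℕ → ℕ
          f k = count (bad? (z + suc k)) (Points N)
          G : ℕ
          G = ∑ L (λ k → g (z + suc k))
          4G≤NN : 4 * G ≤ N * N
          4G≤NN = *-cancelˡ-≤ 16 (begin
            16 * (4 * G)   ≡⟨ *-assoc 16 4 G ⟨
            64 * G         ≡⟨ cong (λ k → k * G) z≡ ⟨
            z * G          ≤⟨ ∑-telescope (16 * (N * N)) L z (λ k → g (z + suc k)) (λ k → qqg≤ (z + suc k)) ⟩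
            16 * (N * N)   ∎)
          12MMKN<NN : 12 * (M * M) * K * N < N * N
          12MMKN<NN = *-monoˡ-< N {{>-nonZero 0<N}} (begin-strict
            12 * (M * M) * K  ≤⟨ m≤n+m _ (3 * z * M) ⟩
            3 * z * M + 12 * (M * M) * K <⟨ L-large ⟩
            L                 ≤⟨ m≤n*m L z {{subst NonZero (sym z≡) _}} ⟩
            z * L            ≡⟨ N≡ ⟨
            N                 ∎)
          lemma₁ : ∀ k G L M N K → 4 * (G + L * (k * N) + 6 * (M * M) * N * K) ≡ 4 * G + 4 * k * L * N + 2 * (12 * (M * M) * K * N)
          lemma₁ = solve-∀
          lemma₂ : ∀ n → n + n + 2 * n ≡ 4 * n
          lemma₂ = solve-∀

        MX : ℕ
        MX = M * X

        R≡2MX : R ≡ 2 * MX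
        R≡2MX = lemma M N
          where
          lemma : ∀ M N → 6 * (M * M) * N ≡ 2 * (M * (3 * (M * N)))
          lemma = solve-∀

        X≤MX : X ≤ MX
        X≤MX = m≤n*m X M

        X≤R : X ≤ R
        X≤R = ≤-trans X≤MX (≤-trans (m≤n*m MX 2) (≤-reflexive (sym R≡2MX)))

        Q₁≤RR : ∀ {i j} → i < N → j < N → Q₁ i j ≤ R * R
        Q₁≤RR {i} {j} i<N j<N = begin
          Q₁ i j                ≤⟨ +-mono-≤ (*-mono-≤ Ma≤MX Ma≤MX) (*-mono-≤ b≤MX b≤MX) ⟩
          MX * MX + MX * MX     ≤⟨ m≤m+n _ (2 * (MX * MX)) ⟩
          MX * MX + MX * MX + 2 * (MX * MX)  ≡⟨ lemma MX ⟩
          2 * MX * (2 * MX)     ≡⟨ cong (λ r → r * r) R≡2MX ⟨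
          R * R                 ∎
          where
          open ≤-Reasoning
          Ma≤MX : M * a i ≤ MX
          Ma≤MX = *-monoʳ-≤ M (a≤X i<N)
          b≤MX : b j ≤ MX
          b≤MX = ≤-trans (b≤X j<N) X≤MX
          lemma : ∀ m → m * m + m * m + 2 * (m * m) ≡ 2 * m * (2 * m)
          lemma = solve-∀

        Q₂≤RR : ∀ {i j} → i < N → j < N → Q₂ i j ≤ R * R
        Q₂≤RR {i} {j} i<N j<N = begin
          Q₂ i j                                                    ≤⟨ m≤m+n _ _ ⟩
          Q₂ i j + (7 * (b j * b j) + 2 * (b j * t i j))            ≡⟨ lemma (b j) (t i j) ⟩
          (3 * b j + t i j) * (3 * b j + t i j)                     ≡⟨ cong (λ n → n * n) (Ma≡3b+t i j<N) ⟨
          M * a i * (M * a i)                                       ≤⟨ m≤m+n _ _ ⟩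
          Q₁ i j                                                    ≤⟨ Q₁≤RR i<N j<N ⟩
          R * R                                                     ∎
          where
          open ≤-Reasoning
          lemma : ∀ b t → 2 * (b * b) + 4 * (b * t) + t * t + (7 * (b * b) + 2 * (b * t)) ≡ (3 * b + t) * (3 * b + t)
          lemma = solve-∀

        m≤m*m : ∀ m → m ≤ m * m
        m≤m*m zero      = z≤n
        m≤m*m m@(suc _) = m≤n*m m m

        0<a : ∀ i → 0 < a i
        0<a i = ≤-trans 0<c (m≤m+n c _)

        0<Q₁ : ∀ i j → 0 < Q₁ i j
        0<Q₁ i j = m≤n⇒m≤o+n (M * a i * (M * a i)) z<s

        0<Q₂ : ∀ i j → 0 < Q₂ i j
        0<Q₂ i j = z<s

        event⇒≤R : ∀ {q i j} → Event q (i , j) → i < N → j < N → q ≤ R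
        event⇒≤R {q} {i} (inj₁ (q∣a , _)) i<N _ = ≤-trans (≤-trans (∣⇒≤ {{>-nonZero (0<a i)}} q∣a) (a≤X i<N)) X≤R
        event⇒≤R {q} {i} (inj₂ (inj₁ d)) i<N _ = ≤-trans (≤-trans (m≤m*m q) (≤-trans (∣⇒≤ {{>-nonZero (0<a i)}} d) (a≤X i<N))) X≤R
        event⇒≤R {q} (inj₂ (inj₂ (inj₁ d))) _ j<N = ≤-trans (≤-trans (m≤m*m q) (≤-trans (∣⇒≤ d) (b≤X j<N))) X≤R
        event⇒≤R {q} {i} {j} (inj₂ (inj₂ (inj₂ (inj₁ (_ , d))))) i<N j<N = square-≤ (≤-trans
          (∣⇒≤ {{>-nonZero (0<Q₁ i j)}} (subst (q * q ∣_) (Q≡Q₁ i j) d)) (Q₁≤RR {i} {j} i<N j<N))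
        event⇒≤R {q} {i} {j} (inj₂ (inj₂ (inj₂ (inj₂ (_ , d))))) i<N j<N = square-≤ (≤-trans
          (∣⇒≤ {{>-nonZero (0<Q₂ i j)}} (subst (q * q ∣_) (Q≡Q₂ i j<N) d)) (Q₂≤RR {i} {j} i<N j<N))

      record SieveSurvivor (i j : ℕ) : Set where
        field
          j<N     : j < N
          a⊥b     : Coprime (a i) (b j)
          ∤a      : ∀ {q} → Prime q → ¬ q ∣ M → ¬ q * q ∣ a i
          ∤b      : ∀ {q} → Prime q → ¬ q ∣ M → ¬ q * q ∣ b j
          ∤Q₁     : ∀ {q} → Prime q → ¬ q ∣ M → ¬ q * q ∣ Q₁ i j
          ∤Q₂     : ∀ {q} → Prime q → ¬ q ∣ M → ¬ q * q ∣ Q₂ i j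

      survivor : ∃[ i ] ∃[ j ] SieveSurvivor i j
      survivor = conclude (escape N (λ k → bad? (z + suc k)) (L + R) total)
        where
        conclude : (∃[ i ] ∃[ j ] i < N × j < N × (∀ k → k < L + R → ¬ Bad (z + suc k) (i , j))) → ∃[ i ] ∃[ j ] SieveSurvivor i j
        conclude (i , j , i<N , j<N , ¬bad) = i , j , record
          { j<N = j<N
          ; a⊥b = a⊥b
          ; ∤a  = λ p p∤M d → ¬event p p∤M (inj₂ (inj₁ d))
          ; ∤b  = λ p p∤M d → ¬event p p∤M (inj₂ (inj₂ (inj₁ d)))
          ; ∤Q₁ = λ {q} p p∤M d → ¬event p p∤M (inj₂ (inj₂ (inj₂ (inj₁ (a⊥b , subst (q * q ∣_) (sym (Q≡Q₁ i j)) d)))))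
          ; ∤Q₂ = λ {q} p p∤M d → ¬event p p∤M (inj₂ (inj₂ (inj₂ (inj₂ (a⊥b , subst (q * q ∣_) (sym (Q≡Q₂ i j<N)) d)))))
          }
          where
          -- A prime outside M exceeds 64 and is therefore of the form z + 1 + k; `event⇒≤R` shows
          -- that k is in the range of the sieve.
          ¬event : ∀ {q} → Prime q → ¬ q ∣ M → ¬ Event q (i , j)
          ¬event {q} p p∤M e = ¬bad (q ∸ suc z) k< (subst (λ q → Bad q (i , j)) q≡ ((p , p∤M) , e))
            where
            z<q : z < q
            z<q = subst (_< q) (sym z≡) (q>64 p p∤M)
            q≡ : q ≡ z + suc (q ∸ suc z)
            q≡ = sym (trans (+-suc z (q ∸ suc z)) (m+[n∸m]≡n z<q))
            k< : q ∸ suc z < L + R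
            k< = ≤-trans (∸-monoʳ-< {q} {suc z} {0} (s≤s z≤n) z<q) (≤-trans (event⇒≤R {q} {i} {j} e i<N j<N) (m≤n+m R L))
          -- A common prime of a and b does not divide M, since b is 1 modulo M; it is thus one of
          -- the sieved primes.
          a⊥b : Coprime (a i) (b j)
          a⊥b {d} (d∣a , d∣b) = decidable-stable (d ≟ 1) (λ d≢1 → go (prime-divisor d d≢1))
            where
            go : ¬ (∃[ q ] Prime q × q ∣ d)
            go (q , q-prime , q∣d) = ¬event q-prime q∤M (inj₁ (∣-trans q∣d d∣a , ∣-trans q∣d d∣b))
              where
              q∤M : ¬ q ∣ M
              q∤M q∣M = <⇒≢ (nonTrivial⇒n>1 q {{prime⇒nonTrivial q-prime}})
                (sym (∣1⇒≡1 (∣m+n∣m⇒∣n (subst (q ∣_) (+-comm 1 _) (∣-trans q∣d d∣b)) (∣m⇒∣m*n (N + j) q∣M))))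

-- Squarefree values of the sextic form in a residue class

module Candidates where
  open Events
  open PrimeSquares
  open Sieving
  open import Data.Empty using (⊥)
  open import Data.Integer.Base as ℤ using (ℤ; 1ℤ)
  open import Data.Integer.Divisibility.Signed as ℤ using (∣ᵤ⇒∣; ∣⇒∣ᵤ) renaming (_∣_ to _∣ℤ_)
  import Data.Integer.Properties as ℤ
  import Data.Integer.Tactic.RingSolver as ℤSolver
  open import Data.List.Base using (List; filter; upTo)
  open import Data.List.Membership.Propositional using (_∈_)
  open import Data.List.Membership.Propositional.Properties using (∈-filter⁺; ∈-filter⁻; ∈-upTo⁺; ∈-upTo⁻)
  open import Data.List.Relation.Unary.All as All using (All)
  open import Data.Nat.Base
  open import Data.Nat.Coprimality using (Coprime; coprime-divisor)
  open import Data.Nat.Divisibility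
  open import Data.Nat.ListAction using (product)
  open import Data.Nat.ListAction.Properties using (∈⇒∣product)
  open import Data.Nat.Primality
  open import Data.Nat.Primality.Factorisation using (factorisationHasAllPrimeFactors)
  open import Data.Nat.Properties
  open import Data.Nat.Tactic.RingSolver using (solve-∀)
  open import Data.Product.Base using (∃-syntax; _×_; _,_; proj₁; proj₂)
  open import Data.Sum.Base using (_⊎_; inj₁; inj₂; [_,_]′)
  open import Function.Base using (_∘_)
  open import Relation.Binary.PropositionalEquality
  open import Relation.Nullary.Decidable using (Dec; yes; no; _×-dec_; ¬?; from-yes)
  open import Relation.Nullary.Negation using (¬_; contradiction)

  prime-∣-prime : ∀ {p q} → Prime p → Prime q → p ∣ q → p ≡ q
  prime-∣-prime p-prime q-prime p∣q = [ (λ p≡1 → contradiction (subst Prime p≡1 p-prime) ¬prime[1]) , (λ p≡q → p≡q) ]′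
    (prime⇒irreducible q-prime p∣q)

  prime-square-splitsℕ : ∀ {q} m n → Prime q → ¬ (q ∣ m × q ∣ n) → q * q ∣ m * n → q * q ∣ m ⊎ q * q ∣ n
  prime-square-splitsℕ {q} m n q-prime ¬both d = [ inj₁ ∘ to m , inj₂ ∘ to n ]′
    (prime-square-splits {ℤ.+ q} q-prime (ℤ.+ m) (ℤ.+ n) (λ (x , y) → ¬both (∣⇒∣ᵤ x , ∣⇒∣ᵤ y)) (subst₂ _∣ℤ_ (ℤ.pos-* q q) (ℤ.pos-* m n) (∣ᵤ⇒∣ d)))
    where
    to : ∀ k → ℤ.+ q ℤ.* ℤ.+ q ∣ℤ ℤ.+ k → q * q ∣ k
    to k d = ∣⇒∣ᵤ (subst (_∣ℤ ℤ.+ k) (sym (ℤ.pos-* q q)) d)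

  module _ {q : ℕ} (q-prime : Prime q) where

    prime∣*⇒∣ : ∀ {m n} → ¬ q ∣ m → q ∣ m * n → q ∣ n
    prime∣*⇒∣ {m} {n} q∤m d = [ (λ q∣m → contradiction q∣m q∤m) , (λ x → x) ]′ (euclidsLemma m n q-prime d)

    prime∣²⇒∣ : ∀ {m} → q ∣ m * m → q ∣ m
    prime∣²⇒∣ {m} d = [ (λ x → x) , (λ x → x) ]′ (euclidsLemma m m q-prime d)

    square-∤-product₄ : ∀ {w x y z} →
      ¬ (q ∣ w × q ∣ x) → ¬ (q ∣ w × q ∣ y) → ¬ (q ∣ w × q ∣ z) → ¬ (q ∣ x × q ∣ y) → ¬ (q ∣ x × q ∣ z) → ¬ (q ∣ y × q ∣ z) →
      ¬ q * q ∣ w → ¬ q * q ∣ x → ¬ q * q ∣ y → ¬ q * q ∣ z → ¬ q * q ∣ w * x * y * z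
    square-∤-product₄ {w} {x} {y} {z} wx wy wz xy xz yz w′ x′ y′ z′ d =
      [ [ [ w′ , x′ ]′ ∘ prime-square-splitsℕ w x q-prime wx , y′ ]′ ∘ prime-square-splitsℕ (w * x) y q-prime wxy , z′ ]′
        (prime-square-splitsℕ (w * x * y) z q-prime wxyz d)
      where
      wxy : ¬ (q ∣ w * x × q ∣ y)
      wxy (d , e) = [ (λ d → wy (d , e)) , (λ d → xy (d , e)) ]′ (euclidsLemma w x q-prime d)
      wxyz : ¬ (q ∣ w * x * y × q ∣ z)
      wxyz (d , e) = [ [ (λ d → wz (d , e)) , (λ d → xz (d , e)) ]′ ∘ euclidsLemma w x q-prime , (λ d → yz (d , e)) ]′
        (euclidsLemma (w * x) y q-prime d)

    module _ (A b t : ℕ) (A≡ : A ≡ 3 * b + t) where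

      private
        Q₁ Q₂ : ℕ
        Q₁ = A * A + b * b
        Q₂ = 2 * (b * b) + 4 * (b * t) + t * t

        Q₂+ : Q₂ + 2 * A * b + b * b ≡ A * A
        Q₂+ = trans (cong (λ A → Q₂ + 2 * A * b + b * b) A≡) (trans (lemma b t) (sym (cong (λ A → A * A) A≡)))
          where
          lemma : ∀ b t → 2 * (b * b) + 4 * (b * t) + t * t + 2 * (3 * b + t) * b + b * b ≡ (3 * b + t) * (3 * b + t)
          lemma = solve-∀

      A,Q₁⇒b : q ∣ A → q ∣ Q₁ → q ∣ b
      A,Q₁⇒b d e = prime∣²⇒∣ (∣m+n∣m⇒∣n e (∣m⇒∣m*n A d))

      b,Q₁⇒A : q ∣ b → q ∣ Q₁ → q ∣ A
      b,Q₁⇒A d e = prime∣²⇒∣ (∣m+n∣m⇒∣n (subst (q ∣_) (+-comm (A * A) (b * b)) e) (∣m⇒∣m*n b d))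

      A,Q₂⇒b : q ∣ A → q ∣ Q₂ → q ∣ b
      A,Q₂⇒b d e = prime∣²⇒∣ (∣m+n∣m⇒∣n (subst (q ∣_) (sym Q₂+) (∣m⇒∣m*n A d)) (∣m∣n⇒∣m+n e (∣m⇒∣m*n b (∣n⇒∣m*n 2 d))))

      b,Q₂⇒A : q ∣ b → q ∣ Q₂ → q ∣ A
      b,Q₂⇒A d e = prime∣²⇒∣ (subst (q ∣_) Q₂+ (∣m∣n⇒∣m+n (∣m∣n⇒∣m+n e (∣n⇒∣m*n (2 * A) d)) (∣m⇒∣m*n b d)))

      -- The resultant of the two quadratic factors is a power of 2: their difference is 2b(A + b)
      -- and their sum 2A(A - b). If q is odd and divides neither A nor b, it divides A + b and A -
      -- b, hence 2b.
      Q₁,Q₂⇒A,b : ¬ q ∣ 2 → q ∣ Q₁ → q ∣ Q₂ → ¬ ¬ (q ∣ A × q ∣ b)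
      Q₁,Q₂⇒A,b q∤2 d e ¬both = q∤b (prime∣*⇒∣ q∤2 (∣m+n∣m⇒∣n (subst (q ∣_) (lemma₃ b t) q∣4b+t) q∣2b+t))
        where
        q∤b : ¬ q ∣ b
        q∤b q∣b = ¬both (b,Q₁⇒A q∣b d , q∣b)
        q∤A : ¬ q ∣ A
        q∤A q∣A = ¬both (q∣A , A,Q₁⇒b q∣A d)
        lemma₁ : ∀ b t → (3 * b + t) * (3 * b + t) + b * b ≡ 2 * (b * (4 * b + t)) + (2 * (b * b) + 4 * (b * t) + t * t)
        lemma₁ = solve-∀
        lemma₂ : ∀ b t → (3 * b + t) * (3 * b + t) + b * b + (2 * (b * b) + 4 * (b * t) + t * t) ≡ 2 * ((3 * b + t) * (2 * b + t))
        lemma₂ = solve-∀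
        lemma₃ : ∀ b t → 4 * b + t ≡ 2 * b + t + 2 * b
        lemma₃ = solve-∀
        q∣4b+t : q ∣ 4 * b + t
        q∣4b+t = prime∣*⇒∣ q∤b (prime∣*⇒∣ q∤2 (∣m+n∣n⇒∣m′ (subst (q ∣_) (trans (cong (λ A → A * A + b * b) A≡) (lemma₁ b t)) d) e))
          where
          ∣m+n∣n⇒∣m′ : ∀ {m n} → q ∣ m + n → q ∣ n → q ∣ m
          ∣m+n∣n⇒∣m′ {m} {n} x = ∣m+n∣m⇒∣n (subst (q ∣_) (+-comm m n) x)
        q∣2b+t : q ∣ 2 * b + t
        q∣2b+t = prime∣*⇒∣ (subst (λ A → ¬ q ∣ A) A≡ q∤A) (prime∣*⇒∣ q∤2
          (subst (q ∣_) (trans (cong (λ A → A * A + b * b + Q₂) A≡) (lemma₂ b t)) (∣m∣n⇒∣m+n d e)))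

  -- d = -n is the squarefree part of -A b (A² + b²) (A² - 2Ab - b²).
  record Candidate (p r B : ℕ) : Set where
    field
      A b t D n : ℕ
      A≡3b+t     : A ≡ 3 * b + t
      D²n≡       : D * D * n ≡ A * b * (A * A + b * b) * (2 * (b * b) + 4 * (b * t) + t * t)
      0<D        : 0 < D
      0<b        : 0 < b
      A⊥b        : Coprime A b
      2∣A        : 2 ∣ A
      2∤b        : ¬ 2 ∣ b
      squarefree : ∀ {q} → Prime q → ¬ q * q ∣ n
      p∣n+r      : p ∣ n + r
      A²<n       : A * A < n
      B<n        : B < n

  primesUpTo : ℕ → List ℕ
  primesUpTo z = filter prime? (upTo (suc z))

  ∈-primesUpTo : ∀ {z q} → Prime q → q ≤ z → q ∈ primesUpTo z
  ∈-primesUpTo q-prime q≤z = ∈-filter⁺ prime? (∈-upTo⁺ (s≤s q≤z)) q-prime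

  all-primesUpTo : ∀ z → All Prime (primesUpTo z)
  all-primesUpTo z = All.tabulate (proj₂ ∘ ∈-filter⁻ prime? {xs = upTo (suc z)})

  n<2^n : ∀ n → n < 2 ^ n
  n<2^n zero    = s≤s z≤n
  n<2^n (suc n) = begin-strict
    suc n           <⟨ s≤s (n<2^n n) ⟩
    suc (2 ^ n)     ≤⟨ +-monoˡ-≤ (2 ^ n) (≤-trans (s≤s z≤n) (n<2^n n)) ⟩
    2 ^ n + 2 ^ n   ≡⟨ cong (2 ^ n +_) (+-identityʳ (2 ^ n)) ⟨
    2 * 2 ^ n       ∎
    where open ≤-Reasoning

  prime∣2^⇒≡2 : ∀ {q} → Prime q → ∀ n → q ∣ 2 ^ n → q ≡ 2
  prime∣2^⇒≡2 q-prime zero    d = contradiction (subst Prime (∣1⇒≡1 d) q-prime) ¬prime[1]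
  prime∣2^⇒≡2 q-prime (suc n) d = [ prime-∣-prime q-prime prime[2] , prime∣2^⇒≡2 q-prime n ]′ (euclidsLemma 2 (2 ^ n) q-prime d)

  prime[3] : Prime 3
  prime[3] = from-yes (prime? 3)

  -- If r ≠ 0, adding to r the product of p and the primes q ≤ z that do not divide r makes it prime to p
  -- and to all q ≤ z.
  representative : ∀ {p} → Prime p → ∀ r → r < p → ∀ z →
    ∃[ c ] 0 < c × (∃[ k ] c ≡ r + p * k) × (∀ {q} → Prime q → q ≡ p ⊎ q ≤ z → ¬ q * q ∣ c)
  representative {p} p-prime zero r<p z =
    p , r<p , (1 , sym (*-identityʳ p)) , λ {q} q-prime _ qq∣p → square∤ q-prime (prime-∣-prime q-prime p-prime (m*n∣⇒m∣ q q qq∣p)) qq∣p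
    where
    square∤ : ∀ {q} → Prime q → q ≡ p → ¬ q * q ∣ p
    square∤ q-prime refl d = <⇒≱ (m<m*n p p {{prime⇒nonZero p-prime}} (nonTrivial⇒n>1 p {{prime⇒nonTrivial p-prime}})) (∣⇒≤ {{prime⇒nonZero p-prime}} d)
  representative {p} p-prime r@(suc _) r<p z =
    r + p * k , z<s , (k , refl) , λ {q} q-prime q≡p⊎q≤z d → [ at-p q-prime (m*n∣⇒m∣ q q d) , at-small q-prime (m*n∣⇒m∣ q q d) ]′ q≡p⊎q≤z
    where
    rest? : ∀ q → Dec (Prime q × ¬ q ∣ r)
    rest? q = prime? q ×-dec ¬? (q ∣? r)
    rest : List ℕ
    rest = filter rest? (upTo (suc z))
    k : ℕ
    k = product rest
    q∣r : ∀ {q} → q ∣ r + p * k → q ∣ p * k → q ∣ r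
    q∣r {q} d = ∣m+n∣m⇒∣n (subst (q ∣_) (+-comm r (p * k)) d)
    p∤r : ¬ p ∣ r
    p∤r p∣r = <⇒≱ r<p (∣⇒≤ p∣r)
    at-p : ∀ {q} → Prime q → q ∣ r + p * k → q ≡ p → ⊥
    at-p q-prime d refl = p∤r (q∣r d (m∣m*n k))
    at-small : ∀ {q} → Prime q → q ∣ r + p * k → q ≤ z → ⊥
    at-small {q} q-prime d q≤z = go (q ∣? r)
      where
      go : Dec (q ∣ r) → ⊥
      go (no q∤r)  = q∤r (q∣r d (∣n⇒∣m*n p (∈⇒∣product (∈-filter⁺ rest? (∈-upTo⁺ (s≤s q≤z)) (q-prime , q∤r)))))
      go (yes q∣r) = [ (λ q∣p → p∤r (subst (_∣ r) (prime-∣-prime q-prime p-prime q∣p) q∣r)) , in-rest ]′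
        (euclidsLemma p k q-prime (∣m+n∣m⇒∣n d q∣r))
        where
        in-rest : q ∣ k → ⊥
        in-rest q∣k = proj₂ (proj₂ (∈-filter⁻ rest? {xs = upTo (suc z)} (factorisationHasAllPrimeFactors q-prime q∣k
          (All.tabulate (proj₁ ∘ proj₂ ∘ ∈-filter⁻ rest? {xs = upTo (suc z)}))))) q∣r

  module _ (M : ℤ) where

    private
      _≈_ : ℤ → ℤ → Set
      x ≈ y = M ∣ℤ x ℤ.- y

      ≈-* : ∀ x x′ y y′ → x ≈ x′ → y ≈ y′ → (x ℤ.* y) ≈ (x′ ℤ.* y′)
      ≈-* x x′ y y′ p q = ∣-by (ℤ.∣m∣n⇒∣m+n (ℤ.∣m⇒∣m*n y p) (ℤ.∣n⇒∣m*n x′ q)) (lemma x x′ y y′)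
        where
        lemma : ∀ x x′ y y′ → (x ℤ.- x′) ℤ.* y ℤ.+ x′ ℤ.* (y ℤ.- y′) ≡ x ℤ.* y ℤ.- x′ ℤ.* y′
        lemma = ℤSolver.solve-∀

    -- Modulo M the four factors are c, 1, 1 and -1, because M a vanishes and b is 1. The sign of
    -- the last one gives n ≡ -c, so that d = -n lies in the class of c.
    candidate-congruence : ∀ a b c Q₁ Q₂ → M ∣ℤ a ℤ.- c → M ∣ℤ b ℤ.- 1ℤ →
      Q₁ ≡ M ℤ.* a ℤ.* (M ℤ.* a) ℤ.+ b ℤ.* b → Q₂ ℤ.+ ℤ.+ 2 ℤ.* (M ℤ.* a) ℤ.* b ℤ.+ b ℤ.* b ≡ M ℤ.* a ℤ.* (M ℤ.* a) →
      M ∣ℤ a ℤ.* b ℤ.* Q₁ ℤ.* Q₂ ℤ.+ c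
    candidate-congruence a b c Q₁ Q₂ a≈c b≈1 Q₁≡ Q₂≡ =
      ∣-by (≈-* (a ℤ.* b ℤ.* Q₁) (c ℤ.* 1ℤ ℤ.* 1ℤ) Q₂ (ℤ.- 1ℤ) (≈-* (a ℤ.* b) (c ℤ.* 1ℤ) Q₁ 1ℤ (≈-* a c b 1ℤ a≈c b≈1) Q₁≈1) Q₂≈-1) (lemma (a ℤ.* b ℤ.* Q₁ ℤ.* Q₂) c)
      where
      lemma : ∀ x c → x ℤ.- c ℤ.* 1ℤ ℤ.* 1ℤ ℤ.* ℤ.- 1ℤ ≡ x ℤ.+ c
      lemma = ℤSolver.solve-∀
      lemma₁ : ∀ A b → A ℤ.* A ℤ.+ (b ℤ.- 1ℤ) ℤ.* (b ℤ.+ 1ℤ) ≡ A ℤ.* A ℤ.+ b ℤ.* b ℤ.- 1ℤ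
      lemma₁ = ℤSolver.solve-∀
      lemma₂ : ∀ A b Q → (Q ℤ.+ ℤ.+ 2 ℤ.* A ℤ.* b ℤ.+ b ℤ.* b) ℤ.- ℤ.+ 2 ℤ.* b ℤ.* A ℤ.- (b ℤ.- 1ℤ) ℤ.* (b ℤ.+ 1ℤ) ≡ Q ℤ.- ℤ.- 1ℤ
      lemma₂ = ℤSolver.solve-∀
      M∣A : M ∣ℤ M ℤ.* a
      M∣A = ℤ.∣m⇒∣m*n a ℤ.∣-refl
      Q₁≈1 : Q₁ ≈ 1ℤ
      Q₁≈1 = ∣-by (ℤ.∣m∣n⇒∣m+n (ℤ.∣m⇒∣m*n (M ℤ.* a) M∣A) (ℤ.∣m⇒∣m*n (b ℤ.+ 1ℤ) b≈1))
        (trans (lemma₁ (M ℤ.* a) b) (cong (ℤ._- 1ℤ) (sym Q₁≡)))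
      Q₂≈-1 : Q₂ ≈ (ℤ.- 1ℤ)
      Q₂≈-1 = ∣-by (ℤ.∣m∣n⇒∣m-n (ℤ.∣m∣n⇒∣m-n (∣-by (ℤ.∣m⇒∣m*n (M ℤ.* a) M∣A) (sym Q₂≡)) (ℤ.∣n⇒∣m*n (ℤ.+ 2 ℤ.* b) M∣A)) (ℤ.∣m⇒∣m*n (b ℤ.+ 1ℤ) b≈1))
        (lemma₂ (M ℤ.* a) b Q₂)

  module _ {p : ℕ} (p-prime : Prime p) {r : ℕ} (r<p : r < p) (B : ℕ) where

    private
      module Construct (z : ℕ) (z≡ : z ≡ 64)
        (c : ℕ) (0<c : 0 < c) (k : ℕ) (c≡ : c ≡ r + p * k)
        (qq∤c : ∀ {q} → Prime q → q ≡ p ⊎ q ≤ z → ¬ q * q ∣ c) where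

        -- M must contain p and all primes up to z. The factor 2 ^ c makes M exceed c without
        -- bringing in a prime beyond 2. M is a square, so A = M a changes the value of the form by
        -- a square only, and q ∣ M implies q² ∣ M.
        Π D M : ℕ
        Π = product (primesUpTo z)
        D = p * Π * 2 ^ c
        M = D * D

        instance
          p≢0 : NonZero p
          p≢0 = prime⇒nonZero p-prime
          Π≢0 : NonZero Π
          Π≢0 = productOfPrimes≢0 (all-primesUpTo z)
          2^c≢0 : NonZero (2 ^ c)
          2^c≢0 = m^n≢0 2 c
          pΠ≢0 : NonZero (p * Π)
          pΠ≢0 = m*n≢0 p Π
          D≢0 : NonZero D
          D≢0 = m*n≢0 (p * Π) (2 ^ c)

        D∣M : D ∣ M
        D∣M = m∣m*n D

        M≥D : D ≤ M
        M≥D = m≤n*m D D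

        q≤z⇒∣D : ∀ {q} → Prime q → q ≤ z → q ∣ D
        q≤z⇒∣D q-prime q≤z = ∣m⇒∣m*n (2 ^ c) (∣n⇒∣m*n p (∈⇒∣product (∈-primesUpTo q-prime q≤z)))

        2≤z : 2 ≤ z
        2≤z = subst (2 ≤_) (sym z≡) (s≤s (s≤s z≤n))

        3≤z : 3 ≤ z
        3≤z = subst (3 ≤_) (sym z≡) (s≤s (s≤s (s≤s z≤n)))

        ∣M⇒ : ∀ {q} → Prime q → q ∣ M → q ≡ p ⊎ q ≤ z
        ∣M⇒ {q} q-prime q∣M = [ [ inj₁ ∘ prime-∣-prime q-prime p-prime , inj₂ ∘ in-Π ]′ ∘ euclidsLemma p Π q-prime
                               , (λ d → inj₂ (subst (_≤ z) (sym (prime∣2^⇒≡2 q-prime c d)) 2≤z)) ]′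
          (euclidsLemma (p * Π) (2 ^ c) q-prime (prime∣²⇒∣ q-prime q∣M))
          where
          in-Π : q ∣ Π → q ≤ z
          in-Π q∣Π = ≤-pred (∈-upTo⁻ (proj₁ (∈-filter⁻ prime? {xs = upTo (suc z)}
            (factorisationHasAllPrimeFactors q-prime q∣Π (all-primesUpTo z)))))

        36≤M : 36 ≤ M
        36≤M = *-mono-≤ {6} {D} {6} {D} 6≤D 6≤D
          where
          6≤D : 6 ≤ D
          6≤D = go (q≤z⇒∣D prime[2] 2≤z) (q≤z⇒∣D prime[3] 3≤z)
            where
            go : 2 ∣ D → 3 ∣ D → 6 ≤ D
            go (divides e D≡e2) 3∣D = ∣⇒≤ (subst (6 ∣_) (sym D≡e2) (*-monoˡ-∣ 2
              (coprime-divisor {3} {2} {e} (prime∤⇒coprime prime[3] (λ d → contradiction (∣⇒≤ d) (<⇒≱ ≤-refl))) (subst (3 ∣_) (trans D≡e2 (*-comm e 2)) 3∣D))))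

        c≤M : c ≤ M
        c≤M = ≤-trans (<⇒≤ (n<2^n c)) (≤-trans (m≤n*m (2 ^ c) (p * Π)) M≥D)

        -- For one q > L, C bounds the pairs with common factor q and K all events. With T = (3zM)²
        -- bins per unit length, X² = T L² for the bound X = 3MN on a and b. In L, the summand 3zM
        -- ensures X < q² for q > L, the next one keeps the large q within the budget, and B makes n
        -- exceed B.
        C T K L N : ℕ
        C = (z + 1) * 2 * ((z + 1) * 2)
        T = 9 * (z * z) * (M * M)
        K = C + ((3 * T + 1) * 2 + (3 * T + 1) * 2)
        L = 1 + (3 * z * M + 12 * (M * M) * K) + B
        N = z * L

        L-large : 3 * z * M + 12 * (M * M) * K < L
        L-large = m≤m+n _ B

        open module S = Sieve M c L 36≤M c≤M 0<c
          (λ q q-prime q≤64 → ∣-trans (q≤z⇒∣D q-prime (subst (q ≤_) (sym z≡) q≤64)) D∣M)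
          z C T K N z≡ refl refl refl refl

        module FromSurvivor (i j : ℕ) (s : SieveSurvivor L-large i j) where
          open SieveSurvivor s

          A n : ℕ
          A = M * a i
          n = a i * b j * Q₁ i j * Q₂ i j

          A≡ : A ≡ 3 * b j + t i j
          A≡ = Ma≡3b+t L-large i j<N

          0<a : 0 < a i
          0<a = ≤-trans 0<c (m≤m+n c _)

          ∣M⇒∤b : ∀ {q} → Prime q → q ∣ M → ¬ q ∣ b j
          ∣M⇒∤b {q} q-prime q∣M q∣b = contradiction (subst Prime (∣1⇒≡1 (∣m+n∣m⇒∣n (subst (q ∣_) (+-comm 1 _) q∣b) (∣m⇒∣m*n (N + j) q∣M))) q-prime) ¬prime[1]

          A⊥b : Coprime A (b j)
          A⊥b {d} (d∣A , d∣b) = a⊥b (coprime-divisor d⊥M d∣A , d∣b)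
            where
            d⊥M : Coprime d M
            d⊥M {e} (e∣d , e∣M) = ∣1⇒≡1 (∣m+n∣m⇒∣n (subst (e ∣_) (+-comm 1 _) (∣-trans e∣d d∣b)) (∣m⇒∣m*n (N + j) e∣M))

          2∣M : 2 ∣ M
          2∣M = ∣-trans (q≤z⇒∣D prime[2] 2≤z) D∣M

          not-both : ∀ {q} → Prime q → ¬ (q ∣ A × q ∣ b j)
          not-both q-prime d = contradiction (subst Prime (A⊥b d) q-prime) ¬prime[1]

          -- Primes outside M were sieved. A prime q ∣ M does not divide b, which is 1 modulo M, nor
          -- a quadratic factor, which would force q ∣ b; and q² ∣ M, so that q² ∣ a would give q² ∣
          -- c.
          squarefree : ∀ {q} → Prime q → ¬ q * q ∣ n
          squarefree {q} q-prime = go (q ∣? M)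
            where
            q∣A : q ∣ a i → q ∣ A
            q∣A = ∣n⇒∣m*n M
            both : q ∣ A → q ∣ b j → ⊥
            both d e = not-both q-prime (d , e)
            go : Dec (q ∣ M) → ¬ q * q ∣ n
            go (no q∤M) = square-∤-product₄ q-prime
              (λ (d , e) → both (q∣A d) e)
              (λ (d , e) → both (q∣A d) (A,Q₁⇒b q-prime A (b j) (t i j) A≡ (q∣A d) e))
              (λ (d , e) → both (q∣A d) (A,Q₂⇒b q-prime A (b j) (t i j) A≡ (q∣A d) e))
              (λ (d , e) → both (b,Q₁⇒A q-prime A (b j) (t i j) A≡ d e) d)
              (λ (d , e) → both (b,Q₂⇒A q-prime A (b j) (t i j) A≡ d e) d)
              (λ (d , e) → Q₁,Q₂⇒A,b q-prime A (b j) (t i j) A≡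
                (λ q∣2 → q∤M (∣-trans q∣2 2∣M)) d e (not-both q-prime))
              (∤a q-prime q∤M) (∤b q-prime q∤M) (∤Q₁ q-prime q∤M) (∤Q₂ q-prime q∤M)
            go (yes q∣M) = square-∤-product₄ q-prime
              (λ (d , e) → q∤b e) (λ (d , e) → q∤Q₁ e) (λ (d , e) → q∤Q₂ e) (λ (d , e) → q∤b d) (λ (d , e) → q∤b d) (λ (d , e) → q∤Q₁ d)
              qq∤a (λ d → q∤b (m*n∣⇒m∣ q q d)) (λ d → q∤Q₁ (m*n∣⇒m∣ q q d)) (λ d → q∤Q₂ (m*n∣⇒m∣ q q d))
              where
              q∤b : ¬ q ∣ b j
              q∤b = ∣M⇒∤b q-prime q∣M
              q∣A′ : q ∣ A
              q∣A′ = ∣m⇒∣m*n (a i) q∣M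
              q∤Q₁ : ¬ q ∣ Q₁ i j
              q∤Q₁ d = q∤b (A,Q₁⇒b q-prime A (b j) (t i j) A≡ q∣A′ d)
              q∤Q₂ : ¬ q ∣ Q₂ i j
              q∤Q₂ d = q∤b (A,Q₂⇒b q-prime A (b j) (t i j) A≡ q∣A′ d)
              qq∣M : q * q ∣ M
              qq∣M = *-pres-∣ (prime∣²⇒∣ q-prime {D} q∣M) (prime∣²⇒∣ q-prime {D} q∣M)
              qq∤a : ¬ q * q ∣ a i
              qq∤a d = qq∤c q-prime (∣M⇒ q-prime q∣M) (∣m+n∣m⇒∣n (subst (q * q ∣_) (+-comm c _) d) (∣m⇒∣m*n (N + i) qq∣M))

          M∣n+c : M ∣ n + c
          M∣n+c = ∣⇒∣ᵤ (subst (ℤ.+ M ∣ℤ_) (sym cast) (candidate-congruence (ℤ.+ M) (ℤ.+ a i) (ℤ.+ b j) (ℤ.+ c) (ℤ.+ Q₁ i j) (ℤ.+ Q₂ i j)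
            (progression c i) (progression 1 j) Q₁≡ Q₂≡))
            where
            progression : ∀ u k → ℤ.+ M ∣ℤ ℤ.+ (u + M * (N + k)) ℤ.- ℤ.+ u
            progression u k = ℤ.divides (ℤ.+ (N + k)) (trans (cong₂ ℤ._-_ {x = ℤ.+ (u + M * (N + k))} (trans (ℤ.pos-+ u _) (cong (ℤ._+_ (ℤ.+ u)) (ℤ.pos-* M (N + k)))) refl) (lemma (ℤ.+ u) (ℤ.+ M) (ℤ.+ (N + k))))
              where
              lemma : ∀ u M k → u ℤ.+ M ℤ.* k ℤ.- u ≡ k ℤ.* M
              lemma = ℤSolver.solve-∀
            Q₁≡ : ℤ.+ Q₁ i j ≡ ℤ.+ M ℤ.* ℤ.+ a i ℤ.* (ℤ.+ M ℤ.* ℤ.+ a i) ℤ.+ ℤ.+ b j ℤ.* ℤ.+ b j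
            Q₁≡ = cong₂ ℤ._+_ (trans (ℤ.pos-* A A) (cong₂ ℤ._*_ (ℤ.pos-* M (a i)) (ℤ.pos-* M (a i)))) (ℤ.pos-* (b j) (b j))
            Q₂≡ℕ : Q₂ i j + 2 * A * b j + b j * b j ≡ A * A
            Q₂≡ℕ = trans (cong (λ A → Q₂ i j + 2 * A * b j + b j * b j) A≡) (trans (lemma (b j) (t i j)) (sym (cong (λ A → A * A) A≡)))
              where
              lemma : ∀ b t → 2 * (b * b) + 4 * (b * t) + t * t + 2 * (3 * b + t) * b + b * b ≡ (3 * b + t) * (3 * b + t)
              lemma = solve-∀
            Q₂≡ : ℤ.+ Q₂ i j ℤ.+ ℤ.+ 2 ℤ.* (ℤ.+ M ℤ.* ℤ.+ a i) ℤ.* ℤ.+ b j ℤ.+ ℤ.+ b j ℤ.* ℤ.+ b j ≡ ℤ.+ M ℤ.* ℤ.+ a i ℤ.* (ℤ.+ M ℤ.* ℤ.+ a i)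
            Q₂≡ = trans (sym (cong₂ (λ x y → ℤ.+ Q₂ i j ℤ.+ x ℤ.+ y)
                (trans (ℤ.pos-* (2 * A) (b j)) (cong (ℤ._* ℤ.+ b j) (trans (ℤ.pos-* 2 A) (cong (ℤ.+ 2 ℤ.*_) (ℤ.pos-* M (a i))))))
                (ℤ.pos-* (b j) (b j))))
              (trans (cong ℤ.+_ Q₂≡ℕ) (trans (ℤ.pos-* A A) (cong₂ ℤ._*_ (ℤ.pos-* M (a i)) (ℤ.pos-* M (a i)))))
            cast : ℤ.+ (n + c) ≡ ℤ.+ a i ℤ.* ℤ.+ b j ℤ.* ℤ.+ Q₁ i j ℤ.* ℤ.+ Q₂ i j ℤ.+ ℤ.+ c
            cast = cong (ℤ._+ ℤ.+ c) (trans (ℤ.pos-* (a i * b j * Q₁ i j) (Q₂ i j)) (cong (ℤ._* ℤ.+ Q₂ i j) (trans (ℤ.pos-* (a i * b j) (Q₁ i j))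
              (cong (ℤ._* ℤ.+ Q₁ i j) (ℤ.pos-* (a i) (b j))))))

          p∣n+r : p ∣ n + r
          p∣n+r = ∣m+n∣m⇒∣n (subst (p ∣_) (trans (cong (n +_) c≡) (lemma n r (p * k))) (∣-trans p∣M M∣n+c)) (m∣m*n k)
            where
            lemma : ∀ n r x → n + (r + x) ≡ x + (n + r)
            lemma = solve-∀
            p∣M : p ∣ M
            p∣M = ∣-trans (∣m⇒∣m*n (2 ^ c) (m∣m*n Π)) D∣M

          instance
            a≢0 : NonZero (a i)
            a≢0 = >-nonZero 0<a
            Q₁≢0 : NonZero (Q₁ i j)
            Q₁≢0 = >-nonZero (m≤n⇒m≤o+n (A * A) z<s)
            M≢0 : NonZero M
            M≢0 = m*n≢0 D D

          Q₁≤n : Q₁ i j ≤ n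
          Q₁≤n = ≤-trans (m≤n*m (Q₁ i j) (a i * b j) {{m*n≢0 (a i) (b j)}}) (m≤m*n _ (Q₂ i j))

          A≤n : A ≤ n
          A≤n = ≤-trans (m≤n*m A A {{m*n≢0 M (a i)}}) (≤-trans (m≤m+n (A * A) _) Q₁≤n)

          N≤A : N ≤ A
          N≤A = ≤-trans (m≤m+n N i) (≤-trans (m≤n*m (N + i) M) (≤-trans (m≤n+m _ c) (m≤n*m (a i) M)))

          B<N : B < N
          B<N = ≤-trans (s≤s (m≤n+m B _)) (m≤n*m L z {{subst NonZero (sym z≡) _}})

          candidate : Candidate p r B
          candidate = record
            { A = A ; b = b j ; t = t i j ; D = D ; n = n
            ; A≡3b+t     = A≡
            ; D²n≡       = lemma M (a i) (b j) (Q₁ i j) (Q₂ i j)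
            ; 0<D        = >-nonZero⁻¹ D
            ; 0<b        = z<s
            ; A⊥b        = A⊥b
            ; 2∣A        = ∣m⇒∣m*n (a i) 2∣M
            ; 2∤b        = ∣M⇒∤b prime[2] 2∣M
            ; squarefree = squarefree
            ; p∣n+r      = p∣n+r
            ; A²<n       = <-≤-trans (m<m+n (A * A) z<s) Q₁≤n
            ; B<n        = <-≤-trans B<N (≤-trans N≤A A≤n)
            }
            where
            lemma : ∀ M a b x y → M * (a * b * x * y) ≡ M * a * b * x * y
            lemma = solve-∀

        candidate : Candidate p r B
        candidate = go (survivor L-large)
          where
          go : ∃[ i ] ∃[ j ] SieveSurvivor L-large i j → Candidate p r B
          go (i , j , s) = FromSurvivor.candidate i j s

    candidate : Candidate p r B
    candidate = go 64 refl
      where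
      go : ∀ z → z ≡ 64 → Candidate p r B
      go z z≡ = from (representative p-prime r r<p z)
        where
        from : ∃[ c ] 0 < c × (∃[ k ] c ≡ r + p * k) × (∀ {q} → Prime q → q ≡ p ⊎ q ≤ z → ¬ q * q ∣ c) → Candidate p r B
        from (c , 0<c , (k , c≡) , qq∤c) = Construct.candidate z z≡ c 0<c k c≡ qq∤c

-- Arithmetic of ℚ(√d)

module Field where
  open import Defs
  open import Algebra.Bundles using (CommutativeRing; RawRing)
  import Algebra.Solver.Ring as RingSolver
  open import Algebra.Solver.Ring.AlmostCommutativeRing using (fromCommutativeRing; _-Raw-AlmostCommutative⟶_)
  open import Data.Integer.Base as ℤ using (ℤ; 0ℤ; 1ℤ; -[1+_])
  import Data.Integer.Properties as ℤ
  import Data.Integer.Tactic.RingSolver as ℤSolver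
  open import Data.Maybe.Base using (Maybe; just; nothing)
  import Data.Nat.Base as ℕ
  import Data.Nat.Properties as ℕ
  open import Data.Product.Base using (_×_; _,_)
  open import Data.Rational.Base as ℚ using (ℚ; 0ℚ; 1ℚ; _/_; toℚᵘ)
  import Data.Rational.Properties as ℚ
  open import Data.Rational.Unnormalised.Base as ℚᵘ using (mkℚᵘ; *≡*; _≃_)
  import Data.Rational.Unnormalised.Properties as ℚᵘ
  open import Data.Sum.Base using (_⊎_; inj₁; inj₂)
  open import Level using (0ℓ)
  open import Relation.Binary.PropositionalEquality
  open import Relation.Nullary.Decidable using (yes; no)

  private
    cast : ∀ n → toℚᵘ (n / 1) ≃ mkℚᵘ n 0
    cast n = ℚ.toℚᵘ-fromℚᵘ (mkℚᵘ n 0)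

  /1-+ : ∀ m n → (m ℤ.+ n) / 1 ≡ m / 1 ℚ.+ n / 1
  /1-+ m n = ℚ.toℚᵘ-injective (ℚᵘ.≃-trans (cast (m ℤ.+ n)) (ℚᵘ.≃-sym
    (ℚᵘ.≃-trans (ℚ.toℚᵘ-homo-+ (m / 1) (n / 1)) (ℚᵘ.≃-trans (ℚᵘ.+-cong (cast m) (cast n)) (*≡* (lemma m n))))))
    where
    lemma : ∀ m n → (m ℤ.* 1ℤ ℤ.+ n ℤ.* 1ℤ) ℤ.* 1ℤ ≡ (m ℤ.+ n) ℤ.* (1ℤ ℤ.* 1ℤ)
    lemma = ℤSolver.solve-∀

  /1-* : ∀ m n → (m ℤ.* n) / 1 ≡ m / 1 ℚ.* (n / 1)
  /1-* m n = ℚ.toℚᵘ-injective (ℚᵘ.≃-trans (cast (m ℤ.* n)) (ℚᵘ.≃-sym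
    (ℚᵘ.≃-trans (ℚ.toℚᵘ-homo-* (m / 1) (n / 1)) (ℚᵘ.≃-trans (ℚᵘ.*-cong (cast m) (cast n)) (*≡* refl)))))

  /1-neg : ∀ m → (ℤ.- m) / 1 ≡ ℚ.- (m / 1)
  /1-neg m = ℚ.toℚᵘ-injective (ℚᵘ.≃-trans (cast (ℤ.- m)) (ℚᵘ.≃-sym
    (ℚᵘ.≃-trans (ℚ.toℚᵘ-homo‿- (m / 1)) (ℚᵘ.-‿cong (cast m)))))

  /1-injective : ∀ {m n} → m / 1 ≡ n / 1 → m ≡ n
  /1-injective {m} {n} eq = go (ℚᵘ.≃-trans (ℚᵘ.≃-sym (cast m)) (ℚᵘ.≃-trans (ℚᵘ.≃-reflexive (cong toℚᵘ eq)) (cast n)))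
    where
    go : mkℚᵘ m 0 ≃ mkℚᵘ n 0 → m ≡ n
    go (*≡* e) = trans (sym (ℤ.*-identityʳ m)) (trans e (ℤ.*-identityʳ n))

  square≡∣∣² : ∀ z → z ℤ.* z ≡ ℤ.+ (ℤ.∣ z ∣ ℕ.* ℤ.∣ z ∣)
  square≡∣∣² (ℤ.+ m)    = sym (ℤ.pos-* m m)
  square≡∣∣² (-[1+ m ]) = refl

  +≢0 : ∀ {m} → 0 ℕ.< m → ℤ.+ m ≢ 0ℤ
  +≢0 0<m eq = ℕ.<⇒≢ 0<m (sym (ℤ.+-injective eq))

  ℚ-integral : ∀ p q → p ℚ.* q ≡ 0ℚ → p ≡ 0ℚ ⊎ q ≡ 0ℚ
  ℚ-integral p q pq≡0 with p ℚ.≟ 0ℚ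
  ... | yes p≡0 = inj₁ p≡0
  ... | no p≢0 = inj₂ (begin
    q                        ≡⟨ ℚ.*-identityˡ q ⟨
    1ℚ ℚ.* q                 ≡⟨ cong (ℚ._* q) (ℚ.*-inverseˡ p) ⟨
    (ℚ.1/ p) ℚ.* p ℚ.* q     ≡⟨ ℚ.*-assoc (ℚ.1/ p) p q ⟩
    (ℚ.1/ p) ℚ.* (p ℚ.* q)   ≡⟨ cong ((ℚ.1/ p) ℚ.*_) pq≡0 ⟩
    (ℚ.1/ p) ℚ.* 0ℚ          ≡⟨ ℚ.*-zeroʳ (ℚ.1/ p) ⟩
    0ℚ                       ∎)
    where
    open ≡-Reasoning
    instance
      p≠0 : ℚ.NonZero p
      p≠0 = ℚ.≢-nonZero p≢0

  module Quadratic (d : ℤ) where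

    K : Set
    K = ℚ[√ d ]

    open CommutativeRing (ℚ[√]-commutativeRing d) public
      using (_+_; _*_; -_; _-_; 0#; 1#; *-comm; *-assoc; *-identityˡ; *-identityʳ; +-identityˡ; +-identityʳ; zeroˡ; zeroʳ; +-comm; +-assoc; distribˡ; distribʳ)

    ⟦_⟧ : ℤ → K
    ⟦ n ⟧ = fromℚ (n / 1)

    int : ℤ → ℤ → K
    int u v = (u / 1) +√ (v / 1)

    int-+ : ∀ u v u′ v′ → int (u ℤ.+ u′) (v ℤ.+ v′) ≡ int u v + int u′ v′
    int-+ u v u′ v′ = cong₂ _+√_ (/1-+ u u′) (/1-+ v v′)

    int-* : ∀ u v u′ v′ → int (u ℤ.* u′ ℤ.+ d ℤ.* (v ℤ.* v′)) (u ℤ.* v′ ℤ.+ v ℤ.* u′) ≡ int u v * int u′ v′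
    int-* u v u′ v′ = cong₂ _+√_
      (trans (/1-+ (u ℤ.* u′) _) (cong₂ ℚ._+_ (/1-* u u′) (trans (/1-* d _) (cong ((d / 1) ℚ.*_) (/1-* v v′)))))
      (trans (/1-+ (u ℤ.* v′) _) (cong₂ ℚ._+_ (/1-* u v′) (/1-* v u′)))

    int-neg : ∀ u v → int (ℤ.- u) (ℤ.- v) ≡ - int u v
    int-neg u v = cong₂ _+√_ (/1-neg u) (/1-neg v)

    int-injective : ∀ {u v u′ v′} → int u v ≡ int u′ v′ → u ≡ u′ × v ≡ v′
    int-injective eq = /1-injective (cong rat eq) , /1-injective (cong irr eq)

    ⟦⟧-+ : ∀ m n → ⟦ m ℤ.+ n ⟧ ≡ ⟦ m ⟧ + ⟦ n ⟧
    ⟦⟧-+ m n = int-+ m 0ℤ n 0ℤ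

    ⟦⟧-* : ∀ m n → ⟦ m ℤ.* n ⟧ ≡ ⟦ m ⟧ * ⟦ n ⟧
    ⟦⟧-* m n = trans (cong₂ int (lemma₁ d m n) (lemma₂ m n)) (int-* m 0ℤ n 0ℤ)
      where
      lemma₁ : ∀ d m n → m ℤ.* n ≡ m ℤ.* n ℤ.+ d ℤ.* (0ℤ ℤ.* 0ℤ)
      lemma₁ = ℤSolver.solve-∀
      lemma₂ : ∀ m n → 0ℤ ≡ m ℤ.* 0ℤ ℤ.+ 0ℤ ℤ.* n
      lemma₂ = ℤSolver.solve-∀

    ⟦⟧-neg : ∀ m → ⟦ ℤ.- m ⟧ ≡ - ⟦ m ⟧
    ⟦⟧-neg m = int-neg m 0ℤ

    ⟦⟧*int : ∀ z X Y → ⟦ z ⟧ * int X Y ≡ int (z ℤ.* X) (z ℤ.* Y)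
    ⟦⟧*int z X Y = trans (sym (int-* z 0ℤ X Y)) (cong₂ int (lemma₁ d z X Y) (lemma₂ z X Y))
      where
      lemma₁ : ∀ d C X Y → C ℤ.* X ℤ.+ d ℤ.* (0ℤ ℤ.* Y) ≡ C ℤ.* X
      lemma₁ = ℤSolver.solve-∀
      lemma₂ : ∀ C X Y → C ℤ.* Y ℤ.+ 0ℤ ℤ.* X ≡ C ℤ.* Y
      lemma₂ = ℤSolver.solve-∀

    private
      ℤ-rawRing : RawRing 0ℓ 0ℓ
      ℤ-rawRing = CommutativeRing.rawRing ℤ.+-*-commutativeRing

      -- Integer coefficients let the solver compare constants although d is a variable.
      morphism : ℤ-rawRing -Raw-AlmostCommutative⟶ fromCommutativeRing (ℚ[√]-commutativeRing d)
      morphism = record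
        { ⟦_⟧    = ⟦_⟧
        ; +-homo = ⟦⟧-+
        ; *-homo = ⟦⟧-*
        ; -‿homo = ⟦⟧-neg
        ; 0-homo = refl
        ; 1-homo = refl
        }

      coeff≟ : ∀ m n → Maybe (⟦ m ⟧ ≡ ⟦ n ⟧)
      coeff≟ m n with m ℤ.≟ n
      ... | yes eq = just (cong ⟦_⟧ eq)
      ... | no _   = nothing

    open RingSolver ℤ-rawRing (fromCommutativeRing (ℚ[√]-commutativeRing d)) morphism coeff≟ public
      using (solve; _:=_; _:+_; _:*_; _:-_; :-_; con)

-- Quadratic points of the curve and part (a)

module Points where
  open import Defs
  open Candidates
  open Field
  open PrimeSquares using (prime-divisor)
  open import Data.Integer.Base as ℤ using (ℤ; 0ℤ; 1ℤ)
  open import Data.Integer.Divisibility as ℤᵤ using ()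
  open import Data.Integer.Divisibility.Signed using (∣ᵤ⇒∣; ∣⇒∣ᵤ; divides; ∣m∣n⇒∣m-n; ∣m⇒∣-m) renaming (_∣_ to _∣ˢ_)
  open import Data.Integer.DivMod using (_%ℕ_; _/ℕ_; a≡a%ℕn+[a/ℕn]*n; n%ℕd<d)
  import Data.Integer.Properties as ℤ
  import Data.Integer.Tactic.RingSolver as ℤSolver
  open import Data.List.Base using (List; []; _∷_; map)
  open import Data.List.Relation.Unary.All as All using (All; []; _∷_)
  open import Data.Nat.Base as ℕ using (ℕ)
  open import Data.Nat.Divisibility using (_∣_; ∣-refl; ∣-trans; *-pres-∣)
  open import Data.Nat.Primality using (Prime; prime⇒nonZero)
  import Data.Nat.Properties as ℕ
  open import Data.Product.Base using (∃; ∃-syntax; _×_; _,_)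
  open import Data.Rational.Base as ℚ using (ℚ; 0ℚ; 1ℚ; _/_)
  import Data.Rational.Properties as ℚ
  import Data.Rational.Solver as ℚSolver
  open import Data.Sum.Base using ([_,_]′)
  open import Function.Base using (_∘_)
  open import Relation.Binary.PropositionalEquality
  open import Relation.Nullary.Decidable using (decidable-stable)
  open import Relation.Nullary.Negation using (¬_; contradiction)

  module _ {d : ℤ} (A b D : ℤ) (A≢0 : A ≢ 0ℤ) (D≢0 : D ≢ 0ℤ)
    (D²d≡ : D ℤ.* D ℤ.* d ≡ ℤ.- (A ℤ.* b) ℤ.* (A ℤ.* A ℤ.+ b ℤ.* b) ℤ.* (A ℤ.* A ℤ.- ℤ.+ 2 ℤ.* (A ℤ.* b) ℤ.- b ℤ.* b)) where

    private
      open Quadratic d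
      open X₁⟨8⟨4⟩⟩ (ℚ[√]-commutativeRing d)

      onCurve : int 0ℤ D * int 0ℤ D ≡
        - (⟦ A ⟧ * ⟦ b ⟧) * (⟦ A ⟧ * ⟦ A ⟧ + ⟦ b ⟧ * ⟦ b ⟧) * (⟦ A ⟧ * ⟦ A ⟧ - (1# + 1#) * (⟦ A ⟧ * ⟦ b ⟧) - ⟦ b ⟧ * ⟦ b ⟧)
      onCurve = begin
        int 0ℤ D * int 0ℤ D                      ≡⟨ int-* 0ℤ D 0ℤ D ⟨
        int (0ℤ ℤ.* 0ℤ ℤ.+ d ℤ.* (D ℤ.* D)) (0ℤ ℤ.* D ℤ.+ D ℤ.* 0ℤ)  ≡⟨ cong₂ int (lemma₁ d D) (lemma₂ D) ⟩
        ⟦ D ℤ.* D ℤ.* d ⟧                        ≡⟨ cong ⟦_⟧ D²d≡ ⟩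
        ⟦ ℤ.- (A ℤ.* b) ℤ.* (A ℤ.* A ℤ.+ b ℤ.* b) ℤ.* (A ℤ.* A ℤ.- ℤ.+ 2 ℤ.* (A ℤ.* b) ℤ.- b ℤ.* b) ⟧
          ≡⟨ trans (⟦⟧-* (ℤ.- (A ℤ.* b) ℤ.* (A ℤ.* A ℤ.+ b ℤ.* b)) _) (cong₂ _*_
               (trans (⟦⟧-* (ℤ.- (A ℤ.* b)) _) (cong₂ _*_
                 (trans (⟦⟧-neg (A ℤ.* b)) (cong -_ (⟦⟧-* A b)))
                 (trans (⟦⟧-+ (A ℤ.* A) _) (cong₂ _+_ (⟦⟧-* A A) (⟦⟧-* b b)))))
               (trans (⟦⟧-+ (A ℤ.* A ℤ.- ℤ.+ 2 ℤ.* (A ℤ.* b)) _) (cong₂ _+_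
                 (trans (⟦⟧-+ (A ℤ.* A) _) (cong₂ _+_ (⟦⟧-* A A) (trans (⟦⟧-neg (ℤ.+ 2 ℤ.* (A ℤ.* b))) (cong -_
                   (trans (⟦⟧-* (ℤ.+ 2) (A ℤ.* b)) (cong₂ _*_ (⟦⟧-+ 1ℤ 1ℤ) (⟦⟧-* A b)))))))
                 (trans (⟦⟧-neg (b ℤ.* b)) (cong -_ (⟦⟧-* b b)))))) ⟩
        _                                        ∎
        where
        open ≡-Reasoning
        lemma₁ : ∀ d D → 0ℤ ℤ.* 0ℤ ℤ.+ d ℤ.* (D ℤ.* D) ≡ D ℤ.* D ℤ.* d
        lemma₁ = ℤSolver.solve-∀
        lemma₂ : ∀ D → 0ℤ ℤ.* D ℤ.+ D ℤ.* 0ℤ ≡ 0ℤ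
        lemma₂ = ℤSolver.solve-∀

      /1≢0 : ∀ {m} → m ≢ 0ℤ → m / 1 ≢ 0ℚ
      /1≢0 m≢0 eq = m≢0 (/1-injective eq)

      point : Point
      point = record
        { x = ⟦ A ⟧ ; y = int 0ℤ D ; z = ⟦ b ⟧
        ; nonzero = λ (x≡0 , _) → /1≢0 A≢0 (cong rat x≡0)
        ; onCurve = onCurve
        }

      -- A scalar t with t A rational is itself rational, and then t³ D √d is rational only if t = 0.
      ¬rational : ¬ (∃ λ (x : ℚ) → ∃ λ (y : ℚ) → ∃ λ (z : ℚ) → point HasCoordinates fromℚ x , fromℚ y , fromℚ z)
      ¬rational (x , y , z , record { t = t₀ +√ t₁ ; t⁻¹ = s₀ +√ s₁ ; tt⁻¹≈1 = ts≡1 ; x≈ = x≈ ; y≈ = y≈ }) =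
        1≢0 (trans (sym (cong rat ts≡1)) (trans (cong₂ (λ u v → u ℚ.* s₀ ℚ.+ (d / 1) ℚ.* (v ℚ.* s₁)) t₀≡0 t₁≡0)
          (ℚsolve 3 (λ d s₀ s₁ → qcon 0ℚ :*q s₀ :+q d :*q (qcon 0ℚ :*q s₁) :=q qcon 0ℚ) refl (d / 1) s₀ s₁)))
        where
        open ℚSolver.+-*-Solver renaming (solve to ℚsolve; _:+_ to _:+q_; _:*_ to _:*q_; _:=_ to _:=q_; con to qcon)
        1≢0 : 1ℚ ≢ 0ℚ
        1≢0 ()
        t₁≡0 : t₁ ≡ 0ℚ
        t₁≡0 = [ (λ e → e) , (λ e → contradiction e (/1≢0 A≢0)) ]′ (ℚ-integral t₁ (A / 1) (trans
          (ℚsolve 3 (λ t₀ t₁ a → t₁ :*q a :=q t₀ :*q qcon 0ℚ :+q t₁ :*q a) refl t₀ t₁ (A / 1)) (sym (cong irr x≈))))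
        t₀³D≡0 : t₀ ℚ.* (t₀ ℚ.* (t₀ ℚ.* (D / 1))) ≡ 0ℚ
        t₀³D≡0 = trans (ℚsolve 3 (λ d t D →
            t :*q (t :*q (t :*q D)) :=q
              ((t :*q t :+q d :*q (qcon 0ℚ :*q qcon 0ℚ)) :*q t :+q d :*q ((t :*q qcon 0ℚ :+q qcon 0ℚ :*q t) :*q qcon 0ℚ)) :*q D
              :+q ((t :*q t :+q d :*q (qcon 0ℚ :*q qcon 0ℚ)) :*q qcon 0ℚ :+q (t :*q qcon 0ℚ :+q qcon 0ℚ :*q t) :*q t) :*q qcon 0ℚ)
            refl (d / 1) t₀ (D / 1))
          (sym (trans (cong irr y≈) (cong (λ t₁ → irr ((t₀ +√ t₁) * (t₀ +√ t₁) * (t₀ +√ t₁) * int 0ℤ D)) t₁≡0)))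
        t₀≡0 : t₀ ≡ 0ℚ
        t₀≡0 = [ (λ e → e) , [ (λ e → e) , [ (λ e → e) , (λ e → contradiction e (/1≢0 D≢0)) ]′ ∘ ℚ-integral t₀ _ ]′ ∘ ℚ-integral t₀ _ ]′
          (ℚ-integral t₀ _ t₀³D≡0)

    quadratic-point : ∃ λ (P : Point) → ¬ (∃ λ (x : ℚ) → ∃ λ (y : ℚ) → ∃ λ (z : ℚ) → _HasCoordinates_,_,_ P (fromℚ x) (fromℚ y) (fromℚ z))
    quadratic-point = point , ¬rational

  hasQuadraticPoint-at : ∀ K (A b D : ℤ) → A ≢ 0ℤ → D ≢ 0ℤ →
    D ℤ.* D ℤ.* QuadraticField.radicand K ≡ ℤ.- (A ℤ.* b) ℤ.* (A ℤ.* A ℤ.+ b ℤ.* b) ℤ.* (A ℤ.* A ℤ.- ℤ.+ 2 ℤ.* (A ℤ.* b) ℤ.- b ℤ.* b) →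
    HasQuadraticPoint K
  hasQuadraticPoint-at K = quadratic-point {QuadraticField.radicand K}

  squarefree-ℤ : ∀ {d} → (∀ {q} → Prime q → ¬ q ℕ.* q ∣ ℤ.∣ d ∣) → Squarefree d
  squarefree-ℤ {d} qq∤d k kk∣d = subst (_∣ 1) (sym ∣k∣≡1) ∣-refl
    where
    ∣k∣≡1 : ℤ.∣ k ∣ ≡ 1
    ∣k∣≡1 = decidable-stable (ℤ.∣ k ∣ ℕ.≟ 1) (λ k≢1 → go (prime-divisor ℤ.∣ k ∣ k≢1))
      where
      go : ¬ (∃[ q ] Prime q × q ∣ ℤ.∣ k ∣)
      go (q , q-prime , q∣k) = qq∤d q-prime (∣-trans (*-pres-∣ q∣k q∣k) (subst (_∣ ℤ.∣ d ∣) (ℤ.abs-* k k) kk∣d))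

  module FromCandidate {p r B : ℕ} (C : Candidate p r B) where
    open Candidate C

    d : ℤ
    d = ℤ.- (ℤ.+ n)

    ∣d∣≡n : ℤ.∣ d ∣ ≡ n
    ∣d∣≡n = ℤ.∣-i∣≡∣i∣ (ℤ.+ n)

    0<n : 0 ℕ.< n
    0<n = ℕ.≤-<-trans ℕ.z≤n B<n

    d<0 : d ℤ.< 0ℤ
    d<0 = ℤ.neg-mono-< {0ℤ} (ℤ.+<+ 0<n)

    squarefree-d : Squarefree d
    squarefree-d = squarefree-ℤ {d} (λ {q} q-prime → subst (λ m → ¬ q ℕ.* q ∣ m) (sym ∣d∣≡n) (squarefree q-prime))

    d≢1 : d ≢ 1ℤ
    d≢1 d≡1 = contradiction (subst (ℤ._< 0ℤ) d≡1 d<0) λ { (ℤ.+<+ ()) }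

    D²d≡F : ℤ.+ D ℤ.* ℤ.+ D ℤ.* d ≡ ℤ.- (ℤ.+ A ℤ.* ℤ.+ b) ℤ.* (ℤ.+ A ℤ.* ℤ.+ A ℤ.+ ℤ.+ b ℤ.* ℤ.+ b)
      ℤ.* (ℤ.+ A ℤ.* ℤ.+ A ℤ.- ℤ.+ 2 ℤ.* (ℤ.+ A ℤ.* ℤ.+ b) ℤ.- ℤ.+ b ℤ.* ℤ.+ b)
    D²d≡F = begin
      ℤ.+ D ℤ.* ℤ.+ D ℤ.* ℤ.- ℤ.+ n                 ≡⟨ ℤ.neg-distribʳ-* (ℤ.+ D ℤ.* ℤ.+ D) (ℤ.+ n) ⟨
      ℤ.- (ℤ.+ D ℤ.* ℤ.+ D ℤ.* ℤ.+ n)               ≡⟨ cong ℤ.-_ (trans (cong (ℤ._* ℤ.+ n) (sym (ℤ.pos-* D D))) (sym (ℤ.pos-* (D ℕ.* D) n))) ⟩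
      ℤ.- ℤ.+ (D ℕ.* D ℕ.* n)                       ≡⟨ cong (ℤ.-_ ∘ ℤ.+_) D²n≡ ⟩
      ℤ.- ℤ.+ (A ℕ.* b ℕ.* (A ℕ.* A ℕ.+ b ℕ.* b) ℕ.* (2 ℕ.* (b ℕ.* b) ℕ.+ 4 ℕ.* (b ℕ.* t) ℕ.+ t ℕ.* t))
        ≡⟨ cong ℤ.-_ (trans (ℤ.pos-* (A ℕ.* b ℕ.* (A ℕ.* A ℕ.+ b ℕ.* b)) _) (cong₂ ℤ._*_
             (trans (ℤ.pos-* (A ℕ.* b) _) (cong₂ ℤ._*_ (ℤ.pos-* A b) (cong₂ ℤ._+_ (ℤ.pos-* A A) (ℤ.pos-* b b))))
             (cong₂ ℤ._+_ (cong₂ ℤ._+_ (cast 2 b b) (cast 4 b t)) (ℤ.pos-* t t)))) ⟩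
      ℤ.- (A′ ℤ.* b′ ℤ.* (A′ ℤ.* A′ ℤ.+ b′ ℤ.* b′) ℤ.* (ℤ.+ 2 ℤ.* (b′ ℤ.* b′) ℤ.+ ℤ.+ 4 ℤ.* (b′ ℤ.* t′) ℤ.+ t′ ℤ.* t′))
        ≡⟨ cong (λ x → ℤ.- (A′ ℤ.* b′ ℤ.* (A′ ℤ.* A′ ℤ.+ b′ ℤ.* b′) ℤ.* x)) (trans (lemma₁ b′ t′) (cong (λ A → A ℤ.* A ℤ.- ℤ.+ 2 ℤ.* (A ℤ.* b′) ℤ.- b′ ℤ.* b′) (sym A≡))) ⟩
      ℤ.- (A′ ℤ.* b′ ℤ.* (A′ ℤ.* A′ ℤ.+ b′ ℤ.* b′) ℤ.* (A′ ℤ.* A′ ℤ.- ℤ.+ 2 ℤ.* (A′ ℤ.* b′) ℤ.- b′ ℤ.* b′))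
        ≡⟨ lemma₂ (A′ ℤ.* b′) (A′ ℤ.* A′ ℤ.+ b′ ℤ.* b′) (A′ ℤ.* A′ ℤ.- ℤ.+ 2 ℤ.* (A′ ℤ.* b′) ℤ.- b′ ℤ.* b′) ⟩
      _                                             ∎
      where
      open ≡-Reasoning
      A′ b′ t′ : ℤ
      A′ = ℤ.+ A
      b′ = ℤ.+ b
      t′ = ℤ.+ t
      cast : ∀ k m n → ℤ.+ (k ℕ.* (m ℕ.* n)) ≡ ℤ.+ k ℤ.* (ℤ.+ m ℤ.* ℤ.+ n)
      cast k m n = trans (ℤ.pos-* k (m ℕ.* n)) (cong (ℤ.+ k ℤ.*_) (ℤ.pos-* m n))
      A≡ : A′ ≡ ℤ.+ 3 ℤ.* b′ ℤ.+ t′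
      A≡ = trans (cong ℤ.+_ A≡3b+t) (cong (ℤ._+ t′) (ℤ.pos-* 3 b))
      lemma₁ : ∀ b t → ℤ.+ 2 ℤ.* (b ℤ.* b) ℤ.+ ℤ.+ 4 ℤ.* (b ℤ.* t) ℤ.+ t ℤ.* t ≡
        (ℤ.+ 3 ℤ.* b ℤ.+ t) ℤ.* (ℤ.+ 3 ℤ.* b ℤ.+ t) ℤ.- ℤ.+ 2 ℤ.* ((ℤ.+ 3 ℤ.* b ℤ.+ t) ℤ.* b) ℤ.- b ℤ.* b
      lemma₁ = ℤSolver.solve-∀
      lemma₂ : ∀ x y z → ℤ.- (x ℤ.* y ℤ.* z) ≡ ℤ.- x ℤ.* y ℤ.* z
      lemma₂ = ℤSolver.solve-∀

    0<A : 0 ℕ.< A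
    0<A = subst (0 ℕ.<_) (sym A≡3b+t) (ℕ.≤-trans 0<b (ℕ.≤-trans (ℕ.m≤n*m b 3) (ℕ.m≤m+n _ t)))

    hasQuadraticPoint : HasQuadraticPoint (ℚ⟮√ d ⟯ squarefree-d d≢1)
    hasQuadraticPoint = hasQuadraticPoint-at (ℚ⟮√ d ⟯ squarefree-d d≢1) (ℤ.+ A) (ℤ.+ b) (ℤ.+ D) (+≢0 0<A) (+≢0 0<D) D²d≡F

    quadraticPoint-over-d : ∃ λ (K : QuadraticField) → QuadraticField.radicand K ≡ d × HasQuadraticPoint K
    quadraticPoint-over-d = ℚ⟮√ d ⟯ squarefree-d d≢1 , refl , hasQuadraticPoint

  max : List ℕ → ℕ
  max []       = 0
  max (x ∷ xs) = x ℕ.⊔ max xs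

  all-≤max : ∀ {X : Set} (f : X → ℕ) xs → All (λ x → f x ℕ.≤ max (map f xs)) xs
  all-≤max f []       = []
  all-≤max f (x ∷ xs) = ℕ.m≤m⊔n (f x) _ ∷ All.map (λ le → ℕ.≤-trans le (ℕ.m≤n⊔m (f x) _)) (all-≤max f xs)

  module _ (p : ℕ) (p-prime : Prime p) (a : ℤ) where

    private
      instance
        p≢0 : ℕ.NonZero p
        p≢0 = prime⇒nonZero p-prime

      Good : ℤ → Set
      Good d = ((ℤ.+ p) ℤᵤ.∣ (d ℤ.- a)) × Squarefree d ×
        (∃ λ (K : QuadraticField) → QuadraticField.radicand K ≡ d × HasQuadraticPoint K)

      module _ {B : ℕ} (C : Candidate p (a %ℕ p) B) where
        open Candidate C
        open FromCandidate C

        p∣d-a : (ℤ.+ p) ℤᵤ.∣ (d ℤ.- a)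
        p∣d-a = ∣⇒∣ᵤ (subst (ℤ.+ p ∣ˢ_) eq (∣m∣n⇒∣m-n (∣m⇒∣-m (∣ᵤ⇒∣ {ℤ.+ p} {ℤ.+ (n ℕ.+ r)} p∣n+r)) (divides (a /ℕ p) refl)))
          where
          r : ℕ
          r = a %ℕ p
          lemma : ∀ n r s → ℤ.- (n ℤ.+ r) ℤ.- s ≡ ℤ.- n ℤ.- (r ℤ.+ s)
          lemma = ℤSolver.solve-∀
          eq : ℤ.- (ℤ.+ n ℤ.+ ℤ.+ r) ℤ.- (a /ℕ p) ℤ.* ℤ.+ p ≡ d ℤ.- a
          eq = trans (lemma (ℤ.+ n) (ℤ.+ r) ((a /ℕ p) ℤ.* ℤ.+ p)) (cong (λ x → ℤ.- ℤ.+ n ℤ.- x) (sym (a≡a%ℕn+[a/ℕn]*n a p)))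

        good : Good d
        good = p∣d-a , squarefree-d , quadraticPoint-over-d

        d≢ : ∀ {y} → ℤ.∣ y ∣ ℕ.≤ B → d ≢ y
        d≢ y≤B d≡y = ℕ.<⇒≱ B<n (subst (ℕ._≤ B) (trans (cong ℤ.∣_∣ (sym d≡y)) ∣d∣≡n) y≤B)

    -- A candidate whose n exceeds every absolute value in the list avoids the list. With r the
    -- residue of a, n ≡ -r modulo p puts d = -n into the class of a.
    infinitelyMany-in-class : InfinitelyMany _≡_ Good
    infinitelyMany-in-class xs = from (candidate p-prime (n%ℕd<d a p) (max (map ℤ.∣_∣ xs)))
      where
      from : Candidate p (a %ℕ p) (max (map ℤ.∣_∣ xs)) → ∃ λ d → Good d × All (λ y → d ≢ y) xs
      from C = FromCandidate.d C , good C , All.map (d≢ C) (all-≤max ℤ.∣_∣ xs)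

-- The ring of integers of ℚ(√d) for even d

module Integers where
  open import Defs
  open Candidates using (n<2^n)
  open Events using (coprime-square)
  open Field
  open PrimeSquares using (prime∣product)
  open import Data.Integer.Base as ℤ using (ℤ; 0ℤ; 1ℤ)
  open import Data.Integer.Divisibility.Signed as ℤ using (∣⇒∣ᵤ) renaming (_∣_ to _∣ℤ_)
  import Data.Integer.Properties as ℤ
  import Data.Integer.Tactic.RingSolver as ℤSolver
  open import Data.List.Base using ([]; _∷_; length)
  open import Data.Nat.Base as ℕ using (ℕ; zero; suc; _^_)
  open import Data.Nat.Primality using (prime[2])
  open import Data.Nat.Coprimality as Coprimality using (Coprime; coprime-divisor)
  open import Data.Nat.Divisibility using (_∣_; ∣-refl; ∣-trans; m∣m*n; ∣⇒≤; ∣1⇒≡1)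
  import Data.Nat.Properties as ℕ
  open import Data.Product.Base using (∃-syntax; _×_; _,_; proj₁; proj₂)
  open import Data.Rational.Base as ℚ using (ℚ; mkℚ; 0ℚ; 1ℚ; _/_)
  import Data.Rational.Properties as ℚ
  import Data.Rational.Solver as ℚSolver
  open import Data.Rational.Unnormalised.Base as ℚᵘ using (mkℚᵘ; *≡*)
  import Data.Rational.Unnormalised.Properties as ℚᵘ
  open import Data.Sum.Base using (_⊎_; [_,_]′)
  open import Function.Base using (_∘_)
  open import Relation.Binary.PropositionalEquality
  open import Relation.Nullary.Decidable using (Dec; yes; no; map′)
  open import Relation.Nullary.Negation using (¬_; contradiction)

  as-fraction : ∀ p → ∃[ m ] ∃[ w ] Coprime ℤ.∣ m ∣ (suc w) × (ℤ.+ suc w / 1) ℚ.* p ≡ m / 1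
  as-fraction p@(mkℚ m w c) = m , w , Coprimality.recompute c , ℚ.toℚᵘ-injective
    (ℚᵘ.≃-trans (ℚ.toℚᵘ-homo-* (ℤ.+ suc w / 1) p)
    (ℚᵘ.≃-trans (ℚᵘ.*-congʳ {mkℚᵘ m w} (ℚ.toℚᵘ-fromℚᵘ (mkℚᵘ (ℤ.+ suc w) 0)))
    (ℚᵘ.≃-trans (*≡* (lemma (ℤ.+ suc w) m)) (ℚᵘ.≃-sym (ℚ.toℚᵘ-fromℚᵘ (mkℚᵘ m 0))))))
    where
    lemma : ∀ w m → w ℤ.* m ℤ.* 1ℤ ≡ m ℤ.* (1ℤ ℤ.* w)
    lemma = ℤSolver.solve-∀

  IsIntegerℚ : ℚ → Set
  IsIntegerℚ p = ∃[ z ] p ≡ z / 1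

  fraction-integer : ∀ p m w → (ℤ.+ suc w / 1) ℚ.* p ≡ m / 1 → suc w ≡ 1 → IsIntegerℚ p
  fraction-integer p m w eq refl = m , trans (sym (ℚ.*-identityˡ p)) eq

  integerℚ? : ∀ p → Dec (IsIntegerℚ p)
  integerℚ? p = go (as-fraction p)
    where
    go : ∃[ m ] ∃[ w ] Coprime ℤ.∣ m ∣ (suc w) × (ℤ.+ suc w / 1) ℚ.* p ≡ m / 1 → Dec (IsIntegerℚ p)
    go (m , w , c , eq) = map′ (fraction-integer p m w eq) denominator≡1 (suc w ℕ.≟ 1)
      where
      denominator≡1 : IsIntegerℚ p → suc w ≡ 1
      denominator≡1 (z , p≡z) = c (subst (suc w ∣_) (trans (sym (ℤ.abs-* (ℤ.+ suc w) z)) (cong ℤ.∣_∣ m≡)) (m∣m*n ℤ.∣ z ∣) , ∣-refl)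
        where
        m≡ : ℤ.+ suc w ℤ.* z ≡ m
        m≡ = /1-injective (trans (/1-* (ℤ.+ suc w) z) (trans (cong ((ℤ.+ suc w / 1) ℚ.*_) (sym p≡z)) eq))

  infixr 8 _^ℚ_
  _^ℚ_ : ℚ → ℕ → ℚ
  p ^ℚ zero  = 1ℚ
  p ^ℚ suc j = p ℚ.* p ^ℚ j

  coprime-^ : ∀ {m w} → Coprime m w → ∀ j → Coprime (m ^ j) w
  coprime-^ c zero    (d∣1 , _) = ∣1⇒≡1 d∣1
  coprime-^ {m} {w} c (suc j) {d} (d∣ , d∣w) = coprime-^ c j (coprime-divisor d⊥m d∣ , d∣w)
    where
    d⊥m : Coprime d m
    d⊥m (e∣d , e∣m) = c (e∣m , ∣-trans e∣d d∣w)

  coprime-power-divisor : ∀ {w m} → Coprime m w → ∀ j {v} → w ^ j ∣ m ℕ.* v → w ^ j ∣ v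
  coprime-power-divisor {w} {m} c j = coprime-divisor (Coprimality.sym (λ {d} (d∣m , d∣wj) → coprime-^ (Coprimality.sym c) j (d∣wj , d∣m)))

  -- w^j | V for all j is impossible for w ≥ 2.
  bounded-denominators : ∀ t V → V ≢ 0ℤ → (∀ j → IsIntegerℚ ((V / 1) ℚ.* t ^ℚ j)) → IsIntegerℚ t
  bounded-denominators t V V≢0 bounded = go (as-fraction t)
    where
    open ℚSolver.+-*-Solver
    open ≡-Reasoning
    go : ∃[ m ] ∃[ w ] Coprime ℤ.∣ m ∣ (suc w) × (ℤ.+ suc w / 1) ℚ.* t ≡ m / 1 → IsIntegerℚ t
    go (m , w , c , eq) = fraction-integer t m w eq (w≡1 w w^∣V)
      where
      W : ℚ
      W = ℤ.+ suc w / 1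
      powers : ∀ j → (ℤ.+ (suc w ^ j) / 1) ℚ.* t ^ℚ j ≡ (m ℤ.^ j) / 1
      powers zero    = refl
      powers (suc j) = begin
        (ℤ.+ (suc w ℕ.* suc w ^ j) / 1) ℚ.* (t ℚ.* t ^ℚ j)          ≡⟨ cong (λ x → (x / 1) ℚ.* (t ℚ.* t ^ℚ j)) (ℤ.pos-* (suc w) (suc w ^ j)) ⟩
        ((ℤ.+ suc w ℤ.* ℤ.+ (suc w ^ j)) / 1) ℚ.* (t ℚ.* t ^ℚ j)    ≡⟨ cong (ℚ._* (t ℚ.* t ^ℚ j)) (/1-* (ℤ.+ suc w) (ℤ.+ (suc w ^ j))) ⟩
        W ℚ.* (ℤ.+ (suc w ^ j) / 1) ℚ.* (t ℚ.* t ^ℚ j)              ≡⟨ solve 4 (λ a b x y → a :* b :* (x :* y) := a :* x :* (b :* y)) refl W (ℤ.+ (suc w ^ j) / 1) t (t ^ℚ j) ⟩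
        W ℚ.* t ℚ.* ((ℤ.+ (suc w ^ j) / 1) ℚ.* t ^ℚ j)              ≡⟨ cong₂ ℚ._*_ eq (powers j) ⟩
        (m / 1) ℚ.* ((m ℤ.^ j) / 1)                                 ≡⟨ /1-* m (m ℤ.^ j) ⟨
        (m ℤ.* m ℤ.^ j) / 1                                         ∎
      abs-^ : ∀ j → ℤ.∣ m ℤ.^ j ∣ ≡ ℤ.∣ m ∣ ^ j
      abs-^ zero    = refl
      abs-^ (suc j) = trans (ℤ.abs-* m (m ℤ.^ j)) (cong (ℤ.∣ m ∣ ℕ.*_) (abs-^ j))
      w^∣V : ∀ j → suc w ^ j ∣ ℤ.∣ V ∣
      w^∣V j = coprime-power-divisor (coprime-^ c j) j (subst (suc w ^ j ∣_) (trans (ℤ.abs-* (m ℤ.^ j) V) (cong (ℕ._* ℤ.∣ V ∣) (abs-^ j)))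
        (subst (λ x → suc w ^ j ∣ ℤ.∣ x ∣) eq′ (subst (suc w ^ j ∣_) (sym (ℤ.abs-* (ℤ.+ (suc w ^ j)) z)) (m∣m*n ℤ.∣ z ∣))))
        where
        z : ℤ
        z = proj₁ (bounded j)
        eq′ : ℤ.+ (suc w ^ j) ℤ.* z ≡ m ℤ.^ j ℤ.* V
        eq′ = /1-injective (begin
          (ℤ.+ (suc w ^ j) ℤ.* z) / 1                          ≡⟨ /1-* (ℤ.+ (suc w ^ j)) z ⟩
          (ℤ.+ (suc w ^ j) / 1) ℚ.* (z / 1)                    ≡⟨ cong ((ℤ.+ (suc w ^ j) / 1) ℚ.*_) (proj₂ (bounded j)) ⟨
          (ℤ.+ (suc w ^ j) / 1) ℚ.* ((V / 1) ℚ.* t ^ℚ j)       ≡⟨ solve 3 (λ a b x → a :* (b :* x) := a :* x :* b) refl (ℤ.+ (suc w ^ j) / 1) (V / 1) (t ^ℚ j) ⟩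
          (ℤ.+ (suc w ^ j) / 1) ℚ.* t ^ℚ j ℚ.* (V / 1)         ≡⟨ cong (ℚ._* (V / 1)) (powers j) ⟩
          ((m ℤ.^ j) / 1) ℚ.* (V / 1)                          ≡⟨ /1-* (m ℤ.^ j) V ⟨
          (m ℤ.^ j ℤ.* V) / 1                                  ∎)
      w≡1 : ∀ w → (∀ j → suc w ^ j ∣ ℤ.∣ V ∣) → suc w ≡ 1
      w≡1 zero    _ = refl
      w≡1 (suc w) w^∣V = contradiction (∣⇒≤ {{ℕ.≢-nonZero (V≢0 ∘ ℤ.∣i∣≡0⇒i≡0)}} (w^∣V ℤ.∣ V ∣))
        (ℕ.<⇒≱ (ℕ.<-≤-trans (n<2^n ℤ.∣ V ∣) (ℕ.^-monoˡ-≤ ℤ.∣ V ∣ (ℕ.s≤s (ℕ.s≤s ℕ.z≤n)))))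

  -- If w is the denominator of p, then w² divides d times the square of a number prime to w, hence
  -- d; squarefreeness leaves w = 1.
  squarefree-root : ∀ {d} → Squarefree d → ∀ p c → (d / 1) ℚ.* (p ℚ.* p) ≡ c / 1 → IsIntegerℚ p
  squarefree-root {d} sf p c dpp≡c = go (as-fraction p)
    where
    open ℚSolver.+-*-Solver
    open ≡-Reasoning
    go : ∃[ m ] ∃[ w ] Coprime ℤ.∣ m ∣ (suc w) × (ℤ.+ suc w / 1) ℚ.* p ≡ m / 1 → IsIntegerℚ p
    go (m , w , cop , eq) = fraction-integer p m w eq (∣1⇒≡1 (sf (ℤ.+ suc w) (subst (_∣ ℤ.∣ d ∣) (sym (ℤ.abs-* W W)) (coprime-divisor WW⊥m
      (coprime-divisor WW⊥m (subst (suc w ℕ.* suc w ∣_) abs≡ (m∣m*n ℤ.∣ c ∣)))))))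
      where
      W : ℤ
      W = ℤ.+ suc w
      WW⊥m : Coprime (suc w ℕ.* suc w) ℤ.∣ m ∣
      WW⊥m = coprime-square (Coprimality.sym cop)
      eq′ : W ℤ.* W ℤ.* c ≡ m ℤ.* (m ℤ.* d)
      eq′ = /1-injective (begin
        (W ℤ.* W ℤ.* c) / 1                                   ≡⟨ trans (/1-* (W ℤ.* W) c) (cong (ℚ._* (c / 1)) (/1-* W W)) ⟩
        (W / 1) ℚ.* (W / 1) ℚ.* (c / 1)                       ≡⟨ cong ((W / 1) ℚ.* (W / 1) ℚ.*_) dpp≡c ⟨
        (W / 1) ℚ.* (W / 1) ℚ.* ((d / 1) ℚ.* (p ℚ.* p))       ≡⟨ solve 3 (λ w d p → w :* w :* (d :* (p :* p)) := w :* p :* (w :* p :* d)) refl (W / 1) (d / 1) p ⟩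
        (W / 1) ℚ.* p ℚ.* ((W / 1) ℚ.* p ℚ.* (d / 1))         ≡⟨ cong (λ x → x ℚ.* (x ℚ.* (d / 1))) eq ⟩
        (m / 1) ℚ.* ((m / 1) ℚ.* (d / 1))                     ≡⟨ trans (/1-* m (m ℤ.* d)) (cong ((m / 1) ℚ.*_) (/1-* m d)) ⟨
        (m ℤ.* (m ℤ.* d)) / 1                                 ∎)
      abs≡ : suc w ℕ.* suc w ℕ.* ℤ.∣ c ∣ ≡ ℤ.∣ m ∣ ℕ.* (ℤ.∣ m ∣ ℕ.* ℤ.∣ d ∣)
      abs≡ = begin
        suc w ℕ.* suc w ℕ.* ℤ.∣ c ∣           ≡⟨ trans (ℤ.abs-* (W ℤ.* W) c) (cong (ℕ._* ℤ.∣ c ∣) (ℤ.abs-* W W)) ⟨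
        ℤ.∣ W ℤ.* W ℤ.* c ∣                   ≡⟨ cong ℤ.∣_∣ eq′ ⟩
        ℤ.∣ m ℤ.* (m ℤ.* d) ∣                 ≡⟨ trans (ℤ.abs-* m (m ℤ.* d)) (cong (ℤ.∣ m ∣ ℕ.*_) (ℤ.abs-* m d)) ⟩
        ℤ.∣ m ∣ ℕ.* (ℤ.∣ m ∣ ℕ.* ℤ.∣ d ∣)     ∎

  module IntegralElements (d : ℤ) where
    open Quadratic d
    open ≡-Reasoning

    IsInt : K → Set
    IsInt x = ∃[ u ] ∃[ v ] x ≡ int u v

    IsInt-+ : ∀ {x y} → IsInt x → IsInt y → IsInt (x + y)
    IsInt-+ (u , v , refl) (u′ , v′ , refl) = u ℤ.+ u′ , v ℤ.+ v′ , sym (int-+ u v u′ v′)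

    IsInt-* : ∀ {x y} → IsInt x → IsInt y → IsInt (x * y)
    IsInt-* (u , v , refl) (u′ , v′ , refl) = u ℤ.* u′ ℤ.+ d ℤ.* (v ℤ.* v′) , u ℤ.* v′ ℤ.+ v ℤ.* u′ , sym (int-* u v u′ v′)

    IsInt-neg : ∀ {x} → IsInt x → IsInt (- x)
    IsInt-neg (u , v , refl) = ℤ.- u , ℤ.- v , sym (int-neg u v)

    IsInt-⟦⟧ : ∀ n → IsInt ⟦ n ⟧
    IsInt-⟦⟧ n = n , 0ℤ , refl

    conj : K → K
    conj (p +√ q) = p +√ (ℚ.- q)

    conj-* : ∀ x y → conj (x * y) ≡ conj x * conj y
    conj-* (a +√ b) (a′ +√ b′) = cong₂ _+√_
      (S.solve 5 (λ d a b a′ b′ → a S.:* a′ S.:+ d S.:* (b S.:* b′) S.:= a S.:* a′ S.:+ d S.:* ((S.:- b) S.:* (S.:- b′))) refl (d / 1) a b a′ b′)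
      (S.solve 4 (λ a b a′ b′ → S.:- (a S.:* b′ S.:+ b S.:* a′) S.:= a S.:* (S.:- b′) S.:+ (S.:- b) S.:* a′) refl a b a′ b′)
      where module S = ℚSolver.+-*-Solver

    conj-int : ∀ u v → conj (int u v) ≡ int u (ℤ.- v)
    conj-int u v = cong (λ z → (u / 1) +√ z) (sym (/1-neg v))

    IsInt-conj : ∀ {x} → IsInt x → IsInt (conj x)
    IsInt-conj (u , v , refl) = u , ℤ.- v , conj-int u v

    IsInt-rational : ∀ {p} → IsInt (fromℚ p) → IsIntegerℚ p
    IsInt-rational (u , v , eq) = u , cong rat eq

    infixr 8 _^ᴷ_
    _^ᴷ_ : K → ℕ → K
    x ^ᴷ zero  = 1#
    x ^ᴷ suc j = x * x ^ᴷ j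

    common-denominator : ∀ x → ∃[ V ] V ≢ 0ℤ × IsInt (⟦ V ⟧ * x)
    common-denominator (p +√ q) = from (as-fraction p) (as-fraction q)
      where
      module S = ℚSolver.+-*-Solver
      from : ∃[ m ] ∃[ w ] Coprime ℤ.∣ m ∣ (suc w) × (ℤ.+ suc w / 1) ℚ.* p ≡ m / 1 →
             ∃[ m ] ∃[ w ] Coprime ℤ.∣ m ∣ (suc w) × (ℤ.+ suc w / 1) ℚ.* q ≡ m / 1 →
             ∃[ V ] V ≢ 0ℤ × IsInt (⟦ V ⟧ * (p +√ q))
      from (m , w , _ , eq) (m′ , w′ , _ , eq′) = W ℤ.* W′ , W*W′≢0 , W′ ℤ.* m , W ℤ.* m′ , (begin
        ⟦ W ℤ.* W′ ⟧ * (p +√ q)                              ≡⟨ cong (_* (p +√ q)) (⟦⟧-* W W′) ⟩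
        ⟦ W ⟧ * ⟦ W′ ⟧ * (p +√ q)                            ≡⟨ cong₂ _+√_
          (S.solve 5 (λ d w w′ p q → (w S.:* w′ S.:+ d S.:* (S.con 0ℚ S.:* S.con 0ℚ)) S.:* p S.:+ d S.:* ((w S.:* S.con 0ℚ S.:+ S.con 0ℚ S.:* w′) S.:* q)
            S.:= w′ S.:* (w S.:* p)) refl (d / 1) (W / 1) (W′ / 1) p q)
          (S.solve 5 (λ d w w′ p q → (w S.:* w′ S.:+ d S.:* (S.con 0ℚ S.:* S.con 0ℚ)) S.:* q S.:+ (w S.:* S.con 0ℚ S.:+ S.con 0ℚ S.:* w′) S.:* p
            S.:= w S.:* (w′ S.:* q)) refl (d / 1) (W / 1) (W′ / 1) p q) ⟩
        ((W′ / 1) ℚ.* ((W / 1) ℚ.* p)) +√ ((W / 1) ℚ.* ((W′ / 1) ℚ.* q)) ≡⟨ cong₂ (λ x y → ((W′ / 1) ℚ.* x) +√ ((W / 1) ℚ.* y)) eq eq′ ⟩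
        ((W′ / 1) ℚ.* (m / 1)) +√ ((W / 1) ℚ.* (m′ / 1))     ≡⟨ cong₂ _+√_ (/1-* W′ m) (/1-* W m′) ⟨
        int (W′ ℤ.* m) (W ℤ.* m′)                            ∎)
        where
        W W′ : ℤ
        W  = ℤ.+ suc w
        W′ = ℤ.+ suc w′
        W*W′≢0 : W ℤ.* W′ ≢ 0ℤ
        W*W′≢0 ()

    ℤ-integral : ∀ {m n} → m ≢ 0ℤ → n ≢ 0ℤ → m ℤ.* n ≢ 0ℤ
    ℤ-integral {m} {n} m≢0 n≢0 mn≡0 = [ m≢0 , n≢0 ]′ (ℤ.i*j≡0⇒i≡0∨j≡0 m mn≡0)

    module _ (x : K) where

      powers-below : ∀ k → ∃[ V ] V ≢ 0ℤ × (∀ j → j ℕ.< k → IsInt (⟦ V ⟧ * x ^ᴷ j))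
      powers-below zero = 1ℤ , (λ ()) , λ j ()
      powers-below (suc k) = from (powers-below k) (common-denominator (x ^ᴷ k))
        where
        from : ∃[ V ] V ≢ 0ℤ × (∀ j → j ℕ.< k → IsInt (⟦ V ⟧ * x ^ᴷ j)) → ∃[ W ] W ≢ 0ℤ × IsInt (⟦ W ⟧ * x ^ᴷ k) →
          ∃[ V ] V ≢ 0ℤ × (∀ j → j ℕ.< suc k → IsInt (⟦ V ⟧ * x ^ᴷ j))
        from (V , V≢0 , V-int) (W , W≢0 , W-int) = V ℤ.* W , ℤ-integral V≢0 W≢0 , int-below
          where
          V*W : ∀ j → ⟦ V ℤ.* W ⟧ * x ^ᴷ j ≡ ⟦ W ⟧ * (⟦ V ⟧ * x ^ᴷ j)
          V*W j = trans (cong (_* x ^ᴷ j) (⟦⟧-* V W)) (solve 3 (λ v w y → v :* w :* y := w :* (v :* y)) refl ⟦ V ⟧ ⟦ W ⟧ (x ^ᴷ j))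
          W*V : ∀ j → ⟦ V ℤ.* W ⟧ * x ^ᴷ j ≡ ⟦ V ⟧ * (⟦ W ⟧ * x ^ᴷ j)
          W*V j = trans (cong (_* x ^ᴷ j) (⟦⟧-* V W)) (*-assoc ⟦ V ⟧ ⟦ W ⟧ (x ^ᴷ j))
          int-below : ∀ j → j ℕ.< suc k → IsInt (⟦ V ℤ.* W ⟧ * x ^ᴷ j)
          int-below j (ℕ.s≤s j≤k) = [ (λ j<k → subst IsInt (sym (V*W j)) (IsInt-* (IsInt-⟦⟧ W) (V-int j j<k)))
                                    , (λ j≡k → subst (λ i → IsInt (⟦ V ℤ.* W ⟧ * x ^ᴷ i)) (sym j≡k) (subst IsInt (sym (W*V k)) (IsInt-* (IsInt-⟦⟧ V) W-int))) ]′
            (ℕ.m≤n⇒m<n∨m≡n j≤k)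

    module Bounded (sf : Squarefree d) (d≢1 : d ≢ 1ℤ) where

      F : QuadraticField
      F = ℚ⟮√ d ⟯ sf d≢1

      -- Every term of V xᵉ f(x) other than the leading one has an exponent covered by the
      -- assumption. Once f(x) = 0, the leading term V x^(deg f + e) is therefore integral as well.
      monic-remainder : ∀ V x cs e → (∀ i → i ℕ.< length cs → IsInt (⟦ V ⟧ * x ^ᴷ (i ℕ.+ e))) →
        IsInt (⟦ V ⟧ * x ^ᴷ e * evalMonic F cs x - ⟦ V ⟧ * x ^ᴷ (length cs ℕ.+ e))
      monic-remainder V x [] e int-powers = 0ℤ , 0ℤ , solve 1 (λ y → y :* con 1ℤ :- y := con 0ℤ) refl (⟦ V ⟧ * x ^ᴷ e)
      monic-remainder V x (c ∷ cs) e int-powers = subst IsInt eq (IsInt-+ (IsInt-* (IsInt-⟦⟧ c) (int-powers 0 (ℕ.s≤s ℕ.z≤n)))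
        (monic-remainder V x cs (suc e) (λ i i<l → subst (λ j → IsInt (⟦ V ⟧ * x ^ᴷ j)) (sym (ℕ.+-suc i e)) (int-powers (suc i) (ℕ.s≤s i<l)))))
        where
        lemma : ∀ c v x y e z → c * (v * y) + (v * (x * y) * e - z) ≡ v * y * (c + x * e) - z
        lemma = solve 6 (λ c v x y e z → c :* (v :* y) :+ (v :* (x :* y) :* e :- z) := v :* y :* (c :+ x :* e) :- z) refl
        eq : ⟦ c ⟧ * (⟦ V ⟧ * x ^ᴷ e) + (⟦ V ⟧ * x ^ᴷ suc e * evalMonic F cs x - ⟦ V ⟧ * x ^ᴷ (length cs ℕ.+ suc e))
          ≡ ⟦ V ⟧ * x ^ᴷ e * (⟦ c ⟧ + x * evalMonic F cs x) - ⟦ V ⟧ * x ^ᴷ (suc (length cs) ℕ.+ e)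
        eq = trans (lemma ⟦ c ⟧ ⟦ V ⟧ x (x ^ᴷ e) (evalMonic F cs x) (⟦ V ⟧ * x ^ᴷ (length cs ℕ.+ suc e)))
          (cong (λ j → ⟦ V ⟧ * x ^ᴷ e * (⟦ c ⟧ + x * evalMonic F cs x) - ⟦ V ⟧ * x ^ᴷ j) (ℕ.+-suc (length cs) e))

      -- V clears the powers below the degree, and the monic equation carries the property upwards.
      integral-powers : ∀ x → Integral F x → ∃[ V ] V ≢ 0ℤ × (∀ j → IsInt (⟦ V ⟧ * x ^ᴷ j))
      integral-powers x (cs , eval≡0) = from (powers-below x l)
        where
        l : ℕ
        l = length cs
        from : ∃[ V ] V ≢ 0ℤ × (∀ j → j ℕ.< l → IsInt (⟦ V ⟧ * x ^ᴷ j)) → ∃[ V ] V ≢ 0ℤ × (∀ j → IsInt (⟦ V ⟧ * x ^ᴷ j))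
        from (V , V≢0 , base) = V , V≢0 , λ j → below (suc j) j ℕ.≤-refl
          where
          step : ∀ e → (∀ i → i ℕ.< l → IsInt (⟦ V ⟧ * x ^ᴷ (i ℕ.+ e))) → IsInt (⟦ V ⟧ * x ^ᴷ (l ℕ.+ e))
          step e h = subst IsInt (trans (cong (λ y → - (⟦ V ⟧ * x ^ᴷ e * y - ⟦ V ⟧ * x ^ᴷ (l ℕ.+ e))) eval≡0)
              (solve 2 (λ a b → :- (a :* con 0ℤ :- b) := b) refl (⟦ V ⟧ * x ^ᴷ e) (⟦ V ⟧ * x ^ᴷ (l ℕ.+ e))))
            (IsInt-neg (monic-remainder V x cs e h))
          below : ∀ k j → j ℕ.< k → IsInt (⟦ V ⟧ * x ^ᴷ j)
          below (suc k) j (ℕ.s≤s j≤k) = go (j ℕ.<? l)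
            where
            go : Dec (j ℕ.< l) → IsInt (⟦ V ⟧ * x ^ᴷ j)
            go (yes j<l) = base j j<l
            go (no j≮l)  = subst (λ i → IsInt (⟦ V ⟧ * x ^ᴷ i)) (ℕ.m+[n∸m]≡n l≤j)
              (step (j ℕ.∸ l) (λ i i<l → below k _ (ℕ.<-≤-trans (subst (i ℕ.+ (j ℕ.∸ l) ℕ.<_) (ℕ.m+[n∸m]≡n l≤j) (ℕ.+-monoˡ-< (j ℕ.∸ l) i<l)) j≤k)))
              where
              l≤j : l ℕ.≤ j
              l≤j = ℕ.≮⇒≥ j≮l

      module _ (x : K) (V : ℤ) (int-powers : ∀ j → IsInt (⟦ V ⟧ * x ^ᴷ j)) where

        -- A ℤ[x, x̄]-module of elements with bounded denominators, containing 1.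
        Multiplier : K → Set
        Multiplier y = ∀ i j → IsInt (⟦ V ⟧ * ⟦ V ⟧ * y * (x ^ᴷ i * conj x ^ᴷ j))

        private
          conj-^ : ∀ j → conj (x ^ᴷ j) ≡ conj x ^ᴷ j
          conj-^ zero    = refl
          conj-^ (suc j) = trans (conj-* x (x ^ᴷ j)) (cong (conj x *_) (conj-^ j))

          conj-⟦⟧ : conj ⟦ V ⟧ ≡ ⟦ V ⟧
          conj-⟦⟧ = refl

          multiplier-1 : Multiplier 1#
          multiplier-1 i j = subst IsInt (lemma ⟦ V ⟧ (x ^ᴷ i) (conj x ^ᴷ j)) (IsInt-* (int-powers i)
            (subst IsInt (trans (conj-* ⟦ V ⟧ (x ^ᴷ j)) (cong₂ _*_ conj-⟦⟧ (conj-^ j))) (IsInt-conj (int-powers j))))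
            where
            lemma : ∀ v a b → v * a * (v * b) ≡ v * v * 1# * (a * b)
            lemma = solve 3 (λ v a b → v :* a :* (v :* b) := v :* v :* con 1ℤ :* (a :* b)) refl

          multiplier-trace : ∀ {y} → Multiplier y → Multiplier ((x + conj x) * y)
          multiplier-trace {y} m i j = subst IsInt (lemma (⟦ V ⟧ * ⟦ V ⟧) x (conj x) y (x ^ᴷ i) (conj x ^ᴷ j)) (IsInt-+ (m (suc i) j) (m i (suc j)))
            where
            lemma : ∀ v x x̄ y a b → v * y * (x * a * b) + v * y * (a * (x̄ * b)) ≡ v * ((x + x̄) * y) * (a * b)
            lemma = solve 6 (λ v x x̄ y a b → v :* y :* (x :* a :* b) :+ v :* y :* (a :* (x̄ :* b)) := v :* ((x :+ x̄) :* y) :* (a :* b)) refl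

          multiplier-norm : ∀ {y} → Multiplier y → Multiplier (x * conj x * y)
          multiplier-norm {y} m i j = subst IsInt (lemma (⟦ V ⟧ * ⟦ V ⟧) x (conj x) y (x ^ᴷ i) (conj x ^ᴷ j)) (m (suc i) (suc j))
            where
            lemma : ∀ v x x̄ y a b → v * y * (x * a * (x̄ * b)) ≡ v * (x * x̄ * y) * (a * b)
            lemma = solve 6 (λ v x x̄ y a b → v :* y :* (x :* a :* (x̄ :* b)) := v :* (x :* x̄ :* y) :* (a :* b)) refl

          powers : ∀ {t} → (∀ {y} → Multiplier y → Multiplier (t * y)) → ∀ j → Multiplier (t ^ᴷ j)
          powers m zero    = multiplier-1
          powers m (suc j) = m (powers m j)

        -- All powers of such a p have denominators dividing V², which only an integer allows.
        -- Applied to x + x̄ and x x̄ this yields integral trace and norm directly, without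
        -- factoring the given polynomial.
        rational-multiplier : V ≢ 0ℤ → ∀ p → (∀ {y} → Multiplier y → Multiplier (fromℚ p * y)) → IsIntegerℚ p
        rational-multiplier V≢0 p m = bounded-denominators p (V ℤ.* V) (ℤ-integral V≢0 V≢0) (λ j → IsInt-rational (subst IsInt (eq j) (powers m j 0 0)))
          where
          module S = ℚSolver.+-*-Solver
          fromℚ-* : ∀ p q → fromℚ p * fromℚ q ≡ fromℚ (p ℚ.* q)
          fromℚ-* p q = cong₂ _+√_
            (S.solve 3 (λ d p q → p S.:* q S.:+ d S.:* (S.con 0ℚ S.:* S.con 0ℚ) S.:= p S.:* q) refl (d / 1) p q)
            (S.solve 2 (λ p q → p S.:* S.con 0ℚ S.:+ S.con 0ℚ S.:* q S.:= S.con 0ℚ) refl p q)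
          fromℚ-^ : ∀ j → fromℚ p ^ᴷ j ≡ fromℚ (p ^ℚ j)
          fromℚ-^ zero    = refl
          fromℚ-^ (suc j) = trans (cong (fromℚ p *_) (fromℚ-^ j)) (fromℚ-* p (p ^ℚ j))
          eq : ∀ j → ⟦ V ⟧ * ⟦ V ⟧ * fromℚ p ^ᴷ j * (1# * 1#) ≡ fromℚ (((V ℤ.* V) / 1) ℚ.* p ^ℚ j)
          eq j = begin
            ⟦ V ⟧ * ⟦ V ⟧ * fromℚ p ^ᴷ j * (1# * 1#)    ≡⟨ cong (λ y → ⟦ V ⟧ * ⟦ V ⟧ * fromℚ p ^ᴷ j * y) (*-identityˡ 1#) ⟩
            ⟦ V ⟧ * ⟦ V ⟧ * fromℚ p ^ᴷ j * 1#           ≡⟨ *-identityʳ (⟦ V ⟧ * ⟦ V ⟧ * fromℚ p ^ᴷ j) ⟩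
            ⟦ V ⟧ * ⟦ V ⟧ * fromℚ p ^ᴷ j                ≡⟨ cong₂ _*_ (sym (⟦⟧-* V V)) (fromℚ-^ j) ⟩
            ⟦ V ℤ.* V ⟧ * fromℚ (p ^ℚ j)                ≡⟨ fromℚ-* ((V ℤ.* V) / 1) (p ^ℚ j) ⟩
            fromℚ (((V ℤ.* V) / 1) ℚ.* p ^ℚ j)          ∎

        trace-integer : V ≢ 0ℤ → IsIntegerℚ (rat x ℚ.+ rat x)
        trace-integer V≢0 = rational-multiplier V≢0 (rat x ℚ.+ rat x)
          (λ {y} m → subst (λ t → Multiplier (t * y)) (cong (λ z → (rat x ℚ.+ rat x) +√ z) (ℚ.+-inverseʳ (irr x))) (multiplier-trace {y} m))

        norm-integer : V ≢ 0ℤ → IsIntegerℚ (rat x ℚ.* rat x ℚ.- (d / 1) ℚ.* (irr x ℚ.* irr x))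
        norm-integer V≢0 = rational-multiplier V≢0 _ (λ {y} m → subst (λ t → Multiplier (t * y)) (cong₂ _+√_
            (S.solve 3 (λ d p q → p S.:* p S.:+ d S.:* (q S.:* (S.:- q)) S.:= p S.:* p S.:- d S.:* (q S.:* q)) refl (d / 1) (rat x) (irr x))
            (S.solve 2 (λ p q → p S.:* (S.:- q) S.:+ q S.:* p S.:= S.con 0ℚ) refl (rat x) (irr x))) (multiplier-norm {y} m))
          where module S = ℚSolver.+-*-Solver

      integer⇒integral : ∀ u v → Integral F (int u v)
      integer⇒integral u v = (u ℤ.* u ℤ.- d ℤ.* (v ℤ.* v)) ∷ (ℤ.- (u ℤ.+ u)) ∷ [] , (begin
        ⟦ u ℤ.* u ℤ.- d ℤ.* (v ℤ.* v) ⟧ + int u v * (⟦ ℤ.- (u ℤ.+ u) ⟧ + int u v * 1#)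
          ≡⟨ cong (λ y → ⟦ u ℤ.* u ℤ.- d ℤ.* (v ℤ.* v) ⟧ + int u v * y)
               (trans (cong (⟦ ℤ.- (u ℤ.+ u) ⟧ +_) (*-identityʳ (int u v))) (sym (int-+ (ℤ.- (u ℤ.+ u)) 0ℤ u v))) ⟩
        ⟦ u ℤ.* u ℤ.- d ℤ.* (v ℤ.* v) ⟧ + int u v * int (ℤ.- (u ℤ.+ u) ℤ.+ u) (0ℤ ℤ.+ v)
          ≡⟨ trans (int-+ (u ℤ.* u ℤ.- d ℤ.* (v ℤ.* v)) 0ℤ (u ℤ.* (ℤ.- (u ℤ.+ u) ℤ.+ u) ℤ.+ d ℤ.* (v ℤ.* (0ℤ ℤ.+ v))) (u ℤ.* (0ℤ ℤ.+ v) ℤ.+ v ℤ.* (ℤ.- (u ℤ.+ u) ℤ.+ u)))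
               (cong (⟦ u ℤ.* u ℤ.- d ℤ.* (v ℤ.* v) ⟧ +_) (int-* u v (ℤ.- (u ℤ.+ u) ℤ.+ u) (0ℤ ℤ.+ v))) ⟨
        int (u ℤ.* u ℤ.- d ℤ.* (v ℤ.* v) ℤ.+ (u ℤ.* (ℤ.- (u ℤ.+ u) ℤ.+ u) ℤ.+ d ℤ.* (v ℤ.* (0ℤ ℤ.+ v))))
            (0ℤ ℤ.+ (u ℤ.* (0ℤ ℤ.+ v) ℤ.+ v ℤ.* (ℤ.- (u ℤ.+ u) ℤ.+ u)))
          ≡⟨ cong₂ int (lemma₁ d u v) (lemma₂ u v) ⟩
        0#  ∎)
        where
        lemma₁ : ∀ d u v → u ℤ.* u ℤ.- d ℤ.* (v ℤ.* v) ℤ.+ (u ℤ.* (ℤ.- (u ℤ.+ u) ℤ.+ u) ℤ.+ d ℤ.* (v ℤ.* (0ℤ ℤ.+ v))) ≡ 0ℤ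
        lemma₁ = ℤSolver.solve-∀
        lemma₂ : ∀ u v → 0ℤ ℤ.+ (u ℤ.* (0ℤ ℤ.+ v) ℤ.+ v ℤ.* (ℤ.- (u ℤ.+ u) ℤ.+ u)) ≡ 0ℤ
        lemma₂ = ℤSolver.solve-∀

      module EvenRadicand (e : ℤ) (d≡2e : d ≡ ℤ.+ 2 ℤ.* e) where

        private
          module S = ℚSolver.+-*-Solver

          double-injective : ∀ p q → p ℚ.+ p ≡ q ℚ.+ q → p ≡ q
          double-injective p q eq = [ (λ p-q≡0 → trans (S.solve 2 (λ p q → p S.:= (p S.:- q) S.:+ q) refl p q) (trans (cong (ℚ._+ q) p-q≡0) (ℚ.+-identityˡ q)))
                                    , (λ ()) ]′
            (ℚ-integral (p ℚ.- q) (1ℚ ℚ.+ 1ℚ) (trans (S.solve 2 (λ p q → (p S.:- q) S.:* (S.con 1ℚ S.:+ S.con 1ℚ) S.:= (p S.:+ p) S.:- (q S.:+ q)) refl p q)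
              (trans (cong (ℚ._- (q ℚ.+ q)) eq) (ℚ.+-inverseʳ (q ℚ.+ q)))))

          halve : ∀ p {m} → p ℚ.+ p ≡ m / 1 → ℤ.+ 2 ∣ℤ m → IsIntegerℚ p
          halve p {m} eq (ℤ.divides k m≡k2) = k , double-injective p (k / 1) (trans eq (trans (cong (_/ 1) (trans m≡k2 (lemma k))) (/1-+ k k)))
            where
            lemma : ∀ k → k ℤ.* ℤ.+ 2 ≡ k ℤ.+ k
            lemma = ℤSolver.solve-∀

          prime-2 : ∀ m n → ℤ.+ 2 ∣ℤ m ℤ.* n → ℤ.+ 2 ∣ℤ m ⊎ ℤ.+ 2 ∣ℤ n
          prime-2 = prime∣product prime[2]

          2∤e : ¬ ℤ.+ 2 ∣ℤ e
          2∤e (ℤ.divides k e≡k2) = 2≢1 (∣1⇒≡1 (sf (ℤ.+ 2) (∣⇒∣ᵤ {ℤ.+ 4} {d} (ℤ.divides k (trans d≡2e (trans (cong (ℤ.+ 2 ℤ.*_) e≡k2) (lemma k)))))))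
            where
            2≢1 : 2 ≢ 1
            2≢1 ()
            lemma : ∀ k → ℤ.+ 2 ℤ.* (k ℤ.* ℤ.+ 2) ≡ k ℤ.* ℤ.+ 4
            lemma = ℤSolver.solve-∀

          2∣square : ∀ m → ℤ.+ 2 ∣ℤ m ℤ.* m → ℤ.+ 2 ∣ℤ m
          2∣square m h = [ (λ x → x) , (λ x → x) ]′ (prime-2 m m h)

          -- Excludes half-integers. T is the trace, N the norm and Q twice the coefficient of √d.
          -- As d = 2e with e odd, T² is even, so T is even, then 4 ∣ 2eQ² and Q is even.
          parity : ∀ T Q N → d ℤ.* (Q ℤ.* Q) ≡ T ℤ.* T ℤ.- ℤ.+ 4 ℤ.* N → ℤ.+ 2 ∣ℤ T × ℤ.+ 2 ∣ℤ Q
          parity T Q N eq = 2∣T , from 2∣T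
            where
            lemma₁ : ∀ T N → (T ℤ.* T ℤ.- ℤ.+ 4 ℤ.* N) ℤ.+ ℤ.+ 4 ℤ.* N ≡ T ℤ.* T
            lemma₁ = ℤSolver.solve-∀
            lemma₂ : ∀ e Q N → ℤ.+ 2 ℤ.* e ℤ.* (Q ℤ.* Q) ℤ.+ ℤ.+ 4 ℤ.* N ≡ (e ℤ.* (Q ℤ.* Q) ℤ.+ ℤ.+ 2 ℤ.* N) ℤ.* ℤ.+ 2
            lemma₂ = ℤSolver.solve-∀
            2∣T : ℤ.+ 2 ∣ℤ T
            2∣T = 2∣square T (ℤ.divides (e ℤ.* (Q ℤ.* Q) ℤ.+ ℤ.+ 2 ℤ.* N)
              (trans (sym (lemma₁ T N)) (trans (cong (ℤ._+ ℤ.+ 4 ℤ.* N) (sym eq)) (trans (cong (λ d → d ℤ.* (Q ℤ.* Q) ℤ.+ ℤ.+ 4 ℤ.* N) d≡2e) (lemma₂ e Q N)))))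
            from : ℤ.+ 2 ∣ℤ T → ℤ.+ 2 ∣ℤ Q
            from (ℤ.divides k T≡k2) = [ (λ 2∣e → contradiction 2∣e 2∤e) , 2∣square Q ]′ (prime-2 e (Q ℤ.* Q)
              (ℤ.divides (k ℤ.* k ℤ.- N) (ℤ.*-cancelˡ-≡ (ℤ.+ 2) _ _
                (trans (trans (sym (ℤ.*-assoc (ℤ.+ 2) e (Q ℤ.* Q))) (cong (ℤ._* (Q ℤ.* Q)) (sym d≡2e)))
                  (trans eq (trans (cong (λ T → T ℤ.* T ℤ.- ℤ.+ 4 ℤ.* N) T≡k2) (lemma₃ k N)))))))
              where
              lemma₃ : ∀ k N → k ℤ.* ℤ.+ 2 ℤ.* (k ℤ.* ℤ.+ 2) ℤ.- ℤ.+ 4 ℤ.* N ≡ ℤ.+ 2 ℤ.* ((k ℤ.* k ℤ.- N) ℤ.* ℤ.+ 2)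
              lemma₃ = ℤSolver.solve-∀

        integral⇒integer : ∀ {x} → Integral F x → IsInt x
        integral⇒integer {x} x-integral = from (integral-powers x x-integral)
          where
          p q D : ℚ
          p = rat x
          q = irr x
          D = d / 1
          from : ∃[ V ] V ≢ 0ℤ × (∀ j → IsInt (⟦ V ⟧ * x ^ᴷ j)) → IsInt x
          from (V , V≢0 , int-powers) = from′ (trace-integer x V int-powers V≢0) (norm-integer x V int-powers V≢0)
            where
            from′ : IsIntegerℚ (p ℚ.+ p) → IsIntegerℚ (p ℚ.* p ℚ.- D ℚ.* (q ℚ.* q)) → IsInt x
            from′ (T , T≡) (N , N≡) = from″ (squarefree-root {d} sf (q ℚ.+ q) c eq)
              where
              c : ℤ
              c = T ℤ.* T ℤ.- ℤ.+ 4 ℤ.* N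
              c≡ : c / 1 ≡ (T / 1) ℚ.* (T / 1) ℚ.- (ℤ.+ 4 / 1) ℚ.* (N / 1)
              c≡ = trans (/1-+ (T ℤ.* T) _) (cong₂ ℚ._+_ (/1-* T T) (trans (/1-neg (ℤ.+ 4 ℤ.* N)) (cong ℚ.-_ (/1-* (ℤ.+ 4) N))))
              eq : D ℚ.* ((q ℚ.+ q) ℚ.* (q ℚ.+ q)) ≡ c / 1
              eq = sym (trans c≡ (trans (cong₂ (λ t n → t ℚ.* t ℚ.- (ℤ.+ 4 / 1) ℚ.* n) (sym T≡) (sym N≡))
                (S.solve 3 (λ D p q → (p S.:+ p) S.:* (p S.:+ p) S.:- S.con (ℤ.+ 4 / 1) S.:* (p S.:* p S.:- D S.:* (q S.:* q)) S.:= D S.:* ((q S.:+ q) S.:* (q S.:+ q))) refl D p q)))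
              from″ : IsIntegerℚ (q ℚ.+ q) → IsInt x
              from″ (Q , Q≡) = from‴ (halve p T≡ (proj₁ even)) (halve q Q≡ (proj₂ even))
                where
                even : ℤ.+ 2 ∣ℤ T × ℤ.+ 2 ∣ℤ Q
                even = parity T Q N (/1-injective (trans (/1-* d (Q ℤ.* Q)) (trans (cong (D ℚ.*_) (trans (/1-* Q Q) (cong (λ y → y ℚ.* y) (sym Q≡)))) eq)))
                from‴ : IsIntegerℚ p → IsIntegerℚ q → IsInt x
                from‴ (u , p≡) (v , q≡) = u , v , cong₂ _+√_ p≡ q≡

-- Ideals as lattices: triangular bases and normal forms

module Lattices where
  open import Defs
  open Field
  open Integers
  open import Data.Integer.Base as ℤ using (ℤ; 0ℤ; 1ℤ; -[1+_])
  open import Data.Integer.DivMod using (_%ℕ_; _/ℕ_; a≡a%ℕn+[a/ℕn]*n; n%ℕd<d)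
  import Data.Integer.Properties as ℤ
  import Data.Integer.Tactic.RingSolver as ℤSolver
  open import Data.List.Base using (List; []; _∷_; map)
  open import Data.List.Relation.Unary.Any using (Any; here; there)
  open import Data.Nat.Base as ℕ using (ℕ; zero; suc)
  open import Data.Nat.Induction using (<-wellFounded)
  import Data.Nat.Properties as ℕ
  open import Data.Product.Base using (∃-syntax; _×_; _,_; proj₁; proj₂)
  open import Data.Rational.Base using (_/_; 1/_)
  import Data.Rational.Base as ℚ
  import Data.Rational.Properties as ℚ
  import Data.Rational.Solver as ℚSolver
  open import Function.Bundles using (_⇔_; mk⇔; module Equivalence)
  open import Induction.WellFounded using (Acc; acc)
  open import Relation.Binary.PropositionalEquality
  open import Relation.Nullary.Decidable using (Dec; yes; no)
  open import Relation.Nullary.Negation using (contradiction)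

  -- The last field makes the matrix with rows (s, t) and (-y′, x′) unimodular. When both numbers
  -- are 0 it cannot be obtained from the other fields by cancelling the gcd, so it is recorded.
  record Bézout (x y : ℤ) : Set where
    field
      gcd s t x′ y′ : ℤ
      gcd≡ : gcd ≡ s ℤ.* x ℤ.+ t ℤ.* y
      x≡   : x ≡ gcd ℤ.* x′
      y≡   : y ≡ gcd ℤ.* y′
      unit : s ℤ.* x′ ℤ.+ t ℤ.* y′ ≡ 1ℤ

  private
    bézoutℕ : ∀ x y → Acc ℕ._<_ y → Bézout x (ℤ.+ y)
    bézoutℕ x zero _ = record
      { gcd = x ; s = 1ℤ ; t = 0ℤ ; x′ = 1ℤ ; y′ = 0ℤ
      ; gcd≡ = lemma x ; x≡ = sym (ℤ.*-identityʳ x) ; y≡ = sym (ℤ.*-zeroʳ x) ; unit = refl }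
      where
      lemma : ∀ x → x ≡ 1ℤ ℤ.* x ℤ.+ 0ℤ ℤ.* 0ℤ
      lemma = ℤSolver.solve-∀
    bézoutℕ x y@(suc _) (acc rec) = from (bézoutℕ (ℤ.+ y) (x %ℕ y) (rec (n%ℕd<d x y)))
      where
      q : ℤ
      q = x /ℕ y
      from : Bézout (ℤ.+ y) (ℤ.+ (x %ℕ y)) → Bézout x (ℤ.+ y)
      from record { gcd = g ; s = s ; t = t ; x′ = y′ ; y′ = r′ ; gcd≡ = gcd≡ ; x≡ = y≡ ; y≡ = r≡ ; unit = unit } = record
        { gcd = g ; s = t ; t = s ℤ.- t ℤ.* q ; x′ = q ℤ.* y′ ℤ.+ r′ ; y′ = y′
        ; gcd≡ = trans gcd≡ (trans (lemma₁ s t (ℤ.+ y) q (ℤ.+ (x %ℕ y))) (cong (λ x → t ℤ.* x ℤ.+ (s ℤ.- t ℤ.* q) ℤ.* ℤ.+ y) (sym x≡)))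
        ; x≡   = trans x≡ (trans (cong₂ (λ r y → r ℤ.+ q ℤ.* y) r≡ y≡) (lemma₂ g r′ q y′))
        ; y≡   = y≡
        ; unit = trans (lemma₃ s t q y′ r′) unit
        }
        where
        x≡ : x ≡ ℤ.+ (x %ℕ y) ℤ.+ q ℤ.* ℤ.+ y
        x≡ = a≡a%ℕn+[a/ℕn]*n x y
        lemma₁ : ∀ s t y q r → s ℤ.* y ℤ.+ t ℤ.* r ≡ t ℤ.* (r ℤ.+ q ℤ.* y) ℤ.+ (s ℤ.- t ℤ.* q) ℤ.* y
        lemma₁ = ℤSolver.solve-∀
        lemma₂ : ∀ g r q y → g ℤ.* r ℤ.+ q ℤ.* (g ℤ.* y) ≡ g ℤ.* (q ℤ.* y ℤ.+ r)
        lemma₂ = ℤSolver.solve-∀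
        lemma₃ : ∀ s t q y r → t ℤ.* (q ℤ.* y ℤ.+ r) ℤ.+ (s ℤ.- t ℤ.* q) ℤ.* y ≡ s ℤ.* y ℤ.+ t ℤ.* r
        lemma₃ = ℤSolver.solve-∀

  bézout : ∀ x y → Bézout x y
  bézout x (ℤ.+ y)      = bézoutℕ x y (<-wellFounded y)
  bézout x y@(-[1+ k ]) = negate (bézoutℕ x (suc k) (<-wellFounded (suc k)))
    where
    negate : Bézout x (ℤ.+ suc k) → Bézout x y
    negate record { gcd = g ; s = s ; t = t ; x′ = x′ ; y′ = y′ ; gcd≡ = gcd≡ ; x≡ = x≡ ; y≡ = y≡ ; unit = unit } = record
      { gcd = g ; s = s ; t = ℤ.- t ; x′ = x′ ; y′ = ℤ.- y′
      ; gcd≡ = trans gcd≡ (cong (λ z → s ℤ.* x ℤ.+ z) (lemma t (ℤ.+ suc k)))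
      ; x≡   = x≡
      ; y≡   = trans (cong ℤ.-_ y≡) (ℤ.neg-distribʳ-* g y′)
      ; unit = trans (cong (λ z → s ℤ.* x′ ℤ.+ z) (sym (lemma t y′))) unit
      }
      where
      lemma : ∀ t y → t ℤ.* y ≡ ℤ.- t ℤ.* ℤ.- y
      lemma = ℤSolver.solve-∀

  -- The lattice with basis (A, 0), (B, C), a Hermite normal form. The entries may vanish, so
  -- degenerate lattices are included.
  Triangular : ℤ → ℤ → ℤ → ℤ → ℤ → Set
  Triangular A B C X Y = ∃[ m ] ∃[ k ] X ≡ m ℤ.* A ℤ.+ k ℤ.* B × Y ≡ k ℤ.* C

  Adjoin : ℤ → ℤ → (ℤ → ℤ → Set) → ℤ → ℤ → Set
  Adjoin u v T X Y = ∃[ r ] ∃[ X′ ] ∃[ Y′ ] T X′ Y′ × X ≡ r ℤ.* u ℤ.+ X′ × Y ≡ r ℤ.* v ℤ.+ Y′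

  IsTriangular : (ℤ → ℤ → Set) → Set
  IsTriangular T = ∃[ A ] ∃[ B ] ∃[ C ] ∀ X Y → T X Y ⇔ Triangular A B C X Y

  -- One step of Hermite reduction. With C = g c and v = g w, a unimodular change turns the rows (B,
  -- C) and (u, v) into (sB + tu, g) and (wB - cu, 0); a second gcd merges the latter with (A, 0).
  adjoin : ∀ A B C u v → IsTriangular (Adjoin u v (Triangular A B C))
  adjoin A B C u v = from (bézout C v)
    where
    from : Bézout C v → IsTriangular (Adjoin u v (Triangular A B C))
    from record { gcd = g ; s = s ; t = t ; x′ = c ; y′ = w ; gcd≡ = g≡ ; x≡ = C≡ ; y≡ = v≡ ; unit = unit } = from′ (bézout A (w ℤ.* B ℤ.- c ℤ.* u))
      where
      B′ : ℤ
      B′ = s ℤ.* B ℤ.+ t ℤ.* u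
      from′ : Bézout A (w ℤ.* B ℤ.- c ℤ.* u) → IsTriangular (Adjoin u v (Triangular A B C))
      from′ record { gcd = h ; s = p ; t = q ; x′ = a ; y′ = f ; gcd≡ = h≡ ; x≡ = A≡ ; y≡ = e≡ } = h , B′ , g , λ X Y → mk⇔ to′ from″
        where
        open ≡-Reasoning
        lemma₁ : ∀ s t c w r k m u B A → r ℤ.* u ℤ.+ (m ℤ.* A ℤ.+ k ℤ.* B) ℤ.+ (s ℤ.* c ℤ.+ t ℤ.* w ℤ.- 1ℤ) ℤ.* (k ℤ.* B ℤ.+ r ℤ.* u)
          ≡ (m ℤ.* A ℤ.+ (k ℤ.* t ℤ.- r ℤ.* s) ℤ.* (w ℤ.* B ℤ.- c ℤ.* u)) ℤ.+ (k ℤ.* c ℤ.+ r ℤ.* w) ℤ.* (s ℤ.* B ℤ.+ t ℤ.* u)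
        lemma₁ = ℤSolver.solve-∀
        lemma₂ : ∀ m h a x f → m ℤ.* (h ℤ.* a) ℤ.+ x ℤ.* (h ℤ.* f) ≡ (m ℤ.* a ℤ.+ x ℤ.* f) ℤ.* h
        lemma₂ = ℤSolver.solve-∀
        lemma₃ : ∀ r w k c g → r ℤ.* (g ℤ.* w) ℤ.+ k ℤ.* (g ℤ.* c) ≡ (k ℤ.* c ℤ.+ r ℤ.* w) ℤ.* g
        lemma₃ = ℤSolver.solve-∀
        lemma₄ : ∀ x y → x ≡ x ℤ.+ (1ℤ ℤ.- 1ℤ) ℤ.* y
        lemma₄ = ℤSolver.solve-∀
        lemma₅ : ∀ m k p q A w B c u s t → m ℤ.* (p ℤ.* A ℤ.+ q ℤ.* (w ℤ.* B ℤ.- c ℤ.* u)) ℤ.+ k ℤ.* (s ℤ.* B ℤ.+ t ℤ.* u)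
          ≡ (k ℤ.* t ℤ.- m ℤ.* q ℤ.* c) ℤ.* u ℤ.+ (m ℤ.* p ℤ.* A ℤ.+ (m ℤ.* q ℤ.* w ℤ.+ k ℤ.* s) ℤ.* B)
        lemma₅ = ℤSolver.solve-∀
        lemma₆ : ∀ k s t g c w m q → k ℤ.* (s ℤ.* (g ℤ.* c) ℤ.+ t ℤ.* (g ℤ.* w))
          ≡ (k ℤ.* t ℤ.- m ℤ.* q ℤ.* c) ℤ.* (g ℤ.* w) ℤ.+ (m ℤ.* q ℤ.* w ℤ.+ k ℤ.* s) ℤ.* (g ℤ.* c)
        lemma₆ = ℤSolver.solve-∀
        to′ : ∀ {X Y} → Adjoin u v (Triangular A B C) X Y → Triangular h B′ g X Y
        to′ {X} {Y} (r , X′ , Y′ , (m , k , X′≡ , Y′≡) , X≡ , Y≡) = m ℤ.* a ℤ.+ (k ℤ.* t ℤ.- r ℤ.* s) ℤ.* f , k ℤ.* c ℤ.+ r ℤ.* w , (begin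
          X                                              ≡⟨ trans X≡ (cong (λ z → r ℤ.* u ℤ.+ z) X′≡) ⟩
          r ℤ.* u ℤ.+ (m ℤ.* A ℤ.+ k ℤ.* B)              ≡⟨ lemma₄ _ (k ℤ.* B ℤ.+ r ℤ.* u) ⟩
          r ℤ.* u ℤ.+ (m ℤ.* A ℤ.+ k ℤ.* B) ℤ.+ (1ℤ ℤ.- 1ℤ) ℤ.* (k ℤ.* B ℤ.+ r ℤ.* u)
            ≡⟨ cong (λ z → r ℤ.* u ℤ.+ (m ℤ.* A ℤ.+ k ℤ.* B) ℤ.+ (z ℤ.- 1ℤ) ℤ.* (k ℤ.* B ℤ.+ r ℤ.* u)) unit ⟨
          r ℤ.* u ℤ.+ (m ℤ.* A ℤ.+ k ℤ.* B) ℤ.+ (s ℤ.* c ℤ.+ t ℤ.* w ℤ.- 1ℤ) ℤ.* (k ℤ.* B ℤ.+ r ℤ.* u)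
            ≡⟨ lemma₁ s t c w r k m u B A ⟩
          (m ℤ.* A ℤ.+ (k ℤ.* t ℤ.- r ℤ.* s) ℤ.* (w ℤ.* B ℤ.- c ℤ.* u)) ℤ.+ (k ℤ.* c ℤ.+ r ℤ.* w) ℤ.* B′
            ≡⟨ cong (ℤ._+ (k ℤ.* c ℤ.+ r ℤ.* w) ℤ.* B′) (trans (cong₂ (λ x y → m ℤ.* x ℤ.+ (k ℤ.* t ℤ.- r ℤ.* s) ℤ.* y) A≡ e≡) (lemma₂ m h a (k ℤ.* t ℤ.- r ℤ.* s) f)) ⟩
          (m ℤ.* a ℤ.+ (k ℤ.* t ℤ.- r ℤ.* s) ℤ.* f) ℤ.* h ℤ.+ (k ℤ.* c ℤ.+ r ℤ.* w) ℤ.* B′ ∎)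
          , trans Y≡ (trans (cong (λ z → r ℤ.* v ℤ.+ z) Y′≡) (trans (cong₂ (λ x y → r ℤ.* x ℤ.+ k ℤ.* y) v≡ C≡) (lemma₃ r w k c g)))
        from″ : ∀ {X Y} → Triangular h B′ g X Y → Adjoin u v (Triangular A B C) X Y
        from″ {X} {Y} (m , k , X≡ , Y≡) = r , _ , _ , (m ℤ.* p , m ℤ.* q ℤ.* w ℤ.+ k ℤ.* s , refl , refl) ,
          trans X≡ (trans (cong (λ z → m ℤ.* z ℤ.+ k ℤ.* B′) h≡) (lemma₅ m k p q A w B c u s t)) ,
          trans Y≡ (trans (cong (k ℤ.*_) (trans g≡ (cong₂ (λ x y → s ℤ.* x ℤ.+ t ℤ.* y) C≡ v≡)))
            (trans (lemma₆ k s t g c w m q) (cong₂ (λ x y → r ℤ.* x ℤ.+ (m ℤ.* q ℤ.* w ℤ.+ k ℤ.* s) ℤ.* y) (sym v≡) (sym C≡))))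
          where
          r : ℤ
          r = k ℤ.* t ℤ.- m ℤ.* q ℤ.* c

  adjoin-triangular : ∀ {T} u v → IsTriangular T → IsTriangular (Adjoin u v T)
  adjoin-triangular {T} u v (A , B , C , T⇔) = compose (adjoin A B C u v)
    where
    open Equivalence
    compose : IsTriangular (Adjoin u v (Triangular A B C)) → IsTriangular (Adjoin u v T)
    compose (A′ , B′ , C′ , eq) = A′ , B′ , C′ , λ X Y → mk⇔
      (λ (r , X′ , Y′ , t , e) → to (eq X Y) (r , X′ , Y′ , to (T⇔ X′ Y′) t , e))
      (λ t → map₂ (from (eq X Y) t))
      where
      map₂ : ∀ {X Y} → Adjoin u v (Triangular A B C) X Y → Adjoin u v T X Y
      map₂ (r , X′ , Y′ , t , e) = r , X′ , Y′ , from (T⇔ X′ Y′) t , e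

  module Homothety (d : ℤ) where
    open Quadratic d
    open Equivalence

    Unit : K → Set
    Unit α = ∃[ α⁻¹ ] α * α⁻¹ ≡ 1#

    infix 4 _≃_
    -- The relation `_∼_` for arbitrary subsets, so that spans can be compared with lattices given
    -- by coordinates. For membership in ideals both unfold to the same type.
    _≃_ : (K → Set) → (K → Set) → Set
    P ≃ Q = ∃[ α ] Unit α × (∀ x → P x ⇔ Q (α * x))

    cancel : ∀ α β → α * β ≡ 1# → ∀ x → α * (β * x) ≡ x
    cancel α β αβ≡1 x = trans (sym (*-assoc α β x)) (trans (cong (_* x) αβ≡1) (*-identityˡ x))

    ≃-equal : ∀ (P Q : K → Set) → (∀ x → P x ⇔ Q x) → P ≃ Q
    ≃-equal P Q P⇔Q = 1# , (1# , *-identityˡ 1#) , λ x → mk⇔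
      (λ p → subst Q (sym (*-identityˡ x)) (to (P⇔Q x) p))
      (λ q → from (P⇔Q x) (subst Q (*-identityˡ x) q))

    ≃-sym : ∀ (P Q : K → Set) → P ≃ Q → Q ≃ P
    ≃-sym P Q (α , (β , αβ≡1) , P⇔Q) = β , (α , trans (*-comm β α) αβ≡1) , λ y → mk⇔
      (λ q → from (P⇔Q (β * y)) (subst Q (sym (cancel α β αβ≡1 y)) q))
      (λ p → subst Q (cancel α β αβ≡1 y) (to (P⇔Q (β * y)) p))

    ≃-trans : ∀ (P Q R : K → Set) → P ≃ Q → Q ≃ R → P ≃ R
    ≃-trans P Q R (α , (β , αβ≡1) , P⇔Q) (γ , (δ , γδ≡1) , Q⇔R) = γ * α , (β * δ , eq) , λ x → mk⇔
      (λ p → subst R (sym (*-assoc γ α x)) (to (Q⇔R (α * x)) (to (P⇔Q x) p)))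
      (λ r → from (P⇔Q x) (from (Q⇔R (α * x)) (subst R (*-assoc γ α x) r)))
      where
      eq : γ * α * (β * δ) ≡ 1#
      eq = trans (*-assoc γ α (β * δ)) (trans (cong (γ *_) (cancel α β αβ≡1 δ)) γδ≡1)

    ⟦⟧-unit : ∀ {c} → c ≢ 0ℤ → Unit ⟦ c ⟧
    ⟦⟧-unit {c} c≢0 = fromℚ (ℚ.1/ p) , cong₂ _+√_
      (trans (S.solve 3 (λ d p q → p S.:* q S.:+ d S.:* (S.con ℚ.0ℚ S.:* S.con ℚ.0ℚ) S.:= p S.:* q) refl (d / 1) p (ℚ.1/ p)) (ℚ.*-inverseʳ p))
      (S.solve 2 (λ p q → p S.:* S.con ℚ.0ℚ S.:+ S.con ℚ.0ℚ S.:* q S.:= S.con ℚ.0ℚ) refl p (ℚ.1/ p))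
      where
      module S = ℚSolver.+-*-Solver
      p : ℚ.ℚ
      p = c / 1
      instance
        p≠0 : ℚ.NonZero p
        p≠0 = ℚ.≢-nonZero (λ p≡0 → c≢0 (/1-injective p≡0))

    unit-* : ∀ α β → Unit α → Unit β → Unit (α * β)
    unit-* α β (α′ , αα′) (β′ , ββ′) = α′ * β′ , trans
      (solve 4 (λ a b a′ b′ → a :* b :* (a′ :* b′) := (a :* a′) :* (b :* b′)) refl α β α′ β′)
      (trans (cong₂ _*_ αα′ ββ′) (*-identityˡ 1#))

    unit-cancel : ∀ α {x y} → Unit α → α * x ≡ α * y → x ≡ y
    unit-cancel α {x} {y} (β , αβ≡1) eq = trans (sym (cancel β α βα≡1 x)) (trans (cong (β *_) eq) (cancel β α βα≡1 y))
      where
      βα≡1 : β * α ≡ 1#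
      βα≡1 = trans (*-comm β α) αβ≡1

  module Ideals (d : ℤ) (sf : Squarefree d) (d≢1 : d ≢ 1ℤ) (e : ℤ) (d≡2e : d ≡ ℤ.+ 2 ℤ.* e) where
    open Quadratic d
    open IntegralElements d
    open Bounded sf d≢1
    open EvenRadicand e d≡2e
    open Homothety d
    open Equivalence

    span-zero : ∀ gs → Span F gs 0#
    span-zero []       = refl
    span-zero (g ∷ gs) = 0# , 0# , integer⇒integral 0ℤ 0ℤ , span-zero gs , sym (trans (+-identityʳ (0# * g)) (zeroˡ g))

    span-+ : ∀ gs {x y} → Span F gs x → Span F gs y → Span F gs (x + y)
    span-+ [] refl refl = +-identityˡ 0#
    span-+ (g ∷ gs) {x} {y} (r , x′ , ri , x′∈ , x≡) (s , y′ , si , y′∈ , y≡) =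
      r + s , x′ + y′ , sum (integral⇒integer {r} ri) (integral⇒integer {s} si) , span-+ gs x′∈ y′∈ ,
      trans (cong₂ _+_ x≡ y≡) (solve 5 (λ r s g x y → r :* g :+ x :+ (s :* g :+ y) := (r :+ s) :* g :+ (x :+ y)) refl r s g x′ y′)
      where
      sum : ∀ {r s} → IsInt r → IsInt s → Integral F (r + s)
      sum r-int s-int with IsInt-+ r-int s-int
      ... | u , v , eq = subst (Integral F) (sym eq) (integer⇒integral u v)

    span-* : ∀ gs u v {x} → Span F gs x → Span F gs (int u v * x)
    span-* [] u v refl = zeroʳ (int u v)
    span-* (g ∷ gs) u v {x} (r , x′ , ri , x′∈ , x≡) =
      int u v * r , int u v * x′ , prod (integral⇒integer {r} ri) , span-* gs u v x′∈ ,
      trans (cong (int u v *_) x≡) (solve 4 (λ z r g x → z :* (r :* g :+ x) := z :* r :* g :+ z :* x) refl (int u v) r g x′)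
      where
      prod : ∀ {r} → IsInt r → Integral F (int u v * r)
      prod r-int with IsInt-* (u , v , refl) r-int
      ... | u′ , v′ , eq = subst (Integral F) (sym eq) (integer⇒integral u′ v′)

    span-there : ∀ g gs {x} → Span F gs x → Span F (g ∷ gs) x
    span-there g gs {x} x∈ = 0# , x , integer⇒integral 0ℤ 0ℤ , x∈ , sym (trans (cong (_+ x) (zeroˡ g)) (+-identityˡ x))

    span-here : ∀ g gs → Span F (g ∷ gs) g
    span-here g gs = 1# , 0# , integer⇒integral 1ℤ 0ℤ , span-zero gs , sym (trans (+-identityʳ (1# * g)) (*-identityˡ g))

    span-nonzero : ∀ {gs} → Any (_≢ 0#) gs → ∃[ x ] x ≢ 0# × Span F gs x
    span-nonzero {g ∷ gs} (here g≢0) = g , g≢0 , span-here g gs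
    span-nonzero {g ∷ gs} (there any) with span-nonzero any
    ... | x , x≢0 , x∈ = x , x≢0 , span-there g gs x∈

    span-scale : ∀ c gs {x} → Span F gs x → Span F (map (c *_) gs) (c * x)
    span-scale c [] refl = zeroʳ c
    span-scale c (g ∷ gs) (r , y , ri , y∈ , x≡) = r , c * y , ri , span-scale c gs y∈ ,
      trans (cong (c *_) x≡) (solve 4 (λ c r g y → c :* (r :* g :+ y) := r :* (c :* g) :+ c :* y) refl c r g y)

    span-unscale : ∀ c gs {z} → Span F (map (c *_) gs) z → ∃[ x ] z ≡ c * x × Span F gs x
    span-unscale c [] refl = 0# , sym (zeroʳ c) , refl
    span-unscale c (g ∷ gs) (r , y , ri , y∈ , z≡) with span-unscale c gs y∈
    ... | x , y≡cx , x∈ = r * g + x , trans z≡ (trans (cong (r * (c * g) +_) y≡cx)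
      (solve 4 (λ c r g x → r :* (c :* g) :+ c :* x := c :* (r :* g :+ x)) refl c r g x)) , (r , x , ri , x∈ , refl)

    span-homothety : ∀ c → Unit c → ∀ gs → Span F gs ≃ Span F (map (c *_) gs)
    span-homothety c c-unit gs = c , c-unit , λ x → mk⇔ (span-scale c gs) λ cx∈ → back (span-unscale c gs cx∈)
      where
      back : ∀ {x} → ∃[ y ] c * x ≡ c * y × Span F gs y → Span F gs x
      back (y , cx≡cy , y∈) = subst (Span F gs) (sym (unit-cancel c c-unit cx≡cy)) y∈

    pair : ℤ × ℤ → K
    pair (u , v) = int u v

    clear-denominators : ∀ gs → ∃[ w ] w ≢ 0ℤ × ∃[ zs ] map (⟦ w ⟧ *_) gs ≡ map pair zs
    clear-denominators [] = 1ℤ , (λ ()) , [] , refl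
    clear-denominators (g ∷ gs) = combine (common-denominator g) (clear-denominators gs)
      where
      combine : ∃[ V ] V ≢ 0ℤ × IsInt (⟦ V ⟧ * g) → ∃[ w ] w ≢ 0ℤ × ∃[ zs ] map (⟦ w ⟧ *_) gs ≡ map pair zs →
        ∃[ w ] w ≢ 0ℤ × ∃[ zs ] map (⟦ w ⟧ *_) (g ∷ gs) ≡ map pair zs
      combine (V , V≢0 , u , v , Vg≡) (w , w≢0 , zs , eq) = w ℤ.* V , ℤ-integral w≢0 V≢0 , (w ℤ.* u , w ℤ.* v) ∷ map times zs ,
        cong₂ _∷_ (trans (scale w V g) (trans (cong (⟦ w ⟧ *_) Vg≡) (⟦⟧*int w u v))) (rest gs zs eq)
        where
        times : ℤ × ℤ → ℤ × ℤ
        times (u , v) = V ℤ.* u , V ℤ.* v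
        scale : ∀ w V g → ⟦ w ℤ.* V ⟧ * g ≡ ⟦ w ⟧ * (⟦ V ⟧ * g)
        scale w V g = trans (cong (_* g) (⟦⟧-* w V)) (*-assoc ⟦ w ⟧ ⟦ V ⟧ g)
        rest : ∀ gs zs → map (⟦ w ⟧ *_) gs ≡ map pair zs → map (⟦ w ℤ.* V ⟧ *_) gs ≡ map pair (map times zs)
        rest []       []       _  = refl
        rest (g ∷ gs) (z ∷ zs) eq = cong₂ _∷_
          (trans (cong (λ m → ⟦ m ⟧ * g) (ℤ.*-comm w V)) (trans (scale V w g) (trans (cong (⟦ V ⟧ *_) (∷-injectiveˡ eq)) (⟦⟧*int V (proj₁ z) (proj₂ z)))))
          (rest gs zs (∷-injectiveʳ eq))
          where open import Data.List.Properties using (∷-injectiveˡ; ∷-injectiveʳ)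

    Coordinates : (ℤ → ℤ → Set) → K → Set
    Coordinates T x = ∃[ X ] ∃[ Y ] x ≡ int X Y × T X Y

    coordinates-cong : ∀ {T U} → (∀ X Y → T X Y ⇔ U X Y) → ∀ x → Coordinates T x ⇔ Coordinates U x
    coordinates-cong T⇔U x = mk⇔ (λ (X , Y , eq , t) → X , Y , eq , to (T⇔U X Y) t) (λ (X , Y , eq , u) → X , Y , eq , from (T⇔U X Y) u)

    -- Coefficients in the ring of integers are coefficients in ℤ[√d], so a generator u + v√d
    -- contributes two generators over ℤ: itself and its multiple dv + u√d by √d.
    span-triangular : ∀ zs → ∃[ T ] IsTriangular T × (∀ x → Span F (map pair zs) x ⇔ Coordinates T x)
    span-triangular [] = (λ X Y → X ≡ 0ℤ × Y ≡ 0ℤ)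
      , (0ℤ , 0ℤ , 0ℤ , λ X Y → mk⇔ (λ (X≡0 , Y≡0) → 0ℤ , 0ℤ , X≡0 , Y≡0)
          (λ (m , k , X≡ , Y≡) → trans X≡ (cong₂ ℤ._+_ (ℤ.*-zeroʳ m) (ℤ.*-zeroʳ k)) , trans Y≡ (ℤ.*-zeroʳ k)))
      , λ x → mk⇔ (λ x≡0 → 0ℤ , 0ℤ , x≡0 , refl , refl) (λ (X , Y , x≡ , X≡0 , Y≡0) → trans x≡ (cong₂ int X≡0 Y≡0))
    span-triangular ((u , v) ∷ zs) = extend (span-triangular zs)
      where
      gs : List K
      gs = map pair zs
      extend : ∃[ T ] IsTriangular T × (∀ x → Span F gs x ⇔ Coordinates T x) →
        ∃[ T ] IsTriangular T × (∀ x → Span F (int u v ∷ gs) x ⇔ Coordinates T x)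
      extend (T , triangular , T⇔) = Adjoin u v (Adjoin (d ℤ.* v) u T) , adjoin-triangular u v (adjoin-triangular (d ℤ.* v) u triangular) , λ x → mk⇔ to′ from′
        where
        expand : ∀ r s X Y → int r s * int u v + int X Y ≡ int (r ℤ.* u ℤ.+ (s ℤ.* (d ℤ.* v) ℤ.+ X)) (r ℤ.* v ℤ.+ (s ℤ.* u ℤ.+ Y))
        expand r s X Y = trans (cong (_+ int X Y) (sym (int-* r s u v))) (trans (sym (int-+ (r ℤ.* u ℤ.+ d ℤ.* (s ℤ.* v)) (r ℤ.* v ℤ.+ s ℤ.* u) X Y))
          (cong₂ int (lemma₁ d r s u v X) (lemma₂ r s u v Y)))
          where
          lemma₁ : ∀ d r s u v X → r ℤ.* u ℤ.+ d ℤ.* (s ℤ.* v) ℤ.+ X ≡ r ℤ.* u ℤ.+ (s ℤ.* (d ℤ.* v) ℤ.+ X)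
          lemma₁ = ℤSolver.solve-∀
          lemma₂ : ∀ r s u v Y → r ℤ.* v ℤ.+ s ℤ.* u ℤ.+ Y ≡ r ℤ.* v ℤ.+ (s ℤ.* u ℤ.+ Y)
          lemma₂ = ℤSolver.solve-∀
        to′ : ∀ {x} → Span F (int u v ∷ gs) x → Coordinates (Adjoin u v (Adjoin (d ℤ.* v) u T)) x
        to′ {x} (r , y , ri , y∈ , x≡) = combine (integral⇒integer {r} ri) (to (T⇔ y) y∈)
          where
          combine : IsInt r → Coordinates T y → Coordinates (Adjoin u v (Adjoin (d ℤ.* v) u T)) x
          combine (r₁ , r₂ , r≡) (X , Y , y≡ , t) = _ , _ , trans x≡ (trans (cong₂ (λ r y → r * int u v + y) r≡ y≡) (expand r₁ r₂ X Y)) ,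
            (r₁ , _ , _ , (r₂ , X , Y , t , refl , refl) , refl , refl)
        from′ : ∀ {x} → Coordinates (Adjoin u v (Adjoin (d ℤ.* v) u T)) x → Span F (int u v ∷ gs) x
        from′ (X , Y , x≡ , r₁ , X₁ , Y₁ , (r₂ , X₂ , Y₂ , t , X₁≡ , Y₁≡) , X≡ , Y≡) =
          int r₁ r₂ , int X₂ Y₂ , integer⇒integral r₁ r₂ , from (T⇔ (int X₂ Y₂)) (X₂ , Y₂ , refl , t) ,
          trans x≡ (trans (cong₂ int (trans X≡ (cong (λ z → r₁ ℤ.* u ℤ.+ z) X₁≡)) (trans Y≡ (cong (λ z → r₁ ℤ.* v ℤ.+ z) Y₁≡))) (sym (expand r₁ r₂ X₂ Y₂)))

    -- The lattice ℤa + ℤ(b + √d). It is stable under √d exactly when a divides b² - d, which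
    -- explains the c in `NormalForm`: (a, 2b, c) is the associated quadratic form.
    L : ℤ → ℤ → K → Set
    L a b = Coordinates (Triangular a b 1ℤ)

    private
      triangular-coordinates : ∀ {gs A B C} → (∀ x → Span F gs x ⇔ Coordinates (Triangular A B C) x) →
        ∀ {X Y} → Triangular A B C X Y → Triangular A B C (d ℤ.* Y) X
      triangular-coordinates {gs} {A} {B} {C} eq {X} {Y} t = extract (to (eq (int (d ℤ.* Y) X))
        (subst (Span F gs) √d*int (span-* gs 0ℤ 1ℤ (from (eq (int X Y)) (X , Y , refl , t)))))
        where
        extract : Coordinates (Triangular A B C) (int (d ℤ.* Y) X) → Triangular A B C (d ℤ.* Y) X
        extract (X′ , Y′ , e , t) = subst₂ (Triangular A B C) (sym (proj₁ inj)) (sym (proj₂ inj)) t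
          where
          inj : d ℤ.* Y ≡ X′ × X ≡ Y′
          inj = int-injective {d ℤ.* Y} {X} {X′} {Y′} e
        √d*int : int 0ℤ 1ℤ * int X Y ≡ int (d ℤ.* Y) X
        √d*int = trans (sym (int-* 0ℤ 1ℤ X Y)) (cong₂ int (lemma₁ d X Y) (lemma₂ X Y))
          where
          lemma₁ : ∀ d X Y → 0ℤ ℤ.* X ℤ.+ d ℤ.* (1ℤ ℤ.* Y) ≡ d ℤ.* Y
          lemma₁ = ℤSolver.solve-∀
          lemma₂ : ∀ X Y → 0ℤ ℤ.* Y ℤ.+ 1ℤ ℤ.* X ≡ X
          lemma₂ = ℤSolver.solve-∀

    d-not-square : ∀ b → d ≢ b ℤ.* b
    d-not-square b d≡bb = d≢1 (trans d≡bb (trans (square≡∣∣² b) (cong (λ k → ℤ.+ (k ℕ.* k)) ∣b∣≡1)))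
      where
      open import Data.Nat.Divisibility using (∣1⇒≡1; ∣-reflexive)
      ∣b∣≡1 : ℤ.∣ b ∣ ≡ 1
      ∣b∣≡1 = ∣1⇒≡1 (sf b (∣-reflexive (cong ℤ.∣_∣ (sym d≡bb))))

    NormalForm : (K → Set) → Set
    NormalForm P = ∃[ a ] ∃[ b ] ∃[ c ] 0 ℕ.< a × ℤ.+ a ℤ.* c ≡ b ℤ.* b ℤ.- d × P ≃ L (ℤ.+ a) b

    private
      make-positive : ∀ {P} a b c → a ℤ.* c ≡ b ℤ.* b ℤ.- d → P ≃ L a b → NormalForm P
      make-positive (ℤ.+ zero)  b c eq _ = contradiction (trans (lemma b d) (trans (cong (λ z → b ℤ.* b ℤ.- z) (sym eq)) (ℤ.+-identityʳ (b ℤ.* b)))) (d-not-square b)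
        where
        lemma : ∀ b d → d ≡ b ℤ.* b ℤ.- (b ℤ.* b ℤ.- d)
        lemma = ℤSolver.solve-∀
      make-positive (ℤ.+ suc k) b c eq P≃L = suc k , b , c , ℕ.z<s , eq , P≃L
      make-positive {P} (-[1+ k ]) b c eq P≃L = suc k , b , ℤ.- c , ℕ.z<s , trans (lemma₁ (ℤ.+ suc k) c) eq ,
        ≃-trans P (L -[1+ k ] b) (L (ℤ.+ suc k) b) P≃L (≃-equal (L -[1+ k ] b) (L (ℤ.+ suc k) b) (coordinates-cong {Triangular -[1+ k ] b 1ℤ} {Triangular (ℤ.+ suc k) b 1ℤ} (λ X Y → mk⇔
          (λ (m , l , X≡ , Y≡) → ℤ.- m , l , trans X≡ (cong (λ z → z ℤ.+ l ℤ.* b) (lemma₂ m (ℤ.+ suc k))) , Y≡)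
          (λ (m , l , X≡ , Y≡) → ℤ.- m , l , trans X≡ (cong (λ z → z ℤ.+ l ℤ.* b) (lemma₃ m (ℤ.+ suc k))) , Y≡))))
        where
        lemma₁ : ∀ k c → k ℤ.* ℤ.- c ≡ ℤ.- k ℤ.* c
        lemma₁ = ℤSolver.solve-∀
        lemma₂ : ∀ m k → m ℤ.* ℤ.- k ≡ ℤ.- m ℤ.* k
        lemma₂ = ℤSolver.solve-∀
        lemma₃ : ∀ m k → m ℤ.* k ≡ ℤ.- m ℤ.* ℤ.- k
        lemma₃ = ℤSolver.solve-∀

      -- Multiplication by √d sends (A, 0) and (B, C) to (0, A) and (dC, B). Hence C divides A and
      -- B, the ideal is C times some `L a b`, and the coordinate dC shows a ∣ b² - d. If C were 0,
      -- every element and its multiple by √d would be rational, hence 0.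
      from-triangular : ∀ {gs} A B C → (∀ x → Span F gs x ⇔ Coordinates (Triangular A B C) x) →
        ∃[ x ] x ≢ 0# × Span F gs x → NormalForm (Span F gs)
      from-triangular {gs} A B C eq (x , x≢0 , x∈) = go (C ℤ.≟ 0ℤ)
        where
        √d-closed : ∀ {X Y} → Triangular A B C X Y → Triangular A B C (d ℤ.* Y) X
        √d-closed = triangular-coordinates {gs} eq
        go : Dec (C ≡ 0ℤ) → NormalForm (Span F gs)
        go (yes refl) = contradiction (all-zero (to (eq x) x∈)) x≢0
          where
          all-zero : Coordinates (Triangular A B 0ℤ) x → x ≡ 0#
          all-zero (X , Y , x≡ , t@(_ , k , _ , Y≡)) = trans x≡ (cong₂ int (second (√d-closed t)) (trans Y≡ (ℤ.*-zeroʳ k)))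
            where
            second : ∀ {X Y} → Triangular A B 0ℤ X Y → Y ≡ 0ℤ
            second (_ , k , _ , Y≡) = trans Y≡ (ℤ.*-zeroʳ k)
        go (no C≢0) = divide (√d-closed (1ℤ , 0ℤ , lemma₁ A B , refl)) (√d-closed (0ℤ , 1ℤ , lemma₂ A B , sym (ℤ.*-identityˡ C)))
          where
          lemma₁ : ∀ A B → A ≡ 1ℤ ℤ.* A ℤ.+ 0ℤ ℤ.* B
          lemma₁ = ℤSolver.solve-∀
          lemma₂ : ∀ A B → B ≡ 0ℤ ℤ.* A ℤ.+ 1ℤ ℤ.* B
          lemma₂ = ℤSolver.solve-∀
          divide : Triangular A B C (d ℤ.* 0ℤ) A → Triangular A B C (d ℤ.* C) B → NormalForm (Span F gs)
          divide (_ , a , _ , A≡aC) (m , b , dC≡ , B≡bC) = make-positive a b (ℤ.- m) (lemma₄ d≡) (≃-sym (L a b) (Span F gs) (⟦ C ⟧ , ⟦⟧-unit C≢0 , scale))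
            where
            lemma₃ : ∀ m a b C → m ℤ.* (a ℤ.* C) ℤ.+ b ℤ.* (b ℤ.* C) ≡ (m ℤ.* a ℤ.+ b ℤ.* b) ℤ.* C
            lemma₃ = ℤSolver.solve-∀
            d≡ : d ≡ m ℤ.* a ℤ.+ b ℤ.* b
            d≡ = ℤ.*-cancelʳ-≡ d (m ℤ.* a ℤ.+ b ℤ.* b) C {{ℤ.≢-nonZero C≢0}} (trans dC≡ (trans (cong₂ (λ A B → m ℤ.* A ℤ.+ b ℤ.* B) A≡aC B≡bC) (lemma₃ m a b C)))
            lemma₄ : ∀ {d} → d ≡ m ℤ.* a ℤ.+ b ℤ.* b → a ℤ.* ℤ.- m ≡ b ℤ.* b ℤ.- d
            lemma₄ refl = lemma a b m
              where
              lemma : ∀ a b m → a ℤ.* ℤ.- m ≡ b ℤ.* b ℤ.- (m ℤ.* a ℤ.+ b ℤ.* b)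
              lemma = ℤSolver.solve-∀
            lemma₇ : ∀ C m k a b → C ℤ.* (m ℤ.* a ℤ.+ k ℤ.* b) ≡ m ℤ.* (a ℤ.* C) ℤ.+ k ℤ.* (b ℤ.* C)
            lemma₇ = ℤSolver.solve-∀
            lemma₈ : ∀ C k → C ℤ.* (k ℤ.* 1ℤ) ≡ k ℤ.* C
            lemma₈ = ℤSolver.solve-∀
            X≡ : ∀ m k → C ℤ.* (m ℤ.* a ℤ.+ k ℤ.* b) ≡ m ℤ.* A ℤ.+ k ℤ.* B
            X≡ m k = trans (lemma₇ C m k a b) (cong₂ (λ A B → m ℤ.* A ℤ.+ k ℤ.* B) (sym A≡aC) (sym B≡bC))
            scale : ∀ x → L a b x ⇔ Span F gs (⟦ C ⟧ * x)
            scale x = mk⇔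
              (λ (X , Y , x≡ , m , k , X≡′ , Y≡′) → from (eq (⟦ C ⟧ * x)) (C ℤ.* X , C ℤ.* Y , trans (cong (⟦ C ⟧ *_) x≡) (⟦⟧*int C X Y) ,
                m , k , trans (cong (C ℤ.*_) X≡′) (X≡ m k) , trans (cong (C ℤ.*_) Y≡′) (lemma₈ C k)))
              (λ Cx∈ → back (to (eq (⟦ C ⟧ * x)) Cx∈))
              where
              back : Coordinates (Triangular A B C) (⟦ C ⟧ * x) → L a b x
              back (X , Y , Cx≡ , m , k , X≡′ , Y≡′) = m ℤ.* a ℤ.+ k ℤ.* b , k ℤ.* 1ℤ ,
                unit-cancel ⟦ C ⟧ (⟦⟧-unit C≢0) (trans Cx≡ (trans (cong₂ int (trans X≡′ (sym (X≡ m k))) (trans Y≡′ (sym (lemma₈ C k)))) (sym (⟦⟧*int C (m ℤ.* a ℤ.+ k ℤ.* b) (k ℤ.* 1ℤ))))) ,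
                m , k , refl , refl

    normal-form : ∀ gs → Any (_≢ 0#) gs → NormalForm (Span F gs)
    normal-form gs nonzero = from′ (clear-denominators gs)
      where
      from′ : ∃[ w ] w ≢ 0ℤ × ∃[ zs ] map (⟦ w ⟧ *_) gs ≡ map pair zs → NormalForm (Span F gs)
      from′ (w , w≢0 , zs , eq) = from″ (span-triangular zs)
        where
        scaled : Span F gs ≃ Span F (map pair zs)
        scaled = subst (λ hs → Span F gs ≃ Span F hs) eq (span-homothety ⟦ w ⟧ (⟦⟧-unit w≢0) gs)
        nonzero-scaled : ∃[ x ] x ≢ 0# × Span F (map pair zs) x
        nonzero-scaled with span-nonzero nonzero
        ... | x , x≢0 , x∈ = ⟦ w ⟧ * x , (λ wx≡0 → x≢0 (unit-cancel ⟦ w ⟧ (⟦⟧-unit w≢0) (trans wx≡0 (sym (zeroʳ ⟦ w ⟧))))) ,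
          subst (λ hs → Span F hs (⟦ w ⟧ * x)) eq (span-scale ⟦ w ⟧ gs x∈)
        from″ : ∃[ T ] IsTriangular T × (∀ x → Span F (map pair zs) x ⇔ Coordinates T x) → NormalForm (Span F gs)
        from″ (T , (A , B , C , T⇔) , span⇔) = compose (from-triangular A B C
          (λ x → mk⇔ (λ x∈ → to (coordinates-cong T⇔ x) (to (span⇔ x) x∈)) (λ x∈ → from (span⇔ x) (from (coordinates-cong T⇔ x) x∈))) nonzero-scaled)
          where
          compose : NormalForm (Span F (map pair zs)) → NormalForm (Span F gs)
          compose (a , b , c , 0<a , ac≡ , zs≃L) = a , b , c , 0<a , ac≡ , ≃-trans (Span F gs) (Span F (map pair zs)) (L (ℤ.+ a) b) scaled zs≃L

-- Cardinality of a set covered by a list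

module Finiteness where
  open import Data.Fin.Base using (Fin; zero; suc)
  open import Data.List.Base using (List; []; _∷_; length; lookup)
  open import Data.List.Relation.Unary.All as All using (All; []; _∷_)
  open import Data.List.Relation.Unary.Any as Any using (Any; here; there; any?)
  open import Data.List.Relation.Unary.AllPairs using (AllPairs; []; _∷_)
  open import Data.List.Relation.Unary.All.Properties using (¬Any⇒All¬)
  open import Data.Product.Base using (∃-syntax; _×_; _,_; proj₁; proj₂)
  open import Function.Bundles using (Bijection)
  open import Level using (0ℓ)
  open import Relation.Binary.Bundles using (Setoid)
  open import Relation.Binary.Definitions using (Decidable)
  open import Relation.Binary.PropositionalEquality as ≡ using (_≡_; refl; cong)
  open import Relation.Nullary.Decidable using (Dec; yes; no)
  open import Relation.Nullary.Negation using (¬_; contradiction)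

  module _ (S : Setoid 0ℓ 0ℓ) (_≟_ : Decidable (Setoid._≈_ S)) where
    open Setoid S using (Carrier; _≈_; sym; trans)

    private
      Distinct : List Carrier → Set
      Distinct = AllPairs (λ x y → ¬ x ≈ y)

      transversal : ∀ xs → ∃[ ys ] Distinct ys × (∀ {x} → Any (x ≈_) xs → Any (x ≈_) ys)
      transversal [] = [] , [] , λ ()
      transversal (x ∷ xs) = extend (transversal xs)
        where
        extend : ∃[ ys ] Distinct ys × (∀ {x} → Any (x ≈_) xs → Any (x ≈_) ys) →
          ∃[ ys ] Distinct ys × (∀ {y} → Any (y ≈_) (x ∷ xs) → Any (y ≈_) ys)
        extend (ys , distinct , covers) = go (any? (x ≟_) ys)
          where
          go : Dec (Any (x ≈_) ys) → _
          go (yes x∈ys) = ys , distinct , λ { (here y≈x) → Any.map (trans y≈x) x∈ys ; (there y∈xs) → covers y∈xs }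
          go (no x∉ys)  = x ∷ ys , ¬Any⇒All¬ ys x∉ys ∷ distinct , λ { (here y≈x) → here y≈x ; (there y∈xs) → there (covers y∈xs) }

      lookup-injective : ∀ {ys} → Distinct ys → ∀ i j → lookup ys i ≈ lookup ys j → i ≡ j
      lookup-injective (_ ∷ _)  zero    zero    _  = refl
      lookup-injective (y≉ ∷ _) zero    (suc j) eq = contradiction eq (all-lookup y≉ j)
        where
        all-lookup : ∀ {P : Carrier → Set} {ys} → All P ys → ∀ j → P (lookup ys j)
        all-lookup (p ∷ _)  zero    = p
        all-lookup (_ ∷ ps) (suc j) = all-lookup ps j
      lookup-injective (y≉ ∷ d) (suc i) zero    eq = ≡.sym (lookup-injective (y≉ ∷ d) zero (suc i) (sym eq))
      lookup-injective (_ ∷ d)  (suc i) (suc j) eq = cong suc (lookup-injective d i j eq)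

      lookup-surjective : ∀ {ys x} → Any (x ≈_) ys → ∃[ i ] lookup ys i ≈ x
      lookup-surjective (here x≈y)  = zero , sym x≈y
      lookup-surjective (there x∈) = suc (proj₁ (lookup-surjective x∈)) , proj₂ (lookup-surjective x∈)

    -- Removing repetitions from the covering list requires a decision procedure for the
    -- equivalence; this is why equivalence of ideals is decided below.
    enumeration : ∀ xs → (∀ x → Any (x ≈_) xs) → ∃[ h ] Bijection (≡.setoid (Fin h)) S
    enumeration xs covers = from (transversal xs)
      where
      from : ∃[ ys ] Distinct ys × (∀ {x} → Any (x ≈_) xs → Any (x ≈_) ys) → ∃[ h ] Bijection (≡.setoid (Fin h)) S
      from (ys , distinct , complete) = length ys , record
        { to        = lookup ys
        ; cong      = λ { refl → Setoid.refl S }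
        ; bijective = (λ {i} {j} → lookup-injective distinct i j)
                    , λ x → proj₁ (index x) , λ { refl → proj₂ (index x) }
        }
        where
        index : ∀ x → ∃[ i ] lookup ys i ≈ x
        index x = lookup-surjective (complete (covers x))

-- Finiteness of the class group by reduction theory

module Decision where
  open import Defs
  open Events using (square-≤)
  open Field
  open Finiteness
  open Integers
  open Lattices
  open import Data.Integer.Base as ℤ using (ℤ; 0ℤ; 1ℤ; -1ℤ; -[1+_])
  open import Data.Integer.Divisibility.Signed as ℤ using () renaming (_∣_ to _∣ℤ_; _∣?_ to _∣ℤ?_)
  open import Data.Integer.DivMod using (_%ℕ_; _/ℕ_; a≡a%ℕn+[a/ℕn]*n; n%ℕd<d)
  import Data.Integer.Properties as ℤ
  import Data.Integer.Tactic.RingSolver as ℤSolver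
  open import Data.List.Base using (List; []; _∷_; map; upTo; cartesianProduct)
  open import Data.List.Membership.Propositional using (lose)
  open import Data.List.Membership.Propositional.Properties using (∈-upTo⁺; ∈-cartesianProduct⁺)
  open import Data.List.Relation.Unary.Any as Any using (Any; here)
  import Data.List.Relation.Unary.Any.Properties as Any
  open import Data.Nat.Base as ℕ using (ℕ; zero; suc)
  open import Data.Nat.Induction using (<-wellFounded)
  import Data.Nat.Properties as ℕ
  import Data.Nat.Tactic.RingSolver as ℕSolver
  open import Data.Product.Base using (∃; ∃-syntax; _×_; _,_; proj₁; proj₂)
  open import Data.Sum.Base using (_⊎_; inj₁; inj₂)
  open import Function.Bundles using (_⇔_; mk⇔; module Equivalence)
  open import Induction.WellFounded using (Acc; acc)
  open import Relation.Binary.PropositionalEquality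
  open import Relation.Nullary.Decidable using (Dec; yes; no; map′; _×-dec_; _⊎-dec_)
  open import Relation.Nullary.Negation using (contradiction)

  bounded-∃? : ∀ {P : ℤ → Set} → (∀ z → Dec (P z)) → ∀ R → (∀ z → P z → ℤ.∣ z ∣ ℕ.≤ R) → Dec (∃ P)
  bounded-∃? {P} P? R bound = map′ found search (ℕ.anyUpTo? (λ i → P? (ℤ.+ i) ⊎-dec P? (ℤ.- ℤ.+ i)) (suc R))
    where
    found : ∃[ i ] i ℕ.< suc R × (P (ℤ.+ i) ⊎ P (ℤ.- ℤ.+ i)) → ∃ P
    found (i , _ , inj₁ p) = ℤ.+ i , p
    found (i , _ , inj₂ p) = ℤ.- ℤ.+ i , p
    search : ∃ P → ∃[ i ] i ℕ.< suc R × (P (ℤ.+ i) ⊎ P (ℤ.- ℤ.+ i))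
    search (ℤ.+ i , p)    = i , ℕ.s≤s (bound _ p) , inj₁ p
    search (-[1+ i ] , p) = suc i , ℕ.s≤s (bound _ p) , inj₂ p

  finite-class-number : ∀ K → (∀ I J → Dec (_∼_ K I J)) → ∀ Is → (∀ I → Any (_∼_ K I) Is) → ∃ (HasClassNumber K)
  finite-class-number K dec Is covers = enumeration (idealClasses K) dec Is covers

  module ImaginaryIdeals (d : ℤ) (sf : Squarefree d) (d≢1 : d ≢ 1ℤ) (e : ℤ) (d≡2e : d ≡ ℤ.+ 2 ℤ.* e)
    (n : ℕ) (d≡-n : d ≡ ℤ.- ℤ.+ n) (2≤n : 2 ℕ.≤ n) where
    open Quadratic d
    open IntegralElements d
    open Bounded sf d≢1
    open EvenRadicand e d≡2e
    open Homothety d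
    open Ideals d sf d≢1 e d≡2e
    open Equivalence

    norm : ℤ → ℤ → ℕ
    norm u y = ℤ.∣ u ∣ ℕ.* ℤ.∣ u ∣ ℕ.+ n ℕ.* (ℤ.∣ y ∣ ℕ.* ℤ.∣ y ∣)

    norm≡ : ∀ u y → ℤ.+ norm u y ≡ u ℤ.* u ℤ.- d ℤ.* (y ℤ.* y)
    norm≡ u y = trans (cong₂ ℤ._+_ (sym (square≡∣∣² u)) (trans (ℤ.pos-* n _) (cong (ℤ.+ n ℤ.*_) (sym (square≡∣∣² y)))))
      (trans (lemma u (ℤ.+ n) y) (cong (λ d → u ℤ.* u ℤ.- d ℤ.* (y ℤ.* y)) (sym d≡-n)))
      where
      lemma : ∀ u n y → u ℤ.* u ℤ.+ n ℤ.* (y ℤ.* y) ≡ u ℤ.* u ℤ.- (ℤ.- n) ℤ.* (y ℤ.* y)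
      lemma = ℤSolver.solve-∀

    norm-* : ∀ {u y u′ y′ R} → int u y * int u′ y′ ≡ ⟦ R ⟧ → norm u y ℕ.* norm u′ y′ ≡ ℤ.∣ R ∣ ℕ.* ℤ.∣ R ∣
    norm-* {u} {y} {u′} {y′} {R} eq = ℤ.+-injective (begin
      ℤ.+ (norm u y ℕ.* norm u′ y′)                                          ≡⟨ ℤ.pos-* (norm u y) _ ⟩
      ℤ.+ norm u y ℤ.* ℤ.+ norm u′ y′                                        ≡⟨ cong₂ ℤ._*_ (norm≡ u y) (norm≡ u′ y′) ⟩
      (u ℤ.* u ℤ.- d ℤ.* (y ℤ.* y)) ℤ.* (u′ ℤ.* u′ ℤ.- d ℤ.* (y′ ℤ.* y′))    ≡⟨ lemma d u y u′ y′ ⟩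
      P ℤ.* P ℤ.- d ℤ.* (S ℤ.* S)                                            ≡⟨ cong₂ (λ p s → p ℤ.* p ℤ.- d ℤ.* (s ℤ.* s)) (proj₁ inj) (proj₂ inj) ⟩
      R ℤ.* R ℤ.- d ℤ.* (0ℤ ℤ.* 0ℤ)                                          ≡⟨ lemma₂ R d ⟩
      R ℤ.* R                                                                ≡⟨ square≡∣∣² R ⟩
      ℤ.+ (ℤ.∣ R ∣ ℕ.* ℤ.∣ R ∣)                                              ∎)
      where
      open ≡-Reasoning
      P S : ℤ
      P = u ℤ.* u′ ℤ.+ d ℤ.* (y ℤ.* y′)
      S = u ℤ.* y′ ℤ.+ y ℤ.* u′
      inj : P ≡ R × S ≡ 0ℤ
      inj = int-injective {P} {S} {R} {0ℤ} (trans (int-* u y u′ y′) eq)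
      lemma : ∀ d u y u′ y′ → (u ℤ.* u ℤ.- d ℤ.* (y ℤ.* y)) ℤ.* (u′ ℤ.* u′ ℤ.- d ℤ.* (y′ ℤ.* y′))
        ≡ (u ℤ.* u′ ℤ.+ d ℤ.* (y ℤ.* y′)) ℤ.* (u ℤ.* u′ ℤ.+ d ℤ.* (y ℤ.* y′)) ℤ.- d ℤ.* ((u ℤ.* y′ ℤ.+ y ℤ.* u′) ℤ.* (u ℤ.* y′ ℤ.+ y ℤ.* u′))
      lemma = ℤSolver.solve-∀
      lemma₂ : ∀ R d → R ℤ.* R ℤ.- d ℤ.* (0ℤ ℤ.* 0ℤ) ≡ R ℤ.* R
      lemma₂ = ℤSolver.solve-∀

    -- The norm form is positive definite, and the norm of a divisor of R is at most R².
    norm-bound : ∀ {u y u′ y′ R} → 0 ℕ.< ℤ.∣ R ∣ → int u y * int u′ y′ ≡ ⟦ R ⟧ → ℤ.∣ u ∣ ℕ.≤ ℤ.∣ R ∣ × ℤ.∣ y ∣ ℕ.≤ ℤ.∣ R ∣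
    norm-bound {u} {y} {u′} {y′} {R} 0<R eq = square-≤ (ℕ.≤-trans (ℕ.m≤m+n _ _) bound) ,
      square-≤ (ℕ.≤-trans (ℕ.≤-trans (ℕ.m≤n*m _ n {{ℕ.>-nonZero (ℕ.≤-trans (ℕ.s≤s ℕ.z≤n) 2≤n)}}) (ℕ.m≤n+m _ (ℤ.∣ u ∣ ℕ.* ℤ.∣ u ∣))) bound)
      where
      product : norm u y ℕ.* norm u′ y′ ≡ ℤ.∣ R ∣ ℕ.* ℤ.∣ R ∣
      product = norm-* {u} {y} {u′} {y′} {R} eq
      norm′≢0 : ∀ m → norm u y ℕ.* m ≡ ℤ.∣ R ∣ ℕ.* ℤ.∣ R ∣ → 0 ℕ.< m
      norm′≢0 zero    eq = contradiction (trans (sym (ℕ.*-zeroʳ (norm u y))) eq) (ℕ.<⇒≢ (ℕ.*-mono-< 0<R 0<R))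
      norm′≢0 (suc m) _  = ℕ.z<s
      bound : norm u y ℕ.≤ ℤ.∣ R ∣ ℕ.* ℤ.∣ R ∣
      bound = ℕ.≤-trans (ℕ.m≤m*n (norm u y) (norm u′ y′) {{ℕ.>-nonZero (norm′≢0 _ product)}}) (ℕ.≤-reflexive product)

    L-⊕ : ∀ {a b x y} → L a b x → L a b y → L a b (x + y)
    L-⊕ {a} {b} (X , Y , x≡ , m , k , X≡ , Y≡) (X′ , Y′ , y≡ , m′ , k′ , X′≡ , Y′≡) =
      X ℤ.+ X′ , Y ℤ.+ Y′ , trans (cong₂ _+_ x≡ y≡) (sym (int-+ X Y X′ Y′)) ,
      m ℤ.+ m′ , k ℤ.+ k′ , trans (cong₂ ℤ._+_ X≡ X′≡) (lemma m a k b m′ k′) , trans (cong₂ ℤ._+_ Y≡ Y′≡) (lemma₂ k k′)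
      where
      lemma : ∀ m a k b m′ k′ → m ℤ.* a ℤ.+ k ℤ.* b ℤ.+ (m′ ℤ.* a ℤ.+ k′ ℤ.* b) ≡ (m ℤ.+ m′) ℤ.* a ℤ.+ (k ℤ.+ k′) ℤ.* b
      lemma = ℤSolver.solve-∀
      lemma₂ : ∀ k k′ → k ℤ.* 1ℤ ℤ.+ k′ ℤ.* 1ℤ ≡ (k ℤ.+ k′) ℤ.* 1ℤ
      lemma₂ = ℤSolver.solve-∀

    L-scale : ∀ z {a b x} → L a b x → L a b (⟦ z ⟧ * x)
    L-scale z {a} {b} (X , Y , x≡ , m , k , X≡ , Y≡) = z ℤ.* X , z ℤ.* Y , trans (cong (⟦ z ⟧ *_) x≡) (⟦⟧*int z X Y) ,
      z ℤ.* m , z ℤ.* k , trans (cong (z ℤ.*_) X≡) (lemma z m a k b) , trans (cong (z ℤ.*_) Y≡) (sym (ℤ.*-assoc z k 1ℤ))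
      where
      lemma : ∀ z m a k b → z ℤ.* (m ℤ.* a ℤ.+ k ℤ.* b) ≡ z ℤ.* m ℤ.* a ℤ.+ z ℤ.* k ℤ.* b
      lemma = ℤSolver.solve-∀

    L-basis₁ : ∀ a b → L a b ⟦ a ⟧
    L-basis₁ a b = a , 0ℤ , refl , 1ℤ , 0ℤ , lemma a b , refl
      where
      lemma : ∀ a b → a ≡ 1ℤ ℤ.* a ℤ.+ 0ℤ ℤ.* b
      lemma = ℤSolver.solve-∀

    L-basis₂ : ∀ a b → L a b (int b 1ℤ)
    L-basis₂ a b = b , 1ℤ , refl , 0ℤ , 1ℤ , lemma a b , refl
      where
      lemma : ∀ a b → b ≡ 0ℤ ℤ.* a ℤ.+ 1ℤ ℤ.* b
      lemma = ℤSolver.solve-∀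

    L-expand : ∀ {a b x} → L a b x → ∃[ m ] ∃[ k ] x ≡ ⟦ m ⟧ * ⟦ a ⟧ + ⟦ k ⟧ * int b 1ℤ
    L-expand {a} {b} {x} (X , Y , x≡ , m , k , X≡ , Y≡) = m , k , (begin
      x                                               ≡⟨ trans x≡ (cong₂ int X≡ Y≡) ⟩
      int (m ℤ.* a ℤ.+ k ℤ.* b) (k ℤ.* 1ℤ)            ≡⟨ cong (int (m ℤ.* a ℤ.+ k ℤ.* b)) (lemma m k) ⟨
      int (m ℤ.* a ℤ.+ k ℤ.* b) (m ℤ.* 0ℤ ℤ.+ k ℤ.* 1ℤ)  ≡⟨ int-+ (m ℤ.* a) (m ℤ.* 0ℤ) (k ℤ.* b) (k ℤ.* 1ℤ) ⟩
      int (m ℤ.* a) (m ℤ.* 0ℤ) + int (k ℤ.* b) (k ℤ.* 1ℤ)  ≡⟨ cong₂ _+_ (⟦⟧*int m a 0ℤ) (⟦⟧*int k b 1ℤ) ⟨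
      ⟦ m ⟧ * ⟦ a ⟧ + ⟦ k ⟧ * int b 1ℤ                ∎)
      where
      open ≡-Reasoning
      lemma : ∀ m k → m ℤ.* 0ℤ ℤ.+ k ℤ.* 1ℤ ≡ k ℤ.* 1ℤ
      lemma = ℤSolver.solve-∀

    L-map : ∀ {a b a′ b′} α → L a′ b′ (α * ⟦ a ⟧) → L a′ b′ (α * int b 1ℤ) → ∀ {x} → L a b x → L a′ b′ (α * x)
    L-map {a} {b} {a′} {b′} α h₁ h₂ {x} x∈ = go (L-expand x∈)
      where
      go : ∃[ m ] ∃[ k ] x ≡ ⟦ m ⟧ * ⟦ a ⟧ + ⟦ k ⟧ * int b 1ℤ → L a′ b′ (α * x)
      go (m , k , x≡) = subst (L a′ b′) (sym (trans (cong (α *_) x≡)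
        (solve 5 (λ α m a k b → α :* (m :* a :+ k :* b) := m :* (α :* a) :+ k :* (α :* b)) refl α ⟦ m ⟧ ⟦ a ⟧ ⟦ k ⟧ (int b 1ℤ))))
        (L-⊕ {a′} {b′} (L-scale m {a′} {b′} h₁) (L-scale k {a′} {b′} h₂))

    isInt? : ∀ x → Dec (IsInt x)
    isInt? (p +√ q) = map′ (λ ((u , p≡) , (v , q≡)) → u , v , cong₂ _+√_ p≡ q≡) (λ (u , v , eq) → (u , cong rat eq) , (v , cong irr eq))
      (integerℚ? p ×-dec integerℚ? q)

    L? : ∀ a b x → Dec (L a b x)
    L? a b x = go (isInt? x)
      where
      go : Dec (IsInt x) → Dec (L a b x)
      go (no ¬int) = no (λ (X , Y , x≡ , _) → ¬int (X , Y , x≡))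
      go (yes (X , Y , x≡)) = map′ build unbuild (a ∣ℤ? X ℤ.- Y ℤ.* b)
        where
        lemma : ∀ X Yb → X ≡ X ℤ.- Yb ℤ.+ Yb
        lemma = ℤSolver.solve-∀
        lemma₂ : ∀ m a k b → m ℤ.* a ℤ.+ k ℤ.* b ℤ.- k ℤ.* 1ℤ ℤ.* b ≡ m ℤ.* a
        lemma₂ = ℤSolver.solve-∀
        build : a ∣ℤ X ℤ.- Y ℤ.* b → L a b x
        build (ℤ.divides m eq) = X , Y , x≡ , m , Y , trans (lemma X (Y ℤ.* b)) (cong (ℤ._+ Y ℤ.* b) eq) , sym (ℤ.*-identityʳ Y)
        unbuild : L a b x → a ∣ℤ X ℤ.- Y ℤ.* b
        unbuild (X′ , Y′ , x≡′ , m , k , X′≡ , Y′≡) = ℤ.divides m (trans (cong₂ (λ X Y → X ℤ.- Y ℤ.* b)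
          (trans (proj₁ inj) X′≡) (trans (proj₂ inj) Y′≡)) (lemma₂ m a k b))
          where
          inj : X ≡ X′ × Y ≡ Y′
          inj = int-injective {X} {Y} {X′} {Y′} (trans (sym x≡) x≡′)

    module _ (a : ℕ) (0<a : 0 ℕ.< a) (b : ℤ) (a′ : ℕ) (0<a′ : 0 ℕ.< a′) (b′ : ℤ) where

      private
        A A′ : ℤ
        A  = ℤ.+ a
        A′ = ℤ.+ a′

        A-unit : Unit ⟦ A ⟧
        A-unit = ⟦⟧-unit (+≢0 0<a)

        A′-unit : Unit ⟦ A′ ⟧
        A′-unit = ⟦⟧-unit (+≢0 0<a′)

        A⁻¹ A′⁻¹ : K
        A⁻¹  = proj₁ A-unit
        A′⁻¹ = proj₁ A′-unit

        -- α = β / a maps one lattice onto the other, with inverse γ / a′.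
        Homothetic : K → K → Set
        Homothetic β γ = (β * γ ≡ ⟦ A ℤ.* A′ ⟧ × L A′ b′ (A⁻¹ * β * ⟦ A ⟧)) × (L A′ b′ (A⁻¹ * β * int b 1ℤ) × L A b (A′⁻¹ * γ * ⟦ A′ ⟧)) × L A b (A′⁻¹ * γ * int b′ 1ℤ)

        K-≟ : ∀ (x y : K) → Dec (x ≡ y)
        K-≟ (p +√ q) (p′ +√ q′) = map′ (λ (e , f) → cong₂ _+√_ e f) (λ e → cong rat e , cong irr e) (p ℚ.≟ p′ ×-dec q ℚ.≟ q′)
          where import Data.Rational.Properties as ℚ

        homothetic? : ∀ β γ → Dec (Homothetic β γ)
        homothetic? β γ = (K-≟ (β * γ) ⟦ A ℤ.* A′ ⟧ ×-dec L? A′ b′ (A⁻¹ * β * ⟦ A ⟧))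
          ×-dec (L? A′ b′ (A⁻¹ * β * int b 1ℤ) ×-dec L? A b (A′⁻¹ * γ * ⟦ A′ ⟧)) ×-dec L? A b (A′⁻¹ * γ * int b′ 1ℤ)

        R : ℕ
        R = ℤ.∣ A ℤ.* A′ ∣

        0<R : 0 ℕ.< R
        0<R = subst (0 ℕ.<_) (sym (ℤ.abs-* A A′)) (ℕ.*-mono-< 0<a 0<a′)

        -- The unknown homothety and its inverse become, after clearing denominators, two elements
        -- of ℤ[√d] with product a a′. Their coordinates are bounded by `norm-bound`, so a finite
        -- search decides whether they exist; by linearity the homothety need only be tested on the
        -- bases.
        Search : Set
        Search = ∃[ u ] ∃[ y ] ∃[ u′ ] ∃[ y′ ] Homothetic (int u y) (int u′ y′)

        search? : Dec Search
        search? = bounded-∃? (λ u → bounded-∃? (λ y → bounded-∃? (λ u′ → bounded-∃? (λ y′ → homothetic? (int u y) (int u′ y′))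
            R (λ y′ h → proj₂ (bound {u′} {y′} {u} {y} (swap u y u′ y′ h))))
            R (λ u′ (y′ , h) → proj₁ (bound {u′} {y′} {u} {y} (swap u y u′ y′ h))))
            R (λ y (u′ , y′ , h) → proj₂ (bound {u} {y} {u′} {y′} (proj₁ (proj₁ h)))))
            R (λ u (y , u′ , y′ , h) → proj₁ (bound {u} {y} {u′} {y′} (proj₁ (proj₁ h))))
          where
          bound : ∀ {u y u′ y′} → int u y * int u′ y′ ≡ ⟦ A ℤ.* A′ ⟧ → ℤ.∣ u ∣ ℕ.≤ R × ℤ.∣ y ∣ ℕ.≤ R
          bound {u} {y} {u′} {y′} = norm-bound {u} {y} {u′} {y′} {A ℤ.* A′} 0<R
          swap : ∀ u y u′ y′ → Homothetic (int u y) (int u′ y′) → int u′ y′ * int u y ≡ ⟦ A ℤ.* A′ ⟧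
          swap u y u′ y′ h = trans (*-comm (int u′ y′) (int u y)) (proj₁ (proj₁ h))

        found : Search → L A b ≃ L A′ b′
        found (u , y , u′ , y′ , (βγ≡ , h₁) , (h₂ , h₃) , h₄) = α , (α′ , αα′≡1) , λ x → mk⇔
          (L-map {A} {b} {A′} {b′} α h₁ h₂)
          (λ αx∈ → subst (L A b) (cancel α′ α (trans (*-comm α′ α) αα′≡1) x) (L-map {A′} {b′} {A} {b} α′ h₃ h₄ αx∈))
          where
          α α′ : K
          α  = A⁻¹ * int u y
          α′ = A′⁻¹ * int u′ y′
          αα′≡1 : α * α′ ≡ 1#
          αα′≡1 = begin
            A⁻¹ * int u y * (A′⁻¹ * int u′ y′)     ≡⟨ solve 4 (λ a b c d → a :* b :* (c :* d) := a :* c :* (b :* d)) refl A⁻¹ (int u y) A′⁻¹ (int u′ y′) ⟩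
            A⁻¹ * A′⁻¹ * (int u y * int u′ y′)     ≡⟨ cong (A⁻¹ * A′⁻¹ *_) (trans βγ≡ (⟦⟧-* A A′)) ⟩
            A⁻¹ * A′⁻¹ * (⟦ A ⟧ * ⟦ A′ ⟧)          ≡⟨ solve 4 (λ a b c d → a :* b :* (c :* d) := c :* a :* (d :* b)) refl A⁻¹ A′⁻¹ ⟦ A ⟧ ⟦ A′ ⟧ ⟩
            ⟦ A ⟧ * A⁻¹ * (⟦ A′ ⟧ * A′⁻¹)          ≡⟨ cong₂ _*_ (proj₂ A-unit) (proj₂ A′-unit) ⟩
            1# * 1#                                ≡⟨ *-identityˡ 1# ⟩
            1#                                     ∎
            where open ≡-Reasoning

        exists : L A b ≃ L A′ b′ → Search
        exists (α , (α′ , αα′≡1) , L⇔L′) = go (to (L⇔L′ ⟦ A ⟧) (L-basis₁ A b)) (back (L-basis₁ A′ b′))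
          where
          back : ∀ {y} → L A′ b′ y → L A b (α′ * y)
          back {y} y∈ = from (L⇔L′ (α′ * y)) (subst (L A′ b′) (sym (cancel α α′ αα′≡1 y)) y∈)
          divide : ∀ α a a⁻¹ → a * a⁻¹ ≡ 1# → ∀ {β} → α * a ≡ β → α ≡ a⁻¹ * β
          divide α a a⁻¹ aa⁻¹≡1 {β} αa≡β = begin
            α                ≡⟨ *-identityʳ α ⟨
            α * 1#           ≡⟨ cong (α *_) aa⁻¹≡1 ⟨
            α * (a * a⁻¹)    ≡⟨ solve 3 (λ x a b → x :* (a :* b) := b :* (x :* a)) refl α a a⁻¹ ⟩
            a⁻¹ * (α * a)    ≡⟨ cong (a⁻¹ *_) αa≡β ⟩
            a⁻¹ * β          ∎
            where open ≡-Reasoning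
          go : L A′ b′ (α * ⟦ A ⟧) → L A b (α′ * ⟦ A′ ⟧) → Search
          go β∈@(u , y , β≡ , _) γ∈@(u′ , y′ , γ≡ , _) = u , y , u′ , y′ ,
            (βγ≡ , subst (λ α → L A′ b′ (α * ⟦ A ⟧)) α≡ β∈) ,
            (subst (λ α → L A′ b′ (α * int b 1ℤ)) α≡ (to (L⇔L′ (int b 1ℤ)) (L-basis₂ A b)) , subst (λ α → L A b (α * ⟦ A′ ⟧)) α′≡ γ∈) ,
            subst (λ α → L A b (α * int b′ 1ℤ)) α′≡ (back (L-basis₂ A′ b′))
            where
            α≡ : α ≡ A⁻¹ * int u y
            α≡ = divide α ⟦ A ⟧ A⁻¹ (proj₂ A-unit) β≡
            α′≡ : α′ ≡ A′⁻¹ * int u′ y′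
            α′≡ = divide α′ ⟦ A′ ⟧ A′⁻¹ (proj₂ A′-unit) γ≡
            βγ≡ : int u y * int u′ y′ ≡ ⟦ A ℤ.* A′ ⟧
            βγ≡ = begin
              int u y * int u′ y′                ≡⟨ cong₂ _*_ β≡ γ≡ ⟨
              α * ⟦ A ⟧ * (α′ * ⟦ A′ ⟧)          ≡⟨ solve 4 (λ x a y b → x :* a :* (y :* b) := x :* y :* (a :* b)) refl α ⟦ A ⟧ α′ ⟦ A′ ⟧ ⟩
              α * α′ * (⟦ A ⟧ * ⟦ A′ ⟧)          ≡⟨ cong₂ _*_ αα′≡1 (sym (⟦⟧-* A A′)) ⟩
              1# * ⟦ A ℤ.* A′ ⟧                  ≡⟨ *-identityˡ ⟦ A ℤ.* A′ ⟧ ⟩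
              ⟦ A ℤ.* A′ ⟧                       ∎
              where open ≡-Reasoning

      homothety? : Dec (L (ℤ.+ a) b ≃ L (ℤ.+ a′) b′)
      homothety? = map′ found exists search?

    open FractionalIdeal

    members : FractionalIdeal F → K → Set
    members I x = _∈ᴵ_ F x I

    ideal-normal-form : ∀ I → NormalForm (members I)
    ideal-normal-form I = normal-form (generators I) (nonzero I)

    ∼? : ∀ I J → Dec (_∼_ F I J)
    ∼? I J = go (ideal-normal-form I) (ideal-normal-form J)
      where
      P Q : K → Set
      P = members I
      Q = members J
      go : NormalForm P → NormalForm Q → Dec (P ≃ Q)
      go (a , b , _ , 0<a , _ , P≃L) (a′ , b′ , _ , 0<a′ , _ , Q≃L) = map′
        (λ L≃L′ → ≃-trans P (L (ℤ.+ a) b) Q P≃L (≃-trans (L (ℤ.+ a) b) (L (ℤ.+ a′) b′) Q L≃L′ (≃-sym Q (L (ℤ.+ a′) b′) Q≃L)))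
        (λ P≃Q → ≃-trans (L (ℤ.+ a) b) P (L (ℤ.+ a′) b′) (≃-sym P (L (ℤ.+ a) b) P≃L) (≃-trans P Q (L (ℤ.+ a′) b′) P≃Q Q≃L))
        (homothety? a 0<a b a′ 0<a′ b′)

    standard : ∀ a b → 0 ℕ.< a → FractionalIdeal F
    standard a b 0<a = record
      { generators = ⟦ ℤ.+ a ⟧ ∷ int b 1ℤ ∷ []
      ; nonzero    = here (λ eq → +≢0 0<a (/1-injective (cong rat eq)))
      }

    -- The equation ac = b² - d makes the ℤ-span of a and b + √d stable under √d, so coefficients
    -- from the ring of integers add nothing.
    standard⇔L : ∀ a b c (0<a : 0 ℕ.< a) → ℤ.+ a ℤ.* c ≡ b ℤ.* b ℤ.- d → ∀ x → members (standard a b 0<a) x ⇔ L (ℤ.+ a) b x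
    standard⇔L a b c 0<a ac≡ x = mk⇔ to′ from′
      where
      A : ℤ
      A = ℤ.+ a
      to′ : Span F (⟦ A ⟧ ∷ int b 1ℤ ∷ []) x → L A b x
      to′ (r , y , ri , (s , z , si , z≡0 , y≡) , x≡) = combine (integral⇒integer {r} ri) (integral⇒integer {s} si)
        where
        combine : IsInt r → IsInt s → L A b x
        combine (r₁ , r₂ , r≡) (s₁ , s₂ , s≡) = X , Y , x≡int , r₁ ℤ.- r₂ ℤ.* b ℤ.- s₂ ℤ.* c , Y , X≡ , sym (ℤ.*-identityʳ Y)
          where
          X Y : ℤ
          X = r₁ ℤ.* A ℤ.+ d ℤ.* (r₂ ℤ.* 0ℤ) ℤ.+ (s₁ ℤ.* b ℤ.+ d ℤ.* (s₂ ℤ.* 1ℤ))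
          Y = r₁ ℤ.* 0ℤ ℤ.+ r₂ ℤ.* A ℤ.+ (s₁ ℤ.* 1ℤ ℤ.+ s₂ ℤ.* b)
          x≡int : x ≡ int X Y
          x≡int = begin
            x                                                 ≡⟨ trans x≡ (cong (λ y → r * ⟦ A ⟧ + y) (trans y≡ (trans (cong (λ z → s * int b 1ℤ + z) z≡0) (+-identityʳ (s * int b 1ℤ))))) ⟩
            r * ⟦ A ⟧ + s * int b 1ℤ                          ≡⟨ cong₂ (λ r s → r * ⟦ A ⟧ + s * int b 1ℤ) r≡ s≡ ⟩
            int r₁ r₂ * ⟦ A ⟧ + int s₁ s₂ * int b 1ℤ          ≡⟨ cong₂ _+_ (int-* r₁ r₂ A 0ℤ) (int-* s₁ s₂ b 1ℤ) ⟨
            int (r₁ ℤ.* A ℤ.+ d ℤ.* (r₂ ℤ.* 0ℤ)) (r₁ ℤ.* 0ℤ ℤ.+ r₂ ℤ.* A) + int (s₁ ℤ.* b ℤ.+ d ℤ.* (s₂ ℤ.* 1ℤ)) (s₁ ℤ.* 1ℤ ℤ.+ s₂ ℤ.* b)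
              ≡⟨ int-+ (r₁ ℤ.* A ℤ.+ d ℤ.* (r₂ ℤ.* 0ℤ)) (r₁ ℤ.* 0ℤ ℤ.+ r₂ ℤ.* A) (s₁ ℤ.* b ℤ.+ d ℤ.* (s₂ ℤ.* 1ℤ)) (s₁ ℤ.* 1ℤ ℤ.+ s₂ ℤ.* b) ⟨
            int X Y                                           ∎
            where open ≡-Reasoning
          lemma₁ : ∀ r₁ r₂ s₁ s₂ A b d → r₁ ℤ.* A ℤ.+ d ℤ.* (r₂ ℤ.* 0ℤ) ℤ.+ (s₁ ℤ.* b ℤ.+ d ℤ.* (s₂ ℤ.* 1ℤ))
            ≡ (r₁ ℤ.- r₂ ℤ.* b) ℤ.* A ℤ.- s₂ ℤ.* (b ℤ.* b ℤ.- d) ℤ.+ (r₁ ℤ.* 0ℤ ℤ.+ r₂ ℤ.* A ℤ.+ (s₁ ℤ.* 1ℤ ℤ.+ s₂ ℤ.* b)) ℤ.* b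
          lemma₁ = ℤSolver.solve-∀
          lemma₂ : ∀ x s A c y → x ℤ.* A ℤ.- s ℤ.* (A ℤ.* c) ℤ.+ y ≡ (x ℤ.- s ℤ.* c) ℤ.* A ℤ.+ y
          lemma₂ = ℤSolver.solve-∀
          X≡ : X ≡ (r₁ ℤ.- r₂ ℤ.* b ℤ.- s₂ ℤ.* c) ℤ.* A ℤ.+ Y ℤ.* b
          X≡ = trans (lemma₁ r₁ r₂ s₁ s₂ A b d) (trans (cong (λ z → (r₁ ℤ.- r₂ ℤ.* b) ℤ.* A ℤ.- s₂ ℤ.* z ℤ.+ Y ℤ.* b) (sym ac≡)) (lemma₂ (r₁ ℤ.- r₂ ℤ.* b) s₂ A c (Y ℤ.* b)))
      from′ : L A b x → Span F (⟦ A ⟧ ∷ int b 1ℤ ∷ []) x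
      from′ x∈ = go (L-expand x∈)
        where
        go : ∃[ m ] ∃[ k ] x ≡ ⟦ m ⟧ * ⟦ A ⟧ + ⟦ k ⟧ * int b 1ℤ → Span F (⟦ A ⟧ ∷ int b 1ℤ ∷ []) x
        go (m , k , x≡) = ⟦ m ⟧ , ⟦ k ⟧ * int b 1ℤ , integer⇒integral m 0ℤ ,
          (⟦ k ⟧ , 0# , integer⇒integral k 0ℤ , refl , sym (+-identityʳ (⟦ k ⟧ * int b 1ℤ))) , x≡

    L-translate : ∀ a b k → L a (b ℤ.+ k ℤ.* a) ≃ L a b
    L-translate a b k = ≃-equal (L a (b ℤ.+ k ℤ.* a)) (L a b) (coordinates-cong {Triangular a (b ℤ.+ k ℤ.* a) 1ℤ} {Triangular a b 1ℤ} (λ X Y → mk⇔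
      (λ (m , l , X≡ , Y≡) → m ℤ.+ l ℤ.* k , l , trans X≡ (lemma₁ m l k a b) , Y≡)
      (λ (m , l , X≡ , Y≡) → m ℤ.- l ℤ.* k , l , trans X≡ (lemma₂ m l k a b) , Y≡)))
      where
      lemma₁ : ∀ m l k a b → m ℤ.* a ℤ.+ l ℤ.* (b ℤ.+ k ℤ.* a) ≡ (m ℤ.+ l ℤ.* k) ℤ.* a ℤ.+ l ℤ.* b
      lemma₁ = ℤSolver.solve-∀
      lemma₂ : ∀ m l k a b → m ℤ.* a ℤ.+ l ℤ.* b ≡ (m ℤ.- l ℤ.* k) ℤ.* a ℤ.+ l ℤ.* (b ℤ.+ k ℤ.* a)
      lemma₂ = ℤSolver.solve-∀

    -- (b - √d)/a maps ℤa + ℤ(b + √d) onto ℤc + ℤ(-b + √d), where ac = b² - d.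
    L-flip : ∀ {a b c} → a ≢ 0ℤ → c ≢ 0ℤ → a ℤ.* c ≡ b ℤ.* b ℤ.- d → L a b ≃ L c (ℤ.- b)
    L-flip {a} {b} {c} a≢0 c≢0 ac≡ = α , (- α′ , αα′≡1) , λ x → mk⇔
      (half a b c a≢0 ac≡)
      (λ αx∈ → subst (L a b) (cancel (- α′) α (trans (*-comm (- α′) α) αα′≡1) x)
        (subst (L a b) (solve 2 (λ x y → (:- con 1ℤ) :* (x :* y) := (:- x) :* y) refl α′ (α * x))
          (L-scale -1ℤ {a} {b} (subst (λ b → L a b (α′ * (α * x))) (ℤ.neg-involutive b) (half c (ℤ.- b) a c≢0 ca≡ αx∈)))))
      where
      flip-factor : ∀ a b → a ≢ 0ℤ → K
      flip-factor a b a≢0 = proj₁ (⟦⟧-unit a≢0) * int b -1ℤ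
      α α′ : K
      α  = flip-factor a b a≢0
      α′ = flip-factor c (ℤ.- b) c≢0
      ca≡ : c ℤ.* a ≡ ℤ.- b ℤ.* ℤ.- b ℤ.- d
      ca≡ = trans (ℤ.*-comm c a) (trans ac≡ (lemma b d))
        where
        lemma : ∀ b d → b ℤ.* b ℤ.- d ≡ ℤ.- b ℤ.* ℤ.- b ℤ.- d
        lemma = ℤSolver.solve-∀
      half : ∀ a b c (a≢0 : a ≢ 0ℤ) → a ℤ.* c ≡ b ℤ.* b ℤ.- d → ∀ {x} → L a b x → L c (ℤ.- b) (flip-factor a b a≢0 * x)
      half a b c a≢0 ac≡ {x} (X , Y , x≡ , m , k , X≡ , Y≡) = X′ , ℤ.- m , fx≡ , k , ℤ.- m , X′≡ , sym (ℤ.*-identityʳ (ℤ.- m))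
        where
        a⁻¹ : K
        a⁻¹ = proj₁ (⟦⟧-unit a≢0)
        X′ : ℤ
        X′ = k ℤ.* c ℤ.+ m ℤ.* b
        lemma₀ : ∀ k c m b → k ℤ.* c ℤ.+ m ℤ.* b ≡ k ℤ.* c ℤ.+ ℤ.- m ℤ.* ℤ.- b
        lemma₀ = ℤSolver.solve-∀
        X′≡ : X′ ≡ k ℤ.* c ℤ.+ ℤ.- m ℤ.* ℤ.- b
        X′≡ = lemma₀ k c m b
        lemma₁ : ∀ b m a k d → b ℤ.* (m ℤ.* a ℤ.+ k ℤ.* b) ℤ.+ d ℤ.* (-1ℤ ℤ.* (k ℤ.* 1ℤ)) ≡ k ℤ.* (b ℤ.* b ℤ.- d) ℤ.+ m ℤ.* b ℤ.* a
        lemma₁ = ℤSolver.solve-∀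
        lemma₂ : ∀ b m a k → b ℤ.* (k ℤ.* 1ℤ) ℤ.+ -1ℤ ℤ.* (m ℤ.* a ℤ.+ k ℤ.* b) ≡ a ℤ.* ℤ.- m
        lemma₂ = ℤSolver.solve-∀
        lemma₃ : ∀ k a c m b → k ℤ.* (a ℤ.* c) ℤ.+ m ℤ.* b ℤ.* a ≡ a ℤ.* (k ℤ.* c ℤ.+ m ℤ.* b)
        lemma₃ = ℤSolver.solve-∀
        fx≡ : a⁻¹ * int b -1ℤ * x ≡ int X′ (ℤ.- m)
        fx≡ = begin
          a⁻¹ * int b -1ℤ * x                                             ≡⟨ *-assoc a⁻¹ (int b -1ℤ) x ⟩
          a⁻¹ * (int b -1ℤ * x)                                           ≡⟨ cong (λ x → a⁻¹ * (int b -1ℤ * x)) (trans x≡ (cong₂ int X≡ Y≡)) ⟩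
          a⁻¹ * (int b -1ℤ * int (m ℤ.* a ℤ.+ k ℤ.* b) (k ℤ.* 1ℤ))        ≡⟨ cong (a⁻¹ *_) (int-* b -1ℤ (m ℤ.* a ℤ.+ k ℤ.* b) (k ℤ.* 1ℤ)) ⟨
          a⁻¹ * int (b ℤ.* (m ℤ.* a ℤ.+ k ℤ.* b) ℤ.+ d ℤ.* (-1ℤ ℤ.* (k ℤ.* 1ℤ))) (b ℤ.* (k ℤ.* 1ℤ) ℤ.+ -1ℤ ℤ.* (m ℤ.* a ℤ.+ k ℤ.* b))
            ≡⟨ cong (a⁻¹ *_) (cong₂ int (trans (lemma₁ b m a k d) (trans (cong (λ z → k ℤ.* z ℤ.+ m ℤ.* b ℤ.* a) (sym ac≡)) (lemma₃ k a c m b))) (lemma₂ b m a k)) ⟩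
          a⁻¹ * int (a ℤ.* X′) (a ℤ.* ℤ.- m)                              ≡⟨ cong (a⁻¹ *_) (⟦⟧*int a X′ (ℤ.- m)) ⟨
          a⁻¹ * (⟦ a ⟧ * int X′ (ℤ.- m))                                  ≡⟨ cancel a⁻¹ ⟦ a ⟧ (trans (*-comm a⁻¹ ⟦ a ⟧) (proj₂ (⟦⟧-unit a≢0))) (int X′ (ℤ.- m)) ⟩
          int X′ (ℤ.- m)                                                  ∎
          where open ≡-Reasoning
      αα′≡1 : α * (- α′) ≡ 1#
      αα′≡1 = begin
        a⁻¹ * int b -1ℤ * (- (c⁻¹ * int (ℤ.- b) -1ℤ))      ≡⟨ solve 4 (λ a x c y → a :* x :* (:- (c :* y)) := a :* c :* (:- (x :* y))) refl a⁻¹ (int b -1ℤ) c⁻¹ (int (ℤ.- b) -1ℤ) ⟩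
        a⁻¹ * c⁻¹ * (- (int b -1ℤ * int (ℤ.- b) -1ℤ))      ≡⟨ cong (λ z → a⁻¹ * c⁻¹ * (- z)) (int-* b -1ℤ (ℤ.- b) -1ℤ) ⟨
        a⁻¹ * c⁻¹ * (- int (b ℤ.* ℤ.- b ℤ.+ d ℤ.* (-1ℤ ℤ.* -1ℤ)) (b ℤ.* -1ℤ ℤ.+ -1ℤ ℤ.* ℤ.- b))  ≡⟨ cong (a⁻¹ * c⁻¹ *_) (trans (sym (int-neg (b ℤ.* ℤ.- b ℤ.+ d ℤ.* (-1ℤ ℤ.* -1ℤ)) (b ℤ.* -1ℤ ℤ.+ -1ℤ ℤ.* ℤ.- b))) (cong₂ int (trans (lemma₁ b d) (sym ac≡)) (lemma₂ b))) ⟩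
        a⁻¹ * c⁻¹ * ⟦ a ℤ.* c ⟧                            ≡⟨ cong (a⁻¹ * c⁻¹ *_) (⟦⟧-* a c) ⟩
        a⁻¹ * c⁻¹ * (⟦ a ⟧ * ⟦ c ⟧)                        ≡⟨ solve 4 (λ a b c d → a :* b :* (c :* d) := c :* a :* (d :* b)) refl a⁻¹ c⁻¹ ⟦ a ⟧ ⟦ c ⟧ ⟩
        ⟦ a ⟧ * a⁻¹ * (⟦ c ⟧ * c⁻¹)                        ≡⟨ cong₂ _*_ (proj₂ (⟦⟧-unit a≢0)) (proj₂ (⟦⟧-unit c≢0)) ⟩
        1# * 1#                                            ≡⟨ *-identityˡ 1# ⟩
        1#                                                 ∎
        where
        open ≡-Reasoning
        a⁻¹ c⁻¹ : K
        a⁻¹ = proj₁ (⟦⟧-unit a≢0)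
        c⁻¹ = proj₁ (⟦⟧-unit c≢0)
        lemma₁ : ∀ b d → ℤ.- (b ℤ.* ℤ.- b ℤ.+ d ℤ.* (-1ℤ ℤ.* -1ℤ)) ≡ b ℤ.* b ℤ.- d
        lemma₁ = ℤSolver.solve-∀
        lemma₂ : ∀ b → ℤ.- (b ℤ.* -1ℤ ℤ.+ -1ℤ ℤ.* ℤ.- b) ≡ 0ℤ
        lemma₂ = ℤSolver.solve-∀

    -- Weaker than Gauss reduction: a ≤ n together with 0 ≤ b < a already leaves a finite list.
    Reduced : (K → Set) → Set
    Reduced P = ∃[ a ] ∃[ b ] ∃[ c ] 0 ℕ.< a × a ℕ.≤ n × b ℕ.< a × ℤ.+ a ℤ.* c ≡ ℤ.+ b ℤ.* ℤ.+ b ℤ.- d × P ≃ L (ℤ.+ a) (ℤ.+ b)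

    private
      centered-residue : ∀ a .{{_ : ℕ.NonZero a}} b → ∃[ r ] ∃[ k ] b ≡ r ℤ.+ k ℤ.* ℤ.+ a × 2 ℕ.* ℤ.∣ r ∣ ℕ.≤ a
      centered-residue a b = go (2 ℕ.* s ℕ.≤? a)
        where
        s : ℕ
        s = b %ℕ a
        go : Dec (2 ℕ.* s ℕ.≤ a) → ∃[ r ] ∃[ k ] b ≡ r ℤ.+ k ℤ.* ℤ.+ a × 2 ℕ.* ℤ.∣ r ∣ ℕ.≤ a
        go (yes 2s≤a) = ℤ.+ s , b /ℕ a , a≡a%ℕn+[a/ℕn]*n b a , 2s≤a
        go (no 2s≰a)  = ℤ.- ℤ.+ (a ℕ.∸ s) , b /ℕ a ℤ.+ 1ℤ , trans (a≡a%ℕn+[a/ℕn]*n b a) eq , subst (λ m → 2 ℕ.* m ℕ.≤ a) (sym (ℤ.∣-i∣≡∣i∣ (ℤ.+ (a ℕ.∸ s)))) bound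
          where
          s≤a : s ℕ.≤ a
          s≤a = ℕ.<⇒≤ (n%ℕd<d b a)
          eq : ℤ.+ s ℤ.+ (b /ℕ a) ℤ.* ℤ.+ a ≡ ℤ.- ℤ.+ (a ℕ.∸ s) ℤ.+ (b /ℕ a ℤ.+ 1ℤ) ℤ.* ℤ.+ a
          eq = trans (lemma (ℤ.+ s) (ℤ.+ (a ℕ.∸ s)) ((b /ℕ a) ℤ.* ℤ.+ a)) (trans (cong (λ A → ℤ.- ℤ.+ (a ℕ.∸ s) ℤ.+ A ℤ.+ (b /ℕ a) ℤ.* ℤ.+ a) (cong ℤ.+_ (ℕ.m+[n∸m]≡n s≤a))) (lemma₂ (ℤ.- ℤ.+ (a ℕ.∸ s)) (ℤ.+ a) (b /ℕ a)))
            where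
            lemma : ∀ s t q → s ℤ.+ q ≡ ℤ.- t ℤ.+ (s ℤ.+ t) ℤ.+ q
            lemma = ℤSolver.solve-∀
            lemma₂ : ∀ t A q → t ℤ.+ A ℤ.+ q ℤ.* A ≡ t ℤ.+ (q ℤ.+ 1ℤ) ℤ.* A
            lemma₂ = ℤSolver.solve-∀
          bound : 2 ℕ.* (a ℕ.∸ s) ℕ.≤ a
          bound = ℕ.+-cancelʳ-≤ (2 ℕ.* s) _ _ (begin
            2 ℕ.* (a ℕ.∸ s) ℕ.+ 2 ℕ.* s    ≡⟨ ℕ.*-distribˡ-+ 2 (a ℕ.∸ s) s ⟨
            2 ℕ.* (a ℕ.∸ s ℕ.+ s)          ≡⟨ cong (2 ℕ.*_) (ℕ.m∸n+n≡m s≤a) ⟩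
            2 ℕ.* a                        ≡⟨ cong (a ℕ.+_) (ℕ.+-identityʳ a) ⟩
            a ℕ.+ a                        ≤⟨ ℕ.+-monoʳ-≤ a (ℕ.<⇒≤ (ℕ.≰⇒> 2s≰a)) ⟩
            a ℕ.+ 2 ℕ.* s                  ∎)
            where open ℕ.≤-Reasoning

      translated : ∀ a c b r k → b ≡ r ℤ.+ k ℤ.* a → a ℤ.* c ≡ b ℤ.* b ℤ.- d → a ℤ.* (c ℤ.- ℤ.+ 2 ℤ.* k ℤ.* r ℤ.- k ℤ.* k ℤ.* a) ≡ r ℤ.* r ℤ.- d
      translated a c b r k b≡ ac≡ = trans (lemma₁ a c k r) (trans (cong (λ z → z ℤ.- (ℤ.+ 2 ℤ.* k ℤ.* r ℤ.* a ℤ.+ k ℤ.* k ℤ.* a ℤ.* a)) ac≡)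
        (trans (cong (λ b → b ℤ.* b ℤ.- d ℤ.- (ℤ.+ 2 ℤ.* k ℤ.* r ℤ.* a ℤ.+ k ℤ.* k ℤ.* a ℤ.* a)) b≡) (lemma₂ r k a d)))
        where
        lemma₁ : ∀ a c k r → a ℤ.* (c ℤ.- ℤ.+ 2 ℤ.* k ℤ.* r ℤ.- k ℤ.* k ℤ.* a) ≡ a ℤ.* c ℤ.- (ℤ.+ 2 ℤ.* k ℤ.* r ℤ.* a ℤ.+ k ℤ.* k ℤ.* a ℤ.* a)
        lemma₁ = ℤSolver.solve-∀
        lemma₂ : ∀ r k a d → (r ℤ.+ k ℤ.* a) ℤ.* (r ℤ.+ k ℤ.* a) ℤ.- d ℤ.- (ℤ.+ 2 ℤ.* k ℤ.* r ℤ.* a ℤ.+ k ℤ.* k ℤ.* a ℤ.* a) ≡ r ℤ.* r ℤ.- d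
        lemma₂ = ℤSolver.solve-∀

      quotient-positive : ∀ a r c → 0 ℕ.< a → ℤ.+ a ℤ.* c ≡ r ℤ.* r ℤ.- d → ∃[ c′ ] c ≡ ℤ.+ c′ × 0 ℕ.< c′ × a ℕ.* c′ ≡ ℤ.∣ r ∣ ℕ.* ℤ.∣ r ∣ ℕ.+ n
      quotient-positive a r c 0<a ac≡ = go c (trans ac≡ (trans (cong (λ d → r ℤ.* r ℤ.- d) d≡-n) (trans (cong₂ ℤ._+_ (square≡∣∣² r) (ℤ.neg-involutive (ℤ.+ n))) refl)))
        where
        N : ℕ
        N = ℤ.∣ r ∣ ℕ.* ℤ.∣ r ∣ ℕ.+ n
        0<N : 0 ℕ.< N
        0<N = ℕ.≤-trans (ℕ.≤-trans (ℕ.s≤s ℕ.z≤n) 2≤n) (ℕ.m≤n+m n _)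
        go : ∀ c → ℤ.+ a ℤ.* c ≡ ℤ.+ N → ∃[ c′ ] c ≡ ℤ.+ c′ × 0 ℕ.< c′ × a ℕ.* c′ ≡ N
        go (ℤ.+ zero) eq = contradiction (ℤ.+-injective (trans (sym (ℤ.*-zeroʳ (ℤ.+ a))) eq)) (ℕ.<⇒≢ 0<N)
        go (ℤ.+ suc c) eq = suc c , refl , ℕ.z<s , ℤ.+-injective (trans (ℤ.pos-* a (suc c)) eq)
        go (-[1+ c ]) eq = contradiction (trans (ℤ.neg-distribʳ-* (ℤ.+ a) (ℤ.+ suc c)) eq) (negative a 0<a)
          where
          negative : ∀ a → 0 ℕ.< a → ℤ.- (ℤ.+ a ℤ.* ℤ.+ suc c) ≢ ℤ.+ N
          negative (suc a) _ ()

      -- From 4ac = (2r)² + 4n < a² + 4a follows 4c < a + 4, and a + 4 ≤ 4a because a > n ≥ 2.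
      quotient-smaller : ∀ {a r c} → n ℕ.< a → 2 ℕ.* r ℕ.≤ a → a ℕ.* c ≡ r ℕ.* r ℕ.+ n → c ℕ.< a
      quotient-smaller {a} {r} {c} n<a 2r≤a ac≡ = ℕ.*-cancelˡ-< 4 c a (ℕ.<-≤-trans (ℕ.*-cancelˡ-< a _ _ (begin-strict
        a ℕ.* (4 ℕ.* c)                      ≡⟨ lemma₁ a c ⟩
        4 ℕ.* (a ℕ.* c)                      ≡⟨ cong (4 ℕ.*_) ac≡ ⟩
        4 ℕ.* (r ℕ.* r ℕ.+ n)                ≡⟨ lemma₂ r n ⟩
        2 ℕ.* r ℕ.* (2 ℕ.* r) ℕ.+ 4 ℕ.* n    <⟨ ℕ.+-mono-≤-< (ℕ.*-mono-≤ 2r≤a 2r≤a) (ℕ.*-monoʳ-< 4 n<a) ⟩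
        a ℕ.* a ℕ.+ 4 ℕ.* a                  ≡⟨ lemma₃ a ⟩
        a ℕ.* (a ℕ.+ 4)                      ∎)) (begin
        a ℕ.+ 4                              ≤⟨ ℕ.+-monoʳ-≤ a (ℕ.*-monoʳ-≤ 2 2≤a) ⟩
        a ℕ.+ 2 ℕ.* a                        ≤⟨ ℕ.m≤m+n _ a ⟩
        a ℕ.+ 2 ℕ.* a ℕ.+ a                  ≡⟨ lemma₄ a ⟩
        4 ℕ.* a                              ∎))
        where
        open ℕ.≤-Reasoning
        2≤a : 2 ℕ.≤ a
        2≤a = ℕ.≤-trans 2≤n (ℕ.<⇒≤ n<a)
        lemma₁ : ∀ a c → a ℕ.* (4 ℕ.* c) ≡ 4 ℕ.* (a ℕ.* c)
        lemma₁ = ℕSolver.solve-∀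
        lemma₂ : ∀ r n → 4 ℕ.* (r ℕ.* r ℕ.+ n) ≡ 2 ℕ.* r ℕ.* (2 ℕ.* r) ℕ.+ 4 ℕ.* n
        lemma₂ = ℕSolver.solve-∀
        lemma₃ : ∀ a → a ℕ.* a ℕ.+ 4 ℕ.* a ≡ a ℕ.* (a ℕ.+ 4)
        lemma₃ = ℕSolver.solve-∀
        lemma₄ : ∀ a → a ℕ.+ 2 ℕ.* a ℕ.+ a ≡ 4 ℕ.* a
        lemma₄ = ℕSolver.solve-∀

    -- Descent on the first coefficient of the form (a, 2b, c): while a > n, b is replaced by its
    -- absolutely least residue modulo a, and flipping the lattice puts c < a in place of a.
    reduce : ∀ a b c → Acc ℕ._<_ a → 0 ℕ.< a → ℤ.+ a ℤ.* c ≡ b ℤ.* b ℤ.- d → Reduced (L (ℤ.+ a) b)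
    reduce a b c (acc rec) 0<a ac≡ = go (a ℕ.≤? n)
      where
      instance
        a≢0 : ℕ.NonZero a
        a≢0 = ℕ.>-nonZero 0<a
      go : Dec (a ℕ.≤ n) → Reduced (L (ℤ.+ a) b)
      go (yes a≤n) = a , s , _ , 0<a , a≤n , n%ℕd<d b a , translated (ℤ.+ a) c b (ℤ.+ s) (b /ℕ a) b≡ ac≡ ,
        subst (λ b → L (ℤ.+ a) b ≃ L (ℤ.+ a) (ℤ.+ s)) (sym b≡) (L-translate (ℤ.+ a) (ℤ.+ s) (b /ℕ a))
        where
        s : ℕ
        s = b %ℕ a
        b≡ : b ≡ ℤ.+ s ℤ.+ (b /ℕ a) ℤ.* ℤ.+ a
        b≡ = a≡a%ℕn+[a/ℕn]*n b a
      go (no a≰n) = step (centered-residue a b)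
        where
        step : ∃[ r ] ∃[ k ] b ≡ r ℤ.+ k ℤ.* ℤ.+ a × 2 ℕ.* ℤ.∣ r ∣ ℕ.≤ a → Reduced (L (ℤ.+ a) b)
        step (r , k , b≡ , 2r≤a) = step′ (c ℤ.- ℤ.+ 2 ℤ.* k ℤ.* r ℤ.- k ℤ.* k ℤ.* ℤ.+ a) (translated (ℤ.+ a) c b r k b≡ ac≡)
          where
          step′ : ∀ c → ℤ.+ a ℤ.* c ≡ r ℤ.* r ℤ.- d → Reduced (L (ℤ.+ a) b)
          step′ c ac≡ = step″ (quotient-positive a r c 0<a ac≡)
            where
            step″ : ∃[ c′ ] c ≡ ℤ.+ c′ × 0 ℕ.< c′ × a ℕ.* c′ ≡ ℤ.∣ r ∣ ℕ.* ℤ.∣ r ∣ ℕ.+ n → Reduced (L (ℤ.+ a) b)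
            step″ (c′ , refl , 0<c′ , ac′≡) = transport (reduce c′ (ℤ.- r) (ℤ.+ a) (rec (quotient-smaller {a} {ℤ.∣ r ∣} (ℕ.≰⇒> a≰n) 2r≤a ac′≡)) 0<c′
              (trans (ℤ.*-comm (ℤ.+ c′) (ℤ.+ a)) (trans ac≡ (lemma r d))))
              where
              lemma : ∀ b d → b ℤ.* b ℤ.- d ≡ ℤ.- b ℤ.* ℤ.- b ℤ.- d
              lemma = ℤSolver.solve-∀
              L≃ : L (ℤ.+ a) b ≃ L (ℤ.+ c′) (ℤ.- r)
              L≃ = ≃-trans (L (ℤ.+ a) b) (L (ℤ.+ a) r) (L (ℤ.+ c′) (ℤ.- r))
                (subst (λ b → L (ℤ.+ a) b ≃ L (ℤ.+ a) r) (sym b≡) (L-translate (ℤ.+ a) r k)) (L-flip (+≢0 0<a) (+≢0 0<c′) ac≡)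
              transport : Reduced (L (ℤ.+ c′) (ℤ.- r)) → Reduced (L (ℤ.+ a) b)
              transport (a₁ , b₁ , c₁ , h₁ , h₂ , h₃ , h₄ , L′≃) = a₁ , b₁ , c₁ , h₁ , h₂ , h₃ , h₄ , ≃-trans (L (ℤ.+ a) b) (L (ℤ.+ c′) (ℤ.- r)) (L (ℤ.+ a₁) (ℤ.+ b₁)) L≃ L′≃

    private
      representative : ℕ × ℕ → FractionalIdeal F
      representative (zero , b)  = standard 1 (ℤ.+ b) ℕ.z<s
      representative (suc a , b) = standard (suc a) (ℤ.+ b) ℕ.z<s

      representatives : List (FractionalIdeal F)
      representatives = map representative (cartesianProduct (upTo (suc n)) (upTo n))

      representative-covers : ∀ I → Reduced (members I) → Any (_∼_ F I) representatives
      representative-covers I (suc a , b , c , _ , a≤n , b<a , ac≡ , I≃L) = Any.map⁺ (lose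
        (∈-cartesianProduct⁺ (∈-upTo⁺ (ℕ.s≤s a≤n)) (∈-upTo⁺ (ℕ.<-≤-trans b<a a≤n))) I∼)
        where
        S : FractionalIdeal F
        S = standard (suc a) (ℤ.+ b) ℕ.z<s
        I∼ : members I ≃ members S
        I∼ = ≃-trans (members I) (L (ℤ.+ suc a) (ℤ.+ b)) (members S) I≃L
          (≃-sym (members S) (L (ℤ.+ suc a) (ℤ.+ b)) (≃-equal (members S) (L (ℤ.+ suc a) (ℤ.+ b)) (standard⇔L (suc a) (ℤ.+ b) c ℕ.z<s ac≡)))

      covers : ∀ I → Any (_∼_ F I) representatives
      covers I = representative-covers I (from-normal (ideal-normal-form I))
        where
        from-normal : NormalForm (members I) → Reduced (members I)
        from-normal (a , b , c , 0<a , ac≡ , I≃L) = from-reduced (reduce a b c (<-wellFounded a) 0<a ac≡)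
          where
          from-reduced : Reduced (L (ℤ.+ a) b) → Reduced (members I)
          from-reduced (a₁ , b₁ , c₁ , h₁ , h₂ , h₃ , h₄ , L≃) = a₁ , b₁ , c₁ , h₁ , h₂ , h₃ , h₄ , ≃-trans (members I) (L (ℤ.+ a) b) (L (ℤ.+ a₁) (ℤ.+ b₁)) I≃L L≃

    class-number : ∃ (HasClassNumber (ℚ⟮√ d ⟯ sf d≢1))
    class-number = finite-class-number (ℚ⟮√ d ⟯ sf d≢1) ∼? representatives covers

-- Free actions of a cyclic group of prime order on a finite set

module FreeActions where
  open import Data.Fin.Base using (Fin)
  open import Data.List.Base using (List; []; _∷_; _++_; [_]; length; applyUpTo)
  open import Data.List.Membership.Propositional using (_∈_; _∉_)
  open import Data.List.Membership.Propositional.Properties using (∈-∃++; ∈-++⁺ʳ; ∈-++⁻; ∈-applyUpTo⁺; ∈-applyUpTo⁻; ∈-allFin)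
  open import Data.List.Properties using (length-++; length-applyUpTo; length-tabulate)
  open import Data.List.Relation.Binary.Permutation.Propositional using (_↭_; ↭-refl; ↭-trans; ↭-prep)
  open import Data.List.Relation.Binary.Permutation.Propositional.Properties using (shift; ∈-resp-↭; ↭-length)
  import Data.List.Relation.Binary.Permutation.Setoid.Properties as Permutation
  import Data.List.Relation.Unary.All as All
  open import Data.List.Relation.Unary.AllPairs using ([]; _∷_)
  open import Data.List.Relation.Unary.Any using (here; there)
  open import Data.List.Relation.Unary.Unique.Propositional using (Unique)
  open import Data.List.Relation.Unary.Unique.Propositional.Properties using (applyUpTo⁺₁; allFin⁺)
  open import Data.Nat.Base
  open import Data.Nat.Coprimality using (coprime-Bézout; prime⇒coprime)
  open import Data.Nat.Divisibility using (_∣_; ∣-refl; ∣m∣n⇒∣m+n; divides)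
  open import Data.Nat.GCD using (module Bézout)
  open import Data.Nat.Induction using (<-wellFounded)
  open import Data.Nat.Primality using (Prime; prime⇒nonZero)
  open import Data.Nat.Properties
  open import Data.Product.Base using (∃-syntax; _×_; _,_; proj₁; proj₂)
  open import Data.Sum.Base using ([_,_]′)
  open import Function.Bundles using (Bijection)
  open import Induction.WellFounded using (Acc; acc)
  open import Level using (0ℓ)
  open import Relation.Binary.Bundles using (Setoid)
  open import Relation.Binary.PropositionalEquality
  open import Relation.Nullary.Negation using (¬_; contradiction)

  private
    variable
      A : Set

  unique-resp-↭ : {xs ys : List A} → xs ↭ ys → Unique xs → Unique ys
  unique-resp-↭ {A} p = Permutation.Unique-resp-↭ (setoid A) (Permutation-setoid p)
    where
    open import Data.List.Relation.Binary.Permutation.Propositional using () renaming (↭⇒↭ₛ to Permutation-setoid)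

  unique-++⁻ : (xs : List A) {ys : List A} → Unique (xs ++ ys) → Unique ys × (∀ {x} → x ∈ xs → x ∉ ys)
  unique-++⁻ []       u = u , λ ()
  unique-++⁻ (x ∷ xs) (x≢ ∷ u) = proj₁ (unique-++⁻ xs u) , λ
    { (here refl) x∈ys → All.lookup x≢ (∈-++⁺ʳ xs x∈ys) refl
    ; (there x∈)       → proj₂ (unique-++⁻ xs u) x∈ }

  remove : {os xs : List A} → Unique os → (∀ {x} → x ∈ os → x ∈ xs) → ∃[ rest ] xs ↭ os ++ rest
  remove {os = []} {xs} _ _ = xs , ↭-refl
  remove {os = o ∷ os} {xs} (o≢ ∷ u) sub with ∈-∃++ (sub (here refl))
  ... | ys , zs , refl = proj₁ ih , ↭-trans (shift o ys zs) (↭-prep o (proj₂ ih))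
    where
    sub′ : ∀ {x} → x ∈ os → x ∈ ys ++ zs
    sub′ x∈ with ∈-resp-↭ (shift o ys zs) (sub (there x∈))
    ... | here refl = contradiction refl (All.lookup o≢ x∈)
    ... | there x∈′ = x∈′
    ih : ∃[ rest ] ys ++ zs ↭ os ++ rest
    ih = remove u sub′

  iterate : (A → A) → ℕ → A → A
  iterate σ zero    x = x
  iterate σ (suc k) x = σ (iterate σ k x)

  iterate-+ : ∀ (σ : A → A) m n x → iterate σ (m + n) x ≡ iterate σ m (iterate σ n x)
  iterate-+ σ zero    n x = refl
  iterate-+ σ (suc m) n x = cong σ (iterate-+ σ m n x)

  iterate-* : ∀ (σ : A → A) k {x} → iterate σ k x ≡ x → ∀ m → iterate σ (m * k) x ≡ x
  iterate-* σ k eq zero    = refl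
  iterate-* σ k {x} eq (suc m) = trans (iterate-+ σ k (m * k) x) (trans (cong (iterate σ k) (iterate-* σ k eq m)) eq)

  module _ {ℓ : ℕ} (ℓ-prime : Prime ℓ) (σ : A → A) (period : ∀ x → iterate σ ℓ x ≡ x) (free : ∀ x → σ x ≢ x) where

    private
      instance
        ℓ≢0 : NonZero ℓ
        ℓ≢0 = prime⇒nonZero ℓ-prime

      -- By Bézout, consecutive numbers occur among the multiples of k and of ℓ, so a point fixed by
      -- the k-th and the ℓ-th iterate would be fixed by σ.
      no-shorter-period : ∀ k .{{_ : NonZero k}} → k < ℓ → ∀ x → iterate σ k x ≢ x
      no-shorter-period k k<ℓ x eq with coprime-Bézout (prime⇒coprime ℓ-prime k<ℓ)
      ... | Bézout.+- a b e = free x (trans (cong σ (sym (iterate-* σ k eq b))) (trans (cong (λ m → iterate σ m x) e) (iterate-* σ ℓ (period x) a)))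
      ... | Bézout.-+ a b e = free x (trans (cong σ (sym (iterate-* σ ℓ (period x) a))) (trans (cong (λ m → iterate σ m x) e) (iterate-* σ k eq b)))

      orbit : A → List A
      orbit x = applyUpTo (λ k → iterate σ k x) ℓ

      -- If the i-th and j-th iterates of x agree, applying σ another ℓ - i times shows that the
      -- iterate of order j - i fixes x.
      orbit-unique : ∀ x → Unique (orbit x)
      orbit-unique x = applyUpTo⁺₁ (λ k → iterate σ k x) ℓ (λ {i} {j} i<j j<ℓ eq →
        no-shorter-period (j ∸ i) {{>-nonZero (m<n⇒0<n∸m i<j)}} (≤-<-trans (m∸n≤m j i) j<ℓ) x
          (trans (sym (trans (iterate-+ σ ℓ (j ∸ i) x) (period _)))
            (trans (cong (λ m → iterate σ m x) (eq₁ (<⇒≤ i<j) (<⇒≤ (<-trans i<j j<ℓ))))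
              (trans (iterate-+ σ (ℓ ∸ i) j x) (trans (cong (iterate σ (ℓ ∸ i)) (sym eq))
                (trans (sym (iterate-+ σ (ℓ ∸ i) i x)) (trans (cong (λ m → iterate σ m x) (m∸n+n≡m (<⇒≤ (<-trans i<j j<ℓ)))) (period x))))))))
        where
        eq₁ : ∀ {i j} → i ≤ j → i ≤ ℓ → ℓ + (j ∸ i) ≡ ℓ ∸ i + j
        eq₁ {i} {j} i≤j i≤ℓ = trans (sym (+-∸-assoc ℓ i≤j)) (+-∸-comm j i≤ℓ)

      orbit-closed : ∀ {x y} → y ∈ orbit x → σ y ∈ orbit x
      orbit-closed {x} y∈ with ∈-applyUpTo⁻ (λ k → iterate σ k x) y∈
      ... | k , k<ℓ , refl = [ (λ sk<ℓ → ∈-applyUpTo⁺ (λ k → iterate σ k x) sk<ℓ)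
                             , (λ sk≡ℓ → subst (_∈ orbit x) (sym (trans (cong (λ m → iterate σ m x) sk≡ℓ) (period x))) (∈-applyUpTo⁺ (λ k → iterate σ k x) (>-nonZero⁻¹ ℓ))) ]′
        (m≤n⇒m<n∨m≡n k<ℓ)

      iterate-closed : ∀ (P : A → Set) → (∀ {y} → P y → P (σ y)) → ∀ k {y} → P y → P (iterate σ k y)
      iterate-closed P closed zero    p = p
      iterate-closed P closed (suc k) p = closed (iterate-closed P closed k p)

      -- The iterate of order ℓ - 1 inverts σ. This makes the complement of an orbit stable.
      σ⁻¹-closed : ∀ (P : A → Set) → (∀ {y} → P y → P (σ y)) → ∀ {y} → P (σ y) → P y
      σ⁻¹-closed P closed {y} p = subst P (trans (sym (iterate-+ σ (pred ℓ) 1 y)) (trans (cong (λ m → iterate σ m y) (trans (+-comm (pred ℓ) 1) (suc-pred ℓ))) (period y)))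
        (iterate-closed P closed (pred ℓ) p)

      -- Removing the orbit of the first element takes away exactly ℓ elements and leaves a shorter
      -- stable list.
      divides-closed : ∀ xs → Acc _<_ (length xs) → Unique xs → (∀ {x} → x ∈ xs → σ x ∈ xs) → ℓ ∣ length xs
      divides-closed [] _ _ _ = divides 0 refl
      divides-closed xs@(x ∷ _) (acc rec) u closed = from (remove (orbit-unique x) sub)
        where
        sub : ∀ {y} → y ∈ orbit x → y ∈ xs
        sub y∈ with ∈-applyUpTo⁻ (λ k → iterate σ k x) y∈
        ... | k , _ , refl = iterate-closed (_∈ xs) closed k (here refl)
        from : ∃[ rest ] xs ↭ orbit x ++ rest → ℓ ∣ length xs
        from (rest , p) = subst (ℓ ∣_) (sym eq) (∣m∣n⇒∣m+n ∣-refl (divides-closed rest (rec rest<xs) (proj₁ split) rest-closed))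
          where
          eq : length xs ≡ ℓ + length rest
          eq = trans (↭-length p) (trans (length-++ (orbit x)) (cong (_+ length rest) (length-applyUpTo (λ k → iterate σ k x) ℓ)))
          rest<xs : length rest < length xs
          rest<xs = subst (length rest <_) (sym eq) (m<n+m (length rest) (>-nonZero⁻¹ ℓ))
          split : Unique rest × (∀ {y} → y ∈ orbit x → y ∉ rest)
          split = unique-++⁻ (orbit x) (unique-resp-↭ p u)
          rest-closed : ∀ {y} → y ∈ rest → σ y ∈ rest
          rest-closed {y} y∈ = [ (λ σy∈ → contradiction y∈ (proj₂ split (σ⁻¹-closed (_∈ orbit x) orbit-closed σy∈))) , (λ σy∈ → σy∈) ]′
            (∈-++⁻ (orbit x) (∈-resp-↭ p (closed (∈-resp-↭ (↭-sym p) (∈-++⁺ʳ (orbit x) y∈)))))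
            where open import Data.List.Relation.Binary.Permutation.Propositional using (↭-sym)

    prime∣length : ∀ {xs} → Unique xs → (∀ x → x ∈ xs) → ℓ ∣ length xs
    prime∣length {xs} u all = divides-closed xs (<-wellFounded _) u (λ _ → all _)

  prime∣Fin : ∀ {ℓ h} → Prime ℓ → (σ : Fin h → Fin h) → (∀ i → iterate σ ℓ i ≡ i) → (∀ i → σ i ≢ i) → ℓ ∣ h
  prime∣Fin {ℓ} {h} ℓ-prime σ period free = subst (ℓ ∣_) (length-tabulate {n = h} (λ i → i)) (prime∣length ℓ-prime σ period free (allFin⁺ h) ∈-allFin)

  module _ (S : Setoid 0ℓ 0ℓ) where
    open Setoid S using (Carrier; _≈_) renaming (trans to ≈-trans; sym to ≈-sym; reflexive to ≈-reflexive)

    -- The action satisfies its laws only up to ≈. Transported to `Fin h` along the bijection it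
    -- satisfies them as equalities, as orbit counting requires.
    prime∣cardinality : ∀ {ℓ h} → Prime ℓ → Bijection (setoid (Fin h)) S → (act : Carrier → Carrier) →
      (∀ {x y} → x ≈ y → act x ≈ act y) → (∀ x → x ≈ iterate act ℓ x) → (∀ x → ¬ x ≈ act x) → ℓ ∣ h
    prime∣cardinality {ℓ} {h} ℓ-prime bij act act-cong period free = prime∣Fin ℓ-prime σ
      (λ i → injective (≈-trans (to-iterate ℓ i) (≈-sym (period (to i)))))
      (λ i σi≡i → free (to i) (≈-trans (≈-reflexive (cong to (sym σi≡i))) (to-σ i)))
      where
      open Bijection bij using (to; injective; surjective)
      σ : Fin h → Fin h
      σ i = proj₁ (surjective (act (to i)))
      to-σ : ∀ i → to (σ i) ≈ act (to i)
      to-σ i = proj₂ (surjective (act (to i))) refl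
      to-iterate : ∀ k i → to (iterate σ k i) ≈ iterate act k (to i)
      to-iterate zero    i = ≈-reflexive refl
      to-iterate (suc k) i = ≈-trans (to-σ (iterate σ k i)) (act-cong (to-iterate k i))

-- The action of the ideal (g, ω) on ideal classes

module Actions where
  open import Defs
  open Decision
  open Field
  open FreeActions
  open Integers
  open Lattices
  open import Data.Integer.Base as ℤ using (ℤ; 0ℤ; 1ℤ)
  open import Data.Integer.Divisibility.Signed as ℤ using (∣⇒∣ᵤ) renaming (_∣_ to _∣ℤ_)
  import Data.Integer.Properties as ℤ
  import Data.Integer.Tactic.RingSolver as ℤSolver
  open import Data.List.Base using (List; []; _∷_; map; _++_)
  open import Data.List.Relation.Unary.Any as Any using (Any)
  import Data.List.Relation.Unary.Any.Properties as Any
  open import Data.Nat.Base as ℕ using (ℕ; zero; suc)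
  open import Data.Nat.Divisibility using (_∣_; ∣-antisym)
  import Data.Nat.Properties as ℕ
  open import Data.Product.Base using (∃-syntax; _×_; _,_; proj₁; proj₂)
  open import Function.Bundles using (mk⇔; module Equivalence)
  open import Relation.Binary.PropositionalEquality
  open import Relation.Nullary.Negation using (¬_; contradiction)

  -- The ideal (g, ω), where ω = P + Q√d has norm gk. The relation x tr(ω) + yg + zk = 1 makes it
  -- invertible: its product with its conjugate is (g).
  module Multiplication (d : ℤ) (sf : Squarefree d) (d≢1 : d ≢ 1ℤ) (e : ℤ) (d≡2e : d ≡ ℤ.+ 2 ℤ.* e)
    (n : ℕ) (d≡-n : d ≡ ℤ.- ℤ.+ n) (2≤n : 2 ℕ.≤ n)
    (g : ℕ) (0<g : 0 ℕ.< g) (P Q k x y z : ℤ) (norm-ω : P ℤ.* P ℤ.- d ℤ.* (Q ℤ.* Q) ≡ ℤ.+ g ℤ.* k)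
    (bezout : x ℤ.* (P ℤ.+ P) ℤ.+ y ℤ.* ℤ.+ g ℤ.+ z ℤ.* k ≡ 1ℤ) where
    open Quadratic d
    open IntegralElements d
    open Bounded sf d≢1
    open EvenRadicand e d≡2e
    open Homothety d
    open Ideals d sf d≢1 e d≡2e
    open ImaginaryIdeals d sf d≢1 e d≡2e n d≡-n 2≤n
    open Equivalence
    open FractionalIdeal

    ω ω̄ G : K
    ω = int P Q
    ω̄ = int P (ℤ.- Q)
    G = ⟦ ℤ.+ g ⟧

    g≢0 : ℤ.+ g ≢ 0ℤ
    g≢0 = +≢0 0<g

    G-unit : Unit G
    G-unit = ⟦⟧-unit g≢0

    conj-ω : conj ω ≡ ω̄
    conj-ω = conj-int P Q

    int*conj : ∀ u v → int u v * conj (int u v) ≡ ⟦ u ℤ.* u ℤ.- d ℤ.* (v ℤ.* v) ⟧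
    int*conj u v = trans (cong (int u v *_) (conj-int u v)) (trans (sym (int-* u v u (ℤ.- v))) (cong₂ int (lemma₁ d u v) (lemma₂ u v)))
      where
      lemma₁ : ∀ d P Q → P ℤ.* P ℤ.+ d ℤ.* (Q ℤ.* ℤ.- Q) ≡ P ℤ.* P ℤ.- d ℤ.* (Q ℤ.* Q)
      lemma₁ = ℤSolver.solve-∀
      lemma₂ : ∀ P Q → P ℤ.* ℤ.- Q ℤ.+ Q ℤ.* P ≡ 0ℤ
      lemma₂ = ℤSolver.solve-∀

    ωω̄≡Gk : ω * ω̄ ≡ G * ⟦ k ⟧
    ωω̄≡Gk = trans (cong (ω *_) (sym conj-ω)) (trans (int*conj P Q) (trans (cong ⟦_⟧ norm-ω) (⟦⟧-* (ℤ.+ g) k)))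

    ω+ω̄ : ω + ω̄ ≡ ⟦ P ℤ.+ P ⟧
    ω+ω̄ = trans (sym (int-+ P Q P (ℤ.- Q))) (cong (int (P ℤ.+ P)) (ℤ.+-inverseʳ Q))

    unity : ⟦ x ⟧ * (ω + ω̄) + ⟦ y ⟧ * G + ⟦ z ⟧ * ⟦ k ⟧ ≡ 1#
    unity = begin
      ⟦ x ⟧ * (ω + ω̄) + ⟦ y ⟧ * G + ⟦ z ⟧ * ⟦ k ⟧                        ≡⟨ cong (λ t → ⟦ x ⟧ * t + ⟦ y ⟧ * G + ⟦ z ⟧ * ⟦ k ⟧) ω+ω̄ ⟩
      ⟦ x ⟧ * ⟦ P ℤ.+ P ⟧ + ⟦ y ⟧ * G + ⟦ z ⟧ * ⟦ k ⟧                    ≡⟨ cong₂ _+_ (cong₂ _+_ (⟦⟧-* x (P ℤ.+ P)) (⟦⟧-* y (ℤ.+ g))) (⟦⟧-* z k) ⟨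
      ⟦ x ℤ.* (P ℤ.+ P) ⟧ + ⟦ y ℤ.* ℤ.+ g ⟧ + ⟦ z ℤ.* k ⟧                ≡⟨ trans (⟦⟧-+ (x ℤ.* (P ℤ.+ P) ℤ.+ y ℤ.* ℤ.+ g) (z ℤ.* k)) (cong (_+ ⟦ z ℤ.* k ⟧) (⟦⟧-+ (x ℤ.* (P ℤ.+ P)) (y ℤ.* ℤ.+ g))) ⟨
      ⟦ x ℤ.* (P ℤ.+ P) ℤ.+ y ℤ.* ℤ.+ g ℤ.+ z ℤ.* k ⟧                    ≡⟨ cong ⟦_⟧ bezout ⟩
      1#                                                                 ∎
      where open ≡-Reasoning

    span-++⁺ : ∀ gs hs {u v} → Span F gs u → Span F hs v → Span F (gs ++ hs) (u + v)
    span-++⁺ [] hs {v = v} refl v∈ = subst (Span F hs) (sym (+-identityˡ v)) v∈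
    span-++⁺ (γ ∷ gs) hs {v = v} (r , u′ , ri , u′∈ , refl) v∈ = r , u′ + v , ri , span-++⁺ gs hs u′∈ v∈ , +-assoc (r * γ) u′ v

    span-++⁻ : ∀ gs hs {w} → Span F (gs ++ hs) w → ∃[ u ] ∃[ v ] Span F gs u × Span F hs v × w ≡ u + v
    span-++⁻ [] hs {w} w∈ = 0# , w , refl , w∈ , sym (+-identityˡ w)
    span-++⁻ (γ ∷ gs) hs (r , w′ , ri , w′∈ , refl) = extend (span-++⁻ gs hs w′∈)
      where
      extend : ∃[ u ] ∃[ v ] Span F gs u × Span F hs v × w′ ≡ u + v → ∃[ u ] ∃[ v ] Span F (γ ∷ gs) u × Span F hs v × r * γ + w′ ≡ u + v
      extend (u , v , u∈ , v∈ , refl) = r * γ + u , v , (r , u , ri , u∈ , refl) , v∈ , sym (+-assoc (r * γ) u v)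

    -- The product of the ideal (g, ω) with I, presented by generators.
    act : FractionalIdeal F → FractionalIdeal F
    act I = record
      { generators = map (G *_) (generators I) ++ map (ω *_) (generators I)
      ; nonzero    = Any.++⁺ˡ (Any.map⁺ (Any.map (λ γ≢0 Gγ≡0 → γ≢0 (unit-cancel G G-unit (trans Gγ≡0 (sym (zeroʳ G))))) (nonzero I)))
      }

    Combination : (K → Set) → K → Set
    Combination M w = ∃[ u ] ∃[ v ] M u × M v × w ≡ G * u + ω * v

    act⁺ : ∀ I {w} → Combination (members I) w → members (act I) w
    act⁺ I (u , v , u∈ , v∈ , refl) = span-++⁺ (map (G *_) (generators I)) (map (ω *_) (generators I)) (span-scale G (generators I) u∈) (span-scale ω (generators I) v∈)

    act⁻ : ∀ I {w} → members (act I) w → Combination (members I) w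
    act⁻ I {w} w∈ = split (span-++⁻ (map (G *_) (generators I)) (map (ω *_) (generators I)) w∈)
      where
      split : ∃[ u ] ∃[ v ] Span F (map (G *_) (generators I)) u × Span F (map (ω *_) (generators I)) v × w ≡ u + v → Combination (members I) w
      split (u , v , u∈ , v∈ , w≡) = combine (span-unscale G (generators I) u∈) (span-unscale ω (generators I) v∈)
        where
        combine : ∃[ u′ ] u ≡ G * u′ × members I u′ → ∃[ v′ ] v ≡ ω * v′ × members I v′ → Combination (members I) w
        combine (u′ , u≡ , u′∈) (v′ , v≡ , v′∈) = u′ , v′ , u′∈ , v′∈ , trans w≡ (cong₂ _+_ u≡ v≡)

    act-cong : ∀ {I J : FractionalIdeal F} → members I ≃ members J → members (act I) ≃ members (act J)
    act-cong {I} {J} (α , (α′ , αα′≡1) , I⇔J) = α , (α′ , αα′≡1) , λ w → mk⇔ (forward w) (backward w)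
      where
      forward : ∀ w → members (act I) w → members (act J) (α * w)
      forward w w∈ = go (act⁻ I w∈)
        where
        go : Combination (members I) w → members (act J) (α * w)
        go (u , v , u∈ , v∈ , w≡) = act⁺ J (α * u , α * v , to (I⇔J u) u∈ , to (I⇔J v) v∈ ,
          trans (cong (α *_) w≡) (solve 5 (λ α g u ω v → α :* (g :* u :+ ω :* v) := g :* (α :* u) :+ ω :* (α :* v)) refl α G u ω v))
      backward : ∀ w → members (act J) (α * w) → members (act I) w
      backward w αw∈ = go (act⁻ J αw∈)
        where
        go : Combination (members J) (α * w) → members (act I) w
        go (u , v , u∈ , v∈ , αw≡) = act⁺ I (α′ * u , α′ * v , pull u∈ , pull v∈ , (begin
          w                              ≡⟨ cancel α′ α (trans (*-comm α′ α) αα′≡1) w ⟨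
          α′ * (α * w)                   ≡⟨ cong (α′ *_) αw≡ ⟩
          α′ * (G * u + ω * v)           ≡⟨ solve 5 (λ α g u ω v → α :* (g :* u :+ ω :* v) := g :* (α :* u) :+ ω :* (α :* v)) refl α′ G u ω v ⟩
          G * (α′ * u) + ω * (α′ * v)    ∎))
          where
          open ≡-Reasoning
          pull : ∀ {u} → members J u → members I (α′ * u)
          pull {u} u∈ = from (I⇔J (α′ * u)) (subst (members J) (sym (cancel α α′ αα′≡1 u)) u∈)

    multiplier-integral : ∀ a b → 0 ℕ.< a → ∀ {γ} → (∀ {w} → L (ℤ.+ a) b w → L (ℤ.+ a) b (γ * w)) → IsInt γ
    multiplier-integral a b 0<a {γ} stable = go (L-expand (stable (L-basis₁ A b))) (L-expand (stable (L-basis₂ A b)))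
      where
      A : ℤ
      A = ℤ.+ a
      β : K
      β = int b 1ℤ
      A≢0 : A ≢ 0ℤ
      A≢0 = +≢0 0<a
      -- Cayley–Hamilton for the matrix of multiplication by γ.
      go : ∃[ r ] ∃[ s ] γ * ⟦ A ⟧ ≡ ⟦ r ⟧ * ⟦ A ⟧ + ⟦ s ⟧ * β → ∃[ r′ ] ∃[ s′ ] γ * β ≡ ⟦ r′ ⟧ * ⟦ A ⟧ + ⟦ s′ ⟧ * β → IsInt γ
      go (r , s , γA≡) (r′ , s′ , γβ≡) = integral⇒integer {γ} ((r ℤ.* s′ ℤ.- s ℤ.* r′) ∷ (ℤ.- (r ℤ.+ s′)) ∷ [] ,
        unit-cancel ⟦ A ⟧ (⟦⟧-unit A≢0) (trans char (sym (zeroʳ ⟦ A ⟧))))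
        where
        open ≡-Reasoning
        rK sK r′K s′K : K
        rK  = ⟦ r ⟧
        sK  = ⟦ s ⟧
        r′K = ⟦ r′ ⟧
        s′K = ⟦ s′ ⟧
        char : ⟦ A ⟧ * (⟦ r ℤ.* s′ ℤ.- s ℤ.* r′ ⟧ + γ * (⟦ ℤ.- (r ℤ.+ s′) ⟧ + γ * 1#)) ≡ 0#
        char = begin
          ⟦ A ⟧ * (⟦ r ℤ.* s′ ℤ.- s ℤ.* r′ ⟧ + γ * (⟦ ℤ.- (r ℤ.+ s′) ⟧ + γ * 1#))
            ≡⟨ cong₂ (λ p q → ⟦ A ⟧ * (p + γ * (q + γ * 1#)))
                 (trans (⟦⟧-+ (r ℤ.* s′) (ℤ.- (s ℤ.* r′))) (cong₂ _+_ (⟦⟧-* r s′) (trans (⟦⟧-neg (s ℤ.* r′)) (cong -_ (⟦⟧-* s r′)))))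
                 (trans (⟦⟧-neg (r ℤ.+ s′)) (cong -_ (⟦⟧-+ r s′))) ⟩
          ⟦ A ⟧ * (rK * s′K - sK * r′K + γ * (- (rK + s′K) + γ * 1#))
            ≡⟨ solve 7 (λ A r s r′ s′ γ β → A :* (r :* s′ :- s :* r′ :+ γ :* (:- (r :+ s′) :+ γ :* con 1ℤ))
                 := (γ :- s′) :* (γ :* A :- (r :* A :+ s :* β)) :+ s :* (γ :* β :- (r′ :* A :+ s′ :* β))) refl ⟦ A ⟧ rK sK r′K s′K γ β ⟩
          (γ - s′K) * (γ * ⟦ A ⟧ - (rK * ⟦ A ⟧ + sK * β)) + sK * (γ * β - (r′K * ⟦ A ⟧ + s′K * β))
            ≡⟨ cong₂ (λ p q → (γ - s′K) * (p - (rK * ⟦ A ⟧ + sK * β)) + sK * (q - (r′K * ⟦ A ⟧ + s′K * β))) γA≡ γβ≡ ⟩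
          (γ - s′K) * (rK * ⟦ A ⟧ + sK * β - (rK * ⟦ A ⟧ + sK * β)) + sK * (r′K * ⟦ A ⟧ + s′K * β - (r′K * ⟦ A ⟧ + s′K * β))
            ≡⟨ solve 4 (λ a s p q → a :* (p :- p) :+ s :* (q :- q) := con 0ℤ) refl (γ - s′K) sK (rK * ⟦ A ⟧ + sK * β) (r′K * ⟦ A ⟧ + s′K * β) ⟩
          0# ∎

    -- Serves to cancel I: an inclusion γI ⊆ I becomes a statement about γ alone. The homothety onto
    -- a lattice `L a b` commutes with multiplication by γ.
    ideal-multiplier-integral : ∀ I {γ} → (∀ {w} → members I w → members I (γ * w)) → IsInt γ
    ideal-multiplier-integral I {γ} stable = go (ideal-normal-form I)
      where
      go : NormalForm (members I) → IsInt γ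
      go (a , b , _ , 0<a , _ , δ , (δ′ , δδ′≡1) , I⇔L) = multiplier-integral a b 0<a λ {w} w∈ →
        subst (L (ℤ.+ a) b) (begin
          δ * (γ * (δ′ * w))    ≡⟨ solve 4 (λ δ γ δ′ w → δ :* (γ :* (δ′ :* w)) := γ :* (δ :* (δ′ :* w))) refl δ γ δ′ w ⟩
          γ * (δ * (δ′ * w))    ≡⟨ cong (γ *_) (cancel δ δ′ δδ′≡1 w) ⟩
          γ * w                 ∎)
          (to (I⇔L (γ * (δ′ * w))) (stable (from (I⇔L (δ′ * w)) (subst (L (ℤ.+ a) b) (sym (cancel δ δ′ δδ′≡1 w)) w∈))))
        where open ≡-Reasoning

    -- If 𝔞I = αI then 𝔞 = (α), and comparing norms α is a rational integer dividing ω.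
    module Free (g<n : g ℕ.< n) (indivisible : ∀ u → u ℤ.* u ≡ ℤ.+ g → ¬ (u ∣ℤ P × u ∣ℤ Q)) where

      private
        -- The hypotheses say that α divides g and ω and, since g divides αω̄, that α lies in the
        -- ideal (g, ω). In g times `unity` the products of g, ω and their conjugates are αᾱ times
        -- integers, whence N(α) η = g. In N(α) times `unity` every term is divisible by g, whence g
        -- ζ = N(α).
        principal : ∀ {α γ δ ε} → IsInt α → IsInt γ → IsInt δ → IsInt ε → α * γ ≡ G → α * δ ≡ ω → G * ε ≡ α * ω̄ →
          ∃[ a₁ ] ∃[ a₂ ] α ≡ int a₁ a₂ × norm a₁ a₂ ≡ g
        principal {α} {γ} {δ} {ε} (a₁ , a₂ , α≡) γ-int δ-int ε-int αγ≡ αδ≡ Gε≡ = a₁ , a₂ , α≡ , ∣-antisym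
          (N∣g (IsInt-η)) (g∣N IsInt-ζ)
          where
          open ≡-Reasoning
          ᾱ γ̄ δ̄ ε̄ xK yK zK kK : K
          ᾱ = conj α
          γ̄ = conj γ
          δ̄ = conj δ
          ε̄ = conj ε
          xK = ⟦ x ⟧
          yK = ⟦ y ⟧
          zK = ⟦ z ⟧
          kK = ⟦ k ⟧
          α-int : IsInt α
          α-int = a₁ , a₂ , α≡
          N : ℕ
          N = norm a₁ a₂
          αᾱ≡N : α * ᾱ ≡ ⟦ ℤ.+ N ⟧
          αᾱ≡N = trans (cong (λ α → α * conj α) α≡) (trans (int*conj a₁ a₂) (cong ⟦_⟧ (sym (norm≡ a₁ a₂))))
          ᾱγ̄≡ : ᾱ * γ̄ ≡ G
          ᾱγ̄≡ = trans (sym (conj-* α γ)) (cong conj αγ≡)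
          ᾱδ̄≡ : ᾱ * δ̄ ≡ ω̄
          ᾱδ̄≡ = trans (sym (conj-* α δ)) (trans (cong conj αδ≡) conj-ω)
          Gε̄≡ : G * ε̄ ≡ ᾱ * ω
          Gε̄≡ = trans (sym (conj-* G ε)) (trans (cong conj Gε≡) (trans (conj-* α ω̄) (cong (ᾱ *_) (trans (conj-int P (ℤ.- Q)) (cong (int P) (ℤ.neg-involutive Q))))))
          η ζ : K
          η = xK * (δ * γ̄ + δ̄ * γ) + yK * (γ * γ̄) + zK * (δ * δ̄)
          ζ = xK * (α * ε̄ + ᾱ * ε) + yK * (α * ᾱ) + zK * (ε * ε̄)
          IsInt-η : IsInt η
          IsInt-η = IsInt-+ (IsInt-+ (IsInt-* (IsInt-⟦⟧ x) (IsInt-+ (IsInt-* δ-int (IsInt-conj γ-int)) (IsInt-* (IsInt-conj δ-int) γ-int)))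
            (IsInt-* (IsInt-⟦⟧ y) (IsInt-* γ-int (IsInt-conj γ-int)))) (IsInt-* (IsInt-⟦⟧ z) (IsInt-* δ-int (IsInt-conj δ-int)))
          IsInt-ζ : IsInt ζ
          IsInt-ζ = IsInt-+ (IsInt-+ (IsInt-* (IsInt-⟦⟧ x) (IsInt-+ (IsInt-* α-int (IsInt-conj ε-int)) (IsInt-* (IsInt-conj α-int) ε-int)))
            (IsInt-* (IsInt-⟦⟧ y) (IsInt-* α-int (IsInt-conj α-int)))) (IsInt-* (IsInt-⟦⟧ z) (IsInt-* ε-int (IsInt-conj ε-int)))
          Nη≡G : α * ᾱ * η ≡ G
          Nη≡G = begin
            α * ᾱ * η
              ≡⟨ solve 9 (λ α ᾱ γ γ̄ δ δ̄ x y z → α :* ᾱ :* (x :* (δ :* γ̄ :+ δ̄ :* γ) :+ y :* (γ :* γ̄) :+ z :* (δ :* δ̄))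
                   := x :* ((α :* δ) :* (ᾱ :* γ̄) :+ (ᾱ :* δ̄) :* (α :* γ)) :+ y :* ((α :* γ) :* (ᾱ :* γ̄)) :+ z :* ((α :* δ) :* (ᾱ :* δ̄))) refl α ᾱ γ γ̄ δ δ̄ xK yK zK ⟩
            xK * ((α * δ) * (ᾱ * γ̄) + (ᾱ * δ̄) * (α * γ)) + yK * ((α * γ) * (ᾱ * γ̄)) + zK * ((α * δ) * (ᾱ * δ̄))
              ≡⟨ cong₂ (λ p q → xK * (p * (ᾱ * γ̄) + (ᾱ * δ̄) * q) + yK * (q * (ᾱ * γ̄)) + zK * (p * (ᾱ * δ̄))) αδ≡ αγ≡ ⟩
            xK * (ω * (ᾱ * γ̄) + (ᾱ * δ̄) * G) + yK * (G * (ᾱ * γ̄)) + zK * (ω * (ᾱ * δ̄))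
              ≡⟨ cong₂ (λ p q → xK * (ω * p + q * G) + yK * (G * p) + zK * (ω * q)) ᾱγ̄≡ ᾱδ̄≡ ⟩
            xK * (ω * G + ω̄ * G) + yK * (G * G) + zK * (ω * ω̄)
              ≡⟨ cong (λ p → xK * (ω * G + ω̄ * G) + yK * (G * G) + zK * p) ωω̄≡Gk ⟩
            xK * (ω * G + ω̄ * G) + yK * (G * G) + zK * (G * kK)
              ≡⟨ solve 7 (λ x y z ω ω̄ G k → x :* (ω :* G :+ ω̄ :* G) :+ y :* (G :* G) :+ z :* (G :* k) := G :* (x :* (ω :+ ω̄) :+ y :* G :+ z :* k)) refl xK yK zK ω ω̄ G kK ⟩
            G * (xK * (ω + ω̄) + yK * G + zK * kK)
              ≡⟨ trans (cong (G *_) unity) (*-identityʳ G) ⟩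
            G ∎
          Gεε̄≡ : G * (ε * ε̄) ≡ α * ᾱ * kK
          Gεε̄≡ = unit-cancel G G-unit (begin
            G * (G * (ε * ε̄))            ≡⟨ solve 3 (λ G e f → G :* (G :* (e :* f)) := (G :* e) :* (G :* f)) refl G ε ε̄ ⟩
            (G * ε) * (G * ε̄)            ≡⟨ cong₂ _*_ Gε≡ Gε̄≡ ⟩
            (α * ω̄) * (ᾱ * ω)            ≡⟨ solve 4 (λ α ω̄ ᾱ ω → (α :* ω̄) :* (ᾱ :* ω) := α :* ᾱ :* (ω :* ω̄)) refl α ω̄ ᾱ ω ⟩
            α * ᾱ * (ω * ω̄)              ≡⟨ cong (α * ᾱ *_) ωω̄≡Gk ⟩
            α * ᾱ * (G * kK)             ≡⟨ solve 3 (λ a G k → a :* (G :* k) := G :* (a :* k)) refl (α * ᾱ) G kK ⟩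
            G * (α * ᾱ * kK)             ∎)
          Gζ≡N : G * ζ ≡ α * ᾱ
          Gζ≡N = begin
            G * ζ
              ≡⟨ solve 8 (λ G x y z α ᾱ ε ε̄ → G :* (x :* (α :* ε̄ :+ ᾱ :* ε) :+ y :* (α :* ᾱ) :+ z :* (ε :* ε̄))
                   := x :* (α :* (G :* ε̄) :+ ᾱ :* (G :* ε)) :+ y :* (G :* (α :* ᾱ)) :+ z :* (G :* (ε :* ε̄))) refl G xK yK zK α ᾱ ε ε̄ ⟩
            xK * (α * (G * ε̄) + ᾱ * (G * ε)) + yK * (G * (α * ᾱ)) + zK * (G * (ε * ε̄))
              ≡⟨ cong₂ (λ p q → xK * (α * p + ᾱ * q) + yK * (G * (α * ᾱ)) + zK * (G * (ε * ε̄))) Gε̄≡ Gε≡ ⟩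
            xK * (α * (ᾱ * ω) + ᾱ * (α * ω̄)) + yK * (G * (α * ᾱ)) + zK * (G * (ε * ε̄))
              ≡⟨ cong (λ p → xK * (α * (ᾱ * ω) + ᾱ * (α * ω̄)) + yK * (G * (α * ᾱ)) + zK * p) Gεε̄≡ ⟩
            xK * (α * (ᾱ * ω) + ᾱ * (α * ω̄)) + yK * (G * (α * ᾱ)) + zK * (α * ᾱ * kK)
              ≡⟨ solve 9 (λ x y z α ᾱ ω ω̄ G k → x :* (α :* (ᾱ :* ω) :+ ᾱ :* (α :* ω̄)) :+ y :* (G :* (α :* ᾱ)) :+ z :* (α :* ᾱ :* k)
                   := α :* ᾱ :* (x :* (ω :+ ω̄) :+ y :* G :+ z :* k)) refl xK yK zK α ᾱ ω ω̄ G kK ⟩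
            α * ᾱ * (xK * (ω + ω̄) + yK * G + zK * kK)
              ≡⟨ trans (cong (α * ᾱ *_) unity) (*-identityʳ (α * ᾱ)) ⟩
            α * ᾱ ∎
          ⟦⟧-divides : ∀ m l {w} → IsInt w → ⟦ ℤ.+ m ⟧ * w ≡ ⟦ ℤ.+ l ⟧ → m ∣ l
          ⟦⟧-divides m l (e₁ , e₂ , w≡) eq = ∣⇒∣ᵤ {ℤ.+ m} {ℤ.+ l} (ℤ.divides e₁ (trans (sym (proj₁ inj)) (ℤ.*-comm (ℤ.+ m) e₁)))
            where
            inj : ℤ.+ m ℤ.* e₁ ≡ ℤ.+ l × ℤ.+ m ℤ.* e₂ ≡ 0ℤ
            inj = int-injective {ℤ.+ m ℤ.* e₁} {ℤ.+ m ℤ.* e₂} {ℤ.+ l} {0ℤ} (trans (sym (⟦⟧*int (ℤ.+ m) e₁ e₂)) (trans (cong (⟦ ℤ.+ m ⟧ *_) (sym w≡)) eq))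
          N∣g : IsInt η → N ∣ g
          N∣g η-int = ⟦⟧-divides N g η-int (trans (cong (_* η) (sym αᾱ≡N)) Nη≡G)
          g∣N : IsInt ζ → g ∣ N
          g∣N ζ-int = ⟦⟧-divides g N ζ-int (trans Gζ≡N αᾱ≡N)

      -- With 𝔞 = (g, ω) and 𝔞I = αI: αI ⊆ I makes α integral, gI and ωI ⊆ αI make g/α and ω/α
      -- integral, and ω̄𝔞 ⊆ (g), a consequence of ωω̄ = gk, makes αω̄/g integral.
      free : ∀ I → ¬ (members I ≃ members (act I))
      free I (α , (α′ , αα′≡1) , I⇔aI) = contradict (principal α-int γ-int δ-int ε-int
        (cancel α α′ αα′≡1 G) (cancel α α′ αα′≡1 ω) (trans (sym (*-assoc G G⁻¹ (α * ω̄))) (trans (cong (_* (α * ω̄)) (proj₂ G-unit)) (*-identityˡ (α * ω̄))))) δ-int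
        where
        open ≡-Reasoning
        G⁻¹ : K
        G⁻¹ = proj₁ G-unit
        gs : List K
        gs = generators I
        image : ∀ {w} → members I w → Combination (members I) (α * w)
        image {w} w∈ = act⁻ I (to (I⇔aI w) w∈)
        α-int : IsInt α
        α-int = ideal-multiplier-integral I λ {w} w∈ → go (image w∈)
          where
          go : ∀ {w} → Combination (members I) w → members I w
          go (u , v , u∈ , v∈ , w≡) = subst (members I) (sym w≡) (span-+ gs (span-* gs (ℤ.+ g) 0ℤ u∈) (span-* gs P Q v∈))
        pull : ∀ {w} β → members (act I) (β * w) → members I (α′ * β * w)
        pull {w} β βw∈ = subst (members I) (sym (*-assoc α′ β w)) (from (I⇔aI (α′ * (β * w))) (subst (members (act I)) (sym (cancel α α′ αα′≡1 (β * w))) βw∈))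
        γ-int : IsInt (α′ * G)
        γ-int = ideal-multiplier-integral I λ {w} w∈ → pull G (act⁺ I (w , 0# , w∈ , span-zero gs , sym (trans (cong (G * w +_) (zeroʳ ω)) (+-identityʳ (G * w)))))
        δ-int : IsInt (α′ * ω)
        δ-int = ideal-multiplier-integral I λ {w} w∈ → pull ω (act⁺ I (0# , w , span-zero gs , w∈ , sym (trans (cong (_+ ω * w) (zeroʳ G)) (+-identityˡ (ω * w)))))
        ε-int : IsInt (G⁻¹ * (α * ω̄))
        ε-int = ideal-multiplier-integral I λ {w} w∈ → go w (image w∈)
          where
          go : ∀ w → Combination (members I) (α * w) → members I (G⁻¹ * (α * ω̄) * w)
          go w (u , v , u∈ , v∈ , αw≡) = subst (members I) (sym (begin
            G⁻¹ * (α * ω̄) * w                            ≡⟨ solve 4 (λ a α ω w → a :* (α :* ω) :* w := a :* (ω :* (α :* w))) refl G⁻¹ α ω̄ w ⟩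
            G⁻¹ * (ω̄ * (α * w))                          ≡⟨ cong (λ t → G⁻¹ * (ω̄ * t)) αw≡ ⟩
            G⁻¹ * (ω̄ * (G * u + ω * v))                  ≡⟨ solve 6 (λ a ω̄ G u ω v → a :* (ω̄ :* (G :* u :+ ω :* v)) := a :* (G :* (ω̄ :* u) :+ ω :* ω̄ :* v)) refl G⁻¹ ω̄ G u ω v ⟩
            G⁻¹ * (G * (ω̄ * u) + ω * ω̄ * v)              ≡⟨ cong (λ t → G⁻¹ * (G * (ω̄ * u) + t * v)) ωω̄≡Gk ⟩
            G⁻¹ * (G * (ω̄ * u) + G * ⟦ k ⟧ * v)          ≡⟨ solve 5 (λ a G x k v → a :* (G :* x :+ G :* k :* v) := a :* (G :* (x :+ k :* v))) refl G⁻¹ G (ω̄ * u) ⟦ k ⟧ v ⟩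
            G⁻¹ * (G * (ω̄ * u + ⟦ k ⟧ * v))              ≡⟨ cancel G⁻¹ G (trans (*-comm G⁻¹ G) (proj₂ G-unit)) (ω̄ * u + ⟦ k ⟧ * v) ⟩
            ω̄ * u + ⟦ k ⟧ * v                            ∎))
            (span-+ gs (span-* gs P (ℤ.- Q) u∈) (span-* gs k 0ℤ v∈))
        contradict : ∃[ a₁ ] ∃[ a₂ ] α ≡ int a₁ a₂ × norm a₁ a₂ ≡ g → ¬ IsInt (α′ * ω)
        contradict (a₁ , a₂ , α≡ , N≡g) (δ₁ , δ₂ , δ≡) = indivisible a₁ a₁²≡g
          (ℤ.divides δ₁ (trans (sym (proj₁ inj)) (ℤ.*-comm a₁ δ₁)) , ℤ.divides δ₂ (trans (sym (proj₂ inj)) (ℤ.*-comm a₁ δ₂)))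
          where
          -- A nonzero coefficient of √d would contribute at least n > g to the norm.
          ∣a₂∣≡0 : ∀ m → ℤ.∣ a₁ ∣ ℕ.* ℤ.∣ a₁ ∣ ℕ.+ n ℕ.* (m ℕ.* m) ≡ g → m ≡ 0
          ∣a₂∣≡0 zero    _  = refl
          ∣a₂∣≡0 m@(suc _) eq = contradiction (ℕ.≤-trans (ℕ.≤-trans (ℕ.m≤m*n n (m ℕ.* m)) (ℕ.m≤n+m (n ℕ.* (m ℕ.* m)) _)) (ℕ.≤-reflexive eq)) (ℕ.<⇒≱ g<n)
          a₂≡0 : a₂ ≡ 0ℤ
          a₂≡0 = ℤ.∣i∣≡0⇒i≡0 (∣a₂∣≡0 ℤ.∣ a₂ ∣ N≡g)
          a₁²≡g : a₁ ℤ.* a₁ ≡ ℤ.+ g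
          a₁²≡g = begin
            a₁ ℤ.* a₁                                   ≡⟨ lemma d a₁ ⟩
            a₁ ℤ.* a₁ ℤ.- d ℤ.* (0ℤ ℤ.* 0ℤ)             ≡⟨ cong (λ a₂ → a₁ ℤ.* a₁ ℤ.- d ℤ.* (a₂ ℤ.* a₂)) a₂≡0 ⟨
            a₁ ℤ.* a₁ ℤ.- d ℤ.* (a₂ ℤ.* a₂)             ≡⟨ norm≡ a₁ a₂ ⟨
            ℤ.+ norm a₁ a₂                              ≡⟨ cong ℤ.+_ N≡g ⟩
            ℤ.+ g                                       ∎
            where
            lemma : ∀ d a → a ℤ.* a ≡ a ℤ.* a ℤ.- d ℤ.* (0ℤ ℤ.* 0ℤ)
            lemma = ℤSolver.solve-∀
          inj : a₁ ℤ.* δ₁ ≡ P × a₁ ℤ.* δ₂ ≡ Q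
          inj = int-injective {a₁ ℤ.* δ₁} {a₁ ℤ.* δ₂} {P} {Q} (begin
            int (a₁ ℤ.* δ₁) (a₁ ℤ.* δ₂)    ≡⟨ ⟦⟧*int a₁ δ₁ δ₂ ⟨
            int a₁ 0ℤ * int δ₁ δ₂          ≡⟨ cong₂ (λ t δ → int a₁ t * δ) a₂≡0 δ≡ ⟨
            int a₁ a₂ * (α′ * ω)           ≡⟨ cong (_* (α′ * ω)) α≡ ⟨
            α * (α′ * ω)                   ≡⟨ cancel α α′ αα′≡1 ω ⟩
            ω                              ∎)

    private
      act-G : ∀ I {u} → members I u → members (act I) (G * u)
      act-G I {u} u∈ = act⁺ I (u , 0# , u∈ , span-zero (generators I) , sym (trans (cong (G * u +_) (zeroʳ ω)) (+-identityʳ (G * u))))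

      act-ω : ∀ I {v} → members I v → members (act I) (ω * v)
      act-ω I {v} v∈ = act⁺ I (0# , v , span-zero (generators I) , v∈ , sym (trans (cong (_+ ω * v) (zeroʳ G)) (+-identityˡ (ω * v))))

      members-* : ∀ I {t w} → IsInt t → members I w → members I (t * w)
      members-* I {t} {w} (u , v , t≡) w∈ = subst (λ t → members I (t * w)) (sym t≡) (span-* (generators I) u v w∈)

    -- For k = g⁴ the fifth power of (g, ω) is (ω): modulo its fifth power, 1 is a power of xω + yg.
    module FifthPower (z≡0 : z ≡ 0ℤ) (k≡g⁴ : k ≡ ℤ.+ g ℤ.* (ℤ.+ g ℤ.* (ℤ.+ g ℤ.* ℤ.+ g))) where

      private
        G⁵ ε : K
        G⁵ = G * (G * (G * (G * G)))
        ε = ⟦ x ⟧ * ω + ⟦ y ⟧ * G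

        ωω̄≡G⁵ : ω * ω̄ ≡ G⁵
        ωω̄≡G⁵ = trans ωω̄≡Gk (cong (G *_) (trans (cong ⟦_⟧ k≡g⁴) (trans (⟦⟧-* (ℤ.+ g) _) (cong (G *_) (trans (⟦⟧-* (ℤ.+ g) _) (cong (G *_) (⟦⟧-* (ℤ.+ g) (ℤ.+ g))))))))

        xω̄≡1-ε : ⟦ x ⟧ * ω̄ ≡ 1# - ε
        xω̄≡1-ε = begin
          ⟦ x ⟧ * ω̄
            ≡⟨ solve 6 (λ x y ω ω̄ G k → x :* ω̄ := x :* (ω :+ ω̄) :+ y :* G :+ con 0ℤ :* k :- (x :* ω :+ y :* G)) refl ⟦ x ⟧ ⟦ y ⟧ ω ω̄ G ⟦ k ⟧ ⟩
          ⟦ x ⟧ * (ω + ω̄) + ⟦ y ⟧ * G + ⟦ 0ℤ ⟧ * ⟦ k ⟧ - ε      ≡⟨ cong (λ z → ⟦ x ⟧ * (ω + ω̄) + ⟦ y ⟧ * G + ⟦ z ⟧ * ⟦ k ⟧ - ε) z≡0 ⟨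
          ⟦ x ⟧ * (ω + ω̄) + ⟦ y ⟧ * G + ⟦ z ⟧ * ⟦ k ⟧ - ε       ≡⟨ cong (_- ε) unity ⟩
          1# - ε                                                ∎
          where open ≡-Reasoning

        ω-unit : Unit ω
        ω-unit = from-unit (unit-* G (G * (G * (G * G))) G-unit (unit-* G (G * (G * G)) G-unit (unit-* G (G * G) G-unit (unit-* G G G-unit G-unit))))
          where
          from-unit : Unit G⁵ → Unit ω
          from-unit (i , eq) = ω̄ * i , trans (sym (*-assoc ω ω̄ i)) (trans (cong (_* i) ωω̄≡G⁵) eq)

        act-ε : ∀ I {w} → members I w → members (act I) (ε * w)
        act-ε I {w} w∈ = act⁺ I (⟦ y ⟧ * w , ⟦ x ⟧ * w , members-* I (IsInt-⟦⟧ y) w∈ , members-* I (IsInt-⟦⟧ x) w∈ ,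
          solve 5 (λ x y ω G w → (x :* ω :+ y :* G) :* w := G :* (y :* w) :+ ω :* (x :* w)) refl ⟦ x ⟧ ⟦ y ⟧ ω G w)

        -- The geometric sum with (1 - ε) s = 1 - ε⁴. As xω̄ = 1 - ε and g⁵ = ωω̄, it gives ω = g⁵ x
        -- s + ω ε⁴, which exhibits ω as an element of the fifth power of (g, ω).
        s : K
        s = 1# + (ε + (ε * ε + ε * (ε * ε)))

        IsInt-xs : IsInt (⟦ x ⟧ * s)
        IsInt-xs = IsInt-* (IsInt-⟦⟧ x) (IsInt-+ (IsInt-⟦⟧ 1ℤ) (IsInt-+ ε-int (IsInt-+ (IsInt-* ε-int ε-int) (IsInt-* ε-int (IsInt-* ε-int ε-int)))))
          where
          ε-int : IsInt ε
          ε-int = IsInt-+ (IsInt-* (IsInt-⟦⟧ x) (P , Q , refl)) (IsInt-* (IsInt-⟦⟧ y) (IsInt-⟦⟧ (ℤ.+ g)))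

        split : ∀ w → G * (G * (G * (G * (G * (⟦ x ⟧ * s * w))))) + ω * (ε * (ε * (ε * (ε * w)))) ≡ ω * w
        split w = begin
          G * (G * (G * (G * (G * (⟦ x ⟧ * s * w))))) + ω * (ε * (ε * (ε * (ε * w))))
            ≡⟨ cong (_+ ω * (ε * (ε * (ε * (ε * w))))) (trans (solve 4 (λ G x s w → G :* (G :* (G :* (G :* (G :* (x :* s :* w))))) := G :* (G :* (G :* (G :* G))) :* (x :* s :* w)) refl G ⟦ x ⟧ s w)
                 (cong (_* (⟦ x ⟧ * s * w)) (sym ωω̄≡G⁵))) ⟩
          ω * ω̄ * (⟦ x ⟧ * s * w) + ω * (ε * (ε * (ε * (ε * w))))
            ≡⟨ cong (_+ ω * (ε * (ε * (ε * (ε * w))))) (trans (solve 5 (λ ω ω̄ x s w → ω :* ω̄ :* (x :* s :* w) := ω :* ((x :* ω̄) :* s :* w)) refl ω ω̄ ⟦ x ⟧ s w)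
                 (cong (λ t → ω * (t * s * w)) xω̄≡1-ε)) ⟩
          ω * ((1# - ε) * s * w) + ω * (ε * (ε * (ε * (ε * w))))
            ≡⟨ solve 3 (λ ω ε w → ω :* ((con 1ℤ :- ε) :* (con 1ℤ :+ (ε :+ (ε :* ε :+ ε :* (ε :* ε)))) :* w) :+ ω :* (ε :* (ε :* (ε :* (ε :* w)))) := ω :* w) refl ω ε w ⟩
          ω * w ∎
          where open ≡-Reasoning

        forward : ∀ I w → members I w → members (iterate act 5 I) (ω * w)
        forward I w w∈ = act⁺ I₄ (_ , _ , act-G I₃ (act-G I₂ (act-G I₁ (act-G I (members-* I IsInt-xs w∈)))) , act-ε I₃ (act-ε I₂ (act-ε I₁ (act-ε I w∈))) , sym (split w))
          where
          I₁ I₂ I₃ I₄ : FractionalIdeal F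
          I₁ = act I
          I₂ = act I₁
          I₃ = act I₂
          I₄ = act I₃

        -- A product of j generators is either the j-th power of g or a multiple of ω. For j = 5
        -- only multiples of ω remain, since g⁵ = ωω̄.
        powers : ∀ j I {w} → members (iterate act j I) w → ∃[ u ] ∃[ v ] members I u × members I v × w ≡ G ^ᴷ j * u + ω * v
        powers zero I {w} w∈ = w , 0# , w∈ , span-zero (generators I) , solve 2 (λ w ω → w := con 1ℤ :* w :+ ω :* con 0ℤ) refl w ω
        powers (suc j) I {w} w∈ = go (act⁻ (iterate act j I) w∈)
          where
          go : Combination (members (iterate act j I)) w → ∃[ u ] ∃[ v ] members I u × members I v × w ≡ G ^ᴷ suc j * u + ω * v
          go (u , v , u∈ , v∈ , w≡) = combine (powers j I u∈) (powers j I v∈)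
            where
            combine : ∃[ u₁ ] ∃[ u₂ ] members I u₁ × members I u₂ × u ≡ G ^ᴷ j * u₁ + ω * u₂ →
              ∃[ v₁ ] ∃[ v₂ ] members I v₁ × members I v₂ × v ≡ G ^ᴷ j * v₁ + ω * v₂ →
              ∃[ u ] ∃[ v ] members I u × members I v × w ≡ G ^ᴷ suc j * u + ω * v
            combine (u₁ , u₂ , u₁∈ , u₂∈ , u≡) (v₁ , v₂ , v₁∈ , v₂∈ , v≡) = u₁ , G * u₂ + (G ^ᴷ j * v₁ + ω * v₂) , u₁∈ ,
              span-+ gs (members-* I (IsInt-⟦⟧ (ℤ.+ g)) u₂∈) (span-+ gs (members-* I (G^-int j) v₁∈) (members-* I (P , Q , refl) v₂∈)) ,
              trans w≡ (trans (cong₂ (λ u v → G * u + ω * v) u≡ v≡)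
                (solve 7 (λ G p ω u₁ u₂ v₁ v₂ → G :* (p :* u₁ :+ ω :* u₂) :+ ω :* (p :* v₁ :+ ω :* v₂) := G :* p :* u₁ :+ ω :* (G :* u₂ :+ (p :* v₁ :+ ω :* v₂))) refl G (G ^ᴷ j) ω u₁ u₂ v₁ v₂))
              where
              gs : List K
              gs = generators I
              G^-int : ∀ j → IsInt (G ^ᴷ j)
              G^-int zero    = IsInt-⟦⟧ 1ℤ
              G^-int (suc j) = IsInt-* (IsInt-⟦⟧ (ℤ.+ g)) (G^-int j)

        backward : ∀ I w → members (iterate act 5 I) (ω * w) → members I w
        backward I w ωw∈ = go (powers 5 I ωw∈)
          where
          go : ∃[ u ] ∃[ v ] members I u × members I v × ω * w ≡ G ^ᴷ 5 * u + ω * v → members I w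
          go (u , v , u∈ , v∈ , ωw≡) = subst (members I) (sym (unit-cancel ω ω-unit (begin
            ω * w                                        ≡⟨ ωw≡ ⟩
            G ^ᴷ 5 * u + ω * v                           ≡⟨ cong (λ t → t * u + ω * v) (trans (cong (λ t → G * (G * (G * (G * t)))) (*-identityʳ G)) (sym ωω̄≡G⁵)) ⟩
            ω * ω̄ * u + ω * v                            ≡⟨ solve 4 (λ ω ω̄ u v → ω :* ω̄ :* u :+ ω :* v := ω :* (ω̄ :* u :+ v)) refl ω ω̄ u v ⟩
            ω * (ω̄ * u + v)                              ∎)))
            (span-+ (generators I) (members-* I (P , ℤ.- Q , refl) u∈) v∈)
            where open ≡-Reasoning

      fifth-power-principal : ∀ I → members I ≃ members (iterate act 5 I)
      fifth-power-principal I = ω , ω-unit , λ w → mk⇔ (forward I w) (backward I w)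

    -- For P = 0 the square of (g, ω) is (g).
    module Square (P≡0 : P ≡ 0ℤ) where

      private
        ω̄≡-ω : ω̄ ≡ - ω
        ω̄≡-ω = trans (cong (λ P → int P (ℤ.- Q)) (trans P≡0 (cong ℤ.-_ (sym P≡0)))) (int-neg P Q)

        ωω≡ : ω * ω ≡ - (G * ⟦ k ⟧)
        ωω≡ = begin
          ω * ω              ≡⟨ solve 1 (λ ω → ω :* ω := :- (ω :* (:- ω))) refl ω ⟩
          - (ω * (- ω))      ≡⟨ cong (λ t → - (ω * t)) ω̄≡-ω ⟨
          - (ω * ω̄)          ≡⟨ cong -_ ωω̄≡Gk ⟩
          - (G * ⟦ k ⟧)      ∎
          where open ≡-Reasoning

        unity′ : ⟦ y ⟧ * G + ⟦ z ⟧ * ⟦ k ⟧ ≡ 1#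
        unity′ = begin
          ⟦ y ⟧ * G + ⟦ z ⟧ * ⟦ k ⟧
            ≡⟨ solve 6 (λ x y z ω G k → y :* G :+ z :* k := x :* (ω :+ (:- ω)) :+ y :* G :+ z :* k) refl ⟦ x ⟧ ⟦ y ⟧ ⟦ z ⟧ ω G ⟦ k ⟧ ⟩
          ⟦ x ⟧ * (ω + (- ω)) + ⟦ y ⟧ * G + ⟦ z ⟧ * ⟦ k ⟧     ≡⟨ cong (λ t → ⟦ x ⟧ * (ω + t) + ⟦ y ⟧ * G + ⟦ z ⟧ * ⟦ k ⟧) ω̄≡-ω ⟨
          ⟦ x ⟧ * (ω + ω̄) + ⟦ y ⟧ * G + ⟦ z ⟧ * ⟦ k ⟧         ≡⟨ unity ⟩
          1#                                                  ∎
          where open ≡-Reasoning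

        -- Since ω² = -gk and yg + zk = 1, g = yg² - zω² lies in the square of the ideal.
        forward : ∀ I w → members I w → members (iterate act 2 I) (G * w)
        forward I w w∈ = act⁺ (act I) (_ , _ , act-G I (members-* I (IsInt-⟦⟧ y) w∈) , act-ω I (members-* I (IsInt-neg (IsInt-⟦⟧ z)) w∈) , (begin
          G * w                                                   ≡⟨ cong (G *_) (*-identityˡ w) ⟨
          G * (1# * w)                                            ≡⟨ cong (λ t → G * (t * w)) unity′ ⟨
          G * ((⟦ y ⟧ * G + ⟦ z ⟧ * ⟦ k ⟧) * w)                   ≡⟨ solve 5 (λ G y z k w → G :* ((y :* G :+ z :* k) :* w) := G :* (G :* (y :* w)) :+ (:- (G :* k)) :* ((:- z) :* w)) refl G ⟦ y ⟧ ⟦ z ⟧ ⟦ k ⟧ w ⟩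
          G * (G * (⟦ y ⟧ * w)) + (- (G * ⟦ k ⟧)) * ((- ⟦ z ⟧) * w)  ≡⟨ cong (λ t → G * (G * (⟦ y ⟧ * w)) + t * ((- ⟦ z ⟧) * w)) ωω≡ ⟨
          G * (G * (⟦ y ⟧ * w)) + ω * ω * ((- ⟦ z ⟧) * w)         ≡⟨ cong (G * (G * (⟦ y ⟧ * w)) +_) (*-assoc ω ω ((- ⟦ z ⟧) * w)) ⟩
          G * (G * (⟦ y ⟧ * w)) + ω * (ω * ((- ⟦ z ⟧) * w))       ∎))
          where open ≡-Reasoning

        backward : ∀ I w → members (iterate act 2 I) (G * w) → members I w
        backward I w Gw∈ = go (act⁻ (act I) Gw∈)
          where
          gs : List K
          gs = generators I
          go : Combination (members (act I)) (G * w) → members I w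
          go (u , v , u∈ , v∈ , Gw≡) = combine (act⁻ I u∈) (act⁻ I v∈)
            where
            combine : Combination (members I) u → Combination (members I) v → members I w
            combine (u₁ , u₂ , u₁∈ , u₂∈ , u≡) (v₁ , v₂ , v₁∈ , v₂∈ , v≡) = subst (members I) (sym (unit-cancel G G-unit (begin
              G * w                                                        ≡⟨ trans Gw≡ (cong₂ (λ u v → G * u + ω * v) u≡ v≡) ⟩
              G * (G * u₁ + ω * u₂) + ω * (G * v₁ + ω * v₂)                ≡⟨ solve 6 (λ G ω u₁ u₂ v₁ v₂ → G :* (G :* u₁ :+ ω :* u₂) :+ ω :* (G :* v₁ :+ ω :* v₂)
                                                                                := G :* (G :* u₁ :+ ω :* (u₂ :+ v₁)) :+ ω :* ω :* v₂) refl G ω u₁ u₂ v₁ v₂ ⟩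
              G * (G * u₁ + ω * (u₂ + v₁)) + ω * ω * v₂                    ≡⟨ cong (λ t → G * (G * u₁ + ω * (u₂ + v₁)) + t * v₂) ωω≡ ⟩
              G * (G * u₁ + ω * (u₂ + v₁)) + (- (G * ⟦ k ⟧)) * v₂          ≡⟨ solve 4 (λ G a k v → G :* a :+ (:- (G :* k)) :* v := G :* (a :+ (:- k) :* v)) refl G (G * u₁ + ω * (u₂ + v₁)) ⟦ k ⟧ v₂ ⟩
              G * (G * u₁ + ω * (u₂ + v₁) + (- ⟦ k ⟧) * v₂)                ∎)))
              (span-+ gs (span-+ gs (members-* I (IsInt-⟦⟧ (ℤ.+ g)) u₁∈) (members-* I (P , Q , refl) (span-+ gs u₂∈ v₁∈))) (members-* I (IsInt-neg (IsInt-⟦⟧ k)) v₂∈))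
              where open ≡-Reasoning

      square-principal : ∀ I → members I ≃ members (iterate act 2 I)
      square-principal I = G , G-unit , λ w → mk⇔ (forward I w) (backward I w)

-- Class numbers divisible by 10 and part (b)

module ClassNumber where
  open import Defs
  open Actions
  open Candidates
  open Decision using (module ImaginaryIdeals)
  open Events using (prime∤⇒coprime; square-≤)
  open Field
  open FreeActions
  open Integers
  open Lattices
  open Points
  open PrimeSquares using (prime-divisor; prime∣product; ∣-by)
  open import Algebra.Morphism.Structures using (module RingMorphisms)
  open import Data.Integer.Base as ℤ using (ℤ; 0ℤ; 1ℤ; -[1+_])
  open import Data.Integer.Divisibility.Signed as ℤ using (∣ᵤ⇒∣; ∣⇒∣ᵤ) renaming (_∣_ to _∣ℤ_)
  import Data.Integer.Properties as ℤ
  import Data.Integer.Tactic.RingSolver as ℤSolver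
  open import Data.List.Base using (map)
  open import Data.List.Relation.Unary.All as All using (All)
  open import Data.Nat.Base as ℕ using (ℕ; zero; suc)
  open import Data.Nat.Coprimality using (coprime-divisor)
  open import Data.Nat.Divisibility using (_∣_; ∣-refl; ∣-trans; ∣1⇒≡1; ∣⇒≤; divides; *-monoˡ-∣; ∣m⇒∣m*n)
  open import Data.Nat.Primality using (Prime; prime[2]; prime?; ¬prime[1])
  import Data.Nat.Properties as ℕ
  open import Data.Product.Base using (∃; ∃-syntax; _×_; _,_)
  open import Data.Rational.Base as ℚ using (ℚ; 0ℚ; 1ℚ; _/_)
  import Data.Rational.Properties as ℚ
  import Data.Rational.Solver as ℚSolver
  open import Data.Sum.Base using (_⊎_; [_,_]′)
  open import Function.Base using (_∘_)
  open import Relation.Binary.PropositionalEquality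
  open import Relation.Nullary.Decidable using (from-yes; decidable-stable)
  open import Relation.Nullary.Negation using (¬_; contradiction)

  private
    prime[5] : Prime 5
    prime[5] = from-yes (prime? 5)

    ∣∣≡1⇒square≡1 : ∀ m → ℤ.∣ m ∣ ≡ 1 → m ℤ.* m ≡ 1ℤ
    ∣∣≡1⇒square≡1 m eq = trans (square≡∣∣² m) (cong (λ k → ℤ.+ (k ℕ.* k)) eq)

    squarefree⇒∣∣≡1 : ∀ {d} → Squarefree d → ∀ m c → d ≡ c ℤ.* (m ℤ.* m) → ℤ.∣ m ∣ ≡ 1
    squarefree⇒∣∣≡1 {d} sf m c eq = ∣1⇒≡1 (sf m (∣⇒∣ᵤ {m ℤ.* m} {d} (ℤ.divides c eq)))

  module _ {K′ L′ : QuadraticField} where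

    private
      module F = QuadraticField K′
      module E = QuadraticField L′
      d e : ℤ
      d = F.radicand
      e = E.radicand
      module KQ = Quadratic d
      module LQ = Quadratic e

      -- √d goes to p + q√e with p² + eq² = d and pq = 0; as d ≠ 1 is squarefree, p = 0 and q² = 1.
      root-of-radicand : ∀ p q → (p ℚ.* p ℚ.+ (e / 1) ℚ.* (q ℚ.* q)) ≡ d / 1 → p ℚ.* q ℚ.+ q ℚ.* p ≡ 0ℚ → d ≡ e
      root-of-radicand p q p²+eq²≡d 2pq≡0 = [ p≡0-case , q≡0-case ]′ (ℚ-integral p q pq≡0)
        where
        module S = ℚSolver.+-*-Solver
        pq≡0 : p ℚ.* q ≡ 0ℚ
        pq≡0 = [ (λ pq≡0 → pq≡0) , (λ ()) ]′ (ℚ-integral (p ℚ.* q) (1ℚ ℚ.+ 1ℚ)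
          (trans (S.solve 2 (λ p q → (p S.:* q) S.:* (S.con 1ℚ S.:+ S.con 1ℚ) S.:= p S.:* q S.:+ q S.:* p) refl p q) 2pq≡0))
        p≡0-case : p ≡ 0ℚ → d ≡ e
        p≡0-case p≡0 = from (squarefree-root {e} E.squarefree q d eq)
          where
          eq : (e / 1) ℚ.* (q ℚ.* q) ≡ d / 1
          eq = trans (S.solve 2 (λ e q → e S.:* (q S.:* q) S.:= S.con 0ℚ S.:* S.con 0ℚ S.:+ e S.:* (q S.:* q)) refl (e / 1) q)
            (trans (cong (λ p → p ℚ.* p ℚ.+ (e / 1) ℚ.* (q ℚ.* q)) (sym p≡0)) p²+eq²≡d)
          from : IsIntegerℚ q → d ≡ e
          from (m , q≡m) = trans d≡em² (trans (cong (e ℤ.*_) (∣∣≡1⇒square≡1 m (squarefree⇒∣∣≡1 {d} F.squarefree m e d≡em²))) (ℤ.*-identityʳ e))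
            where
            d≡em² : d ≡ e ℤ.* (m ℤ.* m)
            d≡em² = /1-injective (sym (trans (/1-* e (m ℤ.* m)) (trans (cong ((e / 1) ℚ.*_) (trans (/1-* m m) (cong (λ q → q ℚ.* q) (sym q≡m)))) eq)))
        q≡0-case : q ≡ 0ℚ → d ≡ e
        q≡0-case q≡0 = from (squarefree-root {1ℤ} (λ k kk∣1 → ∣-trans (∣m⇒∣m*n ℤ.∣ k ∣ ∣-refl) (subst (_∣ 1) (ℤ.abs-* k k) kk∣1)) p d (trans (ℚ.*-identityˡ (p ℚ.* p)) eq))
          where
          eq : p ℚ.* p ≡ d / 1
          eq = trans (S.solve 2 (λ e p → p S.:* p S.:= p S.:* p S.:+ e S.:* (S.con 0ℚ S.:* S.con 0ℚ)) refl (e / 1) p)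
            (trans (cong (λ q → p ℚ.* p ℚ.+ (e / 1) ℚ.* (q ℚ.* q)) (sym q≡0)) p²+eq²≡d)
          from : IsIntegerℚ p → d ≡ e
          from (m , p≡m) = contradiction (trans d≡m² (∣∣≡1⇒square≡1 m (squarefree⇒∣∣≡1 {d} F.squarefree m 1ℤ (trans d≡m² (sym (ℤ.*-identityˡ (m ℤ.* m))))))) F.≢1
            where
            d≡m² : d ≡ m ℤ.* m
            d≡m² = /1-injective (sym (trans (/1-* m m) (trans (cong (λ q → q ℚ.* q) (sym p≡m)) eq)))

    -- An isomorphism fixes ℤ, so the image of √d is a square root of d in the second field.
    isomorphic⇒≡ : K′ ≅ L′ → d ≡ e
    isomorphic⇒≡ (φ , iso) = root-of-radicand (rat φ√d) (irr φ√d) (cong rat square) (cong irr square)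
      where
      open RingMorphisms.IsRingIsomorphism iso using (+-homo; *-homo; 1#-homo; 0#-homo; -‿homo)
      φ√d : ℚ[√ e ]
      φ√d = φ (KQ.int 0ℤ 1ℤ)
      φℕ : ∀ n → φ KQ.⟦ ℤ.+ n ⟧ ≡ LQ.⟦ ℤ.+ n ⟧
      φℕ zero    = 0#-homo
      φℕ (suc n) = trans (cong φ (KQ.⟦⟧-+ 1ℤ (ℤ.+ n))) (trans (+-homo KQ.1# KQ.⟦ ℤ.+ n ⟧) (trans (cong₂ LQ._+_ 1#-homo (φℕ n)) (sym (LQ.⟦⟧-+ 1ℤ (ℤ.+ n)))))
      φℤ : ∀ z → φ KQ.⟦ z ⟧ ≡ LQ.⟦ z ⟧
      φℤ (ℤ.+ n)    = φℕ n
      φℤ (-[1+ n ]) = trans (cong φ (KQ.⟦⟧-neg (ℤ.+ suc n))) (trans (-‿homo KQ.⟦ ℤ.+ suc n ⟧) (trans (cong LQ.-_ (φℕ (suc n))) (sym (LQ.⟦⟧-neg (ℤ.+ suc n)))))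
      √d² : KQ.int 0ℤ 1ℤ KQ.* KQ.int 0ℤ 1ℤ ≡ KQ.⟦ d ⟧
      √d² = trans (sym (KQ.int-* 0ℤ 1ℤ 0ℤ 1ℤ)) (cong (λ u → KQ.int u 0ℤ) (lemma d))
        where
        lemma : ∀ d → 0ℤ ℤ.* 0ℤ ℤ.+ d ℤ.* (1ℤ ℤ.* 1ℤ) ≡ d
        lemma = ℤSolver.solve-∀
      square : φ√d LQ.* φ√d ≡ LQ.⟦ d ⟧
      square = trans (sym (*-homo (KQ.int 0ℤ 1ℤ) (KQ.int 0ℤ 1ℤ))) (trans (cong φ √d²) (φℤ d))

  private
    -- P is written as the result of division by s, with remainder 16 b⁵; this makes it visible
    -- which primes P and s can share.
    torsion-quotient torsion-P torsion-Q : ℤ → ℤ → ℤ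
    torsion-quotient s b = s ℤ.* (s ℤ.* (s ℤ.* (s ℤ.- ℤ.+ 2 ℤ.* b) ℤ.- ℤ.+ 8 ℤ.* (b ℤ.* b)) ℤ.- ℤ.+ 4 ℤ.* (b ℤ.* b ℤ.* b)) ℤ.+ ℤ.+ 16 ℤ.* (b ℤ.* b ℤ.* b ℤ.* b)
    torsion-P s b = s ℤ.* torsion-quotient s b ℤ.+ ℤ.+ 16 ℤ.* (b ℤ.* b ℤ.* b ℤ.* b ℤ.* b)
    torsion-Q A b = ℤ.+ 2 ℤ.* (A ℤ.- ℤ.+ 3 ℤ.* b) ℤ.* (A ℤ.+ b)

    -- P² - FQ² = (a - b)¹⁰ for the sextic form F = -ab(a² + b²)(a² - 2ab - b²) defining the curve, with
    -- P written in s = a - b and b: the function P + Qy on X₁(16) has divisor 10(1, 2) - 10∞.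
    torsion-identity : ∀ s b → torsion-P s b ℤ.* torsion-P s b
      ℤ.- (ℤ.- ((s ℤ.+ b) ℤ.* b) ℤ.* ((s ℤ.+ b) ℤ.* (s ℤ.+ b) ℤ.+ b ℤ.* b) ℤ.* ((s ℤ.+ b) ℤ.* (s ℤ.+ b) ℤ.- ℤ.+ 2 ℤ.* ((s ℤ.+ b) ℤ.* b) ℤ.- b ℤ.* b))
        ℤ.* (torsion-Q (s ℤ.+ b) b ℤ.* torsion-Q (s ℤ.+ b) b)
      ≡ (s ℤ.* s) ℤ.* ((s ℤ.* s) ℤ.* ((s ℤ.* s) ℤ.* ((s ℤ.* s) ℤ.* (s ℤ.* s))))
    torsion-identity = lemma
      where
      -- The definitions are written out so that the ring solver sees the polynomials.
      lemma : ∀ s b →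
        (s ℤ.* (s ℤ.* (s ℤ.* (s ℤ.* (s ℤ.- ℤ.+ 2 ℤ.* b) ℤ.- ℤ.+ 8 ℤ.* (b ℤ.* b)) ℤ.- ℤ.+ 4 ℤ.* (b ℤ.* b ℤ.* b)) ℤ.+ ℤ.+ 16 ℤ.* (b ℤ.* b ℤ.* b ℤ.* b)) ℤ.+ ℤ.+ 16 ℤ.* (b ℤ.* b ℤ.* b ℤ.* b ℤ.* b))
        ℤ.* (s ℤ.* (s ℤ.* (s ℤ.* (s ℤ.* (s ℤ.- ℤ.+ 2 ℤ.* b) ℤ.- ℤ.+ 8 ℤ.* (b ℤ.* b)) ℤ.- ℤ.+ 4 ℤ.* (b ℤ.* b ℤ.* b)) ℤ.+ ℤ.+ 16 ℤ.* (b ℤ.* b ℤ.* b ℤ.* b)) ℤ.+ ℤ.+ 16 ℤ.* (b ℤ.* b ℤ.* b ℤ.* b ℤ.* b))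
        ℤ.- (ℤ.- ((s ℤ.+ b) ℤ.* b) ℤ.* ((s ℤ.+ b) ℤ.* (s ℤ.+ b) ℤ.+ b ℤ.* b) ℤ.* ((s ℤ.+ b) ℤ.* (s ℤ.+ b) ℤ.- ℤ.+ 2 ℤ.* ((s ℤ.+ b) ℤ.* b) ℤ.- b ℤ.* b))
          ℤ.* ((ℤ.+ 2 ℤ.* ((s ℤ.+ b) ℤ.- ℤ.+ 3 ℤ.* b) ℤ.* ((s ℤ.+ b) ℤ.+ b)) ℤ.* (ℤ.+ 2 ℤ.* ((s ℤ.+ b) ℤ.- ℤ.+ 3 ℤ.* b) ℤ.* ((s ℤ.+ b) ℤ.+ b)))
        ≡ (s ℤ.* s) ℤ.* ((s ℤ.* s) ℤ.* ((s ℤ.* s) ℤ.* ((s ℤ.* s) ℤ.* (s ℤ.* s))))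
      lemma = ℤSolver.solve-∀

  private
    10∣ : ∀ {h} → 2 ∣ h → 5 ∣ h → 10 ∣ h
    10∣ {h} (divides c h≡c2) 5∣h = subst (10 ∣_) (sym h≡c2) (*-monoˡ-∣ 2
      (coprime-divisor {5} {2} {c} (prime∤⇒coprime prime[5] (λ 5∣2 → contradiction (∣⇒≤ 5∣2) (ℕ.<⇒≱ (ℕ.s≤s (ℕ.s≤s (ℕ.s≤s ℕ.z≤n)))))) (subst (5 ∣_) (trans h≡c2 (ℕ.*-comm c 2)) 5∣h)))

  -- A record, unlike the corresponding Σ-type, is compared by its parameter K, without unfolding the class group.
  record ClassNumberDivisibleBy10 (K : QuadraticField) : Set where
    constructor divisible
    field
      h              : ℕ
      hasClassNumber : HasClassNumber K h
      10∣h           : 10 ∣ h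

  private
    combine-divisors : ∀ K → ∃ (HasClassNumber K) → (∀ h → HasClassNumber K h → 2 ∣ h) → (∀ h → HasClassNumber K h → 5 ∣ h) →
      ClassNumberDivisibleBy10 K
    combine-divisors K (h , bij) 2∣h 5∣h = divisible h bij (10∣ (2∣h h bij) (5∣h h bij))

    indivisible₂ : ∀ u → u ℤ.* u ≡ ℤ.+ 2 → ¬ (u ∣ℤ 0ℤ × u ∣ℤ 1ℤ)
    indivisible₂ u uu≡2 (_ , u∣1) = contradiction (trans (sym (∣∣≡1⇒square≡1 u (∣1⇒≡1 (∣⇒∣ᵤ {u} {1ℤ} u∣1)))) uu≡2) λ ()

  module _ (d : ℤ) (sf : Squarefree d) (d≢1 : d ≢ 1ℤ) (e : ℤ) (d≡2e : d ≡ ℤ.+ 2 ℤ.* e) (n : ℕ) (d≡-n : d ≡ ℤ.- ℤ.+ n) (2<n : 2 ℕ.< n) where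

    -- The ramified prime (2, √d): here g = 2, ω = √d, and the norm is 2k with k odd. Its square is
    -- (2), and it is not principal because n > 2 and 2 is not the square of an integer.
    2∣class-number : ∀ k → 0ℤ ℤ.* 0ℤ ℤ.- d ℤ.* (1ℤ ℤ.* 1ℤ) ≡ ℤ.+ 2 ℤ.* k →
      (∃[ y ] ∃[ z ] 0ℤ ℤ.* (0ℤ ℤ.+ 0ℤ) ℤ.+ y ℤ.* ℤ.+ 2 ℤ.+ z ℤ.* k ≡ 1ℤ) →
      ∀ h → HasClassNumber (ℚ⟮√ d ⟯ sf d≢1) h → 2 ∣ h
    2∣class-number k norm-√d (y , z , eq) h bij = prime∣cardinality (idealClasses (ℚ⟮√ d ⟯ sf d≢1)) prime[2] bij M.act
      (λ {I} {J} → M.act-cong {I} {J}) square-principal free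
      where
      module M = Multiplication d sf d≢1 e d≡2e n d≡-n (ℕ.<⇒≤ 2<n) 2 ℕ.z<s 0ℤ 1ℤ k 0ℤ y z norm-√d eq
      open M.Square refl using (square-principal)
      open M.Free 2<n indivisible₂ using (free)

    -- The instance g = s², k = g⁴, z = 0: with g = s² the norm of P + Q√d is g⁵, so that the action
    -- has period 5.
    5∣class-number : ∀ s → 0 ℕ.< s ℕ.* s → s ℕ.* s ℕ.< n → ∀ P Q →
      P ℤ.* P ℤ.- d ℤ.* (Q ℤ.* Q) ≡ ℤ.+ (s ℕ.* s) ℤ.* (ℤ.+ (s ℕ.* s) ℤ.* (ℤ.+ (s ℕ.* s) ℤ.* (ℤ.+ (s ℕ.* s) ℤ.* ℤ.+ (s ℕ.* s)))) →
      (∃[ x ] ∃[ y ] x ℤ.* (P ℤ.+ P) ℤ.+ y ℤ.* (ℤ.+ s ℤ.* ℤ.+ s) ≡ 1ℤ) →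
      (∀ u → u ℤ.* u ≡ ℤ.+ (s ℕ.* s) → ¬ (u ∣ℤ P × u ∣ℤ Q)) →
      ∀ h → HasClassNumber (ℚ⟮√ d ⟯ sf d≢1) h → 5 ∣ h
    5∣class-number s 0<ss ss<n P Q norm-P (x , y , eq) indivisible h bij = prime∣cardinality (idealClasses (ℚ⟮√ d ⟯ sf d≢1)) prime[5] bij M.act
      (λ {I} {J} → M.act-cong {I} {J}) fifth-power-principal free
      where
      g : ℤ
      g = ℤ.+ (s ℕ.* s)
      combination : x ℤ.* (P ℤ.+ P) ℤ.+ y ℤ.* g ℤ.+ 0ℤ ℤ.* (g ℤ.* (g ℤ.* (g ℤ.* g))) ≡ 1ℤ
      combination = trans (ℤ.+-identityʳ (x ℤ.* (P ℤ.+ P) ℤ.+ y ℤ.* g)) (trans (cong (λ g → x ℤ.* (P ℤ.+ P) ℤ.+ y ℤ.* g) (ℤ.pos-* s s)) eq)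
      module M = Multiplication d sf d≢1 e d≡2e n d≡-n (ℕ.<⇒≤ 2<n) (s ℕ.* s) 0<ss P Q (g ℤ.* (g ℤ.* (g ℤ.* g))) x y 0ℤ norm-P combination
      open M.FifthPower refl refl using (fifth-power-principal)
      open M.Free ss<n indivisible using (free)

    10∣class-number : ∀ k → 0ℤ ℤ.* 0ℤ ℤ.- d ℤ.* (1ℤ ℤ.* 1ℤ) ≡ ℤ.+ 2 ℤ.* k →
      (∃[ y ] ∃[ z ] 0ℤ ℤ.* (0ℤ ℤ.+ 0ℤ) ℤ.+ y ℤ.* ℤ.+ 2 ℤ.+ z ℤ.* k ≡ 1ℤ) →
      ∀ s → 0 ℕ.< s ℕ.* s → s ℕ.* s ℕ.< n → ∀ P Q →
      P ℤ.* P ℤ.- d ℤ.* (Q ℤ.* Q) ≡ ℤ.+ (s ℕ.* s) ℤ.* (ℤ.+ (s ℕ.* s) ℤ.* (ℤ.+ (s ℕ.* s) ℤ.* (ℤ.+ (s ℕ.* s) ℤ.* ℤ.+ (s ℕ.* s)))) →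
      (∃[ x ] ∃[ y ] x ℤ.* (P ℤ.+ P) ℤ.+ y ℤ.* (ℤ.+ s ℤ.* ℤ.+ s) ≡ 1ℤ) →
      (∀ u → u ℤ.* u ≡ ℤ.+ (s ℕ.* s) → ¬ (u ∣ℤ P × u ∣ℤ Q)) →
      ClassNumberDivisibleBy10 (ℚ⟮√ d ⟯ sf d≢1)
    10∣class-number k norm-√d odd s 0<ss ss<n P Q norm-P unit indivisible = combine-divisors (ℚ⟮√ d ⟯ sf d≢1)
      (ImaginaryIdeals.class-number d sf d≢1 e d≡2e n d≡-n (ℕ.<⇒≤ 2<n))
      (2∣class-number k norm-√d odd) (5∣class-number s 0<ss ss<n P Q norm-P unit indivisible)

  module _ {B : ℕ} (C : Candidate 2 0 B) where

    private
      open Candidate C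
      open FromCandidate C

      -- This is A - b, written without subtraction by means of A = 3b + t.
      s : ℕ
      s = 2 ℕ.* b ℕ.+ t

      A≡s+b : A ≡ s ℕ.+ b
      A≡s+b = trans A≡3b+t (lemma b t)
        where
        open import Data.Nat.Tactic.RingSolver using (solve-∀)
        lemma : ∀ b t → 3 ℕ.* b ℕ.+ t ≡ 2 ℕ.* b ℕ.+ t ℕ.+ b
        lemma = solve-∀

      2≤s : 2 ℕ.≤ s
      2≤s = ℕ.≤-trans (ℕ.*-monoʳ-≤ 2 0<b) (ℕ.m≤m+n (2 ℕ.* b) t)

      ss<n : s ℕ.* s ℕ.< n
      ss<n = ℕ.≤-<-trans (ℕ.*-mono-≤ s≤A s≤A) A²<n
        where
        s≤A : s ℕ.≤ A
        s≤A = ℕ.≤-trans (ℕ.m≤m+n s b) (ℕ.≤-reflexive (sym A≡s+b))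

      2<n : 2 ℕ.< n
      2<n = ℕ.≤-<-trans (ℕ.≤-trans 2≤s (ℕ.m≤m*n s s {{ℕ.>-nonZero (ℕ.≤-trans (ℕ.s≤s ℕ.z≤n) 2≤s)}})) ss<n

      -- The candidate is taken modulo 2 in the class 0 for this: an even d has ring of integers
      -- ℤ[√d] and makes 2 ramify.
      2∣n : 2 ∣ n
      2∣n = subst (2 ∣_) (ℕ.+-identityʳ n) p∣n+r

      m : ℕ
      m = Data.Nat.Divisibility.quotient 2∣n

      n≡2m : n ≡ 2 ℕ.* m
      n≡2m = trans (Data.Nat.Divisibility._∣_.equality 2∣n) (ℕ.*-comm m 2)

      2∤m : ¬ 2 ∣ m
      2∤m 2∣m = squarefree prime[2] (subst (4 ∣_) (sym n≡2m) (subst (2 ℕ.* 2 ∣_) (ℕ.*-comm m 2) (*-monoˡ-∣ 2 2∣m)))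

      e : ℤ
      e = ℤ.- ℤ.+ m

      d≡2e : d ≡ ℤ.+ 2 ℤ.* e
      d≡2e = trans (cong (λ n → ℤ.- ℤ.+ n) n≡2m) (trans (cong ℤ.-_ (ℤ.pos-* 2 m)) (ℤ.neg-distribʳ-* (ℤ.+ 2) (ℤ.+ m)))

      S b′ P Q : ℤ
      S  = ℤ.+ s
      b′ = ℤ.+ b
      P  = torsion-P S b′
      Q  = torsion-Q (S ℤ.+ b′) b′ ℤ.* ℤ.+ D

      -- Modulo s, 2P is 32 b⁵. A common prime would be 2, although s = A - b is odd, or it would
      -- divide b and hence A = s + b, against coprimality.
      no-common-prime : ∀ {q} → Prime q → ℤ.+ q ∣ℤ S → ¬ ℤ.+ q ∣ℤ P ℤ.+ P
      no-common-prime {q} q-prime q∣S q∣2P = [ q∤2 , [ q∤2 , [ q∤2 , [ q∤2 , [ q∤2 , b-case ]′ ∘ split (ℤ.+ 2) b⁵ ]′ ∘ split (ℤ.+ 2) _ ]′ ∘ split (ℤ.+ 2) _ ]′ ∘ split (ℤ.+ 2) _ ]′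
        (split (ℤ.+ 2) _ (∣-by (ℤ.∣m∣n⇒∣m-n q∣2P (ℤ.∣m⇒∣m*n (ℤ.+ 2 ℤ.* torsion-quotient S b′) q∣S)) (lemma S (torsion-quotient S b′) b⁵)))
        where
        b⁵ : ℤ
        b⁵ = b′ ℤ.* b′ ℤ.* b′ ℤ.* b′ ℤ.* b′
        split : ∀ x y → ℤ.+ q ∣ℤ x ℤ.* y → ℤ.+ q ∣ℤ x ⊎ ℤ.+ q ∣ℤ y
        split = prime∣product q-prime
        lemma : ∀ S R b⁵ → S ℤ.* R ℤ.+ ℤ.+ 16 ℤ.* b⁵ ℤ.+ (S ℤ.* R ℤ.+ ℤ.+ 16 ℤ.* b⁵) ℤ.- S ℤ.* (ℤ.+ 2 ℤ.* R)
          ≡ ℤ.+ 2 ℤ.* (ℤ.+ 2 ℤ.* (ℤ.+ 2 ℤ.* (ℤ.+ 2 ℤ.* (ℤ.+ 2 ℤ.* b⁵))))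
        lemma = ℤSolver.solve-∀
        q∣A⇐ : q ∣ b → q ∣ A
        q∣A⇐ q∣b = subst (q ∣_) (sym A≡s+b) (Data.Nat.Divisibility.∣m∣n⇒∣m+n (∣⇒∣ᵤ q∣S) q∣b)
        q∤b : ¬ q ∣ b
        q∤b q∣b = ¬prime[1] (subst Prime (A⊥b (q∣A⇐ q∣b , q∣b)) q-prime)
        q∤2 : ¬ ℤ.+ q ∣ℤ ℤ.+ 2
        q∤2 q∣2 = 2∤b (Data.Nat.Divisibility.∣m+n∣m⇒∣n (subst (2 ∣_) A≡s+b 2∣A) (subst (_∣ s) (prime-∣-prime q-prime prime[2] (∣⇒∣ᵤ q∣2)) (∣⇒∣ᵤ q∣S)))
        b-case : ¬ ℤ.+ q ∣ℤ b⁵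
        b-case h = [ [ [ [ q∤b′ , q∤b′ ]′ ∘ split b′ b′ , q∤b′ ]′ ∘ split (b′ ℤ.* b′) b′ , q∤b′ ]′ ∘ split (b′ ℤ.* b′ ℤ.* b′) b′ , q∤b′ ]′ (split (b′ ℤ.* b′ ℤ.* b′ ℤ.* b′) b′ h)
          where
          q∤b′ : ¬ ℤ.+ q ∣ℤ b′
          q∤b′ q∣b′ = q∤b (∣⇒∣ᵤ q∣b′)

      -- Squaring a relation 2P u + s v = ±1 leaves terms divisible by 2P and the term s² v².
      unit-combination : ∃[ x ] ∃[ y ] x ℤ.* (P ℤ.+ P) ℤ.+ y ℤ.* (S ℤ.* S) ≡ 1ℤ
      unit-combination = from (bézout (P ℤ.+ P) S)
        where
        from : Bézout (P ℤ.+ P) S → ∃[ x ] ∃[ y ] x ℤ.* (P ℤ.+ P) ℤ.+ y ℤ.* (S ℤ.* S) ≡ 1ℤ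
        from record { gcd = g ; s = u ; t = v ; x′ = x′ ; y′ = y′ ; gcd≡ = g≡ ; x≡ = x≡ ; y≡ = y≡ } =
          u ℤ.* (u ℤ.* (P ℤ.+ P) ℤ.+ ℤ.+ 2 ℤ.* (v ℤ.* S)) , v ℤ.* v ,
          trans (lemma u v (P ℤ.+ P) S) (trans (cong (λ g → g ℤ.* g) (sym g≡)) (∣∣≡1⇒square≡1 g ∣g∣≡1))
          where
          lemma : ∀ u v p s → u ℤ.* (u ℤ.* p ℤ.+ ℤ.+ 2 ℤ.* (v ℤ.* s)) ℤ.* p ℤ.+ v ℤ.* v ℤ.* (s ℤ.* s) ≡ (u ℤ.* p ℤ.+ v ℤ.* s) ℤ.* (u ℤ.* p ℤ.+ v ℤ.* s)
          lemma = ℤSolver.solve-∀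
          ∣g∣≡1 : ℤ.∣ g ∣ ≡ 1
          ∣g∣≡1 = decidable-stable (ℤ.∣ g ∣ ℕ.≟ 1) (λ g≢1 → go (prime-divisor ℤ.∣ g ∣ g≢1))
            where
            go : ¬ (∃[ q ] Prime q × q ∣ ℤ.∣ g ∣)
            go (q , q-prime , q∣g) = no-common-prime q-prime
              (∣-by (ℤ.∣m⇒∣m*n y′ (∣ᵤ⇒∣ {ℤ.+ q} {g} q∣g)) (sym y≡)) (∣-by (ℤ.∣m⇒∣m*n x′ (∣ᵤ⇒∣ {ℤ.+ q} {g} q∣g)) (sym x≡))

      norm-P : P ℤ.* P ℤ.- d ℤ.* (Q ℤ.* Q) ≡ ℤ.+ (s ℕ.* s) ℤ.* (ℤ.+ (s ℕ.* s) ℤ.* (ℤ.+ (s ℕ.* s) ℤ.* (ℤ.+ (s ℕ.* s) ℤ.* ℤ.+ (s ℕ.* s))))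
      norm-P = begin
        P ℤ.* P ℤ.- d ℤ.* (Q ℤ.* Q)                                   ≡⟨ cong (λ x → P ℤ.* P ℤ.- x) (lemma d (torsion-Q (S ℤ.+ b′) b′) (ℤ.+ D)) ⟩
        P ℤ.* P ℤ.- ℤ.+ D ℤ.* ℤ.+ D ℤ.* d ℤ.* (torsion-Q (S ℤ.+ b′) b′ ℤ.* torsion-Q (S ℤ.+ b′) b′)
          ≡⟨ cong (λ x → P ℤ.* P ℤ.- x ℤ.* (torsion-Q (S ℤ.+ b′) b′ ℤ.* torsion-Q (S ℤ.+ b′) b′)) (trans D²d≡F (cong F A≡)) ⟩
        P ℤ.* P ℤ.- F (S ℤ.+ b′) ℤ.* (torsion-Q (S ℤ.+ b′) b′ ℤ.* torsion-Q (S ℤ.+ b′) b′)   ≡⟨ torsion-identity S b′ ⟩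
        (S ℤ.* S) ℤ.* ((S ℤ.* S) ℤ.* ((S ℤ.* S) ℤ.* ((S ℤ.* S) ℤ.* (S ℤ.* S))))  ≡⟨ cong (λ g → g ℤ.* (g ℤ.* (g ℤ.* (g ℤ.* g)))) (sym (ℤ.pos-* s s)) ⟩
        _                                                             ∎
        where
        open ≡-Reasoning
        F : ℤ → ℤ
        F A = ℤ.- (A ℤ.* b′) ℤ.* (A ℤ.* A ℤ.+ b′ ℤ.* b′) ℤ.* (A ℤ.* A ℤ.- ℤ.+ 2 ℤ.* (A ℤ.* b′) ℤ.- b′ ℤ.* b′)
        A≡ : ℤ.+ A ≡ S ℤ.+ b′
        A≡ = cong ℤ.+_ A≡s+b
        lemma : ∀ d q D → d ℤ.* (q ℤ.* D ℤ.* (q ℤ.* D)) ≡ D ℤ.* D ℤ.* d ℤ.* (q ℤ.* q)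
        lemma = ℤSolver.solve-∀

      -- The norm s² is a square, so the size of the norm does not rule out a rational generator ±s.
      -- It is ruled out because s ≥ 2 has a prime factor, which would divide P.
      indivisible₅ : ∀ u → u ℤ.* u ≡ ℤ.+ (s ℕ.* s) → ¬ (u ∣ℤ P × u ∣ℤ Q)
      indivisible₅ u uu≡ss (u∣P , _) = go (prime-divisor s (λ s≡1 → ℕ.<⇒≢ 2≤s (sym s≡1)))
        where
        ∣u∣≡s : ℤ.∣ u ∣ ≡ s
        ∣u∣≡s = ℕ-square-injective (ℤ.+-injective (trans (sym (square≡∣∣² u)) uu≡ss))
          where
          ℕ-square-injective : ∀ {k l} → k ℕ.* k ≡ l ℕ.* l → k ≡ l
          ℕ-square-injective {k} {l} eq = ℕ.≤-antisym (square-≤ (ℕ.≤-reflexive eq)) (square-≤ (ℕ.≤-reflexive (sym eq)))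
        go : ¬ (∃[ q ] Prime q × q ∣ s)
        go (q , q-prime , q∣s) = no-common-prime q-prime (∣ᵤ⇒∣ q∣s) (ℤ.∣m∣n⇒∣m+n q∣P q∣P)
          where
          q∣P : ℤ.+ q ∣ℤ P
          q∣P = ℤ.∣-trans (∣ᵤ⇒∣ {ℤ.+ q} {u} (subst (q ∣_) (sym ∣u∣≡s) q∣s)) u∣P

      norm-√d : 0ℤ ℤ.* 0ℤ ℤ.- d ℤ.* (1ℤ ℤ.* 1ℤ) ≡ ℤ.+ 2 ℤ.* ℤ.+ m
      norm-√d = trans (lemma (ℤ.+ n)) (trans (cong ℤ.+_ n≡2m) (ℤ.pos-* 2 m))
        where
        lemma : ∀ n → 0ℤ ℤ.* 0ℤ ℤ.- (ℤ.- n) ℤ.* (1ℤ ℤ.* 1ℤ) ≡ n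
        lemma = ℤSolver.solve-∀

      -- m is odd because n = 2m is squarefree. The gcd found is 1 or -1, and multiplying the
      -- relation by it corrects the sign.
      odd-combination : ∃[ y ] ∃[ z ] 0ℤ ℤ.* (0ℤ ℤ.+ 0ℤ) ℤ.+ y ℤ.* ℤ.+ 2 ℤ.+ z ℤ.* ℤ.+ m ≡ 1ℤ
      odd-combination = from (bézout (ℤ.+ 2) (ℤ.+ m))
        where
        from : Bézout (ℤ.+ 2) (ℤ.+ m) → ∃[ y ] ∃[ z ] 0ℤ ℤ.* (0ℤ ℤ.+ 0ℤ) ℤ.+ y ℤ.* ℤ.+ 2 ℤ.+ z ℤ.* ℤ.+ m ≡ 1ℤ
        from record { gcd = g ; s = u ; t = v ; x′ = x′ ; y′ = y′ ; gcd≡ = g≡ ; x≡ = x≡ ; y≡ = y≡ } = g ℤ.* u , g ℤ.* v ,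
          trans (lemma g u v (ℤ.+ m)) (trans (cong (g ℤ.*_) (sym g≡)) (∣∣≡1⇒square≡1 g ∣g∣≡1))
          where
          lemma : ∀ g u v m → 0ℤ ℤ.* (0ℤ ℤ.+ 0ℤ) ℤ.+ g ℤ.* u ℤ.* ℤ.+ 2 ℤ.+ g ℤ.* v ℤ.* m ≡ g ℤ.* (u ℤ.* ℤ.+ 2 ℤ.+ v ℤ.* m)
          lemma = ℤSolver.solve-∀
          ∣g∣≡1 : ℤ.∣ g ∣ ≡ 1
          ∣g∣≡1 = prime∤⇒coprime prime[2] 2∤m (∣⇒∣ᵤ {g} {ℤ.+ 2} (ℤ.divides x′ (trans x≡ (ℤ.*-comm g x′))) , ∣⇒∣ᵤ {g} {ℤ.+ m} (ℤ.divides y′ (trans y≡ (ℤ.*-comm g y′))))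

    class-number-divisible-by-10 : ClassNumberDivisibleBy10 (ℚ⟮√ FromCandidate.d C ⟯ (FromCandidate.squarefree-d C) (FromCandidate.d≢1 C))
    class-number-divisible-by-10 = 10∣class-number d squarefree-d d≢1 e d≡2e n refl 2<n (ℤ.+ m) norm-√d odd-combination s 0<ss ss<n P Q norm-P unit-combination indivisible₅
      where
      0<ss : 0 ℕ.< s ℕ.* s
      0<ss = ℕ.*-mono-≤ {1} {s} {1} {s} (ℕ.≤-trans (ℕ.s≤s ℕ.z≤n) 2≤s) (ℕ.≤-trans (ℕ.s≤s ℕ.z≤n) 2≤s)

  private
    Good : QuadraticField → Set
    Good K = Imaginary K × (∃ λ (h : ℕ) → HasClassNumber K h × 10 ∣ h) × HasQuadraticPoint K

    good-intro : ∀ d (sf : Squarefree d) (d≢1 : d ≢ 1ℤ) → d ℤ.< 0ℤ → ClassNumberDivisibleBy10 (ℚ⟮√ d ⟯ sf d≢1) →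
      ∀ (A b D : ℤ) → A ≢ 0ℤ → D ≢ 0ℤ →
      D ℤ.* D ℤ.* d ≡ ℤ.- (A ℤ.* b) ℤ.* (A ℤ.* A ℤ.+ b ℤ.* b) ℤ.* (A ℤ.* A ℤ.- ℤ.+ 2 ℤ.* (A ℤ.* b) ℤ.- b ℤ.* b) →
      Good (ℚ⟮√ d ⟯ sf d≢1)
    good-intro d sf d≢1 d<0 (divisible h bij 10∣h) A b D A≢0 D≢0 eq = d<0 , (h , bij , 10∣h) , hasQuadraticPoint-at (ℚ⟮√ d ⟯ sf d≢1) A b D A≢0 D≢0 eq

  -- Isomorphic fields have equal radicands, so a candidate with n above all absolute radicands in
  -- the list gives a field isomorphic to none of them.
  infinitelyMany-class-number-divisible-by-10 : InfinitelyMany _≅_ Good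
  infinitelyMany-class-number-divisible-by-10 Ks = from (candidate prime[2] (ℕ.s≤s ℕ.z≤n) (max (map size Ks)))
    where
    size : QuadraticField → ℕ
    size K = ℤ.∣ QuadraticField.radicand K ∣
    from : Candidate 2 0 (max (map size Ks)) → ∃ λ K → Good K × All (λ L → ¬ (K ≅ L)) Ks
    from C = ℚ⟮√ d ⟯ squarefree-d d≢1 ,
      good-intro d squarefree-d d≢1 d<0 (class-number-divisible-by-10 C) (ℤ.+ A) (ℤ.+ b) (ℤ.+ D) (+≢0 0<A) (+≢0 0<D) D²d≡F ,
      All.map (λ {L} → not-isomorphic L) (all-≤max size Ks)
      where
      open FromCandidate C
      open Candidate C
      not-isomorphic : ∀ L → size L ℕ.≤ max (map size Ks) → ¬ (ℚ⟮√ d ⟯ squarefree-d d≢1 ≅ L)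
      not-isomorphic L L≤B K≅L = ℕ.<⇒≱ B<n (subst (ℕ._≤ max (map size Ks)) (trans (cong ℤ.∣_∣ (sym (isomorphic⇒≡ {ℚ⟮√ d ⟯ squarefree-d d≢1} {L} K≅L))) ∣d∣≡n) L≤B)

open import Defs
open import Data.Integer.Base using (ℤ; +_; _-_)
open import Data.Integer.Divisibility using () renaming (_∣_ to _∣ℤ_)
open import Data.Nat.Base using (ℕ)
open import Data.Nat.Divisibility using (_∣_)
open import Data.Nat.Primality using (Prime)
open import Data.Product.Base using (∃; _×_; _,_)
open import Relation.Binary.PropositionalEquality using (_≡_)

theorem1p9 : (∀ (p : ℕ) → Prime p → ∀ (a : ℤ) →
    InfinitelyMany _≡_ (λ (d : ℤ) →
    ((+ p) ∣ℤ (d - a)) × Squarefree d ×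
    (∃ λ (K : QuadraticField) → QuadraticField.radicand K ≡ d × HasQuadraticPoint K)))
    ×
    InfinitelyMany _≅_ (λ (K : QuadraticField) →
    Imaginary K ×
    (∃ λ (h : ℕ) → HasClassNumber K h × 10 ∣ h) ×
    HasQuadraticPoint K)
theorem1p9 = Points.infinitelyMany-in-class , ClassNumber.infinitelyMany-class-number-divisible-by-10
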